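{- Let $p>3$ be a prime. If $p\equiv1\pmod4$, write $p=x^2+y^2$ with integers $x,y$ and $4\mid x-1$; then $$\sum_{k=0}^{p-1}(8k+3)\binom{ -3/4}k^4\equiv(-1)^{\frac{p-1}4}\Big(\frac{3p^2}{2x}+\frac{3p^3}{8x^3}\Big)\pmod{p^4}.$$ If $p\equiv3\pmod4$, then $$\sum_{k=0}^{p-1}(8k+3)\binom{ -3/4}k^4\equiv(-1)^{\frac{p-3}4}p\binom{\frac{p-3}2}{\frac{p-3}4}\Big(1-p\big(1+\tfrac12q_p(2)\big)+p^2\big(\tfrac12q_p(2)+\tfrac38q_p(2)^2+\tfrac14E_{p-3}\big)\Big)\pmod{p^4}.$$
   Context: The general binomial coefficient is $\binom a0=1$, $\binom ak=a(a-1)\cdots(a-k+1)/k!$ for $k\ge1$. Congruences are in the ring of rationals with denominators prime to $p$. $q_p(2)=(2^{p-1}-1)/p$. The Euler numbers are $E_0=1$, $E_{2n-1}=0$, $E_{2n}=-\sum_{k=1}^n\binom{2n}{2k}E_{2n-2k}$ ($n\ge1$). -}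

module Defs where

open import Data.Nat as ℕ using (ℕ; zero; suc)
open import Data.Nat.Divisibility using (_∣_)
open import Data.Nat.Combinatorics using (_C_)
open import Data.Integer as ℤ using (ℤ; +_)
open import Data.Rational as ℚ using (ℚ; 0ℚ; 1ℚ; _+_; _*_; _-_; -_; ↧ₙ_; 1/_)
open import Data.Rational.Properties using (_≟_)
open import Data.List using (List; []; _∷_; zipWith; upTo; sum; length)
open import Data.Product using (∃; _×_)
open import Relation.Nullary using (¬_; yes; no)
open import Relation.Binary.PropositionalEquality using (_≡_)

ℕ→ℚ : ℕ → ℚ
ℕ→ℚ n = (+ n) ℚ./ 1

ℤ→ℚ : ℤ → ℚ
ℤ→ℚ z = z ℚ./ 1

_^ℚ_ : ℚ → ℕ → ℚ
q ^ℚ zero = 1ℚ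
q ^ℚ suc n = q * (q ^ℚ n)

-- total division on ℚ (a / 0 := 0); only ever used with nonzero divisors here
_÷ℚ_ : ℚ → ℚ → ℚ
a ÷ℚ b with b ≟ 0ℚ
... | yes _ = 0ℚ
... | no b≢0 = a * (1/_ b {{ℚ.≢-nonZero b≢0}})

Σ< : ℕ → (ℕ → ℚ) → ℚ
Σ< zero f = 0ℚ
Σ< (suc n) f = Σ< n f + f n

binom : ℚ → ℕ → ℚ
binom a zero = 1ℚ
binom a (suc k) = (binom a k * (a - ℕ→ℚ k)) ÷ℚ ℕ→ℚ (suc k)

-- Euler numbers.  evenEs n = [E_{2n}, E_{2n-2}, ..., E_0]
evenEs : ℕ → List ℤ
evenEs zero = + 1 ∷ []
evenEs (suc n) = next ∷ evenEs n
  where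
  -- E_{2n+2} = - Σ_{k=1}^{n+1} C(2n+2,2k) E_{2n+2-2k};  index j = k-1 of evenEs n is E_{2n-2j}
  next : ℤ
  next = ℤ.- Data.List.foldr ℤ._+_ (+ 0)
           (zipWith (λ j e → + ((2 ℕ.* suc n) C (2 ℕ.* suc j)) ℤ.* e) (upTo (suc n)) (evenEs n))

headℤ : List ℤ → ℤ
headℤ [] = + 0
headℤ (x ∷ _) = x

euler : ℕ → ℤ
euler n with n ℕ.% 2
... | zero = headℤ (evenEs (n ℕ./ 2))
... | suc _ = + 0

qp2 : ℕ → ℚ
qp2 p = (ℕ→ℚ (2 ℕ.^ (p ℕ.∸ 1)) - 1ℚ) ÷ℚ ℕ→ℚ p

sgn : ℕ → ℚ
sgn n = (- 1ℚ) ^ℚ n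

CongMod : ℕ → ℕ → ℚ → ℚ → Set
CongMod p k a b = ∃ λ (r : ℚ) → (¬ (p ∣ ↧ₙ r)) × (a - b ≡ (ℕ→ℚ p ^ℚ k) * r)

-- Put 4j + 3 = cp with c ∈ {1, 3} and t = cp/4, so that j is the index of the first k with p ∣ 4k + 3.
-- Replace (3/4)ₖ⁴/k!⁴ by ∏_{i < k} z(z³ - t³)/(s(s³ + t³)) with z = 3/4 + i and s = i + 1, that is, three of the
-- four parameters 3/4 by 3/4 - t = -j, 3/4 - ωt and 3/4 - ω²t where ω³ = 1. The first-order term in t³ of this
-- change cancels modulo p under k ↦ j - k, and the new sum is a terminating very-well-poised ₅F₄ which a
-- Wilf–Zeilberger pair evaluates. Hence the sum is cp ∏_{m ≤ j} (1 - t²/m²)(1 + 1/(2m)) modulo p⁴.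
-- For p ≡ 3 (mod 4) the product is a central binomial coefficient, a power of 2 and Σ_{m ≤ j} 1/m², which
-- is -4 E_{p-3} modulo p because the alternating power sums of odd numbers obey the recurrence of E.
-- For p ≡ 1 (mod 4) the product has one factor p, and the cofactor is determined modulo p² by C(2n, n),
-- n = (p - 1)/4. The Jacobsthal sum Σ χ(u) χ(u² - 1) equals ± 2x by its second moment, and evaluating it
-- modulo p² at Teichmüller representatives relates C(2n, n) to x (Chowla, Dwork and Evans).
module Submission where

open import Algebra.Bundles using (CommutativeMonoid; CommutativeRing; RawRing)
open import Algebra.Structures using (IsCommutativeMonoid; IsCommutativeRing)
open import Algebra.Solver.Ring.AlmostCommutativeRing using (AlmostCommutativeRing; fromCommutativeRing; _-Raw-AlmostCommutative⟶_)
import Algebra.Solver.Ring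
import Algebra.Properties.Ring
import Algebra.Properties.Semiring.Exp
import Algebra.Properties.CommutativeSemiring.Exp
import Algebra.Properties.Semiring.Mult
import Algebra.Properties.CommutativeSemiring.Binomial as Binomial
import Algebra.Properties.CommutativeMonoid.Sum
open import Data.Empty using (⊥; ⊥-elim)
open import Data.Fin using (Fin; toℕ; fromℕ<)
import Data.Fin.Properties as Fin
import Data.Fin.Permutation as Perm
open import Data.Integer as ℤ using (ℤ; -[1+_])
import Data.Integer.Properties as ℤ
open import Data.Maybe.Base using (Maybe; just; nothing)
open import Data.Nat as ℕ using (ℕ; zero; suc; _<_; _≤_; _∸_; z≤n; s≤s)
import Data.Nat.Properties as ℕ
open import Data.Nat.Combinatorics using (_C_; nCk≡nC[n∸k]; nCk+nC[k+1]≡[n+1]C[k+1]; nCn≡1)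
open import Data.Nat.Divisibility using (_∣_; _∤_; _∣?_; divides)
import Data.Nat.Divisibility as Div
open import Data.Nat.Primality using (Prime; euclidsLemma; prime⇒nonTrivial)
open import Data.Product using (∃; _×_; _,_; proj₁; proj₂)
open import Data.Sum using (_⊎_; inj₁; inj₂)
open import Function using (_∘_)
open import Level using (0ℓ)
open import Relation.Binary.PropositionalEquality hiding (J)
open import Relation.Nullary using (¬_; yes; no; Dec)
open import Relation.Binary.Definitions using (Tri; tri<; tri≈; tri>)
open import Data.Nat.Solver using (module +-*-Solver)
open +-*-Solver using () renaming (solve to solveℕ; _:=_ to _:≡_; _:+_ to _⊞_; _:*_ to _⊠_; con to #)

-- The three parameters are moved along the cube roots of unity because the products then depend on
-- t only through t³. Terms of order p and p² never arise, one term of order p³ has to be cancelled,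
-- and the next error is of order p⁶. The fourth parameter stays at 3/4, since it is the parameter
-- to which the series is well-poised. The roots of unity need not exist in the field: the conjugate
-- pair enters only through x² - tx + t². For p ≡ 1 (mod 4) the obstacle is that the second moment
-- yields only a sum of two squares, J(1)² + J(g)² = 4p with a nonresidue g. Identifying J(1) with ±
-- 2x takes the uniqueness of such a representation, and the sign relative to x ≡ 1 (mod 4) takes
-- J(1) modulo 8, which is found from the product of the signs in the sum. No primitive root is
-- used. The existence of nonresidues and of square roots, Wilson's theorem and the correlations of
-- χ all come from one fact: the sum of u^s over the residues is 0 or -1 modulo p.

module BigOp {A : Set} {_∙_ : A → A → A} {ε : A} (M : IsCommutativeMonoid _≡_ _∙_ ε) where
  open IsCommutativeMonoid M using (assoc; comm; identityˡ; identityʳ)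
  open ≡-Reasoning

  big : ℕ → (ℕ → A) → A
  big zero f = ε
  big (suc n) f = big n f ∙ f n

  big-cong< : ∀ n {f g} → (∀ i → i < n → f i ≡ g i) → big n f ≡ big n g
  big-cong< zero e = refl
  big-cong< (suc n) e = cong₂ _∙_ (big-cong< n (λ i i<n → e i (ℕ.m<n⇒m<1+n i<n))) (e n ℕ.≤-refl)

  big-cong : ∀ n {f g} → (∀ i → f i ≡ g i) → big n f ≡ big n g
  big-cong n e = big-cong< n (λ i _ → e i)

  interchange : ∀ a b c d → (a ∙ b) ∙ (c ∙ d) ≡ (a ∙ c) ∙ (b ∙ d)
  interchange a b c d = begin
    (a ∙ b) ∙ (c ∙ d) ≡⟨ assoc a b _ ⟩
    a ∙ (b ∙ (c ∙ d)) ≡⟨ cong (a ∙_) (trans (sym (assoc b c d)) (trans (cong (_∙ d) (comm b c)) (assoc c b d))) ⟩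
    a ∙ (c ∙ (b ∙ d)) ≡⟨ sym (assoc a c _) ⟩
    (a ∙ c) ∙ (b ∙ d) ∎

  big-∙ : ∀ n f g → big n (λ i → f i ∙ g i) ≡ big n f ∙ big n g
  big-∙ zero f g = sym (identityˡ ε)
  big-∙ (suc n) f g = trans (cong (_∙ (f n ∙ g n)) (big-∙ n f g)) (interchange _ _ _ _)

  big-ε : ∀ n {f} → (∀ i → i < n → f i ≡ ε) → big n f ≡ ε
  big-ε zero e = refl
  big-ε (suc n) e = trans (cong₂ _∙_ (big-ε n (λ i i<n → e i (ℕ.m<n⇒m<1+n i<n))) (e n ℕ.≤-refl)) (identityˡ ε)

  big-first : ∀ n f → big (suc n) f ≡ f 0 ∙ big n (λ i → f (suc i))
  big-first zero f = comm ε (f 0)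
  big-first (suc n) f = trans (cong (_∙ f (suc n)) (big-first n f)) (assoc _ _ _)

  big-split : ∀ m n f → big (m ℕ.+ n) f ≡ big m f ∙ big n (λ i → f (m ℕ.+ i))
  big-split m zero f = trans (cong (λ k → big k f) (ℕ.+-identityʳ m)) (sym (identityʳ _))
  big-split m (suc n) f = begin
    big (m ℕ.+ suc n) f ≡⟨ cong (λ k → big k f) (ℕ.+-suc m n) ⟩
    big (m ℕ.+ n) f ∙ f (m ℕ.+ n) ≡⟨ cong (_∙ f (m ℕ.+ n)) (big-split m n f) ⟩
    (big m f ∙ big n (λ i → f (m ℕ.+ i))) ∙ f (m ℕ.+ n) ≡⟨ assoc _ _ _ ⟩
    big m f ∙ big (suc n) (λ i → f (m ℕ.+ i)) ∎

  big-reverse : ∀ n f → big n f ≡ big n (λ i → f (n ∸ suc i))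
  big-reverse zero f = refl
  big-reverse (suc n) f = begin
    big n f ∙ f n ≡⟨ comm _ _ ⟩
    f n ∙ big n f ≡⟨ cong (f n ∙_) (big-reverse n f) ⟩
    f n ∙ big n (λ i → f (n ∸ suc i)) ≡⟨ sym (big-first n (λ i → f (n ∸ i))) ⟩
    big (suc n) (λ i → f (n ∸ i)) ∎

  big-parity : ∀ n f → big (2 ℕ.* n) f ≡ big n (λ i → f (2 ℕ.* i)) ∙ big n (λ i → f (suc (2 ℕ.* i)))
  big-parity zero f = sym (identityˡ ε)
  big-parity (suc n) f = begin
    big (2 ℕ.* suc n) f ≡⟨ cong (λ k → big k f) (ℕ.*-suc 2 n) ⟩
    (big (2 ℕ.* n) f ∙ f (2 ℕ.* n)) ∙ f (suc (2 ℕ.* n)) ≡⟨ assoc _ _ _ ⟩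
    big (2 ℕ.* n) f ∙ (f (2 ℕ.* n) ∙ f (suc (2 ℕ.* n))) ≡⟨ cong (_∙ (f (2 ℕ.* n) ∙ f (suc (2 ℕ.* n)))) (big-parity n f) ⟩
    (big n (λ i → f (2 ℕ.* i)) ∙ big n (λ i → f (suc (2 ℕ.* i)))) ∙ (f (2 ℕ.* n) ∙ f (suc (2 ℕ.* n))) ≡⟨ interchange _ _ _ _ ⟩
    big (suc n) (λ i → f (2 ℕ.* i)) ∙ big (suc n) (λ i → f (suc (2 ℕ.* i))) ∎

  big-swap : ∀ m n (f : ℕ → ℕ → A) → big m (λ i → big n (f i)) ≡ big n (λ j → big m (λ i → f i j))
  big-swap zero n f = sym (big-ε n (λ _ _ → refl))
  big-swap (suc m) n f = trans (cong (_∙ big n (f m)) (big-swap m n f)) (sym (big-∙ n _ _))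

  big-single : ∀ n {f} k → k < n → (∀ i → i < n → i ≢ k → f i ≡ ε) → big n f ≡ f k
  big-single (suc n) {f} k k<n e with ℕ.m≤n⇒m<n∨m≡n (ℕ.≤-pred k<n)
  ... | inj₁ k<n′ = trans (cong₂ _∙_ (big-single n k k<n′ (λ i i<n → e i (ℕ.m<n⇒m<1+n i<n))) (e n ℕ.≤-refl λ n≡k → ℕ.<-irrefl (sym n≡k) k<n′)) (identityʳ _)
  ... | inj₂ refl = trans (cong (_∙ f k) (big-ε n λ i i<n → e i (ℕ.m<n⇒m<1+n i<n) λ i≡n → ℕ.<-irrefl i≡n i<n)) (identityˡ _)

  big-pair : ∀ n {f} j k → j < k → k < n → (∀ i → i < n → i ≢ j → i ≢ k → f i ≡ ε) → big n f ≡ f j ∙ f k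
  big-pair (suc n) {f} j k j<k k<n e with ℕ.m≤n⇒m<n∨m≡n (ℕ.≤-pred k<n)
  ... | inj₁ k<n′ = trans (cong₂ _∙_ (big-pair n j k j<k k<n′ (λ i i<n → e i (ℕ.m<n⇒m<1+n i<n)))
                            (e n ℕ.≤-refl (λ n≡j → ℕ.<-irrefl (sym n≡j) (ℕ.<-trans j<k k<n′)) λ n≡k → ℕ.<-irrefl (sym n≡k) k<n′)) (identityʳ _)
  ... | inj₂ refl = cong (_∙ f k) (big-single n j j<k λ i i<n i≢j → e i (ℕ.m<n⇒m<1+n i<n) i≢j λ i≡n → ℕ.<-irrefl i≡n i<n)

  private
    commutativeMonoid : CommutativeMonoid 0ℓ 0ℓ
    commutativeMonoid = record { isCommutativeMonoid = M }
  module F = Algebra.Properties.CommutativeMonoid.Sum commutativeMonoid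

  big-sum : ∀ n f → big n f ≡ F.sum {n} (λ i → f (toℕ i))
  big-sum zero f = refl
  big-sum (suc n) f = trans (big-first n f) (cong (f 0 ∙_) (big-sum n (λ i → f (suc i))))

  big-permute : ∀ n f (π ρ : ℕ → ℕ) → (∀ i → i < n → π i < n) → (∀ i → i < n → ρ i < n) →
    (∀ i → i < n → π (ρ i) ≡ i) → (∀ i → i < n → ρ (π i) ≡ i) → big n (λ i → f (π i)) ≡ big n f
  big-permute n f π ρ π< ρ< πρ ρπ = begin
    big n (λ i → f (π i)) ≡⟨ big-sum n _ ⟩
    F.sum {n} (λ i → f (π (toℕ i))) ≡⟨ F.sum-cong-≗ (λ i → cong f (sym (Fin.toℕ-fromℕ< (π< (toℕ i) (Fin.toℕ<n i))))) ⟩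
    F.sum {n} (λ i → f (toℕ (to i))) ≡⟨ sym (F.sum-permute (λ i → f (toℕ i)) perm) ⟩
    F.sum {n} (λ i → f (toℕ i)) ≡⟨ sym (big-sum n f) ⟩
    big n f ∎
    where
    to from : Fin n → Fin n
    to i = fromℕ< (π< (toℕ i) (Fin.toℕ<n i))
    from i = fromℕ< (ρ< (toℕ i) (Fin.toℕ<n i))
    to-from : ∀ i → to (from i) ≡ i
    to-from i = Fin.toℕ-injective (trans (Fin.toℕ-fromℕ< _) (trans (cong π (Fin.toℕ-fromℕ< _)) (πρ _ (Fin.toℕ<n i))))
    from-to : ∀ i → from (to i) ≡ i
    from-to i = Fin.toℕ-injective (trans (Fin.toℕ-fromℕ< _) (trans (cong ρ (Fin.toℕ-fromℕ< _)) (ρπ _ (Fin.toℕ<n i))))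
    perm : Perm.Permutation n n
    perm = Perm.permutation to from to-from from-to

-- Commutative rings, the image of the integers, finite sums and products

record CRing : Set₁ where
  infixl 6 _+_ _-_
  infixl 7 _*_
  infix 8 -_
  field
    Carrier : Set
    _+_ _*_ : Carrier → Carrier → Carrier
    -_ : Carrier → Carrier
    0# 1# : Carrier
    isCommutativeRing : IsCommutativeRing _≡_ _+_ _*_ -_ 0# 1#

  open IsCommutativeRing isCommutativeRing public
    using (+-assoc; +-comm; +-identityˡ; +-identityʳ; -‿inverseʳ; -‿inverseˡ
          ; *-assoc; *-comm; *-identityˡ; *-identityʳ; zeroˡ; zeroʳ; distribˡ; distribʳ)

  _-_ : Carrier → Carrier → Carrier
  x - y = x + - y

  ι : ℕ → Carrier
  ι zero = 0#
  ι (suc n) = 1# + ι n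

module RingTheory (R : CRing) where
  open CRing R public

  commutativeRing : CommutativeRing 0ℓ 0ℓ
  commutativeRing = record { isCommutativeRing = isCommutativeRing }

  open Algebra.Properties.Semiring.Exp (CommutativeRing.semiring commutativeRing) public
    using (_^_; ^-homo-*; ^-assocʳ)
  open Algebra.Properties.CommutativeSemiring.Exp (CommutativeRing.commutativeSemiring commutativeRing) public
    using (^-distrib-*)
  open Algebra.Properties.Ring (CommutativeRing.ring commutativeRing) using (-‿distribˡ-*; -‿involutive; -‿+-comm; -0#≈0#)
  open ≡-Reasoning

  ι-+ : ∀ m n → ι (m ℕ.+ n) ≡ ι m + ι n
  ι-+ zero n = sym (+-identityˡ _)
  ι-+ (suc m) n = trans (cong (1# +_) (ι-+ m n)) (sym (+-assoc _ _ _))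

  ι-* : ∀ m n → ι (m ℕ.* n) ≡ ι m * ι n
  ι-* zero n = sym (zeroˡ _)
  ι-* (suc m) n = begin
    ι (n ℕ.+ m ℕ.* n)   ≡⟨ ι-+ n _ ⟩
    ι n + ι (m ℕ.* n)   ≡⟨ cong₂ _+_ (sym (*-identityˡ _)) (ι-* m n) ⟩
    1# * ι n + ι m * ι n ≡⟨ sym (distribʳ _ _ _) ⟩
    (1# + ι m) * ι n ∎

  -- The clause for 1 makes the solver constant 1 denote `1#` itself. The element `ι 1` is `1# + 0#`
  -- instead, which is why it is entered as `κ 1 :+ κ 0` in many identities below.
  ιℤ : ℤ → Carrier
  ιℤ (ℤ.+ 1) = 1#
  ιℤ (ℤ.+ n) = ι n
  ιℤ -[1+ n ] = - ι (suc n)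

  ιℤ-pos : ∀ n → ιℤ (ℤ.+ n) ≡ ι n
  ιℤ-pos 0 = refl
  ιℤ-pos 1 = sym (+-identityʳ _)
  ιℤ-pos (suc (suc n)) = refl

  ιℤ-neg : ∀ z → ιℤ (ℤ.- z) ≡ - ιℤ z
  ιℤ-neg (ℤ.+ 0) = sym -0#≈0#
  ιℤ-neg (ℤ.+ 1) = cong -_ (+-identityʳ _)
  ιℤ-neg (ℤ.+ suc (suc n)) = refl
  ιℤ-neg -[1+ n ] = trans (ιℤ-pos (suc n)) (sym (-‿involutive _))

  ιℤ-⊖ : ∀ m n → ιℤ (m ℤ.⊖ n) ≡ ι m - ι n
  ιℤ-⊖ m zero = trans (ιℤ-pos m) (sym (trans (cong (ι m +_) -0#≈0#) (+-identityʳ _)))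
  ιℤ-⊖ zero (suc n) = sym (+-identityˡ _)
  ιℤ-⊖ (suc m) (suc n) = begin
    ιℤ (suc m ℤ.⊖ suc n) ≡⟨ cong ιℤ (ℤ.[1+m]⊖[1+n]≡m⊖n m n) ⟩
    ιℤ (m ℤ.⊖ n) ≡⟨ ιℤ-⊖ m n ⟩
    ι m - ι n ≡⟨ cong (_- ι n) (sym (trans (cong (_+ ι m) (-‿inverseˡ 1#)) (+-identityˡ _))) ⟩
    - 1# + 1# + ι m - ι n ≡⟨ cong (_- ι n) (trans (+-assoc _ _ _) (+-comm _ _)) ⟩
    1# + ι m + - 1# - ι n ≡⟨ +-assoc _ _ _ ⟩
    1# + ι m + (- 1# - ι n) ≡⟨ cong (1# + ι m +_) (-‿+-comm _ _) ⟩
    1# + ι m - (1# + ι n) ∎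

  ιℤ-+ : ∀ x y → ιℤ (x ℤ.+ y) ≡ ιℤ x + ιℤ y
  ιℤ-+ (ℤ.+ m) (ℤ.+ n) = trans (ιℤ-pos (m ℕ.+ n)) (trans (ι-+ m n) (sym (cong₂ _+_ (ιℤ-pos m) (ιℤ-pos n))))
  ιℤ-+ (ℤ.+ m) -[1+ n ] = trans (ιℤ-⊖ m (suc n)) (cong (_+ _) (sym (ιℤ-pos m)))
  ιℤ-+ -[1+ m ] (ℤ.+ n) = trans (ιℤ-⊖ n (suc m)) (trans (+-comm _ _) (cong (_ +_) (sym (ιℤ-pos n))))
  ιℤ-+ -[1+ m ] -[1+ n ] = begin
    - ι (suc (suc (m ℕ.+ n))) ≡⟨ cong (λ k → - ι (suc k)) (sym (ℕ.+-suc m n)) ⟩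
    - ι (suc m ℕ.+ suc n) ≡⟨ cong -_ (ι-+ (suc m) (suc n)) ⟩
    - (ι (suc m) + ι (suc n)) ≡⟨ sym (-‿+-comm _ _) ⟩
    - ι (suc m) - ι (suc n) ∎

  ιℤ-*ⁿ : ∀ m y → ιℤ (ℤ.+ m ℤ.* y) ≡ ι m * ιℤ y
  ιℤ-*ⁿ zero y = trans (cong ιℤ (ℤ.*-zeroˡ y)) (sym (zeroˡ _))
  ιℤ-*ⁿ (suc m) y = begin
    ιℤ (ℤ.+ suc m ℤ.* y) ≡⟨ cong ιℤ (ℤ.suc-* (ℤ.+ m) y) ⟩
    ιℤ (y ℤ.+ ℤ.+ m ℤ.* y) ≡⟨ ιℤ-+ y _ ⟩
    ιℤ y + ιℤ (ℤ.+ m ℤ.* y) ≡⟨ cong₂ _+_ (sym (*-identityˡ _)) (ιℤ-*ⁿ m y) ⟩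
    1# * ιℤ y + ι m * ιℤ y ≡⟨ sym (distribʳ _ _ _) ⟩
    ι (suc m) * ιℤ y ∎

  ιℤ-* : ∀ x y → ιℤ (x ℤ.* y) ≡ ιℤ x * ιℤ y
  ιℤ-* (ℤ.+ m) y = trans (ιℤ-*ⁿ m y) (cong (_* ιℤ y) (sym (ιℤ-pos m)))
  ιℤ-* -[1+ m ] y = begin
    ιℤ (-[1+ m ] ℤ.* y) ≡⟨ cong ιℤ (sym (ℤ.neg-distribˡ-* (ℤ.+ suc m) y)) ⟩
    ιℤ (ℤ.- (ℤ.+ suc m ℤ.* y)) ≡⟨ ιℤ-neg (ℤ.+ suc m ℤ.* y) ⟩
    - ιℤ (ℤ.+ suc m ℤ.* y) ≡⟨ cong -_ (ιℤ-*ⁿ (suc m) y) ⟩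
    - (ι (suc m) * ιℤ y) ≡⟨ -‿distribˡ-* _ _ ⟩
    - ι (suc m) * ιℤ y ∎

  private
    ℤ-rawRing : RawRing 0ℓ 0ℓ
    ℤ-rawRing = record { Carrier = ℤ ; _≈_ = _≡_ ; _+_ = ℤ._+_ ; _*_ = ℤ._*_ ; -_ = ℤ.-_ ; 0# = ℤ.+ 0 ; 1# = ℤ.+ 1 }

    acr : AlmostCommutativeRing 0ℓ 0ℓ
    acr = fromCommutativeRing commutativeRing

    ιℤ-morphism : ℤ-rawRing -Raw-AlmostCommutative⟶ acr
    ιℤ-morphism = record
      { ⟦_⟧ = ιℤ ; +-homo = ιℤ-+ ; *-homo = ιℤ-* ; -‿homo = ιℤ-neg ; 0-homo = refl ; 1-homo = refl }

    _≟_ : ∀ x y → Maybe (ιℤ x ≡ ιℤ y)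
    x ≟ y with x ℤ.≟ y
    ... | yes eq = just (cong ιℤ eq)
    ... | no _ = nothing

  open Algebra.Solver.Ring ℤ-rawRing acr ιℤ-morphism _≟_ public
    using (solve; _:=_; _:+_; _:*_; _:-_; _:^_; con; var; Polynomial) renaming (:-_ to ⊝_)
  κ : ∀ {n} → ℕ → Polynomial n
  κ n = con (ℤ.+ n)

module Sums (R : CRing) where
  open RingTheory R public
  open ≡-Reasoning
  private module IR = IsCommutativeRing isCommutativeRing

  open BigOp IR.+-isCommutativeMonoid public using () renaming
    ( big to ∑; big-cong< to ∑-cong<; big-cong to ∑-cong; big-∙ to ∑-+; big-ε to ∑-0; big-first to ∑-first
    ; big-split to ∑-split; big-reverse to ∑-reverse; big-swap to ∑-swap; big-single to ∑-single
    ; big-pair to ∑-pair; big-permute to ∑-permute; big-sum to ∑-sum; big-parity to ∑-parity; module F to FinSum)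
  open BigOp IR.*-isCommutativeMonoid public using () renaming
    ( big to ∏; big-cong< to ∏-cong<; big-cong to ∏-cong; big-∙ to ∏-*; big-first to ∏-first
    ; big-split to ∏-split; big-reverse to ∏-reverse; big-ε to ∏-1; big-parity to ∏-parity; big-permute to ∏-permute)

  ∑-*ˡ : ∀ n c (f : ℕ → Carrier) → ∑ n (λ i → c * f i) ≡ c * ∑ n f
  ∑-*ˡ zero c f = sym (zeroʳ c)
  ∑-*ˡ (suc n) c f = trans (cong (_+ c * f n) (∑-*ˡ n c f)) (sym (distribˡ c _ _))

  ∑-*ʳ : ∀ n c (f : ℕ → Carrier) → ∑ n (λ i → f i * c) ≡ ∑ n f * c
  ∑-*ʳ n c f = trans (∑-cong n (λ i → *-comm (f i) c)) (trans (∑-*ˡ n c f) (*-comm c _))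

  ∑-neg : ∀ n (f : ℕ → Carrier) → ∑ n (λ i → - f i) ≡ - ∑ n f
  ∑-neg zero f = solve 0 (con (ℤ.+ 0) := ⊝ con (ℤ.+ 0)) refl
  ∑-neg (suc n) f = trans (cong (_- f n) (∑-neg n f)) (solve 2 (λ x y → ⊝ x :- y := ⊝ (x :+ y)) refl _ _)

  ∑-- : ∀ n (f g : ℕ → Carrier) → ∑ n (λ i → f i - g i) ≡ ∑ n f - ∑ n g
  ∑-- n f g = trans (∑-+ n f (λ i → - g i)) (cong (∑ n f +_) (∑-neg n g))

  ∑-const : ∀ n c → ∑ n (λ _ → c) ≡ ι n * c
  ∑-const zero c = sym (zeroˡ c)
  ∑-const (suc n) c = trans (cong (_+ c) (∑-const n c)) (solve 2 (λ x y → x :* y :+ y := (κ 1 :+ x) :* y) refl _ _)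

  ∑-telescope : ∀ n (f : ℕ → Carrier) → ∑ n (λ i → f (suc i) - f i) ≡ f n - f 0
  ∑-telescope zero f = sym (-‿inverseʳ _)
  ∑-telescope (suc n) f = trans (cong (_+ (f (suc n) - f n)) (∑-telescope n f))
    (solve 3 (λ x y z → x :- y :+ (z :- x) := z :- y) refl (f n) (f 0) (f (suc n)))

  ∏-const : ∀ n c → ∏ n (λ _ → c) ≡ c ^ n
  ∏-const zero c = refl
  ∏-const (suc n) c = trans (cong (_* c) (∏-const n c)) (*-comm _ c)

  ∏-*ˡ : ∀ n c (f : ℕ → Carrier) → ∏ n (λ i → c * f i) ≡ c ^ n * ∏ n f
  ∏-*ˡ n c f = trans (∏-* n (λ _ → c) f) (cong (_* ∏ n f) (∏-const n c))

  1^ : ∀ n → 1# ^ n ≡ 1#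
  1^ zero = refl
  1^ (suc n) = trans (*-identityˡ _) (1^ n)

  ∏-^ : ∀ n k (f : ℕ → Carrier) → ∏ n (λ i → f i ^ k) ≡ ∏ n f ^ k
  ∏-^ zero k f = sym (1^ k)
  ∏-^ (suc n) k f = trans (cong (_* f n ^ k) (∏-^ n k f)) (sym (^-distrib-* (∏ n f) (f n) k))

  ∏-zero : ∀ n {f} k → k < n → f k ≡ 0# → ∏ n f ≡ 0#
  ∏-zero (suc n) {f} k k<n e with ℕ.m≤n⇒m<n∨m≡n (ℕ.≤-pred k<n)
  ... | inj₁ k<n′ = trans (cong (_* f n) (∏-zero n k k<n′ e)) (zeroˡ _)
  ... | inj₂ refl = trans (cong (∏ n f *_) e) (zeroʳ _)

  ι-^ : ∀ m n → ι (m ℕ.^ n) ≡ ι m ^ n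
  ι-^ m zero = +-identityʳ 1#
  ι-^ m (suc n) = trans (ι-* m (m ℕ.^ n)) (cong (ι m *_) (ι-^ m n))

  ι-∸ : ∀ {m n} → n ≤ m → ι (m ∸ n) ≡ ι m - ι n
  ι-∸ {m} {n} n≤m = begin
    ι (m ∸ n) ≡⟨ solve 2 (λ x y → x := x :+ y :- y) refl _ (ι n) ⟩
    ι (m ∸ n) + ι n - ι n ≡⟨ cong (_- ι n) (sym (ι-+ (m ∸ n) n)) ⟩
    ι (m ∸ n ℕ.+ n) - ι n ≡⟨ cong (λ k → ι k - ι n) (ℕ.m∸n+n≡m n≤m) ⟩
    ι m - ι n ∎

  private
    commutativeSemiring = CommutativeRing.commutativeSemiring commutativeRing
    open Algebra.Properties.Semiring.Mult (CommutativeRing.semiring commutativeRing) using () renaming (_×_ to _×′_)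

    ×-ι : ∀ n x → n ×′ x ≡ ι n * x
    ×-ι zero x = sym (zeroˡ x)
    ×-ι (suc n) x = trans (cong (x +_) (×-ι n x)) (solve 2 (λ x y → x :+ y :* x := (κ 1 :+ y) :* x) refl _ _)

  binomial-theorem : ∀ n x y → (x + y) ^ n ≡ ∑ (suc n) (λ k → ι (n C k) * (x ^ k * y ^ (n ∸ k)))
  binomial-theorem n x y = begin
    (x + y) ^ n ≡⟨ Binomial.theorem commutativeSemiring n x y ⟩
    Binomial.binomialExpansion commutativeSemiring x y n ≡⟨ sym (∑-sum (suc n) (λ k → (n C k) ×′ (x ^ k * y ^ (n ∸ k)))) ⟩
    ∑ (suc n) (λ k → (n C k) ×′ (x ^ k * y ^ (n ∸ k))) ≡⟨ ∑-cong (suc n) (λ k → ×-ι (n C k) _) ⟩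
    ∑ (suc n) (λ k → ι (n C k) * (x ^ k * y ^ (n ∸ k))) ∎

-- Fields of characteristic zero

record Field : Set₁ where
  field
    cring : CRing
  open CRing cring
  field
    inv : Carrier → Carrier
    *-invʳ : ∀ x → x ≢ 0# → x * inv x ≡ 1#
    char-0 : ∀ n → ι (suc n) ≢ 0#

module FieldTheory (F : Field) where
  open Field F public using (inv; *-invʳ; char-0)
  open Sums (Field.cring F) public
  open ≡-Reasoning

  1≢0 : 1# ≢ 0#
  1≢0 e = char-0 0 (trans (+-identityʳ 1#) e)

  *-cancelˡ : ∀ {c x y} → c ≢ 0# → c * x ≡ c * y → x ≡ y
  *-cancelˡ {c} {x} {y} c≢0 e = begin
    x ≡⟨ sym (*-identityˡ x) ⟩
    1# * x ≡⟨ cong (_* x) (sym (*-invʳ c c≢0)) ⟩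
    c * inv c * x ≡⟨ solve 3 (λ c i x → c :* i :* x := i :* (c :* x)) refl c _ x ⟩
    inv c * (c * x) ≡⟨ cong (inv c *_) e ⟩
    inv c * (c * y) ≡⟨ solve 3 (λ c i x → i :* (c :* x) := c :* i :* x) refl c _ y ⟩
    c * inv c * y ≡⟨ cong (_* y) (*-invʳ c c≢0) ⟩
    1# * y ≡⟨ *-identityˡ y ⟩
    y ∎

  *-≢0 : ∀ {x y} → x ≢ 0# → y ≢ 0# → x * y ≢ 0#
  *-≢0 {x} {y} x≢0 y≢0 e = y≢0 (*-cancelˡ x≢0 (trans e (sym (zeroʳ x))))

  unit-≢0 : ∀ {x y} → x * y ≡ 1# → x ≢ 0#
  unit-≢0 {x} {y} e x≡0 = 1≢0 (trans (sym e) (trans (cong (_* y) x≡0) (zeroˡ y)))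

  ι-≢0 : ∀ n → n ≢ 0 → ι n ≢ 0#
  ι-≢0 zero n≢0 = ⊥-elim (n≢0 refl)
  ι-≢0 (suc n) _ = char-0 n

  inv-unique : ∀ {x y} → x * y ≡ 1# → inv x ≡ y
  inv-unique {x} {y} e = *-cancelˡ (unit-≢0 e) (trans (*-invʳ x (unit-≢0 e)) (sym e))

  inv-* : ∀ {x y} → x ≢ 0# → y ≢ 0# → inv (x * y) ≡ inv x * inv y
  inv-* {x} {y} x≢0 y≢0 = inv-unique (begin
    x * y * (inv x * inv y) ≡⟨ solve 4 (λ x y i j → x :* y :* (i :* j) := x :* i :* (y :* j)) refl x y _ _ ⟩
    x * inv x * (y * inv y) ≡⟨ cong₂ _*_ (*-invʳ x x≢0) (*-invʳ y y≢0) ⟩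
    1# * 1# ≡⟨ *-identityˡ 1# ⟩
    1# ∎)

  inv-1 : inv 1# ≡ 1#
  inv-1 = inv-unique (*-identityˡ 1#)

  *-inv-cancelʳ : ∀ {c} x → c ≢ 0# → x * c * inv c ≡ x
  *-inv-cancelʳ {c} x c≢0 = trans (*-assoc x c _) (trans (cong (x *_) (*-invʳ c c≢0)) (*-identityʳ x))

  div-unique : ∀ {x y z} → y ≢ 0# → x ≡ z * y → x * inv y ≡ z
  div-unique {y = y} {z} y≢0 e = trans (cong (_* inv y) e) (*-inv-cancelʳ z y≢0)

  cross-multiply : ∀ {a b c d} → b ≢ 0# → d ≢ 0# → a * d ≡ c * b → a * inv b ≡ c * inv d
  cross-multiply {a} {b} {c} {d} b≢0 d≢0 e = *-cancelˡ (*-≢0 b≢0 d≢0) (begin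
    b * d * (a * inv b) ≡⟨ solve 4 (λ a b d i → b :* d :* (a :* i) := b :* i :* (a :* d)) refl a b d _ ⟩
    b * inv b * (a * d) ≡⟨ cong₂ _*_ (*-invʳ b b≢0) e ⟩
    1# * (c * b) ≡⟨ cong (_* (c * b)) (sym (*-invʳ d d≢0)) ⟩
    d * inv d * (c * b) ≡⟨ solve 4 (λ c b d i → d :* i :* (c :* b) := b :* d :* (c :* i)) refl c b d _ ⟩
    b * d * (c * inv d) ∎)

  ∏-≢0 : ∀ n {f} → (∀ i → i < n → f i ≢ 0#) → ∏ n f ≢ 0#
  ∏-≢0 zero h = 1≢0
  ∏-≢0 (suc n) h = *-≢0 (∏-≢0 n (λ i i<n → h i (ℕ.m<n⇒m<1+n i<n))) (h n ℕ.≤-refl)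

  ^-≢0 : ∀ n {x} → x ≢ 0# → x ^ n ≢ 0#
  ^-≢0 zero h = 1≢0
  ^-≢0 (suc n) h = *-≢0 h (^-≢0 n h)

  inv-∏ : ∀ n {f : ℕ → Carrier} → (∀ i → i < n → f i ≢ 0#) → inv (∏ n f) ≡ ∏ n (λ i → inv (f i))
  inv-∏ zero h = inv-1
  inv-∏ (suc n) {f} h = trans (inv-* (∏-≢0 n h′) (h n ℕ.≤-refl)) (cong (_* inv (f n)) (inv-∏ n h′))
    where h′ = λ i i<n → h i (ℕ.m<n⇒m<1+n i<n)

  inv-^ : ∀ n {x} → x ≢ 0# → inv (x ^ n) ≡ inv x ^ n
  inv-^ zero h = inv-1
  inv-^ (suc n) {x} h = trans (inv-* h (^-≢0 n h)) (cong (inv x *_) (inv-^ n h))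

-- ℤ₍ₚ₎ as a predicate on an abstract field: over ℚ itself every operation would normalise fractions during type checking.
record Localisation (F : Field) (p : ℕ) : Set₁ where
  open FieldTheory F
  field
    Integral : Carrier → Set
    Integral-+ : ∀ {x y} → Integral x → Integral y → Integral (x + y)
    Integral-* : ∀ {x y} → Integral x → Integral y → Integral (x * y)
    Integral-neg : ∀ {x} → Integral x → Integral (- x)
    Integral-0 : Integral 0#
    Integral-1 : Integral 1#
    Integral-inv : ∀ n → p ∤ n → Integral (inv (ι n))
    descend : ∀ z {r} → Integral r → ιℤ z ≡ ι p * r → p ∣ ℤ.∣ z ∣

-- Congruences modulo powers of p

module Congruences (F : Field) (p : ℕ) (L : Localisation F p) where
  open FieldTheory F public
  open ≡-Reasoning
  private module L = Localisation L

  record O (x : Carrier) : Set where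
    constructor mkO
    field integral-element : L.Integral x
  open O

  +-O : ∀ {x y} → O x → O y → O (x + y)
  +-O (mkO a) (mkO b) = mkO (L.Integral-+ a b)
  *-O : ∀ {x y} → O x → O y → O (x * y)
  *-O (mkO a) (mkO b) = mkO (L.Integral-* a b)
  neg-O : ∀ {x} → O x → O (- x)
  neg-O (mkO a) = mkO (L.Integral-neg a)

  instance
    O-+ : ∀ {x y} {{_ : O x}} {{_ : O y}} → O (x + y)
    O-+ {{a}} {{b}} = +-O a b
    O-* : ∀ {x y} {{_ : O x}} {{_ : O y}} → O (x * y)
    O-* {{a}} {{b}} = *-O a b
    O-neg : ∀ {x} {{_ : O x}} → O (- x)
    O-neg {{a}} = neg-O a
    O-0 : O 0#
    O-0 = mkO L.Integral-0
    O-1 : O 1#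
    O-1 = mkO L.Integral-1

  O-ι : ∀ n → O (ι n)
  O-ι zero = O-0
  O-ι (suc n) = +-O O-1 (O-ι n)

  O-^ : ∀ {x} n → O x → O (x ^ n)
  O-^ zero a = O-1
  O-^ (suc n) a = *-O a (O-^ n a)

  O-inv : ∀ {n} → p ∤ n → O (inv (ι n))
  O-inv p∤n = mkO (L.Integral-inv _ p∤n)

  descend : ∀ z {r} → O r → ιℤ z ≡ ι p * r → p ∣ ℤ.∣ z ∣
  descend z (mkO a) = L.descend z a

  O-ιℤ : ∀ z → O (ιℤ z)
  O-ιℤ (ℤ.+ n) = subst O (sym (ιℤ-pos n)) (O-ι n)
  O-ιℤ -[1+ n ] = neg-O (O-ι (suc n))

  O-∑ : ∀ n {f} → (∀ i → i < n → O (f i)) → O (∑ n f)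
  O-∑ zero h = O-0
  O-∑ (suc n) h = +-O (O-∑ n λ i i<n → h i (ℕ.m<n⇒m<1+n i<n)) (h n ℕ.≤-refl)

  O-∏ : ∀ n {f} → (∀ i → i < n → O (f i)) → O (∏ n f)
  O-∏ zero h = O-1
  O-∏ (suc n) h = *-O (O-∏ n λ i i<n → h i (ℕ.m<n⇒m<1+n i<n)) (h n ℕ.≤-refl)

  infix 4 _≈_[_]
  record _≈_[_] (x y : Carrier) (k : ℕ) : Set where
    constructor modulo
    field
      quot : Carrier
      integral : O quot
      difference : x - y ≡ ι p ^ k * quot
  open _≈_[_] public

  ≈-reflexive : ∀ {x y k} → x ≡ y → x ≈ y [ k ]
  ≈-reflexive {x} refl = modulo 0# O-0 (trans (-‿inverseʳ x) (sym (zeroʳ _)))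

  ≈-refl : ∀ {x k} → x ≈ x [ k ]
  ≈-refl = ≈-reflexive refl

  ≈-sym : ∀ {x y k} → x ≈ y [ k ] → y ≈ x [ k ]
  ≈-sym {x} {y} (modulo r Or e) = modulo (- r) (neg-O Or)
    (trans (solve 2 (λ x y → y :- x := ⊝ (x :- y)) refl x y) (trans (cong -_ e) (solve 2 (λ x y → ⊝ (x :* y) := x :* (⊝ y)) refl _ r)))

  ≈-+ : ∀ {x y x′ y′ k} → x ≈ y [ k ] → x′ ≈ y′ [ k ] → x + x′ ≈ y + y′ [ k ]
  ≈-+ {x} {y} {x′} {y′} (modulo r Or e) (modulo s Os f) = modulo (r + s) (+-O Or Os)
    (trans (solve 4 (λ x y x′ y′ → x :+ x′ :- (y :+ y′) := x :- y :+ (x′ :- y′)) refl x y x′ y′) (trans (cong₂ _+_ e f) (sym (distribˡ _ r s))))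

  ≈-trans : ∀ {x y z k} → x ≈ y [ k ] → y ≈ z [ k ] → x ≈ z [ k ]
  ≈-trans {x} {y} {z} (modulo r Or e) (modulo s Os f) = modulo (r + s) (+-O Or Os)
    (trans (solve 3 (λ x y z → x :- z := x :- y :+ (y :- z)) refl x y z) (trans (cong₂ _+_ e f) (sym (distribˡ _ r s))))

  ≈-neg : ∀ {x y k} → x ≈ y [ k ] → - x ≈ - y [ k ]
  ≈-neg {x} {y} (modulo r Or e) = modulo (- r) (neg-O Or)
    (trans (solve 2 (λ x y → ⊝ x :- ⊝ y := ⊝ (x :- y)) refl x y) (trans (cong -_ e) (solve 2 (λ x y → ⊝ (x :* y) := x :* (⊝ y)) refl _ r)))

  ≈-- : ∀ {x y x′ y′ k} → x ≈ y [ k ] → x′ ≈ y′ [ k ] → x - x′ ≈ y - y′ [ k ]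
  ≈-- a b = ≈-+ a (≈-neg b)

  ≈-*ˡ : ∀ {x y k} c {{_ : O c}} → x ≈ y [ k ] → c * x ≈ c * y [ k ]
  ≈-*ˡ {x} {y} c {{Oc}} (modulo r Or e) = modulo (c * r) (*-O Oc Or)
    (trans (solve 3 (λ c x y → c :* x :- c :* y := c :* (x :- y)) refl c x y) (trans (cong (c *_) e) (solve 3 (λ x y z → x :* (y :* z) := y :* (x :* z)) refl c _ r)))

  ≈-*ʳ : ∀ {x y k} c {{_ : O c}} → x ≈ y [ k ] → x * c ≈ y * c [ k ]
  ≈-*ʳ {x} {y} {k} c h = subst₂ (λ a b → a ≈ b [ k ]) (*-comm c x) (*-comm c y) (≈-*ˡ {k = k} c h)

  ≈-* : ∀ {x y x′ y′ k} {{_ : O x}} {{_ : O y′}} → x ≈ y [ k ] → x′ ≈ y′ [ k ] → x * x′ ≈ y * y′ [ k ]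
  ≈-* {x} {y} {x′} {y′} {k} a b = ≈-trans (≈-*ˡ x b) (≈-*ʳ y′ a)

  ≈-lower : ∀ {x y} j {k} → x ≈ y [ k ℕ.+ j ] → x ≈ y [ j ]
  ≈-lower j {k} (modulo r Or e) = modulo (ι p ^ k * r) (*-O (O-^ k (O-ι p)) Or)
    (trans e (trans (cong (_* r) (^-homo-* (ι p) k j)) (solve 3 (λ x y z → x :* y :* z := y :* (x :* z)) refl _ _ r)))

  -- A factor divisible by p^j raises the precision by j. This is how a value known modulo p² or p³
  -- suffices for the result modulo p⁴.
  ≈-scale : ∀ {c x y j k} {{_ : O x}} → c ≈ 0# [ j ] → x ≈ y [ k ] → c * x ≈ c * y [ j ℕ.+ k ]
  ≈-scale {c} {x} {y} {j} {k} (modulo q Oq e) (modulo r Or f) = modulo (q * r) (O-* {{Oq}} {{Or}}) (begin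
    c * x - c * y ≡⟨ solve 3 (λ c x y → c :* x :- c :* y := (c :- κ 0) :* (x :- y)) refl c x y ⟩
    (c - 0#) * (x - y) ≡⟨ cong₂ _*_ e f ⟩
    ι p ^ j * q * (ι p ^ k * r) ≡⟨ solve 4 (λ x y z w → x :* y :* (z :* w) := x :* z :* (y :* w)) refl _ q _ r ⟩
    ι p ^ j * ι p ^ k * (q * r) ≡⟨ cong (_* (q * r)) (sym (^-homo-* (ι p) j k)) ⟩
    ι p ^ (j ℕ.+ k) * (q * r) ∎)

  ≈0-* : ∀ {c x j k} → c ≈ 0# [ j ] → x ≈ 0# [ k ] → c * x ≈ 0# [ j ℕ.+ k ]
  ≈0-* {c} {x} {j} {k} (modulo q Oq e) (modulo r Or f) = modulo (q * r) (O-* {{Oq}} {{Or}}) (begin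
    c * x - 0# ≡⟨ solve 2 (λ c x → c :* x :- κ 0 := (c :- κ 0) :* (x :- κ 0)) refl c x ⟩
    (c - 0#) * (x - 0#) ≡⟨ cong₂ _*_ e f ⟩
    ι p ^ j * q * (ι p ^ k * r) ≡⟨ solve 4 (λ x y z w → x :* y :* (z :* w) := x :* z :* (y :* w)) refl _ q _ r ⟩
    ι p ^ j * ι p ^ k * (q * r) ≡⟨ cong (_* (q * r)) (sym (^-homo-* (ι p) j k)) ⟩
    ι p ^ (j ℕ.+ k) * (q * r) ∎)

  ≈0-*ʳ : ∀ {c k} x {{_ : O x}} → c ≈ 0# [ k ] → c * x ≈ 0# [ k ]
  ≈0-*ʳ {k = k} x h = ≈-trans (≈-*ʳ x h) (≈-reflexive (zeroˡ x))

  ≈0-*ˡ : ∀ {c k} x {{_ : O x}} → c ≈ 0# [ k ] → x * c ≈ 0# [ k ]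
  ≈0-*ˡ {k = k} x h = ≈-trans (≈-*ˡ x h) (≈-reflexive (zeroʳ x))

  p≈0 : ι p ≈ 0# [ 1 ]
  p≈0 = modulo 1# O-1 (solve 1 (λ x → x :- κ 0 := x :* κ 1 :* κ 1) refl _)

  ≈⇒-≈0 : ∀ {x y k} → x ≈ y [ k ] → x - y ≈ 0# [ k ]
  ≈⇒-≈0 (modulo r Or e) = modulo r Or (trans (solve 1 (λ x → x :- κ 0 := x) refl _) e)

  -≈0⇒≈ : ∀ {x y k} → x - y ≈ 0# [ k ] → x ≈ y [ k ]
  -≈0⇒≈ (modulo r Or e) = modulo r Or (trans (solve 1 (λ x → x := x :- κ 0) refl _) e)

  ≈-cancel : ∀ {c x y k} d {{_ : O d}} → d * c ≡ 1# → c * x ≈ c * y [ k ] → x ≈ y [ k ]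
  ≈-cancel {c} {x} {y} d e h = ≈-trans (≈-reflexive (sym (lemma x))) (≈-trans (≈-*ˡ d h) (≈-reflexive (lemma y)))
    where
    lemma : ∀ x → d * (c * x) ≡ x
    lemma x = trans (sym (*-assoc d c x)) (trans (cong (_* x) e) (*-identityˡ x))

  O-≈ : ∀ {x y k} {{_ : O y}} → x ≈ y [ k ] → O x
  O-≈ {x} {y} {k} {{Oy}} (modulo r Or e) = subst O (trans (cong (_+ y) (sym e)) (solve 2 (λ x y → x :- y :+ y := x) refl x y)) (+-O (*-O (O-^ k (O-ι p)) Or) Oy)

  ≈-^ : ∀ {x y k} n {{_ : O x}} {{_ : O y}} → x ≈ y [ k ] → x ^ n ≈ y ^ n [ k ]
  ≈-^ {k = k} zero h = ≈-refl {1#} {k}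
  ≈-^ {k = k} (suc n) {{Ox}} {{Oy}} h = ≈-* {k = k} {{Ox}} {{O-^ n Oy}} h (≈-^ n {{Ox}} {{Oy}} h)

  ∑-≈ : ∀ n {f g k} → (∀ i → i < n → f i ≈ g i [ k ]) → ∑ n f ≈ ∑ n g [ k ]
  ∑-≈ zero h = ≈-refl
  ∑-≈ (suc n) h = ≈-+ (∑-≈ n λ i i<n → h i (ℕ.m<n⇒m<1+n i<n)) (h n ℕ.≤-refl)

  ∑-≈0 : ∀ n {f k} → (∀ i → i < n → f i ≈ 0# [ k ]) → ∑ n f ≈ 0# [ k ]
  ∑-≈0 n h = ≈-trans (∑-≈ n h) (≈-reflexive (∑-0 n (λ _ _ → refl)))

  ∏-≈ : ∀ n {f g k} → (∀ i → i < n → O (f i)) → (∀ i → i < n → O (g i)) → (∀ i → i < n → f i ≈ g i [ k ]) → ∏ n f ≈ ∏ n g [ k ]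
  ∏-≈ zero a b h = ≈-refl
  ∏-≈ (suc n) a b h = ≈-* {{O-∏ n λ i i<n → a i (ℕ.m<n⇒m<1+n i<n)}} {{b n ℕ.≤-refl}}
    (∏-≈ n (λ i i<n → a i (ℕ.m<n⇒m<1+n i<n)) (λ i i<n → b i (ℕ.m<n⇒m<1+n i<n)) λ i i<n → h i (ℕ.m<n⇒m<1+n i<n)) (h n ℕ.≤-refl)

  -- Modulo p^k the element e behaves as a dual number, so only the linear term of the expanded
  -- product survives.
  ∏-1+ : ∀ n {e y k} {{_ : O e}} → e * e ≈ 0# [ k ] → (∀ i → i < n → O (y i)) → ∏ n (λ i → 1# + e * y i) ≈ 1# + e * ∑ n y [ k ]
  ∏-1+ zero {e} h O-y = ≈-reflexive (solve 1 (λ e → κ 1 := κ 1 :+ e :* κ 0) refl e)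
  ∏-1+ (suc n) {e} {y} {k} h O-y = ≈-trans (≈-*ʳ (1# + e * y n) (∏-1+ n h O-y′)) (≈-trans
      (≈-reflexive (solve 3 (λ e s y → (κ 1 :+ e :* s) :* (κ 1 :+ e :* y) := κ 1 :+ e :* (s :+ y) :+ e :* e :* (s :* y)) refl e (∑ n y) (y n)))
      (≈-trans (≈-+ ≈-refl (≈0-*ʳ (∑ n y * y n) h)) (≈-reflexive (+-identityʳ _))))
    where
    O-y′ : ∀ i → i < n → O (y i)
    O-y′ i i<n = O-y i (ℕ.m<n⇒m<1+n i<n)
    instance
      _ : O (y n)
      _ = O-y n ℕ.≤-refl
      _ : O (∑ n y)
      _ = O-∑ n O-y′

  module ≈-Reasoning where
    infix 1 begin≈_
    infixr 2 _≈⟨_⟩_ _≡≈⟨_⟩_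
    infix 3 _∎≈
    begin≈_ : ∀ {x y k} → x ≈ y [ k ] → x ≈ y [ k ]
    begin≈ h = h
    _≈⟨_⟩_ : ∀ x {y z k} → x ≈ y [ k ] → y ≈ z [ k ] → x ≈ z [ k ]
    x ≈⟨ h ⟩ h′ = ≈-trans h h′
    _≡≈⟨_⟩_ : ∀ x {y z k} → x ≡ y → y ≈ z [ k ] → x ≈ z [ k ]
    x ≡≈⟨ refl ⟩ h = h
    _∎≈ : ∀ x {k} → x ≈ x [ k ]
    x ∎≈ = ≈-refl

-- A terminating very-well-poised series

module VeryWellPoised (F : Field) where
  open FieldTheory F
  open ≡-Reasoning

  module _ (a e f : Carrier) where
    -- This is (x + β)(x + γ), given by e = β + γ and f = βγ so that β and γ need not lie in the
    -- field. The numerator parameters that it encodes are a - β and a - γ.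
    D : Carrier → Carrier
    D x = x * x + e * x + f

    W : ℕ → Carrier
    W k = ∏ k (λ i → (a + ι i) * D (- (a + ι i)) * inv (ι (suc i) * D (ι (suc i))))

    -- The well-poised pair (-n)_k / (1 + a + n)_k, which terminates the series.
    ρ : ℕ → ℕ → Carrier
    ρ n k = ∏ k (λ i → (ι i - ι n) * inv (ι (suc n) + a + ι i))

    -- The weight a + 2k is a times the very-well-poised factor (1 + a/2)_k / (a/2)_k.
    summand : ℕ → ℕ → Carrier
    summand n k = (a + ι 2 * ι k) * (W k * ρ n k)

    module _ (D≢0 : ∀ i → D (ι (suc i)) ≢ 0#) (a≢0 : ∀ i → a + ι (suc i) ≢ 0#) where

      module _ (n : ℕ) where
        private
          m = ι (suc n)

          q≢0 : ∀ k → m + a + ι k ≢ 0#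
          q≢0 k h = a≢0 (n ℕ.+ k) (trans (cong (a +_) (ι-+ (suc n) k))
            (trans (solve 3 (λ a m k → a :+ (m :+ k) := m :+ a :+ k) refl a m (ι k)) h))

        -- It has the numerator of `ρ (suc n)` and the denominator of `ρ n`. Both are simple
        -- multiples of it, so that a recurrence in n becomes a polynomial identity.
        σ : ℕ → Carrier
        σ k = ∏ k (λ i → (ι i - m) * inv (m + a + ι i))

        ρ-σ : ∀ k → ρ n k * m ≡ σ k * (m - ι k)
        ρ-σ zero = solve 1 (λ m → κ 1 :* m := κ 1 :* (m :- κ 0)) refl m
        ρ-σ (suc k) = begin
          ρ n k * ((ι k - ι n) * v) * m ≡⟨ solve 5 (λ r k n v m → r :* ((k :- n) :* v) :* m := r :* m :* ((k :- n) :* v)) refl (ρ n k) (ι k) (ι n) v m ⟩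
          ρ n k * m * ((ι k - ι n) * v) ≡⟨ cong (_* ((ι k - ι n) * v)) (ρ-σ k) ⟩
          σ k * (m - ι k) * ((ι k - ι n) * v) ≡⟨ solve 4 (λ s k n v → s :* (κ 1 :+ n :- k) :* ((k :- n) :* v) := s :* ((k :- (κ 1 :+ n)) :* v) :* (κ 1 :+ n :- (κ 1 :+ k))) refl (σ k) (ι k) (ι n) v ⟩
          σ k * ((ι k - m) * v) * (m - ι (suc k)) ∎
          where v = inv (m + a + ι k)

        ρ-suc-σ : ∀ k → ρ (suc n) k * (m + a + ι k) ≡ σ k * (m + a)
        ρ-suc-σ zero = solve 2 (λ m a → κ 1 :* (m :+ a :+ κ 0) := κ 1 :* (m :+ a)) refl m a
        ρ-suc-σ (suc k) = begin
          ρ (suc n) k * ((ι k - m) * inv (ι (suc (suc n)) + a + ι k)) * (m + a + ι (suc k))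
            ≡⟨ solve 6 (λ r d v m a k → r :* (d :* v) :* (m :+ a :+ (κ 1 :+ k)) := r :* d :* ((κ 1 :+ m :+ a :+ k) :* v)) refl (ρ (suc n) k) (ι k - m) v m a (ι k) ⟩
          ρ (suc n) k * (ι k - m) * (q′ * v) ≡⟨ cong (ρ (suc n) k * (ι k - m) *_) (trans (*-invʳ q′ q′≢0) (sym (*-invʳ _ (q≢0 k)))) ⟩
          ρ (suc n) k * (ι k - m) * (q * inv q) ≡⟨ solve 4 (λ r d q i → r :* d :* (q :* i) := r :* q :* (d :* i)) refl (ρ (suc n) k) (ι k - m) q (inv q) ⟩
          ρ (suc n) k * q * ((ι k - m) * inv q) ≡⟨ cong (_* ((ι k - m) * inv q)) (ρ-suc-σ k) ⟩
          σ k * (m + a) * ((ι k - m) * inv q) ≡⟨ solve 3 (λ s t d → s :* t :* d := s :* d :* t) refl (σ k) (m + a) ((ι k - m) * inv q) ⟩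
          σ k * ((ι k - m) * inv q) * (m + a) ∎
          where
          q = m + a + ι k
          q′ = ι (suc (suc n)) + a + ι k
          v = inv q′
          q′≢0 : q′ ≢ 0#
          q′≢0 h = q≢0 (suc k) (trans (solve 3 (λ m a k → m :+ a :+ (κ 1 :+ k) := κ 1 :+ m :+ a :+ k) refl m a (ι k)) h)

        W-suc : ∀ k → W (suc k) * (ι (suc k) * D (ι (suc k))) ≡ W k * ((a + ι k) * D (- (a + ι k)))
        W-suc k = begin
          W k * (x * inv y) * y ≡⟨ solve 4 (λ w x i y → w :* (x :* i) :* y := w :* x :* (y :* i)) refl (W k) x (inv y) y ⟩
          W k * x * (y * inv y) ≡⟨ cong (W k * x *_) (*-invʳ y (*-≢0 (char-0 k) (D≢0 k))) ⟩
          W k * x * 1# ≡⟨ *-identityʳ _ ⟩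
          W k * x ∎
          where
          x = (a + ι k) * D (- (a + ι k))
          y = ι (suc k) * D (ι (suc k))

        -- The Wilf–Zeilberger certificate.
        G : ℕ → Carrier
        G k = σ k * (W k * (ι k * D (ι k)))

        summand-recurrence : ∀ k → m * (D m * summand (suc n) k - (m + a) * (m - a + e) * summand n k)
          ≡ - (m + a) * (G (suc k) - G k)
        summand-recurrence k = *-cancelˡ (q≢0 k) (begin
          q * (m * (D m * summand (suc n) k - (m + a) * (m - a + e) * summand n k))
            ≡⟨ solve 9 (λ q m d c w r′ t u r → q :* (m :* (d :* (c :* (w :* r′)) :- t :* u :* (c :* (w :* r))))
                 := c :* w :* (m :* d :* (r′ :* q) :- t :* u :* (r :* m) :* q)) refl
                 q m (D m) (a + ι 2 * ι k) (W k) (ρ (suc n) k) (m + a) (m - a + e) (ρ n k) ⟩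
          (a + ι 2 * ι k) * W k * (m * D m * (ρ (suc n) k * q) - (m + a) * (m - a + e) * (ρ n k * m) * q)
            ≡⟨ cong₂ (λ x y → (a + ι 2 * ι k) * W k * (m * D m * x - (m + a) * (m - a + e) * y * q)) (ρ-suc-σ k) (ρ-σ k) ⟩
          (a + ι 2 * ι k) * W k * (m * D m * (σ k * (m + a)) - (m + a) * (m - a + e) * (σ k * (m - ι k)) * q)
            -- With `σ k` and `W k` as common factors, the whole recurrence is this polynomial
            -- identity in a, e, f, m and k.
            ≡⟨ solve 7 (λ a e f m k w s → let d = λ x → x :* x :+ e :* x :+ f in
                 (a :+ κ 2 :* k) :* w :* (m :* d m :* (s :* (m :+ a)) :- (m :+ a) :* (m :- a :+ e) :* (s :* (m :- k)) :* (m :+ a :+ k))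
                 := ⊝ (m :+ a) :* (s :* (k :- m) :* (w :* ((a :+ k) :* d (⊝ (a :+ k)))) :- (m :+ a :+ k) :* (s :* (w :* (k :* d k)))))
                 refl a e f m (ι k) (W k) (σ k) ⟩
          - (m + a) * (σ k * (ι k - m) * (W k * ((a + ι k) * D (- (a + ι k)))) - q * G k)
            ≡⟨ cong (λ x → - (m + a) * (x - q * G k)) (sym G-suc) ⟩
          - (m + a) * (q * G (suc k) - q * G k)
            ≡⟨ solve 4 (λ t q g h → ⊝ t :* (q :* g :- q :* h) := q :* (⊝ t :* (g :- h))) refl (m + a) q (G (suc k)) (G k) ⟩
          q * (- (m + a) * (G (suc k) - G k)) ∎)
          where
          q = m + a + ι k
          G-suc : q * G (suc k) ≡ σ k * (ι k - m) * (W k * ((a + ι k) * D (- (a + ι k))))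
          G-suc = begin
            q * (σ k * ((ι k - m) * inv q) * (W (suc k) * (ι (suc k) * D (ι (suc k))))) ≡⟨ cong (λ x → q * (σ k * ((ι k - m) * inv q) * x)) (W-suc k) ⟩
            q * (σ k * ((ι k - m) * inv q) * x) ≡⟨ solve 5 (λ q s d i x → q :* (s :* (d :* i) :* x) := q :* i :* (s :* d :* x)) refl q (σ k) (ι k - m) (inv q) x ⟩
            q * inv q * (σ k * (ι k - m) * x) ≡⟨ cong (_* (σ k * (ι k - m) * x)) (*-invʳ q (q≢0 k)) ⟩
            1# * (σ k * (ι k - m) * x) ≡⟨ *-identityˡ _ ⟩
            σ k * (ι k - m) * x ∎
            where x = W k * ((a + ι k) * D (- (a + ι k)))

        sum-recurrence : D m * ∑ (suc (suc n)) (summand (suc n)) ≡ (m + a) * (m - a + e) * ∑ (suc n) (summand n)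
        sum-recurrence = begin
          D m * ∑ N (summand (suc n)) ≡⟨ solve 2 (λ x y → x := x :- y :+ y) refl _ (c * ∑ N (summand n)) ⟩
          D m * ∑ N (summand (suc n)) - c * ∑ N (summand n) + c * ∑ N (summand n) ≡⟨ cong₂ _+_ vanish (cong (c *_) last) ⟩
          0# + c * ∑ (suc n) (summand n) ≡⟨ +-identityˡ _ ⟩
          c * ∑ (suc n) (summand n) ∎
          where
          N = suc (suc n)
          c = (m + a) * (m - a + e)
          -- The factor i = n of `ρ n (suc n)` is zero, so both sums may run over the same range.
          last : ∑ N (summand n) ≡ ∑ (suc n) (summand n)
          last = trans (cong (∑ (suc n) (summand n) +_)
                   (trans (cong (λ x → (a + ι 2 * m) * (W (suc n) * x)) (∏-zero (suc n) n ℕ.≤-refl (trans (cong (_* inv (m + a + ι n)) (-‿inverseʳ (ι n))) (zeroˡ _))))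
                     (solve 2 (λ x y → x :* (y :* κ 0) := κ 0) refl _ (W (suc n)))))
                   (+-identityʳ _)
          -- The factor i = n + 1 kills `G` at the upper end; at the lower end it vanishes through
          -- its factor k.
          σ-end : σ N ≡ 0#
          σ-end = ∏-zero N (suc n) ℕ.≤-refl (trans (cong (_* inv (m + a + m)) (-‿inverseʳ m)) (zeroˡ _))
          vanish : D m * ∑ N (summand (suc n)) - c * ∑ N (summand n) ≡ 0#
          vanish = *-cancelˡ (char-0 n) (begin
            m * (D m * ∑ N (summand (suc n)) - c * ∑ N (summand n)) ≡⟨ cong (m *_) (sym (cong₂ _-_ (∑-*ˡ N (D m) (summand (suc n))) (∑-*ˡ N c (summand n)))) ⟩
            m * (∑ N (λ k → D m * summand (suc n) k) - ∑ N (λ k → c * summand n k)) ≡⟨ cong (m *_) (sym (∑-- N _ _)) ⟩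
            m * ∑ N (λ k → D m * summand (suc n) k - c * summand n k) ≡⟨ sym (∑-*ˡ N m _) ⟩
            ∑ N (λ k → m * (D m * summand (suc n) k - c * summand n k)) ≡⟨ ∑-cong N summand-recurrence ⟩
            ∑ N (λ k → - (m + a) * (G (suc k) - G k)) ≡⟨ ∑-*ˡ N (- (m + a)) (λ k → G (suc k) - G k) ⟩
            - (m + a) * ∑ N (λ k → G (suc k) - G k) ≡⟨ cong (- (m + a) *_) (∑-telescope N G) ⟩
            - (m + a) * (σ N * (W N * (ι N * D (ι N))) - 1# * (1# * (0# * D 0#))) ≡⟨ cong (λ x → - (m + a) * (x * (W N * (ι N * D (ι N))) - 1# * (1# * (0# * D 0#)))) σ-end ⟩
            - (m + a) * (0# * (W N * (ι N * D (ι N))) - 1# * (1# * (0# * D 0#))) ≡⟨ solve 4 (λ t x d m → ⊝ t :* (κ 0 :* x :- κ 1 :* (κ 1 :* (κ 0 :* d))) := m :* κ 0) refl (m + a) _ (D 0#) m ⟩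
            m * 0# ∎)

      -- With b = a - β and c = a - γ this is the classical value (1 + a)_n (1 + a - b - c)_n / ((1
      -- + a - b)_n (1 + a - c)_n), multiplied by the a that the weight contains.
      sum-closed-form : ∀ n → ∑ (suc n) (summand n) ≡ a * ∏ n (λ i → (ι (suc i) + a) * (ι (suc i) - a + e) * inv (D (ι (suc i))))
      sum-closed-form zero = solve 1 (λ a → κ 0 :+ (a :+ κ 2 :* κ 0) :* (κ 1 :* κ 1) := a :* κ 1) refl a
      sum-closed-form (suc n) = *-cancelˡ (D≢0 n) (begin
        D m * ∑ (suc (suc n)) (summand (suc n)) ≡⟨ sum-recurrence n ⟩
        c * ∑ (suc n) (summand n) ≡⟨ cong (c *_) (sum-closed-form n) ⟩
        c * (a * P) ≡⟨ sym (*-identityˡ _) ⟩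
        1# * (c * (a * P)) ≡⟨ cong (_* (c * (a * P))) (sym (*-invʳ (D m) (D≢0 n))) ⟩
        D m * inv (D m) * (c * (a * P)) ≡⟨ solve 5 (λ d i c a p → d :* i :* (c :* (a :* p)) := d :* (a :* (p :* (c :* i)))) refl (D m) (inv (D m)) c a P ⟩
        D m * (a * (P * (c * inv (D m)))) ∎)
        where
        m = ι (suc n)
        c = (m + a) * (m - a + e)
        P = ∏ n (λ i → (ι (suc i) + a) * (ι (suc i) - a + e) * inv (D (ι (suc i))))

-- Units modulo p and a symmetric binomial sum

module PrimeCongruences (F : Field) (p : ℕ) (L : Localisation F p) (p-prime : Prime p) (3<p : 3 < p) where
  open Congruences F p L public
  open ≡-Reasoning

  instance
    O-p : O (ι p)
    O-p = O-ι p

  p∤ : ∀ {n} → n ≢ 0 → n < p → p ∤ n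
  p∤ {zero} n≢0 _ = ⊥-elim (n≢0 refl)
  p∤ {suc n} _ n<p = Div.>⇒∤ n<p

  p∤-* : ∀ {m n} → p ∤ m → p ∤ n → p ∤ m ℕ.* n
  p∤-* {m} {n} a b h with euclidsLemma m n p-prime h
  ... | inj₁ c = a c
  ... | inj₂ c = b c

  p∤2 : p ∤ 2
  p∤2 = p∤ (λ ()) (ℕ.<-trans (ℕ.n<1+n 2) 3<p)

  p∤3 : p ∤ 3
  p∤3 = p∤ (λ ()) 3<p

  p∤4 : p ∤ 4
  p∤4 = p∤-* {2} {2} p∤2 p∤2

  p∤⇒≢0 : ∀ {n} → p ∤ n → n ≢ 0
  p∤⇒≢0 h refl = h (p Div.∣0)

  p≢0 : p ≢ 0
  p≢0 refl = ℕ.n≮0 3<p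

  ιp≢0 : ι p ≢ 0#
  ιp≢0 = ι-≢0 p p≢0

  ι-invʳ : ∀ {n} → p ∤ n → ι n * inv (ι n) ≡ 1#
  ι-invʳ {n} h = *-invʳ (ι n) (ι-≢0 n (p∤⇒≢0 h))

  ι-invˡ : ∀ {n} → p ∤ n → inv (ι n) * ι n ≡ 1#
  ι-invˡ h = trans (*-comm _ _) (ι-invʳ h)

  ι-cancel : ∀ {n x y k} → p ∤ n → ι n * x ≈ ι n * y [ k ] → x ≈ y [ k ]
  ι-cancel {n} h = ≈-cancel (inv (ι n)) {{O-inv h}} (ι-invˡ h)

  inv-reflect : ∀ {m n} → p ∤ m → p ∤ n → m ℕ.+ n ≡ p → inv (ι m) ≈ - inv (ι n) [ 1 ]
  inv-reflect {m} {n} p∤m p∤n e = ι-cancel p∤m (begin≈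
    ι m * inv (ι m) ≡≈⟨ trans (ι-invʳ p∤m) (trans (sym (ι-invʳ p∤n)) (trans (solve 3 (λ m n i → n :* i := m :* (⊝ i) :+ (m :+ n) :* i) refl (ι m) (ι n) (inv (ι n))) (cong (λ x → ι m * - inv (ι n) + x * inv (ι n)) (trans (sym (ι-+ m n)) (cong ι e))))) ⟩
    ι m * - inv (ι n) + ι p * inv (ι n) ≈⟨ ≈-+ ≈-refl (≈0-*ʳ (inv (ι n)) {{O-inv p∤n}} p≈0) ⟩
    ι m * - inv (ι n) + 0# ≡≈⟨ +-identityʳ _ ⟩
    ι m * - inv (ι n) ∎≈)
    where open ≈-Reasoning

  ∏-≈0 : ∀ n {f} k → k < n → (∀ i → i < n → O (f i)) → f k ≈ 0# [ 1 ] → ∏ n f ≈ 0# [ 1 ]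
  ∏-≈0 (suc n) {f} k k<n h e with ℕ.m≤n⇒m<n∨m≡n (ℕ.≤-pred k<n)
  ... | inj₁ k<n′ = ≈0-*ʳ (f n) {{h n ℕ.≤-refl}} (∏-≈0 n k k<n′ (λ i i<n → h i (ℕ.m<n⇒m<1+n i<n)) e)
  ... | inj₂ refl = ≈0-*ˡ (∏ n f) {{O-∏ n (λ i i<n → h i (ℕ.m<n⇒m<1+n i<n))}} e

  double-zero : ∀ {x} → x ≡ - x → x ≡ 0#
  double-zero {x} e = *-cancelˡ (char-0 1) (begin
    ι 2 * x ≡⟨ solve 1 (λ x → κ 2 :* x := x :+ x) refl x ⟩
    x + x ≡⟨ cong (_+ x) e ⟩
    - x + x ≡⟨ solve 1 (λ x → ⊝ x :+ x := κ 2 :* κ 0) refl x ⟩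
    ι 2 * 0# ∎)

  ∑-antisymmetric : ∀ n {f} → (∀ k → k ≤ n → f (n ∸ k) ≡ - f k) → ∑ (suc n) f ≡ 0#
  ∑-antisymmetric n {f} h = double-zero (begin
    ∑ (suc n) f ≡⟨ ∑-reverse (suc n) f ⟩
    ∑ (suc n) (λ k → f (n ∸ k)) ≡⟨ ∑-cong< (suc n) (λ k k<n → h k (ℕ.≤-pred k<n)) ⟩
    ∑ (suc n) (λ k → - f k) ≡⟨ ∑-neg (suc n) f ⟩
    - ∑ (suc n) f ∎)

  factorial : ℕ → Carrier
  factorial n = ∏ n (λ i → ι (suc i))

  factorial-≢0 : ∀ n → factorial n ≢ 0#
  factorial-≢0 n = ∏-≢0 n (λ i _ → char-0 i)

  -- The binomial coefficient as a product of k quotients, a form that can be compared factor by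
  -- factor with the product `B k` of the reduction.
  choose : ℕ → ℕ → Carrier
  choose j k = ∏ k (λ i → ι (j ∸ i) * inv (ι (suc i)))

  ∸-suc : ∀ {j k} → k < j → j ∸ k ≡ suc (j ∸ suc k)
  ∸-suc {j} {k} k<j = ℕ.+-∸-assoc 1 k<j

  choose-factorial : ∀ j k → k ≤ j → choose j k * (factorial k * factorial (j ∸ k)) ≡ factorial j
  choose-factorial j zero _ = solve 1 (λ x → κ 1 :* (κ 1 :* x) := x) refl (factorial j)
  choose-factorial j (suc k) k<j = begin
    choose j k * (ι (j ∸ k) * inv (ι (suc k))) * (factorial k * ι (suc k) * factorial (j ∸ suc k))
      ≡⟨ solve 6 (λ c x i f s g → c :* (x :* i) :* (f :* s :* g) := c :* (f :* (g :* x)) :* (s :* i)) refl (choose j k) (ι (j ∸ k)) (inv (ι (suc k))) (factorial k) (ι (suc k)) (factorial (j ∸ suc k)) ⟩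
    choose j k * (factorial k * (factorial (j ∸ suc k) * ι (j ∸ k))) * (ι (suc k) * inv (ι (suc k)))
      ≡⟨ cong₂ (λ x y → choose j k * (factorial k * x) * y) step (*-invʳ _ (char-0 k)) ⟩
    choose j k * (factorial k * factorial (j ∸ k)) * 1# ≡⟨ *-identityʳ _ ⟩
    choose j k * (factorial k * factorial (j ∸ k)) ≡⟨ choose-factorial j k (ℕ.<⇒≤ k<j) ⟩
    factorial j ∎
    where
    step : factorial (j ∸ suc k) * ι (j ∸ k) ≡ factorial (j ∸ k)
    step rewrite ∸-suc k<j = refl

  choose-sym : ∀ j k → k ≤ j → choose j (j ∸ k) ≡ choose j k
  choose-sym j k k≤j = *-cancelˡ (*-≢0 (factorial-≢0 k) (factorial-≢0 (j ∸ k))) (begin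
    factorial k * factorial (j ∸ k) * choose j (j ∸ k) ≡⟨ solve 3 (λ x y z → x :* y :* z := z :* (y :* x)) refl (factorial k) (factorial (j ∸ k)) _ ⟩
    choose j (j ∸ k) * (factorial (j ∸ k) * factorial k) ≡⟨ cong (λ i → choose j (j ∸ k) * (factorial (j ∸ k) * factorial i)) (sym (ℕ.m∸[m∸n]≡n k≤j)) ⟩
    choose j (j ∸ k) * (factorial (j ∸ k) * factorial (j ∸ (j ∸ k))) ≡⟨ choose-factorial j (j ∸ k) (ℕ.m∸n≤m j k) ⟩
    factorial j ≡⟨ sym (choose-factorial j k k≤j) ⟩
    choose j k * (factorial k * factorial (j ∸ k)) ≡⟨ *-comm _ _ ⟩
    factorial k * factorial (j ∸ k) * choose j k ∎)

  harmonic³ : ℕ → Carrier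
  harmonic³ n = ∑ n (λ i → inv (ι (suc i)) ^ 3)

  harmonic³-top : ∀ j k → k ≤ j → ∑ k (λ i → inv (ι (j ∸ i)) ^ 3) ≡ harmonic³ j - harmonic³ (j ∸ k)
  harmonic³-top j zero _ = sym (-‿inverseʳ _)
  harmonic³-top j (suc k) k<j = begin
    ∑ k (λ i → inv (ι (j ∸ i)) ^ 3) + inv (ι (j ∸ k)) ^ 3 ≡⟨ cong₂ _+_ (harmonic³-top j k (ℕ.<⇒≤ k<j)) refl ⟩
    harmonic³ j - harmonic³ (j ∸ k) + inv (ι (j ∸ k)) ^ 3 ≡⟨ cong (λ n → harmonic³ j - harmonic³ n + inv (ι n) ^ 3) (∸-suc k<j) ⟩
    harmonic³ j - (harmonic³ (j ∸ suc k) + x) + x ≡⟨ solve 3 (λ a b x → a :- (b :+ x) :+ x := a :- b) refl _ _ x ⟩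
    harmonic³ j - harmonic³ (j ∸ suc k) ∎
    where x = inv (ι (suc (j ∸ suc k))) ^ 3

  -- Let H be the sums of inverse cubes. The inner sum is H_k + H_{j-k} - H_j, hence unchanged under
  -- k ↦ j - k, as is the binomial coefficient, while the weight 2k - j changes sign.
  weighted-choose-sum : ∀ j → ∑ (suc j) (λ k → (ι 2 * ι k - ι j) * choose j k ^ 4 * ∑ k (λ i → inv (ι (suc i)) ^ 3 - inv (ι (j ∸ i)) ^ 3)) ≡ 0#
  weighted-choose-sum j = ∑-antisymmetric j step
    where
    h : ℕ → Carrier
    h k = ∑ k (λ i → inv (ι (suc i)) ^ 3 - inv (ι (j ∸ i)) ^ 3)
    h-eq : ∀ k → k ≤ j → h k ≡ harmonic³ k - (harmonic³ j - harmonic³ (j ∸ k))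
    h-eq k k≤j = trans (∑-- k _ _) (cong (λ x → harmonic³ k - x) (harmonic³-top j k k≤j))
    h-sym : ∀ k → k ≤ j → h (j ∸ k) ≡ h k
    h-sym k k≤j = begin
      h (j ∸ k) ≡⟨ h-eq (j ∸ k) (ℕ.m∸n≤m j k) ⟩
      harmonic³ (j ∸ k) - (harmonic³ j - harmonic³ (j ∸ (j ∸ k))) ≡⟨ cong (λ i → harmonic³ (j ∸ k) - (harmonic³ j - harmonic³ i)) (ℕ.m∸[m∸n]≡n k≤j) ⟩
      harmonic³ (j ∸ k) - (harmonic³ j - harmonic³ k) ≡⟨ solve 3 (λ x y z → x :- (y :- z) := z :- (y :- x)) refl _ _ _ ⟩
      harmonic³ k - (harmonic³ j - harmonic³ (j ∸ k)) ≡⟨ sym (h-eq k k≤j) ⟩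
      h k ∎
    step : ∀ k → k ≤ j → (ι 2 * ι (j ∸ k) - ι j) * choose j (j ∸ k) ^ 4 * h (j ∸ k) ≡ - ((ι 2 * ι k - ι j) * choose j k ^ 4 * h k)
    step k k≤j = trans
      (cong₂ (λ x y → (ι 2 * x - ι j) * choose j (j ∸ k) ^ 4 * y) (ι-∸ k≤j) (h-sym k k≤j))
      (trans (cong (λ c → (ι 2 * (ι j - ι k) - ι j) * c ^ 4 * h k) (choose-sym j k k≤j))
        (solve 4 (λ j k c h → (κ 2 :* (j :- k) :- j) :* c :^ 4 :* h := ⊝ ((κ 2 :* k :- j) :* c :^ 4 :* h)) refl (ι j) (ι k) (choose j k) (h k)))

-- Reduction of the sum to a finite product

module Reduction (F : Field) (p : ℕ) (L : Localisation F p) (p-prime : Prime p) (3<p : 3 < p)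
  (c j : ℕ) (4j+3≡cp : 4 ℕ.* j ℕ.+ 3 ≡ c ℕ.* p) (j<p : j < p) where
  open PrimeCongruences F p L p-prime 3<p
  open VeryWellPoised F using (D; W; ρ; summand; sum-closed-form)
  open ≡-Reasoning

  ¼ a t θ : Carrier
  ¼ = inv (ι 4)
  a = ι 3 * ¼
  t = ι c * ι p * ¼
  θ = t * t * t

  instance
    O-¼ : O ¼
    O-¼ = O-inv p∤4
    O-c : O (ι c)
    O-c = O-ι c

  O-t : O t
  O-t = *-O (*-O O-c O-p) O-¼

  4t : ι 4 * t ≡ ι c * ι p
  4t = trans (solve 3 (λ f x i → f :* (x :* i) := x :* (f :* i)) refl (ι 4) (ι c * ι p) ¼)
         (trans (cong (ι c * ι p *_) (ι-invʳ p∤4)) (*-identityʳ _))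

  4a : ι 4 * a ≡ ι 3
  4a = trans (solve 3 (λ f x i → f :* (x :* i) := x :* (f :* i)) refl (ι 4) (ι 3) ¼)
         (trans (cong (ι 3 *_) (ι-invʳ p∤4)) (*-identityʳ _))

  z : ℕ → Carrier
  z i = a + ι i

  4z : ∀ i → ι 4 * z i ≡ ι (4 ℕ.* i ℕ.+ 3)
  4z i = begin
    ι 4 * (a + ι i) ≡⟨ distribˡ _ _ _ ⟩
    ι 4 * a + ι 4 * ι i ≡⟨ cong₂ _+_ 4a (sym (ι-* 4 i)) ⟩
    ι 3 + ι (4 ℕ.* i) ≡⟨ +-comm _ _ ⟩
    ι (4 ℕ.* i) + ι 3 ≡⟨ sym (ι-+ (4 ℕ.* i) 3) ⟩
    ι (4 ℕ.* i ℕ.+ 3) ∎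

  z-j : z j ≡ t
  z-j = *-cancelˡ (char-0 3) (trans (4z j) (trans (cong ι 4j+3≡cp) (trans (ι-* c p) (sym 4t))))

  ι-j : ι j ≡ t - a
  ι-j = trans (solve 2 (λ a j → j := a :+ j :- a) refl a (ι j)) (cong (_- a) z-j)

  z-top : ∀ {i} → i ≤ j → z i ≡ t - ι (j ∸ i)
  z-top {i} i≤j = begin
    a + ι i ≡⟨ solve 3 (λ a i t → a :+ i := t :- (t :- a :- i)) refl a (ι i) t ⟩
    t - (t - a - ι i) ≡⟨ cong (λ x → t - (x - ι i)) (sym ι-j) ⟩
    t - (ι j - ι i) ≡⟨ cong (λ x → t - x) (sym (ι-∸ i≤j)) ⟩
    t - ι (j ∸ i) ∎

  t≈0 : t ≈ 0# [ 1 ]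
  t≈0 = ≈0-*ʳ ¼ (≈0-*ˡ (ι c) p≈0)

  θ≈0 : θ ≈ 0# [ 3 ]
  θ≈0 = ≈0-* (≈0-* t≈0 t≈0) t≈0

  O-θ : O θ
  O-θ = O-≈ θ≈0

  s : ℕ → Carrier
  s i = ι (suc i)

  𝔇 : Carrier → Carrier
  𝔇 = D a (- t) (t * t)

  X : ℕ → Carrier
  X i = s i * s i * s i + θ

  X-factor : ∀ i → X i ≡ (s i + t) * 𝔇 (s i)
  X-factor i = solve 2 (λ s t → s :* s :* s :+ t :* t :* t := (s :+ t) :* (s :* s :+ ⊝ t :* s :+ t :* t)) refl (s i) t

  private
    4s cp³ : ℕ → ℕ
    4s i = 4 ℕ.* suc i
    cp³ i = c ℕ.* p ℕ.* (c ℕ.* p) ℕ.* (c ℕ.* p)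

  N : ℕ → ℕ
  N i = 4s i ℕ.* 4s i ℕ.* 4s i ℕ.+ cp³ i

  -- Clearing the denominator 4 of t shows a positive integer that is (4s)³ modulo p. The first
  -- property gives `X≢0`, the second the integrality of 1/X when s is prime to p.
  64X : ∀ i → ι 4 * ι 4 * ι 4 * X i ≡ ι (N i)
  64X i = begin
    ι 4 * ι 4 * ι 4 * X i ≡⟨ solve 3 (λ f s t → f :* f :* f :* (s :* s :* s :+ t :* t :* t) := f :* s :* (f :* s) :* (f :* s) :+ f :* t :* (f :* t) :* (f :* t)) refl (ι 4) (s i) t ⟩
    ι 4 * s i * (ι 4 * s i) * (ι 4 * s i) + ι 4 * t * (ι 4 * t) * (ι 4 * t) ≡⟨ cong₂ (λ x y → x * x * x + y * y * y) (sym (ι-* 4 (suc i))) (trans 4t (sym (ι-* c p))) ⟩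
    ι (4s i) * ι (4s i) * ι (4s i) + ι cp * ι cp * ι cp ≡⟨ sym (trans (ι-+ (4s i ℕ.* 4s i ℕ.* 4s i) (cp³ i)) (cong₂ _+_ (cube (4s i)) (cube cp))) ⟩
    ι (N i) ∎
    where
    cp = c ℕ.* p
    cube : ∀ n → ι (n ℕ.* n ℕ.* n) ≡ ι n * ι n * ι n
    cube n = trans (ι-* (n ℕ.* n) n) (cong (_* ι n) (ι-* n n))

  X≢0 : ∀ i → X i ≢ 0#
  X≢0 i e = ι-≢0 (N i) (λ ()) (trans (sym (64X i)) (trans (cong (ι 4 * ι 4 * ι 4 *_) e) (zeroʳ _)))

  𝔇≢0 : ∀ i → 𝔇 (s i) ≢ 0#
  𝔇≢0 i e = X≢0 i (trans (X-factor i) (trans (cong ((s i + t) *_) e) (zeroʳ _)))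

  s+t≢0 : ∀ i → s i + t ≢ 0#
  s+t≢0 i e = X≢0 i (trans (X-factor i) (trans (cong (_* 𝔇 (s i)) e) (zeroˡ _)))

  a+s≢0 : ∀ i → a + ι (suc i) ≢ 0#
  a+s≢0 i e = ι-≢0 (4 ℕ.* suc i ℕ.+ 3) (λ ()) (trans (sym (4z (suc i))) (trans (cong (ι 4 *_) e) (zeroʳ _)))

  p∤s : ∀ {i} → suc i < p → p ∤ suc i
  p∤s = p∤ (λ ())

  O-inv-X : ∀ {i} → suc i < p → O (inv (X i))
  O-inv-X {i} h = subst O (sym (inv-unique (trans (solve 3 (λ x f n → x :* (f :* n) := f :* x :* n) refl (X i) (ι 4 * ι 4 * ι 4) (inv (ι (N i))))
    (trans (cong (_* inv (ι (N i))) (64X i)) (ι-invʳ p∤N))))) (*-O (*-O (*-O (O-ι 4) (O-ι 4)) (O-ι 4)) (O-inv p∤N))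
    where
    p∤4s = p∤-* {4} {suc i} p∤4 (p∤s {i} h)
    p∤N : p ∤ N i
    p∤N d = p∤-* {4s i ℕ.* 4s i} {4s i} (p∤-* {4s i} {4s i} p∤4s p∤4s) p∤4s
      (Div.∣m+n∣m⇒∣n (subst (p ∣_) (ℕ.+-comm _ (cp³ i)) d) (Div.∣n⇒∣m*n (c ℕ.* p ℕ.* (c ℕ.* p)) (Div.n∣m*n c)))

  O-inv-s : ∀ {i} → suc i < p → O (inv (s i))
  O-inv-s {i} h = O-inv (p∤s {i} h)

  -- The multiple cp of p exceeds 4i + 3 by 4(j - i), where 0 < j - i < p.
  p∤4i+3 : ∀ {i} → i < j → p ∤ 4 ℕ.* i ℕ.+ 3
  p∤4i+3 {i} i<j d = p∤-* {4} {j ∸ i} p∤4 (p∤ (λ e → ℕ.<-irrefl refl (ℕ.<-≤-trans i<j (ℕ.m∸n≡0⇒m≤n e))) (ℕ.≤-<-trans (ℕ.m∸n≤m j i) j<p))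
    (Div.∣m+n∣m⇒∣n (subst (p ∣_) eq (Div.n∣m*n c)) d)
    where
    eq : c ℕ.* p ≡ 4 ℕ.* i ℕ.+ 3 ℕ.+ 4 ℕ.* (j ∸ i)
    eq = trans (sym 4j+3≡cp) (trans (cong (λ n → 4 ℕ.* n ℕ.+ 3) (sym (ℕ.m+[n∸m]≡n (ℕ.<⇒≤ i<j))))
      (solveℕ 2 (λ x y → # 4 ⊠ (x ⊞ y) ⊞ # 3 :≡ # 4 ⊠ x ⊞ # 3 ⊞ # 4 ⊠ y) refl i (j ∸ i)))

  z⁻¹ : ℕ → Carrier
  z⁻¹ i = ι 4 * inv (ι (4 ℕ.* i ℕ.+ 3))

  z-inv : ∀ i → z i * z⁻¹ i ≡ 1#
  z-inv i = trans (solve 3 (λ z f n → z :* (f :* n) := f :* z :* n) refl (z i) (ι 4) _)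
    (trans (cong (_* inv (ι (4 ℕ.* i ℕ.+ 3))) (4z i)) (*-invʳ _ (ι-≢0 _ (λ e → ℕ.1+n≢0 (trans (ℕ.+-comm 3 (4 ℕ.* i)) e)))))

  O-z⁻¹ : ∀ {i} → i < j → O (z⁻¹ i)
  O-z⁻¹ i<j = *-O (O-ι 4) (O-inv (p∤4i+3 i<j))

  V : ℕ → Carrier
  V i = z i * (z i * z i * z i - θ) * inv (s i * X i)

  V-eq : ∀ i → (a + ι i) * 𝔇 (- (a + ι i)) * inv (s i * 𝔇 (s i)) * ((ι i - ι j) * inv (ι (suc j) + a + ι i)) ≡ V i
  V-eq i = begin
    z i * 𝔇 (- z i) * inv (s i * 𝔇 (s i)) * ((ι i - ι j) * inv (ι (suc j) + a + ι i))
      ≡⟨ cong₂ (λ x y → z i * 𝔇 (- z i) * inv (s i * 𝔇 (s i)) * (x * inv y)) num den ⟩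
    z i * 𝔇 (- z i) * inv (s i * 𝔇 (s i)) * ((z i - t) * inv (s i + t))
      ≡⟨ solve 5 (λ z d u w v → z :* d :* u :* (w :* v) := z :* (w :* d) :* (u :* v)) refl (z i) (𝔇 (- z i)) (inv (s i * 𝔇 (s i))) (z i - t) (inv (s i + t)) ⟩
    z i * ((z i - t) * 𝔇 (- z i)) * (inv (s i * 𝔇 (s i)) * inv (s i + t))
      ≡⟨ cong₂ (λ x y → z i * x * y)
           (solve 2 (λ z t → (z :- t) :* (⊝ z :* ⊝ z :+ ⊝ t :* ⊝ z :+ t :* t) := z :* z :* z :- t :* t :* t) refl (z i) t)
           (sym (inv-* (*-≢0 (char-0 i) (𝔇≢0 i)) (s+t≢0 i))) ⟩
    z i * (z i * z i * z i - θ) * inv (s i * 𝔇 (s i) * (s i + t))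
      ≡⟨ cong (λ x → z i * (z i * z i * z i - θ) * inv x) (trans (solve 3 (λ s d x → s :* d :* x := s :* (x :* d)) refl (s i) (𝔇 (s i)) (s i + t)) (cong (s i *_) (sym (X-factor i)))) ⟩
    V i ∎
    where
    num : ι i - ι j ≡ z i - t
    num = trans (cong (λ x → ι i - x) ι-j) (solve 3 (λ i t a → i :- (t :- a) := a :+ i :- t) refl (ι i) t a)
    den : ι (suc j) + a + ι i ≡ s i + t
    den = trans (cong (λ x → 1# + x + a + ι i) ι-j) (solve 3 (λ i t a → κ 1 :+ (t :- a) :+ a :+ i := κ 1 :+ i :+ t) refl (ι i) t a)

  Wρ : ∀ k → W a (- t) (t * t) k * ρ a (- t) (t * t) j k ≡ ∏ k V
  Wρ k = trans (sym (∏-* k _ _)) (∏-cong k V-eq)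

  r h : ℕ → Carrier
  r i = z i * inv (s i)
  h i = z⁻¹ i ^ 3 + inv (s i) ^ 3

  -- `V i` is the undeformed factor `r i ^ 4` times (1 - θ/z³)/(1 + θ/s³). Expanding to first order
  -- in θ leaves an error divisible by θ², thus by p⁶.
  V≈ : ∀ {i} → i < j → V i ≈ r i ^ 4 * (1# + - θ * h i) [ 4 ]
  V≈ {i} i<j = ≈-sym (≈-cancel (σ * inv (X i)) cancel (-≈0⇒≈ (≈-trans (≈-reflexive diff) (≈0-*ʳ (E) (≈-lower 4 {2} (≈0-* θ≈0 θ≈0))))))
    where
    s+1<p = ℕ.≤-<-trans i<j j<p
    σ = inv (s i)
    instance
      _ : O σ
      _ = O-inv-s {i} s+1<p
      _ : O (inv (X i))
      _ = O-inv-X {i} s+1<p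
      _ : O (z⁻¹ i)
      _ = O-z⁻¹ i<j
      _ : O (ι i)
      _ = O-ι i
    ss : s i * σ ≡ 1#
    ss = *-invʳ (s i) (char-0 i)
    zz = z-inv i
    sX≢0 = *-≢0 (char-0 i) (X≢0 i)
    cancel : σ * inv (X i) * (s i * X i) ≡ 1#
    cancel = trans (cong (_* (s i * X i)) (sym (inv-* (char-0 i) (X≢0 i)))) (trans (*-comm _ _) (*-invʳ _ sX≢0))
    -- The coefficient of θ² that remains when the first-order expansion is multiplied by sX.
    E : Carrier
    E = - (z i * (σ * σ * σ)) - z i * z i * z i * z i * (σ * σ * σ * σ * σ * σ)
    sXV : s i * X i * V i ≡ z i * (z i * z i * z i - θ)
    sXV = trans (*-comm _ _) (trans (*-assoc _ _ _) (trans (cong (z i * (z i * z i * z i - θ) *_) (trans (*-comm _ _) (*-invʳ _ sX≢0))) (*-identityʳ _)))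
    -- Both sides are evaluated after replacing z z⁻¹ and s σ by 1.
    normal : s i * X i * (r i ^ 4 * (1# + - θ * h i)) ≡ z i * z i * z i * z i - θ * z i + θ * θ * E
    normal = begin
      s i * X i * (r i ^ 4 * (1# + - θ * h i))
        ≡⟨ solve 5 (λ z w s σ θ → s :* (s :* s :* s :+ θ) :* ((z :* σ) :^ 4 :* (κ 1 :+ ⊝ θ :* (w :^ 3 :+ σ :^ 3)))
             := (s :* σ) :^ 4 :* (z :^ 4 :- θ :* z :* (z :* w) :^ 3 :- θ :* z :^ 4 :* σ :^ 3)
                :+ (s :* σ) :* θ :* (σ :^ 3 :* (z :^ 4 :- θ :* z :* (z :* w) :^ 3 :- θ :* z :^ 4 :* σ :^ 3))) refl (z i) (z⁻¹ i) (s i) σ θ ⟩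
      (s i * σ) ^ 4 * (z i ^ 4 - θ * z i * (z i * z⁻¹ i) ^ 3 - θ * z i ^ 4 * σ ^ 3) + s i * σ * θ * (σ ^ 3 * (z i ^ 4 - θ * z i * (z i * z⁻¹ i) ^ 3 - θ * z i ^ 4 * σ ^ 3))
        ≡⟨ cong₂ (λ x y → x ^ 4 * (z i ^ 4 - θ * z i * y ^ 3 - θ * z i ^ 4 * σ ^ 3) + x * θ * (σ ^ 3 * (z i ^ 4 - θ * z i * y ^ 3 - θ * z i ^ 4 * σ ^ 3))) ss zz ⟩
      1# ^ 4 * (z i ^ 4 - θ * z i * 1# ^ 3 - θ * z i ^ 4 * σ ^ 3) + 1# * θ * (σ ^ 3 * (z i ^ 4 - θ * z i * 1# ^ 3 - θ * z i ^ 4 * σ ^ 3))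
        ≡⟨ solve 3 (λ z σ θ → κ 1 :^ 4 :* (z :^ 4 :- θ :* z :* κ 1 :^ 3 :- θ :* z :^ 4 :* σ :^ 3) :+ κ 1 :* θ :* (σ :^ 3 :* (z :^ 4 :- θ :* z :* κ 1 :^ 3 :- θ :* z :^ 4 :* σ :^ 3))
             := z :* z :* z :* z :- θ :* z :+ θ :* θ :* (⊝ (z :* (σ :* σ :* σ)) :- z :* z :* z :* z :* (σ :* σ :* σ :* σ :* σ :* σ))) refl (z i) σ θ ⟩
      z i * z i * z i * z i - θ * z i + θ * θ * E ∎
    diff : s i * X i * (r i ^ 4 * (1# + - θ * h i)) - s i * X i * V i ≡ θ * θ * E
    diff = trans (cong₂ _-_ normal sXV) (solve 3 (λ z θ e → z :* z :* z :* z :- θ :* z :+ θ :* θ :* e :- z :* (z :* z :* z :- θ) := θ :* θ :* e) refl (z i) θ E)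

  O-s : ∀ i → O (s i)
  O-s i = O-ι (suc i)

  O-z : ∀ i → O (z i)
  O-z i = +-O (*-O (O-ι 3) O-¼) (O-ι i)

  O-r : ∀ {i} → suc i < p → O (r i)
  O-r {i} h = *-O (O-z i) (O-inv-s {i} h)

  O-h : ∀ {i} → i < j → O (h i)
  O-h {i} i<j = +-O (O-^ 3 (O-z⁻¹ i<j)) (O-^ 3 (O-inv-s {i} (ℕ.≤-<-trans i<j j<p)))

  s<p : ∀ {i} → i < j → suc i < p
  s<p i<j = ℕ.≤-<-trans i<j j<p

  B : ℕ → Carrier
  B k = ∏ k r

  weight : ℕ → Carrier
  weight k = a + ι 2 * ι k

  O-weight : ∀ k → O (weight k)
  O-weight k = +-O (*-O (O-ι 3) O-¼) (*-O (O-ι 2) (O-ι k))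

  O-B : ∀ {k} → k < p → O (B k)
  O-B {k} k<p = O-∏ k (λ i i<k → O-r {i} (ℕ.≤-<-trans i<k k<p))

  ∏V≈ : ∀ {k} → k ≤ j → ∏ k V ≈ B k ^ 4 * (1# + - θ * ∑ k h) [ 4 ]
  ∏V≈ {k} k≤j = begin≈
    ∏ k V ≈⟨ ∏-≈ k (λ i i<k → O-≈ {{O-V₀ i i<k}} (V≈ (i<j i<k))) O-V₀ (λ i i<k → V≈ (i<j i<k)) ⟩
    ∏ k (λ i → r i ^ 4 * (1# + - θ * h i)) ≡≈⟨ trans (∏-* k _ _) (cong (_* ∏ k (λ i → 1# + - θ * h i)) (∏-^ k 4 r)) ⟩
    B k ^ 4 * ∏ k (λ i → 1# + - θ * h i) ≈⟨ ≈-*ˡ (B k ^ 4) {{O-^ 4 (O-B (ℕ.≤-<-trans k≤j j<p))}} (∏-1+ k (≈-lower 4 {2} θθ) λ i i<k → O-h (i<j i<k)) ⟩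
    B k ^ 4 * (1# + - θ * ∑ k h) ∎≈
    where
    open ≈-Reasoning
    i<j : ∀ {i} → i < k → i < j
    i<j i<k = ℕ.<-≤-trans i<k k≤j
    O-V₀ : ∀ i → i < k → O (r i ^ 4 * (1# + - θ * h i))
    O-V₀ i i<k = *-O (O-^ 4 (O-r {i} (s<p (i<j i<k)))) (+-O O-1 (*-O (neg-O O-θ) (O-h (i<j i<k))))
    θθ : - θ * - θ ≈ 0# [ 6 ]
    θθ = ≈-trans (≈-reflexive (solve 1 (λ x → ⊝ x :* ⊝ x := x :* x) refl θ)) (≈0-* θ≈0 θ≈0)

  correction : ℕ → Carrier
  correction k = weight k * B k ^ 4 * ∑ k h

  -- From z j = t ≡ 0 it follows that z i ≡ -(j - i) modulo p. So `B k ^ 4` becomes the fourth power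
  -- of a binomial coefficient, the weight becomes 2k - j, and the sum turns into
  -- `weighted-choose-sum`.
  correction≈0 : ∑ (suc j) correction ≈ 0# [ 1 ]
  correction≈0 = ≈-trans (∑-≈ (suc j) λ k k<1+j → step (ℕ.≤-pred k<1+j)) (≈-reflexive (weighted-choose-sum j))
    where
    open ≈-Reasoning
    z≈ : ∀ {i} → i < j → z i ≈ - ι (j ∸ i) [ 1 ]
    z≈ {i} i<j = ≈-trans (≈-reflexive (z-top (ℕ.<⇒≤ i<j))) (≈-trans (≈-+ t≈0 ≈-refl) (≈-reflexive (+-identityˡ _)))
    p∤j-i : ∀ {i} → i < j → p ∤ j ∸ i
    p∤j-i {i} i<j rewrite ∸-suc i<j = p∤s {j ∸ suc i} (subst (_< p) (∸-suc i<j) (ℕ.≤-<-trans (ℕ.m∸n≤m j i) j<p))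
    z⁻¹≈ : ∀ {i} → i < j → z⁻¹ i ≈ - inv (ι (j ∸ i)) [ 1 ]
    z⁻¹≈ {i} i<j = ≈-cancel (z⁻¹ i) {{O-z⁻¹ i<j}} (trans (*-comm _ _) (z-inv i)) (begin≈
      z i * z⁻¹ i ≡≈⟨ trans (z-inv i) (trans (sym (ι-invʳ (p∤j-i i<j))) (solve 2 (λ x y → x :* y := ⊝ x :* ⊝ y) refl _ _)) ⟩
      - ι (j ∸ i) * - inv (ι (j ∸ i)) ≈⟨ ≈-*ʳ _ {{neg-O (O-inv (p∤j-i i<j))}} (≈-sym (z≈ i<j)) ⟩
      z i * - inv (ι (j ∸ i)) ∎≈)
    h≈ : ∀ {i} → i < j → h i ≈ inv (s i) ^ 3 - inv (ι (j ∸ i)) ^ 3 [ 1 ]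
    h≈ {i} i<j = begin≈
      z⁻¹ i ^ 3 + inv (s i) ^ 3 ≈⟨ ≈-+ (≈-^ 3 {{O-z⁻¹ i<j}} {{neg-O (O-inv (p∤j-i i<j))}} (z⁻¹≈ i<j)) ≈-refl ⟩
      (- inv (ι (j ∸ i))) ^ 3 + inv (s i) ^ 3 ≡≈⟨ solve 2 (λ x y → (⊝ x) :^ 3 :+ y := y :- x :^ 3) refl _ _ ⟩
      inv (s i) ^ 3 - inv (ι (j ∸ i)) ^ 3 ∎≈
    r⁴≈ : ∀ {i} → i < j → r i ^ 4 ≈ (ι (j ∸ i) * inv (s i)) ^ 4 [ 1 ]
    r⁴≈ {i} i<j = begin≈
      r i ^ 4 ≈⟨ ≈-^ 4 {{O-r {i} (s<p i<j)}} {{*-O (neg-O (O-ι (j ∸ i))) O-σ}} (≈-*ʳ (inv (s i)) {{O-σ}} (z≈ i<j)) ⟩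
      (- ι (j ∸ i) * inv (s i)) ^ 4 ≡≈⟨ solve 2 (λ x y → (⊝ x :* y) :^ 4 := (x :* y) :^ 4) refl _ _ ⟩
      (ι (j ∸ i) * inv (s i)) ^ 4 ∎≈
      where O-σ = O-inv-s {i} (s<p i<j)
    B⁴≈ : ∀ {k} → k ≤ j → B k ^ 4 ≈ choose j k ^ 4 [ 1 ]
    B⁴≈ {k} k≤j = subst₂ (λ x y → x ≈ y [ 1 ]) (∏-^ k 4 r) (∏-^ k 4 _) (∏-≈ k
      (λ i i<k → O-^ 4 (O-r {i} (s<p (ℕ.<-≤-trans i<k k≤j))))
      (λ i i<k → O-^ 4 (*-O (O-ι (j ∸ i)) (O-inv-s {i} (s<p (ℕ.<-≤-trans i<k k≤j)))))
      λ i i<k → r⁴≈ (ℕ.<-≤-trans i<k k≤j))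
    weight≈ : ∀ k → weight k ≈ ι 2 * ι k - ι j [ 1 ]
    weight≈ k = begin≈
      a + ι 2 * ι k ≡≈⟨ trans (solve 3 (λ a k j → a :+ κ 2 :* k := a :+ j :+ (κ 2 :* k :- j)) refl a (ι k) (ι j)) (cong (_+ (ι 2 * ι k - ι j)) z-j) ⟩
      t + (ι 2 * ι k - ι j) ≈⟨ ≈-+ t≈0 ≈-refl ⟩
      0# + (ι 2 * ι k - ι j) ≡≈⟨ +-identityˡ _ ⟩
      ι 2 * ι k - ι j ∎≈
    step : ∀ {k} → k ≤ j → correction k ≈ (ι 2 * ι k - ι j) * choose j k ^ 4 * ∑ k (λ i → inv (ι (suc i)) ^ 3 - inv (ι (j ∸ i)) ^ 3) [ 1 ]
    step {k} k≤j = ≈-* {{*-O (O-weight k) O-B⁴}} {{O-∑ k λ i i<k → +-O (O-^ 3 (O-inv-s {i} (s<p (i<j i<k)))) (neg-O (O-^ 3 (O-inv (p∤j-i (i<j i<k)))))}}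
        (≈-* {{O-weight k}} {{O-≈ {{O-B⁴}} (≈-sym (B⁴≈ k≤j))}} (weight≈ k) (B⁴≈ k≤j)) (∑-≈ k λ i i<k → h≈ (i<j i<k))
      where
      i<j : ∀ {i} → i < k → i < j
      i<j i<k = ℕ.<-≤-trans i<k k≤j
      O-B⁴ = O-^ 4 (O-B {k} (ℕ.≤-<-trans k≤j j<p))

  f : ℕ → Carrier
  f = summand a (- t) (t * t) j

  ∑f≈ : ∑ (suc j) f ≈ ∑ (suc j) (λ k → weight k * B k ^ 4) [ 4 ]
  ∑f≈ = begin≈
    ∑ (suc j) f ≈⟨ ∑-≈ (suc j) (λ k k<1+j → step (ℕ.≤-pred k<1+j)) ⟩
    ∑ (suc j) (λ k → weight k * B k ^ 4 - θ * correction k) ≡≈⟨ trans (∑-- (suc j) _ _) (cong (λ x → S - x) (∑-*ˡ (suc j) θ correction)) ⟩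
    S - θ * ∑ (suc j) correction ≈⟨ ≈-- ≈-refl (≈0-* θ≈0 correction≈0) ⟩
    S - 0# ≡≈⟨ solve 1 (λ x → x :- κ 0 := x) refl S ⟩
    S ∎≈
    where
    open ≈-Reasoning
    S = ∑ (suc j) (λ k → weight k * B k ^ 4)
    step : ∀ {k} → k ≤ j → f k ≈ weight k * B k ^ 4 - θ * correction k [ 4 ]
    step {k} k≤j = begin≈
      f k ≡≈⟨ cong (weight k *_) (Wρ k) ⟩
      weight k * ∏ k V ≈⟨ ≈-*ˡ (weight k) {{O-weight k}} (∏V≈ k≤j) ⟩
      weight k * (B k ^ 4 * (1# + - θ * ∑ k h)) ≡≈⟨ solve 4 (λ w b θ s → w :* (b :* (κ 1 :+ ⊝ θ :* s)) := w :* b :- θ :* (w :* b :* s)) refl (weight k) (B k ^ 4) θ (∑ k h) ⟩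
      weight k * B k ^ 4 - θ * correction k ∎≈

  ½ : Carrier
  ½ = inv (ι 2)

  O-½ : O ½
  O-½ = O-inv p∤2

  2a : ι 2 * a ≡ 1# + ½
  2a = *-cancelˡ (char-0 1) (begin
    ι 2 * (ι 2 * a) ≡⟨ solve 1 (λ a → κ 2 :* (κ 2 :* a) := κ 4 :* a) refl a ⟩
    ι 4 * a ≡⟨ 4a ⟩
    ι 3 ≡⟨ solve 0 (κ 3 := κ 2 :+ κ 1) refl ⟩
    ι 2 + 1# ≡⟨ cong (ι 2 +_) (sym (ι-invʳ p∤2)) ⟩
    ι 2 + ι 2 * ½ ≡⟨ solve 2 (λ x h → x :+ x :* h := x :* (κ 1 :+ h)) refl (ι 2) ½ ⟩
    ι 2 * (1# + ½) ∎)

  reflect : ∀ {i} → i < j → j ∸ (j ∸ suc i) ≡ suc i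
  reflect i<j = ℕ.m∸[m∸n]≡n i<j

  -- Because j = t - a, counting the factors from the top turns a ∏ (m + a) into t ∏ (t - m). It
  -- turns ∏ (m - a - t) into ∏ -(m + 1/2), since 2a = 3/2. The cube s³ + t³ reappears when t - s is
  -- extended by s + t.
  4∑f : ι 4 * ∑ (suc j) f ≡ ι c * ι p * ∏ j (λ i → (s i * s i - t * t) * (s i + ½) * inv (X i))
  4∑f = begin
    ι 4 * ∑ (suc j) f ≡⟨ cong (ι 4 *_) (sum-closed-form a (- t) (t * t) 𝔇≢0 a+s≢0 j) ⟩
    ι 4 * (a * ∏ j (λ i → (s i + a) * (s i - a + - t) * inv (𝔇 (s i)))) ≡⟨ cong (λ x → ι 4 * (a * x)) (trans (∏-* j _ _) (cong (_* ∏ j (λ i → inv (𝔇 (s i)))) (∏-* j _ _))) ⟩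
    ι 4 * (a * (P * Q * R)) ≡⟨ solve 5 (λ f a p q r → f :* (a :* (p :* q :* r)) := f :* (a :* p) :* q :* r) refl (ι 4) a P Q R ⟩
    ι 4 * (a * P) * Q * R ≡⟨ cong₂ (λ x y → ι 4 * x * y * R) P-eq Q-eq ⟩
    ι 4 * (P′ * t) * Q′ * R ≡⟨ solve 5 (λ f p t q r → f :* (p :* t) :* q :* r := f :* t :* (p :* q :* r)) refl (ι 4) P′ t Q′ R ⟩
    ι 4 * t * (P′ * Q′ * R) ≡⟨ cong₂ _*_ 4t (sym (trans (∏-* j _ _) (cong (_* R) (∏-* j _ _)))) ⟩
    ι c * ι p * ∏ j (λ i → (t - s i) * - (s i + ½) * inv (𝔇 (s i))) ≡⟨ cong (ι c * ι p *_) (∏-cong j factor) ⟩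
    ι c * ι p * ∏ j (λ i → (s i * s i - t * t) * (s i + ½) * inv (X i)) ∎
    where
    P = ∏ j (λ i → s i + a)
    Q = ∏ j (λ i → s i - a + - t)
    R = ∏ j (λ i → inv (𝔇 (s i)))
    P′ = ∏ j (λ i → t - s i)
    Q′ = ∏ j (λ i → - (s i + ½))
    P-eq : a * P ≡ P′ * t
    P-eq = begin
      a * P ≡⟨ cong₂ _*_ (sym (+-identityʳ a)) (∏-cong j (λ i → +-comm _ a)) ⟩
      z 0 * ∏ j (λ i → z (suc i)) ≡⟨ sym (∏-first j z) ⟩
      ∏ j z * z j ≡⟨ cong₂ _*_ (trans (∏-reverse j z) (∏-cong< j λ i i<j → trans (z-top (ℕ.m∸n≤m j (suc i))) (cong (λ n → t - ι n) (reflect i<j)))) z-j ⟩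
      P′ * t ∎
    Q-eq : Q ≡ Q′
    Q-eq = trans (∏-reverse j _) (∏-cong< j λ i i<j → begin
      s (j ∸ suc i) - a + - t ≡⟨ cong (λ n → ι n - a + - t) (sym (∸-suc i<j)) ⟩
      ι (j ∸ i) - a + - t ≡⟨ cong (λ x → x - a + - t) (trans (ι-∸ (ℕ.<⇒≤ i<j)) (cong (_- ι i) ι-j)) ⟩
      t - a - ι i - a + - t ≡⟨ solve 3 (λ t a i → t :- a :- i :- a :+ ⊝ t := ⊝ (i :+ κ 2 :* a)) refl t a (ι i) ⟩
      - (ι i + ι 2 * a) ≡⟨ cong (λ x → - (ι i + x)) 2a ⟩
      - (ι i + (1# + ½)) ≡⟨ solve 2 (λ i h → ⊝ (i :+ (κ 1 :+ h)) := ⊝ (κ 1 :+ i :+ h)) refl (ι i) ½ ⟩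
      - (s i + ½) ∎)
    factor : ∀ i → (t - s i) * - (s i + ½) * inv (𝔇 (s i)) ≡ (s i * s i - t * t) * (s i + ½) * inv (X i)
    factor i = cross-multiply (𝔇≢0 i) (X≢0 i) (trans (cong ((t - s i) * - (s i + ½) *_) (X-factor i))
      (solve 4 (λ t s h d → (t :- s) :* ⊝ (s :+ h) :* ((s :+ t) :* d) := (s :* s :- t :* t) :* (s :+ h) :* d) refl t (s i) ½ (𝔇 (s i))))

  closed-form : Carrier
  closed-form = ∏ j (λ i → (1# - t * t * (inv (s i) * inv (s i))) * ((s i + ½) * inv (s i)))

  -- The number θ is divisible by p³, so s³ + θ may be replaced by s³. The factor p in front of the
  -- product supplies the fourth power.
  ∏≈ : ∏ j (λ i → (s i * s i - t * t) * (s i + ½) * inv (X i)) ≈ closed-form [ 3 ]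
  ∏≈ = ∏-≈ j (λ i i<j → O-≈ {{O-right i i<j}} (step i i<j)) O-right step
    where
    O-right : ∀ i → i < j → O ((1# - t * t * (inv (s i) * inv (s i))) * ((s i + ½) * inv (s i)))
    O-right i i<j = *-O (+-O O-1 (neg-O (*-O (*-O O-t O-t) (*-O O-σ O-σ)))) (*-O (+-O (O-s i) O-½) O-σ)
      where O-σ = O-inv-s {i} (s<p i<j)
    step : ∀ i → i < j → (s i * s i - t * t) * (s i + ½) * inv (X i) ≈ (1# - t * t * (inv (s i) * inv (s i))) * ((s i + ½) * inv (s i)) [ 3 ]
    step i i<j = ≈-cancel (inv (X i)) {{O-inv-X {i} (s<p i<j)}} (trans (*-comm _ _) (*-invʳ _ (X≢0 i)))
      (≈-sym (-≈0⇒≈ (≈-trans (≈-reflexive diff) (≈0-*ʳ _ {{O-right i i<j}} θ≈0))))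
      where
      σ = inv (s i)
      diff : X i * ((1# - t * t * (σ * σ)) * ((s i + ½) * σ)) - X i * ((s i * s i - t * t) * (s i + ½) * inv (X i))
        ≡ θ * ((1# - t * t * (σ * σ)) * ((s i + ½) * σ))
      diff = begin
        X i * ((1# - t * t * (σ * σ)) * ((s i + ½) * σ)) - X i * ((s i * s i - t * t) * (s i + ½) * inv (X i))
          ≡⟨ solve 7 (λ s θ t σ h x y → (s :* s :* s :+ θ) :* ((κ 1 :- t :* t :* (σ :* σ)) :* ((s :+ h) :* σ)) :- x :* ((s :* s :- t :* t) :* (s :+ h) :* y)
               := (s :* s :* (s :* σ) :- t :* t :* (s :* σ) :^ 3) :* (s :+ h) :- (x :* y) :* ((s :* s :- t :* t) :* (s :+ h)) :+ θ :* ((κ 1 :- t :* t :* (σ :* σ)) :* ((s :+ h) :* σ)))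
               refl (s i) θ t σ ½ (X i) (inv (X i)) ⟩
        (s i * s i * (s i * σ) - t * t * (s i * σ) ^ 3) * (s i + ½) - X i * inv (X i) * ((s i * s i - t * t) * (s i + ½)) + θ * E
          ≡⟨ cong₂ (λ x y → (s i * s i * x - t * t * x ^ 3) * (s i + ½) - y * ((s i * s i - t * t) * (s i + ½)) + θ * E) (*-invʳ _ (char-0 i)) (*-invʳ _ (X≢0 i)) ⟩
        (s i * s i * 1# - t * t * 1# ^ 3) * (s i + ½) - 1# * ((s i * s i - t * t) * (s i + ½)) + θ * E
          ≡⟨ solve 4 (λ s t h e → (s :* s :* κ 1 :- t :* t :* κ 1 :^ 3) :* (s :+ h) :- κ 1 :* ((s :* s :- t :* t) :* (s :+ h)) :+ e := e) refl (s i) t ½ (θ * E) ⟩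
        θ * E ∎
        where E = (1# - t * t * (σ * σ)) * ((s i + ½) * σ)

  4weight : ∀ k → ι 4 * weight k ≡ ι (8 ℕ.* k ℕ.+ 3)
  4weight k = begin
    ι 4 * (a + ι 2 * ι k) ≡⟨ solve 2 (λ a k → κ 4 :* (a :+ κ 2 :* k) := κ 8 :* k :+ κ 4 :* a) refl a (ι k) ⟩
    ι 8 * ι k + ι 4 * a ≡⟨ cong₂ _+_ (sym (ι-* 8 k)) 4a ⟩
    ι (8 ℕ.* k) + ι 3 ≡⟨ sym (ι-+ (8 ℕ.* k) 3) ⟩
    ι (8 ℕ.* k ℕ.+ 3) ∎

  reduction : ∑ p (λ k → ι (8 ℕ.* k ℕ.+ 3) * B k ^ 4) ≈ ι c * ι p * closed-form [ 4 ]
  reduction = begin≈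
    ∑ p T ≡≈⟨ trans (cong (λ n → ∑ n T) (sym (ℕ.m+[n∸m]≡n j<p))) (∑-split (suc j) (p ∸ suc j) T) ⟩
    ∑ (suc j) T + ∑ (p ∸ suc j) (λ i → T (suc j ℕ.+ i)) ≈⟨ ≈-+ ≈-refl (∑-≈0 (p ∸ suc j) tail) ⟩
    ∑ (suc j) T + 0# ≡≈⟨ trans (+-identityʳ _) (trans (∑-cong (suc j) (λ k → trans (cong (_* B k ^ 4) (sym (4weight k))) (*-assoc _ _ _))) (∑-*ˡ (suc j) (ι 4) _)) ⟩
    ι 4 * ∑ (suc j) (λ k → weight k * B k ^ 4) ≈⟨ ≈-*ˡ (ι 4) {{O-ι 4}} (≈-sym ∑f≈) ⟩
    ι 4 * ∑ (suc j) f ≡≈⟨ 4∑f ⟩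
    ι c * ι p * _ ≈⟨ ≈-scale {j = 1} {{O-≈ {{O-closed}} ∏≈}} (≈0-*ˡ (ι c) p≈0) ∏≈ ⟩
    ι c * ι p * closed-form ∎≈
    where
    open ≈-Reasoning
    T : ℕ → Carrier
    T k = ι (8 ℕ.* k ℕ.+ 3) * B k ^ 4
    O-closed : O closed-form
    O-closed = O-∏ j λ i i<j → let O-σ = O-inv-s {i} (s<p i<j) in
      *-O (+-O O-1 (neg-O (*-O (*-O O-t O-t) (*-O O-σ O-σ)))) (*-O (+-O (O-s i) O-½) O-σ)
    -- For k > j the product `B k` contains z j = t, so its fourth power is divisible by p⁴.
    tail : ∀ i → i < p ∸ suc j → T (suc j ℕ.+ i) ≈ 0# [ 4 ]
    tail i i<p-j-1 = ≈0-*ˡ (ι (8 ℕ.* (suc j ℕ.+ i) ℕ.+ 3)) {{O-ι (8 ℕ.* (suc j ℕ.+ i) ℕ.+ 3)}} (≈-trans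
        (≈-reflexive (solve 1 (λ x → x :^ 4 := x :* x :* (x :* x)) refl (B k))) (≈0-* (≈0-* Bk Bk) (≈0-* Bk Bk)))
      where
      k = suc j ℕ.+ i
      k<p : k < p
      k<p = subst (k <_) (ℕ.m+[n∸m]≡n j<p) (ℕ.+-monoʳ-< (suc j) i<p-j-1)
      Bk : B k ≈ 0# [ 1 ]
      Bk = ∏-≈0 k j (ℕ.m≤m+n (suc j) i) (λ i i<k → O-r {i} (ℕ.≤-<-trans i<k k<p))
        (≈-trans (≈-reflexive (cong (_* inv (s j)) z-j)) (≈0-*ʳ (inv (s j)) {{O-inv-s {j} (ℕ.≤-<-trans (ℕ.m≤m+n (suc j) i) k<p)}} t≈0))

-- Fermat's theorem, the quadratic character of 2, central binomial coefficients

absorption : ∀ n k → suc k ℕ.* (suc n C suc k) ≡ suc n ℕ.* (n C k)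
absorption zero zero = refl
absorption zero (suc k) = ℕ.*-zeroʳ (suc (suc k))
absorption (suc n) k = begin
  suc k ℕ.* (suc (suc n) C suc k) ≡⟨ cong (suc k ℕ.*_) (sym (nCk+nC[k+1]≡[n+1]C[k+1] (suc n) k)) ⟩
  suc k ℕ.* (suc n C k ℕ.+ suc n C suc k) ≡⟨ ℕ.*-distribˡ-+ (suc k) (suc n C k) _ ⟩
  suc n C k ℕ.+ k ℕ.* (suc n C k) ℕ.+ suc k ℕ.* (suc n C suc k) ≡⟨ cong (suc n C k ℕ.+ k ℕ.* (suc n C k) ℕ.+_) (absorption n k) ⟩
  suc n C k ℕ.+ k ℕ.* (suc n C k) ℕ.+ suc n ℕ.* (n C k) ≡⟨ ℕ.+-assoc (suc n C k) _ _ ⟩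
  suc n C k ℕ.+ (k ℕ.* (suc n C k) ℕ.+ suc n ℕ.* (n C k)) ≡⟨ cong (suc n C k ℕ.+_) (rest k) ⟩
  suc n C k ℕ.+ suc n ℕ.* (suc n C k) ∎
  where
  open ≡-Reasoning
  rest : ∀ k → k ℕ.* (suc n C k) ℕ.+ suc n ℕ.* (n C k) ≡ suc n ℕ.* (suc n C k)
  rest zero = refl
  rest (suc k) = begin
    suc k ℕ.* (suc n C suc k) ℕ.+ suc n ℕ.* (n C suc k) ≡⟨ cong (ℕ._+ suc n ℕ.* (n C suc k)) (absorption n k) ⟩
    suc n ℕ.* (n C k) ℕ.+ suc n ℕ.* (n C suc k) ≡⟨ sym (ℕ.*-distribˡ-+ (suc n) (n C k) _) ⟩
    suc n ℕ.* (n C k ℕ.+ n C suc k) ≡⟨ cong (suc n ℕ.*_) (nCk+nC[k+1]≡[n+1]C[k+1] n k) ⟩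
    suc n ℕ.* (suc n C suc k) ∎

module Fermat (F : Field) (p : ℕ) (L : Localisation F p) (p-prime : Prime p) (3<p : 3 < p) where
  open PrimeCongruences F p L p-prime 3<p public
  open ≡-Reasoning

  p-1 : ℕ
  p-1 = ℕ.pred p

  p≡1+p-1 : suc p-1 ≡ p
  p≡1+p-1 = ℕ.suc-pred p {{ℕ.≢-nonZero p≢0}}

  pC≈0 : ∀ k → suc k < p → ι (p C suc k) ≈ 0# [ 1 ]
  pC≈0 k k<p = ι-cancel {suc k} (p∤ (λ ()) k<p) (begin≈
    ι (suc k) * ι (p C suc k) ≡≈⟨ sym (ι-* (suc k) (p C suc k)) ⟩
    ι (suc k ℕ.* (p C suc k)) ≡≈⟨ cong ι (subst (λ q → suc k ℕ.* (q C suc k) ≡ q ℕ.* (p-1 C k)) p≡1+p-1 (absorption p-1 k)) ⟩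
    ι (p ℕ.* (p-1 C k)) ≡≈⟨ ι-* p (p-1 C k) ⟩
    ι p * ι (p-1 C k) ≈⟨ ≈0-*ʳ (ι (p-1 C k)) {{O-ι (p-1 C k)}} p≈0 ⟩
    0# ≡≈⟨ sym (zeroʳ (ι (suc k))) ⟩
    ι (suc k) * 0# ∎≈)
    where open ≈-Reasoning

  -1^ : ℕ → Carrier
  -1^ n = (- 1#) ^ n

  O--1^ : ∀ n → O (-1^ n)
  O--1^ n = O-^ n (neg-O O-1)

  -1^-square : ∀ n → -1^ n * -1^ n ≡ 1#
  -1^-square n = trans (sym (^-distrib-* (- 1#) (- 1#) n)) (trans (cong (_^ n) (solve 0 (⊝ κ 1 :* ⊝ κ 1 := κ 1) refl)) (1^ n))

  -1^-double : ∀ n → -1^ (2 ℕ.* n) ≡ 1#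
  -1^-double n = trans (sym (^-assocʳ (- 1#) 2 n)) (trans (cong (_^ n) (solve 0 ((⊝ κ 1) :^ 2 := κ 1) refl)) (1^ n))

  -1^-∸ : ∀ {m i} → i ≤ m → -1^ (m ∸ i) ≡ -1^ m * -1^ i
  -1^-∸ {m} {i} i≤m = begin
    -1^ (m ∸ i) ≡⟨ sym (*-identityʳ _) ⟩
    -1^ (m ∸ i) * 1# ≡⟨ cong (-1^ (m ∸ i) *_) (sym (-1^-square i)) ⟩
    -1^ (m ∸ i) * (-1^ i * -1^ i) ≡⟨ sym (*-assoc _ _ _) ⟩
    -1^ (m ∸ i) * -1^ i * -1^ i ≡⟨ cong (_* -1^ i) (trans (sym (^-homo-* (- 1#) (m ∸ i) i)) (cong -1^ (ℕ.m∸n+n≡m i≤m))) ⟩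
    -1^ m * -1^ i ∎

  [p-1]C≈ : ∀ k → k < p → ι (p-1 C k) ≈ -1^ k [ 1 ]
  [p-1]C≈ zero _ = ≈-reflexive (+-identityʳ 1#)
  [p-1]C≈ (suc k) k<p = begin≈
    ι (p-1 C suc k) ≡≈⟨ solve 2 (λ x y → y := x :+ y :- x) refl (ι (p-1 C k)) _ ⟩
    ι (p-1 C k) + ι (p-1 C suc k) - ι (p-1 C k) ≡≈⟨ cong (_- ι (p-1 C k)) (trans (sym (ι-+ (p-1 C k) (p-1 C suc k))) (cong ι (trans (nCk+nC[k+1]≡[n+1]C[k+1] p-1 k) (cong (_C suc k) p≡1+p-1)))) ⟩
    ι (p C suc k) - ι (p-1 C k) ≈⟨ ≈-- (pC≈0 k k<p) ([p-1]C≈ k (ℕ.<-trans (ℕ.n<1+n k) k<p)) ⟩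
    0# - -1^ k ≡≈⟨ solve 1 (λ x → κ 0 :- x := ⊝ κ 1 :* x) refl (-1^ k) ⟩
    -1^ (suc k) ∎≈
    where open ≈-Reasoning

  fermat : ∀ n → ι n ^ p ≈ ι n [ 1 ]
  fermat zero = ≈-reflexive (subst (λ q → 0# ^ q ≡ 0#) p≡1+p-1 (zeroˡ _))
  fermat (suc n) = begin≈
    (1# + ι n) ^ p ≡≈⟨ binomial-theorem p 1# (ι n) ⟩
    ∑ p T + T p ≡≈⟨ cong (λ q → ∑ q T + T p) (sym p≡1+p-1) ⟩
    ∑ (suc p-1) T + T p ≡≈⟨ cong (_+ T p) (∑-first p-1 T) ⟩
    T 0 + ∑ p-1 (λ k → T (suc k)) + T p ≈⟨ ≈-+ (≈-+ ≈-refl (∑-≈0 p-1 middle)) ≈-refl ⟩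
    T 0 + 0# + T p ≡≈⟨ cong₂ (λ x y → (x * (1# * ι n ^ p) + 0#) + y * (1# ^ p * ι n ^ (p ∸ p))) (+-identityʳ 1#) (trans (cong ι (nCn≡1 p)) (+-identityʳ 1#)) ⟩
    1# * (1# * ι n ^ p) + 0# + 1# * (1# ^ p * ι n ^ (p ∸ p)) ≡≈⟨ cong₂ (λ x y → 1# * (1# * ι n ^ p) + 0# + 1# * (x * ι n ^ y)) (1^ p) (ℕ.n∸n≡0 p) ⟩
    1# * (1# * ι n ^ p) + 0# + 1# * (1# * 1#) ≡≈⟨ solve 1 (λ x → κ 1 :* (κ 1 :* x) :+ κ 0 :+ κ 1 :* (κ 1 :* κ 1) := κ 1 :+ x) refl (ι n ^ p) ⟩
    1# + ι n ^ p ≈⟨ ≈-+ ≈-refl (fermat n) ⟩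
    1# + ι n ∎≈
    where
    open ≈-Reasoning
    T : ℕ → Carrier
    T k = ι (p C k) * (1# ^ k * ι n ^ (p ∸ k))
    middle : ∀ k → k < p-1 → T (suc k) ≈ 0# [ 1 ]
    middle k k<p-1 = ≈0-*ʳ (1# ^ suc k * ι n ^ (p ∸ suc k)) {{*-O (O-^ (suc k) O-1) (O-^ (p ∸ suc k) (O-ι n))}} (pC≈0 k (subst (suc k <_) p≡1+p-1 (s≤s k<p-1)))

  fermat-unit : ∀ {n} → p ∤ n → ι n ^ p-1 ≈ 1# [ 1 ]
  fermat-unit {n} p∤n = ι-cancel p∤n (begin≈
    ι n * ι n ^ p-1 ≡≈⟨ cong (ι n ^_) p≡1+p-1 ⟩
    ι n ^ p ≈⟨ fermat n ⟩
    ι n ≡≈⟨ sym (*-identityʳ _) ⟩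
    ι n * 1# ∎≈)
    where open ≈-Reasoning

  odd : ℕ → Carrier
  odd i = ι (suc (2 ℕ.* i))

  odds evens : ℕ → Carrier
  odds n = ∏ n odd
  evens n = ∏ n (λ i → ι (2 ℕ.* suc i))

  factorial-even : ∀ n → factorial (2 ℕ.* n) ≡ odds n * evens n
  factorial-even n = trans (∏-parity n _) (cong (odds n *_) (∏-cong n λ i → cong ι (sym (ℕ.*-suc 2 i))))

  factorial-odd : ∀ n → factorial (suc (2 ℕ.* n)) ≡ odds (suc n) * evens n
  factorial-odd n = trans (cong (_* odd n) (factorial-even n)) (solve 3 (λ x y z → x :* y :* z := x :* z :* y) refl (odds n) (evens n) (odd n))

  evens-factorial : ∀ n → evens n ≡ ι 2 ^ n * factorial n
  evens-factorial n = trans (∏-cong n λ i → ι-* 2 (suc i)) (∏-*ˡ n (ι 2) _)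

  evens-≢0 : ∀ n → evens n ≢ 0#
  evens-≢0 n = ∏-≢0 n λ i _ → char-0 (i ℕ.+ suc (i ℕ.+ 0))

  -- Gauss's lemma for the residue 2: the even numbers exceeding p/2 are p minus the small odd numbers.
  gauss-lemma : ∀ e o → p ≡ suc (2 ℕ.* (e ℕ.+ o)) → factorial (e ℕ.+ o) ≡ odds o * evens e →
    ι 2 ^ (e ℕ.+ o) * odds o ≡ ∏ o (λ i → ι p - odd i)
  gauss-lemma e o p≡ fact = *-cancelˡ (evens-≢0 e) (begin
    evens e * (ι 2 ^ N * odds o) ≡⟨ solve 3 (λ x y z → x :* (y :* z) := y :* (z :* x)) refl (evens e) (ι 2 ^ N) (odds o) ⟩
    ι 2 ^ N * (odds o * evens e) ≡⟨ trans (cong (ι 2 ^ N *_) (sym fact)) (sym (evens-factorial N)) ⟩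
    evens N ≡⟨ ∏-split e o _ ⟩
    evens e * ∏ o (λ i → ι (2 ℕ.* suc (e ℕ.+ i))) ≡⟨ cong (evens e *_) (trans (∏-reverse o _) (∏-cong< o reflect)) ⟩
    evens e * ∏ o (λ i → ι p - odd i) ∎)
    where
    N = e ℕ.+ o
    reflect : ∀ i → i < o → ι (2 ℕ.* suc (e ℕ.+ (o ∸ suc i))) ≡ ι p - odd i
    reflect i i<o = trans (solve 2 (λ x y → x := x :+ y :- y) refl _ (odd i)) (cong (_- odd i) (trans (sym (ι-+ (2 ℕ.* suc (e ℕ.+ (o ∸ suc i))) _)) (cong ι (begin
      2 ℕ.* suc (e ℕ.+ (o ∸ suc i)) ℕ.+ suc (2 ℕ.* i) ≡⟨ solveℕ 3 (λ e d i → # 2 ⊠ (# 1 ⊞ (e ⊞ d)) ⊞ (# 1 ⊞ # 2 ⊠ i) :≡ # 1 ⊞ # 2 ⊠ (e ⊞ (d ⊞ (# 1 ⊞ i)))) refl e (o ∸ suc i) i ⟩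
      suc (2 ℕ.* (e ℕ.+ (o ∸ suc i ℕ.+ suc i))) ≡⟨ cong (λ m → suc (2 ℕ.* (e ℕ.+ m))) (ℕ.m∸n+n≡m i<o) ⟩
      suc (2 ℕ.* N) ≡⟨ sym p≡ ⟩
      p ∎))))

  p∤odd : ∀ o → 2 ℕ.* o ≤ p → ∀ {i} → i < o → p ∤ suc (2 ℕ.* i)
  p∤odd o 2o≤p {i} i<o = p∤ (λ ()) (ℕ.<-≤-trans (subst (suc (2 ℕ.* i) <_) (sym (ℕ.*-suc 2 i)) ℕ.≤-refl) (ℕ.≤-trans (ℕ.*-monoʳ-≤ 2 i<o) 2o≤p))

  -- Here e and o count the even and the odd numbers up to (p - 1)/2. One statement thus serves both
  -- classes of p, with o = (p - 1)/4 or o = (p + 1)/4. It is `gauss-lemma` read modulo p, where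
  -- each p - (2i + 1) is -(2i + 1).
  2-residue : ∀ e o → p ≡ suc (2 ℕ.* (e ℕ.+ o)) → factorial (e ℕ.+ o) ≡ odds o * evens e → ι 2 ^ (e ℕ.+ o) ≈ -1^ o [ 1 ]
  2-residue e o p≡ fact = ≈-cancel (∏ o (λ i → inv (odd i))) {{O-∏ o λ i i<o → O-inv (p∤o i<o)}}
      (trans (sym (∏-* o _ _)) (∏-1 o λ i i<o → ι-invˡ (p∤o i<o)))
      (begin≈
    odds o * ι 2 ^ (e ℕ.+ o) ≡≈⟨ trans (*-comm _ _) (gauss-lemma e o p≡ fact) ⟩
    ∏ o (λ i → ι p - odd i) ≈⟨ ∏-≈ o (λ i _ → +-O O-p (neg-O (O-ι (suc (2 ℕ.* i))))) (λ i _ → *-O (neg-O O-1) (O-ι (suc (2 ℕ.* i)))) (λ i _ → ≈-trans (≈-- p≈0 ≈-refl) (≈-reflexive (solve 1 (λ x → κ 0 :- x := ⊝ κ 1 :* x) refl (odd i)))) ⟩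
    ∏ o (λ i → - 1# * odd i) ≡≈⟨ trans (∏-*ˡ o (- 1#) odd) (*-comm _ _) ⟩
    odds o * -1^ o ∎≈)
    where
    open ≈-Reasoning
    p∤o : ∀ {i} → i < o → p ∤ suc (2 ℕ.* i)
    p∤o = p∤odd o (subst (2 ℕ.* o ≤_) (sym p≡) (ℕ.m≤n⇒m≤1+n (ℕ.*-monoʳ-≤ 2 (ℕ.m≤n+m o e))))

  central-binomial : ∀ n → ι (suc n) * ι ((2 ℕ.* suc n) C suc n) ≡ ι 2 * ι (suc (2 ℕ.* n)) * ι ((2 ℕ.* n) C n)
  central-binomial n = *-cancelˡ (char-0 n) (begin
    m * (m * ι ((2 ℕ.* suc n) C suc n)) ≡⟨ cong (m *_) (sym (ι-* (suc n) ((2 ℕ.* suc n) C suc n))) ⟩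
    m * ι (suc n ℕ.* ((2 ℕ.* suc n) C suc n)) ≡⟨ cong (λ x → m * ι x) (subst (λ N → suc n ℕ.* (N C suc n) ≡ suc (suc (2 ℕ.* n)) ℕ.* (suc (2 ℕ.* n) C n)) (sym (ℕ.*-suc 2 n)) (absorption (suc (2 ℕ.* n)) n)) ⟩
    m * ι (suc (suc (2 ℕ.* n)) ℕ.* (suc (2 ℕ.* n) C n)) ≡⟨ cong (m *_) (trans (ι-* (suc (suc (2 ℕ.* n))) (suc (2 ℕ.* n) C n)) (cong₂ (λ x y → ι x * ι y) (sym (ℕ.*-suc 2 n)) symm)) ⟩
    m * (ι (2 ℕ.* suc n) * c) ≡⟨ cong (λ x → m * (x * c)) (ι-* 2 (suc n)) ⟩
    m * (ι 2 * m * c) ≡⟨ solve 2 (λ m c → m :* (κ 2 :* m :* c) := m :* (κ 2 :* (m :* c))) refl m c ⟩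
    m * (ι 2 * (m * c)) ≡⟨ cong (λ x → m * (ι 2 * x)) (trans (sym (ι-* (suc n) (suc (2 ℕ.* n) C suc n))) (trans (cong ι (absorption (2 ℕ.* n) n)) (ι-* (suc (2 ℕ.* n)) ((2 ℕ.* n) C n)))) ⟩
    m * (ι 2 * (ι (suc (2 ℕ.* n)) * ι ((2 ℕ.* n) C n))) ≡⟨ cong (m *_) (sym (*-assoc _ _ _)) ⟩
    m * (ι 2 * ι (suc (2 ℕ.* n)) * ι ((2 ℕ.* n) C n)) ∎)
    where
    m = ι (suc n)
    c = ι (suc (2 ℕ.* n) C suc n)
    symm : suc (2 ℕ.* n) C n ≡ suc (2 ℕ.* n) C suc n
    symm = trans (nCk≡nC[n∸k] {n} {suc (2 ℕ.* n)} (ℕ.m≤n⇒m≤1+n (ℕ.m≤m+n n (n ℕ.+ 0)))) (cong (suc (2 ℕ.* n) C_)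
      (trans (ℕ.+-∸-assoc 1 (ℕ.m≤m+n n (n ℕ.+ 0))) (cong suc (trans (ℕ.m+n∸m≡n n (n ℕ.+ 0)) (ℕ.+-identityʳ n)))))

-- The Euler number E_{p-3} modulo p as a sum of inverse squares

module EulerCongruence (F : Field) (p : ℕ) (L : Localisation F p) (p-prime : Prime p) (3<p : 3 < p)
  (j : ℕ) (p≡4j+3 : p ≡ 4 ℕ.* j ℕ.+ 3) where
  open Fermat F p L p-prime 3<p
  open ≡-Reasoning

  r : ℕ
  r = suc (2 ℕ.* j)

  p≡2r+1 : p ≡ suc (2 ℕ.* r)
  p≡2r+1 = trans p≡4j+3 (solveℕ 1 (λ j → # 4 ⊠ j ⊞ # 3 :≡ # 1 ⊞ # 2 ⊠ (# 1 ⊞ # 2 ⊠ j)) refl j)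

  p-1≡2r : p-1 ≡ 2 ℕ.* r
  p-1≡2r = cong ℕ.pred p≡2r+1

  q : ℕ → Carrier
  q i = inv (ι i) ^ 2

  H : ℕ → Carrier
  H n = ∑ n (λ i → q (suc i))

  ¼ : Carrier
  ¼ = q 2

  O-q : ∀ {i} → p ∤ i → O (q i)
  O-q h = O-^ 2 (O-inv h)

  q-reflect : ∀ {m n} → p ∤ m → p ∤ n → m ℕ.+ n ≡ p → q m ≈ q n [ 1 ]
  q-reflect {m} {n} p∤m p∤n e = begin≈
    q m ≈⟨ ≈-^ 2 {{O-inv p∤m}} {{neg-O (O-inv p∤n)}} (inv-reflect p∤m p∤n e) ⟩
    (- inv (ι n)) ^ 2 ≡≈⟨ solve 1 (λ x → (⊝ x) :^ 2 := x :^ 2) refl (inv (ι n)) ⟩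
    q n ∎≈
    where open ≈-Reasoning

  q-double : ∀ i → q (2 ℕ.* suc i) ≡ ¼ * q (suc i)
  q-double i = trans (cong (_^ 2) (trans (cong inv (ι-* 2 (suc i))) (inv-* (char-0 1) (char-0 i)))) (^-distrib-* (inv (ι 2)) (inv (ι (suc i))) 2)

  q-odd : ∀ i → i < r → q (suc (2 ℕ.* (r ∸ suc i))) ≈ ¼ * q (suc i) [ 1 ]
  q-odd i i<r = ≈-trans (q-reflect (p∤ (λ ()) odd<p) (p∤ (λ ()) even<p) sum-p) (≈-reflexive (q-double i))
    where
    sum-p : suc (2 ℕ.* (r ∸ suc i)) ℕ.+ 2 ℕ.* suc i ≡ p
    sum-p = trans (cong suc (trans (sym (ℕ.*-distribˡ-+ 2 (r ∸ suc i) (suc i))) (cong (2 ℕ.*_) (ℕ.m∸n+n≡m i<r)))) (sym p≡2r+1)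
    even<p : 2 ℕ.* suc i < p
    even<p = subst (2 ℕ.* suc i <_) sum-p (ℕ.m<n+m _ (s≤s z≤n))
    odd<p : suc (2 ℕ.* (r ∸ suc i)) < p
    odd<p = subst (suc (2 ℕ.* (r ∸ suc i)) <_) sum-p (ℕ.m<m+n _ (s≤s z≤n))

  H-evens : ∀ n → ∑ n (λ i → q (suc (suc (2 ℕ.* i)))) ≡ ¼ * H n
  H-evens n = trans (∑-cong n λ i → trans (cong q (sym (ℕ.*-suc 2 i))) (q-double i)) (∑-*ˡ n ¼ _)

  -- The inverse squares up to p - 1 are summed twice. Reflection i ↦ p - i gives 2 H r. Separating
  -- parities and reflecting the odd numbers into even ones gives H r / 2. So 3 H r ≡ 0, and 3 is a
  -- unit.
  half-sum≈0 : H r ≈ 0# [ 1 ]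
  half-sum≈0 = ι-cancel p∤3 (≈-trans (-≈0⇒≈ {y = ι 3 * 0#} (≈-trans (≈-reflexive lemma) (≈⇒-≈0 (≈-*ˡ (ι 2) {{O-ι 2}} (≈-trans (≈-sym reflected) split))))) ≈-refl)
    where
    open ≈-Reasoning
    split : H (2 ℕ.* r) ≈ ¼ * H r + ¼ * H r [ 1 ]
    split = begin≈
      H (2 ℕ.* r) ≡≈⟨ ∑-parity r _ ⟩
      ∑ r (λ i → q (suc (2 ℕ.* i))) + ∑ r (λ i → q (suc (suc (2 ℕ.* i)))) ≡≈⟨ cong₂ _+_ (∑-reverse r _) (H-evens r) ⟩
      ∑ r (λ i → q (suc (2 ℕ.* (r ∸ suc i)))) + ¼ * H r ≈⟨ ≈-+ (∑-≈ r q-odd) ≈-refl ⟩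
      ∑ r (λ i → ¼ * q (suc i)) + ¼ * H r ≡≈⟨ cong (_+ ¼ * H r) (∑-*ˡ r ¼ _) ⟩
      ¼ * H r + ¼ * H r ∎≈
    2r : 2 ℕ.* r ≡ r ℕ.+ r
    2r = cong (r ℕ.+_) (ℕ.+-identityʳ r)
    top : ∀ i → i < r → q (suc (r ℕ.+ (r ∸ suc i))) ≈ q (suc i) [ 1 ]
    top i i<r = q-reflect (p∤ (λ ()) (subst (suc (r ℕ.+ (r ∸ suc i)) <_) sum-p (ℕ.m<m+n _ (s≤s z≤n)))) (p∤ (λ ()) (subst (suc i <_) sum-p (ℕ.m<n+m (suc i) {suc (r ℕ.+ (r ∸ suc i))} (s≤s z≤n)))) sum-p
      where
      sum-p : suc (r ℕ.+ (r ∸ suc i)) ℕ.+ suc i ≡ p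
      sum-p = trans (cong suc (trans (ℕ.+-assoc r _ _) (trans (cong (r ℕ.+_) (ℕ.m∸n+n≡m i<r)) (sym 2r)))) (sym p≡2r+1)
    reflected : H (2 ℕ.* r) ≈ H r + H r [ 1 ]
    reflected = begin≈
      H (2 ℕ.* r) ≡≈⟨ trans (cong H 2r) (∑-split r r _) ⟩
      H r + ∑ r (λ i → q (suc (r ℕ.+ i))) ≡≈⟨ cong (H r +_) (∑-reverse r _) ⟩
      H r + ∑ r (λ i → q (suc (r ℕ.+ (r ∸ suc i)))) ≈⟨ ≈-+ ≈-refl (∑-≈ r top) ⟩
      H r + H r ∎≈
    4¼ : ι 2 * inv (ι 2) ≡ 1#
    4¼ = ι-invʳ p∤2
    lemma : ι 3 * H r - ι 3 * 0# ≡ ι 2 * (H r + H r) - ι 2 * (¼ * H r + ¼ * H r)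
    lemma = begin
      ι 3 * H r - ι 3 * 0# ≡⟨ solve 1 (λ h → κ 3 :* h :- κ 3 :* κ 0 := κ 4 :* h :- κ 1 :^ 2 :* h) refl (H r) ⟩
      ι 4 * H r - 1# ^ 2 * H r ≡⟨ cong (λ x → ι 4 * H r - x ^ 2 * H r) (sym 4¼) ⟩
      ι 4 * H r - (ι 2 * inv (ι 2)) ^ 2 * H r ≡⟨ solve 2 (λ h i → κ 4 :* h :- (κ 2 :* i) :^ 2 :* h := κ 2 :* (h :+ h) :- κ 2 :* (i :^ 2 :* h :+ i :^ 2 :* h)) refl (H r) (inv (ι 2)) ⟩
      ι 2 * (H r + H r) - ι 2 * (¼ * H r + ¼ * H r) ∎

  -- Modulo p this is E_{2n} for n ≥ 1, but it is 2 instead of 1 at n = 0. That surplus is matched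
  -- by the right-hand side 1, in place of 0, of `alternating-recurrence`.
  alternating : ℕ → Carrier
  alternating n = ι 2 * ∑ r (λ i → -1^ i * odd i ^ (2 ℕ.* n))

  p∤r : ∀ {i} → i < r → p ∤ suc (2 ℕ.* i)
  p∤r = p∤odd r (subst (2 ℕ.* r ≤_) (sym p≡2r+1) (ℕ.n≤1+n _))

  -- By Fermat, x^{p-3} ≡ x^{-2}.
  alternating≈ : alternating (2 ℕ.* j) ≈ - (q 2 * H j) [ 1 ]
  alternating≈ = begin≈
    ι 2 * ∑ r (λ i → -1^ i * odd i ^ (2 ℕ.* (2 ℕ.* j))) ≈⟨ ≈-*ˡ (ι 2) {{O-ι 2}} (∑-≈ r λ i i<r → ≈-*ˡ (-1^ i) {{O--1^ i}} (power i i<r)) ⟩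
    ι 2 * ∑ r (λ i → -1^ i * q (suc (2 ℕ.* i))) ≡≈⟨ cong (ι 2 *_) (∑-reverse r _) ⟩
    ι 2 * ∑ r (λ i → -1^ (2 ℕ.* j ∸ i) * q (suc (2 ℕ.* (r ∸ suc i)))) ≈⟨ ≈-*ˡ (ι 2) {{O-ι 2}} (∑-≈ r λ i i<r → begin≈
       -1^ (2 ℕ.* j ∸ i) * q (suc (2 ℕ.* (r ∸ suc i))) ≡≈⟨ cong (_* q (suc (2 ℕ.* (r ∸ suc i)))) (trans (-1^-∸ (ℕ.≤-pred i<r)) (trans (cong (_* -1^ i) (-1^-double j)) (*-identityˡ _))) ⟩
       -1^ i * q (suc (2 ℕ.* (r ∸ suc i))) ≈⟨ ≈-*ˡ (-1^ i) {{O--1^ i}} (q-odd i i<r) ⟩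
       -1^ i * (¼ * q (suc i)) ∎≈) ⟩
    ι 2 * ∑ r (λ i → -1^ i * (¼ * q (suc i))) ≡≈⟨ cong (ι 2 *_) (trans (∑-cong r λ i → solve 3 (λ x y z → x :* (y :* z) := y :* (x :* z)) refl (-1^ i) ¼ (q (suc i))) (trans (∑-*ˡ r ¼ _) (cong (¼ *_) signs))) ⟩
    ι 2 * (¼ * (H r - ι 2 * (¼ * H j))) ≈⟨ ≈-*ˡ (ι 2) {{O-ι 2}} (≈-*ˡ ¼ {{O-q p∤2}} (≈-- half-sum≈0 ≈-refl)) ⟩
    ι 2 * (¼ * (0# - ι 2 * (¼ * H j))) ≡≈⟨ solve 2 (λ i h → κ 2 :* (i :^ 2 :* (κ 0 :- κ 2 :* (i :^ 2 :* h))) := ⊝ ((κ 2 :* i) :^ 2 :* (i :^ 2 :* h))) refl (inv (ι 2)) (H j) ⟩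
    - ((ι 2 * inv (ι 2)) ^ 2 * (¼ * H j)) ≡≈⟨ cong (λ x → - (x ^ 2 * (¼ * H j))) (ι-invʳ p∤2) ⟩
    - (1# ^ 2 * (¼ * H j)) ≡≈⟨ solve 1 (λ x → ⊝ (κ 1 :^ 2 :* x) := ⊝ x) refl (¼ * H j) ⟩
    - (¼ * H j) ∎≈
    where
    open ≈-Reasoning
    exponent : 2 ℕ.+ 2 ℕ.* (2 ℕ.* j) ≡ p-1
    exponent = trans (sym (ℕ.*-suc 2 (2 ℕ.* j))) (sym p-1≡2r)
    power : ∀ i → i < r → odd i ^ (2 ℕ.* (2 ℕ.* j)) ≈ q (suc (2 ℕ.* i)) [ 1 ]
    power i i<r = ≈-cancel (q (suc (2 ℕ.* i))) {{O-q (p∤r i<r)}} inverse (begin≈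
      odd i ^ 2 * odd i ^ (2 ℕ.* (2 ℕ.* j)) ≡≈⟨ trans (sym (^-homo-* (odd i) 2 (2 ℕ.* (2 ℕ.* j)))) (cong (odd i ^_) exponent) ⟩
      odd i ^ p-1 ≈⟨ fermat-unit (p∤r i<r) ⟩
      1# ≡≈⟨ trans (sym inverse) (*-comm _ _) ⟩
      odd i ^ 2 * q (suc (2 ℕ.* i)) ∎≈)
      where
      inverse : q (suc (2 ℕ.* i)) * odd i ^ 2 ≡ 1#
      inverse = trans (sym (^-distrib-* (inv (odd i)) (odd i) 2)) (trans (cong (_^ 2) (ι-invˡ (p∤r i<r))) (1^ 2))
    signs : ∑ r (λ i → -1^ i * q (suc i)) ≡ H r - ι 2 * (¼ * H j)
    signs = begin
      ∑ (2 ℕ.* j) (λ i → -1^ i * q (suc i)) + -1^ (2 ℕ.* j) * q r ≡⟨ cong₂ _+_ (∑-parity j _) (trans (cong (_* q r) (-1^-double j)) (*-identityˡ _)) ⟩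
      ∑ j (λ i → -1^ (2 ℕ.* i) * q (suc (2 ℕ.* i))) + ∑ j (λ i → -1^ (suc (2 ℕ.* i)) * q (suc (suc (2 ℕ.* i)))) + q r
        ≡⟨ cong₂ (λ x y → x + y + q r)
             (∑-cong j λ i → trans (cong (_* q (suc (2 ℕ.* i))) (-1^-double i)) (*-identityˡ _))
             (trans (∑-cong j λ i → trans (cong (λ x → - 1# * x * q (suc (suc (2 ℕ.* i)))) (-1^-double i)) (solve 1 (λ x → ⊝ κ 1 :* κ 1 :* x := ⊝ x) refl _)) (∑-neg j _)) ⟩
      A + - E + q r ≡⟨ solve 3 (λ a e q → a :+ ⊝ e :+ q := a :+ e :+ q :- κ 2 :* e) refl A E (q r) ⟩
      A + E + q r - ι 2 * E ≡⟨ cong₂ (λ x y → x + q r - ι 2 * y) (sym (∑-parity j _)) (H-evens j) ⟩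
      H r - ι 2 * (¼ * H j) ∎
      where
      A = ∑ j (λ i → q (suc (2 ℕ.* i)))
      E = ∑ j (λ i → q (suc (suc (2 ℕ.* i))))

  even-binomial : ∀ n x → (1# + x) ^ (2 ℕ.* n) + (- 1# + x) ^ (2 ℕ.* n) ≡ ι 2 * ∑ (suc n) (λ k → ι ((2 ℕ.* n) C (2 ℕ.* k)) * x ^ (2 ℕ.* (n ∸ k)))
  even-binomial n x = begin
    (1# + x) ^ N + (- 1# + x) ^ N ≡⟨ cong₂ _+_ (binomial-theorem N 1# x) (binomial-theorem N (- 1#) x) ⟩
    ∑ (suc N) (T 1#) + ∑ (suc N) (T (- 1#)) ≡⟨ sym (∑-+ (suc N) _ _) ⟩
    ∑ (suc N) S ≡⟨ cong (_+ S N) (∑-parity n S) ⟩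
    ∑ n (λ k → S (2 ℕ.* k)) + ∑ n (λ k → S (suc (2 ℕ.* k))) + S N ≡⟨ cong (λ y → ∑ n (λ k → S (2 ℕ.* k)) + y + S N) (∑-0 n λ k _ → odd-part k) ⟩
    ∑ n (λ k → S (2 ℕ.* k)) + 0# + S N ≡⟨ cong (_+ S N) (+-identityʳ _) ⟩
    ∑ (suc n) (λ k → S (2 ℕ.* k)) ≡⟨ ∑-cong (suc n) even-part ⟩
    ∑ (suc n) (λ k → ι 2 * (ι (N C (2 ℕ.* k)) * x ^ (2 ℕ.* (n ∸ k)))) ≡⟨ ∑-*ˡ (suc n) (ι 2) _ ⟩
    ι 2 * ∑ (suc n) (λ k → ι (N C (2 ℕ.* k)) * x ^ (2 ℕ.* (n ∸ k))) ∎
    where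
    N = 2 ℕ.* n
    T : Carrier → ℕ → Carrier
    T e k = ι (N C k) * (e ^ k * x ^ (N ∸ k))
    S : ℕ → Carrier
    S k = T 1# k + T (- 1#) k
    odd-part : ∀ k → S (suc (2 ℕ.* k)) ≡ 0#
    odd-part k = trans (cong₂ (λ u v → c * (1# * u * y) + c * (- 1# * v * y)) (1^ (2 ℕ.* k)) (-1^-double k)) (solve 2 (λ c y → c :* (κ 1 :* κ 1 :* y) :+ c :* (⊝ κ 1 :* κ 1 :* y) := κ 0) refl c y)
      where
      c = ι (N C suc (2 ℕ.* k))
      y = x ^ (N ∸ suc (2 ℕ.* k))
    even-part : ∀ k → S (2 ℕ.* k) ≡ ι 2 * (ι (N C (2 ℕ.* k)) * x ^ (2 ℕ.* (n ∸ k)))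
    even-part k = trans (cong₂ (λ u v → c * (u * y) + c * (v * y)) (1^ (2 ℕ.* k)) (-1^-double k))
      (trans (solve 2 (λ c y → c :* (κ 1 :* y) :+ c :* (κ 1 :* y) := κ 2 :* (c :* y)) refl c y) (cong (λ m → ι 2 * (c * x ^ m)) (sym (ℕ.*-distribˡ-∸ 2 n k))))
      where
      c = ι (N C (2 ℕ.* k))
      y = x ^ (N ∸ 2 ℕ.* k)

  -- By `even-binomial` at x = 2i + 1 the sum over k is (2i + 2)^{2m} + (2i)^{2m} with m = n + 1.
  -- With alternating signs this telescopes to (p - 1)^{2m} ≡ 1.
  alternating-recurrence : ∀ n → ∑ (suc (suc n)) (λ k → ι ((2 ℕ.* suc n) C (2 ℕ.* k)) * alternating (suc n ∸ k)) ≈ 1# [ 1 ]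
  alternating-recurrence n = begin≈
    ∑ (suc m) (λ k → c k * (ι 2 * ∑ r (λ i → -1^ i * odd i ^ (2 ℕ.* (m ∸ k))))) ≡≈⟨ ∑-cong (suc m) (λ k →
        trans (solve 2 (λ c s → c :* (κ 2 :* s) := κ 2 :* c :* s) refl (c k) _) (sym (∑-*ˡ r (ι 2 * c k) _))) ⟩
    ∑ (suc m) (λ k → ∑ r (λ i → ι 2 * c k * (-1^ i * odd i ^ (2 ℕ.* (m ∸ k))))) ≡≈⟨ ∑-swap (suc m) r _ ⟩
    ∑ r (λ i → ∑ (suc m) (λ k → ι 2 * c k * (-1^ i * odd i ^ (2 ℕ.* (m ∸ k))))) ≡≈⟨ ∑-cong r inner ⟩
    ∑ r (λ i → g (suc i) - g i) ≡≈⟨ ∑-telescope r g ⟩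
    - (-1^ r * ι (2 ℕ.* r) ^ (2 ℕ.* m)) - - (1# * 0# ^ (2 ℕ.* m)) ≡≈⟨ cong₂ (λ x y → - (x * ι (2 ℕ.* r) ^ (2 ℕ.* m)) - - (1# * y)) (trans (cong (- 1# *_) (-1^-double j)) (*-identityʳ _)) (trans (cong (0# ^_) (ℕ.*-suc 2 n)) (zeroˡ _)) ⟩
    - (- 1# * ι (2 ℕ.* r) ^ (2 ℕ.* m)) - - (1# * 0#) ≡≈⟨ solve 1 (λ x → ⊝ (⊝ κ 1 :* x) :- ⊝ (κ 1 :* κ 0) := x) refl _ ⟩
    ι (2 ℕ.* r) ^ (2 ℕ.* m) ≈⟨ ≈-^ (2 ℕ.* m) {{O-ι (2 ℕ.* r)}} {{neg-O O-1}} top ⟩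
    -1^ (2 ℕ.* m) ≡≈⟨ -1^-double m ⟩
    1# ∎≈
    where
    open ≈-Reasoning
    m = suc n
    c : ℕ → Carrier
    c k = ι ((2 ℕ.* m) C (2 ℕ.* k))
    g : ℕ → Carrier
    g i = - (-1^ i * ι (2 ℕ.* i) ^ (2 ℕ.* m))
    top : ι (2 ℕ.* r) ≈ - 1# [ 1 ]
    top = begin≈
      ι (2 ℕ.* r) ≡≈⟨ trans (solve 1 (λ x → x := ⊝ κ 1 :+ (κ 1 :+ x)) refl _) (cong (λ k → - 1# + ι k) (sym p≡2r+1)) ⟩
      - 1# + ι p ≈⟨ ≈-+ ≈-refl p≈0 ⟩
      - 1# + 0# ≡≈⟨ +-identityʳ _ ⟩
      - 1# ∎≈
    inner : ∀ i → ∑ (suc m) (λ k → ι 2 * c k * (-1^ i * odd i ^ (2 ℕ.* (m ∸ k)))) ≡ g (suc i) - g i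
    inner i = begin
      ∑ (suc m) (λ k → ι 2 * c k * (-1^ i * odd i ^ (2 ℕ.* (m ∸ k)))) ≡⟨ ∑-cong (suc m) (λ k → solve 4 (λ t c e o → t :* c :* (e :* o) := e :* t :* (c :* o)) refl (ι 2) (c k) (-1^ i) (odd i ^ (2 ℕ.* (m ∸ k)))) ⟩
      ∑ (suc m) (λ k → -1^ i * ι 2 * (c k * odd i ^ (2 ℕ.* (m ∸ k)))) ≡⟨ ∑-*ˡ (suc m) (-1^ i * ι 2) _ ⟩
      -1^ i * ι 2 * ∑ (suc m) (λ k → c k * odd i ^ (2 ℕ.* (m ∸ k))) ≡⟨ trans (*-assoc _ _ _) (cong (-1^ i *_) (sym (even-binomial m (odd i)))) ⟩
      -1^ i * ((1# + odd i) ^ (2 ℕ.* m) + (- 1# + odd i) ^ (2 ℕ.* m)) ≡⟨ cong₂ (λ x y → -1^ i * (x ^ (2 ℕ.* m) + y ^ (2 ℕ.* m))) (cong ι (sym (ℕ.*-suc 2 i))) (solve 1 (λ x → ⊝ κ 1 :+ (κ 1 :+ x) := x) refl (ι (2 ℕ.* i))) ⟩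
      -1^ i * (ι (2 ℕ.* suc i) ^ (2 ℕ.* m) + ι (2 ℕ.* i) ^ (2 ℕ.* m)) ≡⟨ solve 3 (λ e x y → e :* (x :+ y) := ⊝ (⊝ κ 1 :* e :* x) :- ⊝ (e :* y)) refl (-1^ i) _ _ ⟩
      g (suc i) - g i ∎

  alternating-0 : alternating 0 ≡ ι 2
  alternating-0 = trans (cong (ι 2 *_) (trans (∑-cong r (λ i → *-identityʳ (-1^ i))) (partial j))) (*-identityʳ _)
    where
    partial : ∀ j → ∑ (suc (2 ℕ.* j)) -1^ ≡ 1#
    partial j = begin
      ∑ (2 ℕ.* j) -1^ + -1^ (2 ℕ.* j) ≡⟨ cong₂ _+_ (∑-parity j -1^) (-1^-double j) ⟩
      ∑ j (λ i → -1^ (2 ℕ.* i)) + ∑ j (λ i → -1^ (suc (2 ℕ.* i))) + 1# ≡⟨ cong (_+ 1#) (sym (∑-+ j _ _)) ⟩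
      ∑ j (λ i → -1^ (2 ℕ.* i) + -1^ (suc (2 ℕ.* i))) + 1# ≡⟨ cong (_+ 1#) (∑-0 j λ i _ → solve 1 (λ x → x :+ ⊝ κ 1 :* x := κ 0) refl _) ⟩
      0# + 1# ≡⟨ +-identityˡ _ ⟩
      1# ∎

  module _ (𝔼 : ℕ → Carrier) (𝔼-0 : 𝔼 0 ≡ 1#)
    (𝔼-recurrence : ∀ n → ∑ (suc (suc n)) (λ k → ι ((2 ℕ.* suc n) C (2 ℕ.* k)) * 𝔼 (suc n ∸ k)) ≡ 0#) where

    private
      d : ℕ → Carrier
      d n = alternating n - 𝔼 n

      d-0 : d 0 ≡ 1#
      d-0 = trans (cong₂ _-_ alternating-0 𝔼-0) (solve 0 (κ 2 :- κ 1 := κ 1) refl)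

      d-recurrence : ∀ n → ∑ (suc (suc n)) (λ k → ι ((2 ℕ.* suc n) C (2 ℕ.* k)) * d (suc n ∸ k)) ≈ 1# [ 1 ]
      d-recurrence n = ≈-trans (≈-reflexive (trans (∑-cong (suc (suc n)) (λ k → solve 3 (λ c a e → c :* (a :- e) := c :* a :- c :* e) refl _ (alternating (suc n ∸ k)) (𝔼 (suc n ∸ k)))) (∑-- (suc (suc n)) _ _)))
        (≈-trans (≈-- (alternating-recurrence n) (≈-reflexive (𝔼-recurrence n))) (≈-reflexive (solve 1 (λ x → x :- κ 0 := x) refl 1#)))

      -- In the recurrence of d the term of d 0 = 1 cancels the right-hand side 1. What is left
      -- determines d (n + 1) from smaller positive indices, which vanish by induction; N bounds the
      -- depth.
      d≈0 : ∀ N n → n < N → d (suc n) ≈ 0# [ 1 ]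
      d≈0 (suc N) n n<N = begin≈
        d (suc n) ≡≈⟨ solve 2 (λ d s → d := κ 1 :* d :+ κ 0 :+ κ 1 :- κ 1) refl (d (suc n)) 0# ⟩
        1# * d (suc n) + 0# + 1# - 1# ≈⟨ ≈-- (≈-+ (≈-+ ≈-refl (≈-sym (∑-≈0 n middle))) ≈-refl) ≈-refl ⟩
        1# * d (suc n) + ∑ n (λ k → T (suc k)) + 1# - 1# ≡≈⟨ cong₂ (λ x y → x * d (suc n) + ∑ n (λ k → T (suc k)) + y - 1#) (sym (+-identityʳ 1#)) (sym last) ⟩
        T 0 + ∑ n (λ k → T (suc k)) + T (suc n) - 1# ≡≈⟨ cong (λ x → x + T (suc n) - 1#) (sym (∑-first n T)) ⟩
        ∑ (suc (suc n)) T - 1# ≈⟨ ≈-- (d-recurrence n) ≈-refl ⟩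
        1# - 1# ≡≈⟨ -‿inverseʳ 1# ⟩
        0# ∎≈
        where
        open ≈-Reasoning
        T : ℕ → Carrier
        T k = ι ((2 ℕ.* suc n) C (2 ℕ.* k)) * d (suc n ∸ k)
        last : T (suc n) ≡ 1#
        last = trans (cong₂ (λ x y → ι x * d y) (nCn≡1 (2 ℕ.* suc n)) (ℕ.n∸n≡0 n)) (trans (cong (ι 1 *_) d-0) (trans (*-identityʳ _) (+-identityʳ 1#)))
        middle : ∀ k → k < n → T (suc k) ≈ 0# [ 1 ]
        middle k k<n = ≈0-*ˡ (ι ((2 ℕ.* suc n) C (2 ℕ.* suc k))) {{O-ι ((2 ℕ.* suc n) C (2 ℕ.* suc k))}}
          (subst (λ m → d m ≈ 0# [ 1 ]) (sym (∸-suc k<n)) (d≈0 N (n ∸ suc k) (ℕ.<-≤-trans (ℕ.∸-monoʳ-< {n} {suc k} {0} (s≤s z≤n) k<n) (ℕ.≤-pred n<N))))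

    -- At j = 0 the index would be 0, where the two sequences differ by d 0 = 1.
    euler≈ : 0 < j → 𝔼 (2 ℕ.* j) ≈ - (q 2 * H j) [ 1 ]
    euler≈ (s≤s _) = ≈-trans (≈-sym (-≈0⇒≈ (d≈0 _ _ ℕ.≤-refl))) alternating≈

-- Primes that are 3 modulo 4

module CaseThree (F : Field) (p : ℕ) (L : Localisation F p) (p-prime : Prime p) (3<p : 3 < p)
  (j : ℕ) (p≡4j+3 : p ≡ 4 ℕ.* j ℕ.+ 3) where
  open Fermat F p L p-prime 3<p
  open EulerCongruence F p L p-prime 3<p j p≡4j+3 using (q; H; ¼; O-q; euler≈)
  open ≡-Reasoning

  j<p : j < p
  j<p = subst (j <_) (sym p≡4j+3) (ℕ.≤-<-trans (ℕ.m≤m+n j (3 ℕ.* j)) (ℕ.m<m+n (4 ℕ.* j) (s≤s z≤n)))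

  open Reduction F p L p-prime 3<p 1 j (trans (sym p≡4j+3) (sym (ℕ.*-identityˡ p))) j<p
    using (B; reduction; closed-form; s; ½; O-½; t; 4t; t≈0; O-t; s<p; O-inv-s; O-s)

  private
    P Q y g h : Carrier
    P = ι p
    h = ½
    g = ι 3 * inv (ι 8)

    p∤8 : p ∤ 8
    p∤8 = p∤-* {2} {4} p∤2 p∤4

    2^p-1≈ : ι 2 ^ p-1 ≈ 1# [ 1 ]
    2^p-1≈ = fermat-unit p∤2

    Q = (ι 2 ^ p-1 - 1#) * inv P
    y = P * Q

    y-eq : y ≡ ι 2 ^ p-1 - 1#
    y-eq = trans (solve 3 (λ p x i → p :* (x :* i) := x :* (p :* i)) refl P (ι 2 ^ p-1 - 1#) (inv P))
      (trans (cong ((ι 2 ^ p-1 - 1#) *_) (*-invʳ P ιp≢0)) (*-identityʳ _))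

    O-Q : O Q
    O-Q = subst O (sym (div-unique ιp≢0 (trans (difference 2^p-1≈) (solve 2 (λ p r → p :* κ 1 :* r := r :* p) refl P _)))) (integral 2^p-1≈)

    O-e8 : O (inv (ι 8))
    O-e8 = O-inv p∤8

    O-g : O g
    O-g = *-O (O-ι 3) O-e8

    y≈0 : y ≈ 0# [ 1 ]
    y≈0 = ≈0-*ʳ Q {{O-Q}} p≈0

    O-y : O y
    O-y = *-O O-p O-Q

    v : Carrier
    v = 1# - h * y + g * (y * y)

    O-v : O v
    O-v = +-O (+-O O-1 (neg-O (*-O O-½ O-y))) (*-O O-g (*-O O-y O-y))

    2h : ι 2 * h ≡ 1#
    2h = ι-invʳ p∤2

    -- The coefficient of y² in v²(1 + y); the values h = 1/2 and g = 3/8 make it vanish.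
    quadratic : h * h + ι 2 * g - ι 2 * h ≡ 0#
    quadratic = *-cancelˡ (char-0 7) (begin
      ι 8 * (h * h + ι 2 * (ι 3 * inv (ι 8)) - ι 2 * h) ≡⟨ solve 2 (λ h e → κ 8 :* (h :* h :+ κ 2 :* (κ 3 :* e) :- κ 2 :* h) := κ 2 :* (κ 2 :* h) :* (κ 2 :* h) :+ κ 6 :* (κ 8 :* e) :- κ 8 :* (κ 2 :* h)) refl h (inv (ι 8)) ⟩
      ι 2 * (ι 2 * h) * (ι 2 * h) + ι 6 * (ι 8 * inv (ι 8)) - ι 8 * (ι 2 * h) ≡⟨ cong₂ (λ x z → ι 2 * x * x + ι 6 * z - ι 8 * x) 2h (ι-invʳ p∤8) ⟩
      ι 2 * 1# * 1# + ι 6 * 1# - ι 8 * 1# ≡⟨ solve 0 (κ 2 :* κ 1 :* κ 1 :+ κ 6 :* κ 1 :- κ 8 :* κ 1 := κ 8 :* κ 0) refl ⟩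
      ι 8 * 0# ∎)

    -- v truncates the series of (1 + y)^{-1/2}.
    v²≈ : v * v * (1# + y) ≈ 1# [ 3 ]
    v²≈ = -≈0⇒≈ (≈-trans (≈-reflexive (begin
      v * v * (1# + y) - 1# ≡⟨ solve 3 (λ h g y → let v = κ 1 :- h :* y :+ g :* (y :* y) in
          v :* v :* (κ 1 :+ y) :- κ 1 := (κ 1 :- κ 2 :* h) :* y :+ (h :* h :+ κ 2 :* g :- κ 2 :* h) :* (y :* y)
            :+ y :* y :* y :* (h :* h :+ κ 2 :* g :- κ 2 :* h :* g :+ (g :* g :- κ 2 :* h :* g) :* y :+ g :* g :* y :* y)) refl h g y ⟩
      (1# - ι 2 * h) * y + (h * h + ι 2 * g - ι 2 * h) * (y * y) + y * y * y * R ≡⟨ cong₂ (λ a b → (1# - a) * y + b * (y * y) + y * y * y * R) 2h quadratic ⟩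
      (1# - 1#) * y + 0# * (y * y) + y * y * y * R ≡⟨ solve 2 (λ y r → (κ 1 :- κ 1) :* y :+ κ 0 :* (y :* y) :+ y :* y :* y :* r := y :* y :* y :* r) refl y R ⟩
      y * y * y * R ∎)) (≈0-*ʳ R {{O-R}} (≈0-* (≈0-* y≈0 y≈0) y≈0)))
      where
      R = h * h + ι 2 * g - ι 2 * h * g + (g * g - ι 2 * h * g) * y + g * g * y * y
      O-2hg = *-O (*-O (O-ι 2) O-½) O-g
      O-R : O R
      O-R = +-O (+-O (+-O (+-O (*-O O-½ O-½) (*-O (O-ι 2) O-g)) (neg-O O-2hg)) (*-O (+-O (*-O O-g O-g) (neg-O O-2hg)) O-y)) (*-O (*-O (*-O O-g O-g) O-y) O-y)

    -- Of the two square roots ± 2^((p-1)/2) of 2^(p-1), w is the one that is 1 modulo p; its sign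
    -- is the quadratic character of 2.
    U w : Carrier
    U = ι 2 ^ (j ℕ.+ suc j)
    w = -1^ (suc j) * U

    N-eq : j ℕ.+ suc j ≡ suc (2 ℕ.* j)
    N-eq = solveℕ 1 (λ j → j ⊞ (# 1 ⊞ j) :≡ # 1 ⊞ # 2 ⊠ j) refl j

    p-eq : p ≡ suc (2 ℕ.* (j ℕ.+ suc j))
    p-eq = trans p≡4j+3 (solveℕ 1 (λ j → # 4 ⊠ j ⊞ # 3 :≡ # 1 ⊞ # 2 ⊠ (j ⊞ (# 1 ⊞ j))) refl j)

    w≈1 : w ≈ 1# [ 1 ]
    w≈1 = ≈-trans (≈-*ˡ (-1^ (suc j)) {{O--1^ (suc j)}} (2-residue j (suc j) p-eq (trans (cong factorial N-eq) (factorial-odd j)))) (≈-reflexive (-1^-square (suc j)))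

    w² : w * w ≡ 1# + y
    w² = begin
      -1^ (suc j) * U * (-1^ (suc j) * U) ≡⟨ solve 2 (λ e u → e :* u :* (e :* u) := e :* e :* (u :* u)) refl _ U ⟩
      -1^ (suc j) * -1^ (suc j) * (U * U) ≡⟨ cong₂ _*_ (-1^-square (suc j)) (trans (sym (^-homo-* (ι 2) (j ℕ.+ suc j) _)) (cong (ι 2 ^_) (trans (cong (λ n → j ℕ.+ suc j ℕ.+ n) (sym (ℕ.+-identityʳ _))) (sym (cong ℕ.pred p-eq))))) ⟩
      1# * ι 2 ^ p-1 ≡⟨ solve 1 (λ x → κ 1 :* x := κ 1 :+ (x :- κ 1)) refl _ ⟩
      1# + (ι 2 ^ p-1 - 1#) ≡⟨ cong (1# +_) (sym y-eq) ⟩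
      1# + y ∎

    -- For x = vw - 1 the congruence for v² says x² + 2x ≡ 0 modulo p³. As x ≡ 0 modulo p, the
    -- equation 2x ≡ -x² raises this first to p² and then to p³.
    vw≈1 : v * w ≈ 1# [ 3 ]
    vw≈1 = -≈0⇒≈ (halve (≈-trans (≈-reflexive (solve 1 (λ x → κ 2 :* x := x :* x :+ κ 2 :* x :- x :* x) refl x)) (≈-trans (≈-- square (≈-lower 3 {1} (≈0-* x≈0₂ x≈0₂))) (≈-reflexive (-‿inverseʳ 0#)))))
      where
      x = v * w - 1#
      halve : ∀ {x k} → ι 2 * x ≈ 0# [ k ] → x ≈ 0# [ k ]
      halve e = ι-cancel p∤2 (≈-trans e (≈-reflexive (sym (zeroʳ _))))
      square : x * x + ι 2 * x ≈ 0# [ 3 ]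
      square = ≈-trans (≈-reflexive (trans (solve 2 (λ v w → (v :* w :- κ 1) :* (v :* w :- κ 1) :+ κ 2 :* (v :* w :- κ 1) := v :* v :* (w :* w) :- κ 1) refl v w) (cong (λ z → v * v * z - 1#) w²))) (≈⇒-≈0 v²≈)
      v≈1 : v ≈ 1# [ 1 ]
      v≈1 = ≈-trans (≈-reflexive (solve 3 (λ h g y → κ 1 :- h :* y :+ g :* (y :* y) := κ 1 :+ y :* (⊝ h :+ g :* y)) refl h g y)) (≈-trans (≈-+ ≈-refl (≈0-*ʳ (- h + g * y) {{+-O (neg-O O-½) (*-O O-g O-y)}} y≈0)) (≈-reflexive (+-identityʳ 1#)))
      x≈0 : x ≈ 0# [ 1 ]
      x≈0 = ≈⇒-≈0 (≈-trans (≈-* {{O-v}} v≈1 w≈1) (≈-reflexive (*-identityʳ 1#)))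
      x≈0₂ : x ≈ 0# [ 2 ]
      x≈0₂ = halve (≈-trans (≈-reflexive (solve 1 (λ x → κ 2 :* x := x :* x :+ κ 2 :* x :- x :* x) refl x)) (≈-trans (≈-- (≈-lower 2 {1} square) (≈0-* x≈0 x≈0)) (≈-reflexive (-‿inverseʳ 0#))))

    M : ℕ → Carrier
    M n = ∏ n (λ i → (s i + ½) * inv (s i))

    c : ℕ → Carrier
    c n = ι ((2 ℕ.* n) C n)

    -- The product is (2n + 1) C(2n, n) / 4^n. At n = j the exponent 2n + 1 equals (p - 1)/2, so the
    -- power of 2 is `U`, and 2(2j + 1) is p - 1.
    M-eq : ∀ n → M n * ι 2 ^ (n ℕ.+ suc n) ≡ ι 2 * (odd n * c n)
    M-eq zero = solve 0 (κ 1 :* (κ 2 :* κ 1) := κ 2 :* ((κ 1 :+ κ 0) :* (κ 1 :+ κ 0))) refl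
    M-eq (suc n) = begin
      M n * ((m + ½) * inv m) * (ι 2 * ι 2 ^ (n ℕ.+ suc (suc n))) ≡⟨ cong (λ k → M n * ((m + ½) * inv m) * (ι 2 * ι 2 ^ k)) (ℕ.+-suc n (suc n)) ⟩
      M n * ((m + ½) * inv m) * (ι 2 * (ι 2 * ι 2 ^ (n ℕ.+ suc n))) ≡⟨ solve 5 (λ x m h i z → x :* ((m :+ h) :* i) :* (κ 2 :* (κ 2 :* z)) := (x :* z) :* (κ 2 :* (i :* (κ 2 :* m :+ κ 2 :* h)))) refl (M n) m ½ (inv m) _ ⟩
      M n * ι 2 ^ (n ℕ.+ suc n) * (ι 2 * (inv m * (ι 2 * m + ι 2 * ½))) ≡⟨ cong₂ (λ x z → x * (ι 2 * (inv m * z))) (M-eq n) (trans (cong₂ _+_ (sym (ι-* 2 (suc n))) 2h) (+-comm _ 1#)) ⟩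
      ι 2 * (odd n * c n) * (ι 2 * (inv m * odd (suc n))) ≡⟨ solve 4 (λ o c i o′ → κ 2 :* (o :* c) :* (κ 2 :* (i :* o′)) := κ 2 :* (o′ :* (κ 2 :* o :* c :* i))) refl (odd n) (c n) (inv m) (odd (suc n)) ⟩
      ι 2 * (odd (suc n) * (ι 2 * odd n * c n * inv m)) ≡⟨ cong (λ x → ι 2 * (odd (suc n) * x)) (div-unique (char-0 n) (trans (sym (central-binomial n)) (*-comm _ _))) ⟩
      ι 2 * (odd (suc n) * c (suc n)) ∎
      where m = ι (suc n)

    MU : M j * U ≡ (P - 1#) * c j
    MU = trans (M-eq j) (trans (sym (*-assoc _ _ _)) (cong (_* c j) (begin
      ι 2 * odd j ≡⟨ sym (ι-* 2 (suc (2 ℕ.* j))) ⟩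
      ι (2 ℕ.* suc (2 ℕ.* j)) ≡⟨ solve 1 (λ x → x := κ 1 :+ x :- κ 1) refl _ ⟩
      ι (suc (2 ℕ.* suc (2 ℕ.* j))) - 1# ≡⟨ cong (λ n → ι n - 1#) (trans (cong (λ m → suc (2 ℕ.* m)) (sym N-eq)) (sym p-eq)) ⟩
      P - 1# ∎)))

    O-C : O (c j)
    O-C = O-ι ((2 ℕ.* j) C j)

    O-M : O (M j)
    O-M = O-∏ j λ i i<j → *-O (+-O (O-s i) O-½) (O-inv-s {i} (s<p i<j))

    M≈ : M j ≈ -1^ j * c j * ((1# - P) * v) [ 3 ]
    M≈ = begin≈
      M j ≡≈⟨ sym (*-identityʳ _) ⟩
      M j * 1# ≈⟨ ≈-*ˡ (M j) {{O-M}} (≈-sym vw≈1) ⟩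
      M j * (v * (- 1# * -1^ j * U)) ≡≈⟨ solve 4 (λ m v e u → m :* (v :* (⊝ κ 1 :* e :* u)) := m :* u :* (⊝ κ 1 :* e :* v)) refl (M j) v (-1^ j) U ⟩
      M j * U * (- 1# * -1^ j * v) ≡≈⟨ cong (_* (- 1# * -1^ j * v)) MU ⟩
      (P - 1#) * c j * (- 1# * -1^ j * v) ≡≈⟨ solve 4 (λ p c e v → (p :- κ 1) :* c :* (⊝ κ 1 :* e :* v) := e :* c :* ((κ 1 :- p) :* v)) refl P (c j) (-1^ j) v ⟩
      -1^ j * c j * ((1# - P) * v) ∎≈
      where open ≈-Reasoning

    O-H : O (H j)
    O-H = O-∑ j λ i i<j → O-^ 2 (O-inv-s {i} (s<p i<j))

  module _ (𝔼 : ℕ → Carrier) (𝔼-0 : 𝔼 0 ≡ 1#)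
    (𝔼-recurrence : ∀ n → ∑ (suc (suc n)) (λ k → ι ((2 ℕ.* suc n) C (2 ℕ.* k)) * 𝔼 (suc n ∸ k)) ≡ 0#) (0<j : 0 < j) where

    private
      E = 𝔼 (2 ℕ.* j)

      E≈ : E ≈ - (q 2 * H j) [ 1 ]
      E≈ = euler≈ 𝔼 𝔼-0 𝔼-recurrence 0<j

      O-E : O E
      O-E = O-≈ {{neg-O (*-O (O-q p∤2) O-H)}} E≈

      -t²H≈ : - (t * t) * H j ≈ P * P * (inv (ι 4) * E) [ 3 ]
      -t²H≈ = begin≈
        - (t * t) * H j ≡≈⟨ lemma ⟩
        P * P * (inv (ι 4) * - (q 2 * H j)) ≈⟨ ≈-scale {{*-O (O-inv p∤4) (neg-O (*-O (O-q p∤2) O-H))}} (≈0-* p≈0 p≈0) (≈-*ˡ (inv (ι 4)) {{O-inv p∤4}} (≈-sym E≈)) ⟩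
        P * P * (inv (ι 4) * E) ∎≈
        where
        open ≈-Reasoning
        ¼-eq : q 2 ≡ inv (ι 4)
        ¼-eq = sym (inv-unique (trans (solve 1 (λ i → κ 4 :* i :^ 2 := (κ 2 :* i) :^ 2) refl (inv (ι 2))) (trans (cong (_^ 2) (ι-invʳ p∤2)) (1^ 2))))
        lemma : - (t * t) * H j ≡ P * P * (inv (ι 4) * - (q 2 * H j))
        lemma = begin
          - (t * t) * H j ≡⟨ solve 3 (λ p i h → ⊝ ((κ 1 :+ κ 0) :* p :* i :* ((κ 1 :+ κ 0) :* p :* i)) :* h := p :* p :* (i :* ⊝ (i :* h))) refl P (inv (ι 4)) (H j) ⟩
          P * P * (inv (ι 4) * - (inv (ι 4) * H j)) ≡⟨ cong (λ x → P * P * (inv (ι 4) * - (x * H j))) (sym ¼-eq) ⟩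
          P * P * (inv (ι 4) * - (q 2 * H j)) ∎

      closed≈ : closed-form ≈ (1# + P * P * (inv (ι 4) * E)) * (-1^ j * c j * ((1# - P) * v)) [ 3 ]
      closed≈ = begin≈
        closed-form ≡≈⟨ trans (∏-* j _ _) (cong (_* M j) (∏-cong j λ i → solve 2 (λ t σ → κ 1 :- t :* t :* (σ :* σ) := κ 1 :+ ⊝ (t :* t) :* σ :^ 2) refl t (inv (s i)))) ⟩
        ∏ j (λ i → 1# + - (t * t) * q (suc i)) * M j ≈⟨ ≈-*ʳ (M j) {{O-M}} (∏-1+ j {{neg-O (*-O O-t O-t)}} (≈-lower 3 {1} tttt) λ i i<j → O-^ 2 (O-inv-s {i} (s<p i<j))) ⟩
        (1# + - (t * t) * H j) * M j ≈⟨ ≈-* {{+-O O-1 (*-O (neg-O (*-O O-t O-t)) O-H)}} {{*-O (*-O (O--1^ j) O-C) (*-O (+-O O-1 (neg-O O-p)) O-v)}} (≈-+ ≈-refl -t²H≈) M≈ ⟩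
        (1# + P * P * (inv (ι 4) * E)) * (-1^ j * c j * ((1# - P) * v)) ∎≈
        where
        open ≈-Reasoning
        tttt : - (t * t) * - (t * t) ≈ 0# [ 4 ]
        tttt = ≈-trans (≈-reflexive (solve 1 (λ x → ⊝ x :* ⊝ x := x :* x) refl (t * t))) (≈0-* (≈0-* t≈0 t≈0) (≈0-* t≈0 t≈0))

      expand : (1# + P * P * (inv (ι 4) * E)) * ((1# - P) * v) ≈ 1# - P * (1# + h * Q) + P ^ 2 * (h * Q + g * Q ^ 2 + inv (ι 4) * E) [ 3 ]
      expand = -≈0⇒≈ (≈-trans (≈-reflexive
        (solve 5 (λ p q h g e → (κ 1 :+ p :* p :* e) :* ((κ 1 :- p) :* (κ 1 :- h :* (p :* q) :+ g :* (p :* q :* (p :* q)))) :- (κ 1 :- p :* (κ 1 :+ h :* q) :+ p :^ 2 :* (h :* q :+ g :* q :^ 2 :+ e))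
            := p :* p :* p :* (⊝ g :* q :* q :+ e :* (⊝ κ 1 :- h :* q :+ h :* p :* q :+ g :* p :* q :* q :- g :* p :* p :* q :* q))) refl P Q h g (inv (ι 4) * E)))
        (≈0-*ʳ _ {{O-R}} (≈0-* (≈0-* p≈0 p≈0) p≈0)))
        where
        e = inv (ι 4) * E
        O-e : O e
        O-e = *-O (O-inv p∤4) O-E
        O-R : O (- g * Q * Q + e * (- 1# - h * Q + h * P * Q + g * P * Q * Q - g * P * P * Q * Q))
        O-R = +-O (*-O (*-O (neg-O O-g) O-Q) O-Q) (*-O O-e (+-O (+-O (+-O (+-O (neg-O O-1) (neg-O (*-O O-½ O-Q))) (*-O (*-O O-½ O-p) O-Q)) (*-O (*-O (*-O O-g O-p) O-Q) O-Q)) (neg-O (*-O (*-O (*-O (*-O O-g O-p) O-p) O-Q) O-Q))))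

    case-three : ∑ p (λ k → ι (8 ℕ.* k ℕ.+ 3) * B k ^ 4)
      ≈ -1^ j * P * c j * (1# - P * (1# + h * Q) + P ^ 2 * (h * Q + g * Q ^ 2 + inv (ι 4) * E)) [ 4 ]
    case-three = begin≈
      ∑ p (λ k → ι (8 ℕ.* k ℕ.+ 3) * B k ^ 4) ≈⟨ reduction ⟩
      ι 1 * P * closed-form ≡≈⟨ cong (_* closed-form) (solve 1 (λ p → (κ 1 :+ κ 0) :* p := p) refl P) ⟩
      P * closed-form ≈⟨ ≈-scale {{O-≈ {{O-target}} step}} p≈0 step ⟩
      P * (-1^ j * c j * X) ≡≈⟨ solve 4 (λ p e c x → p :* (e :* c :* x) := e :* p :* c :* x) refl P (-1^ j) (c j) X ⟩
      -1^ j * P * c j * X ∎≈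
      where
      open ≈-Reasoning
      X = 1# - P * (1# + h * Q) + P ^ 2 * (h * Q + g * Q ^ 2 + inv (ι 4) * E)
      O-target : O (-1^ j * c j * X)
      O-target = *-O (*-O (O--1^ j) O-C) (+-O (+-O O-1 (neg-O (*-O O-p (+-O O-1 (*-O O-½ O-Q)))))
        (*-O (O-^ 2 O-p) (+-O (+-O (*-O O-½ O-Q) (*-O O-g (O-^ 2 O-Q))) (*-O (O-inv p∤4) O-E))))
      step : closed-form ≈ -1^ j * c j * X [ 3 ]
      step = begin≈
        closed-form ≈⟨ closed≈ ⟩
        (1# + P * P * (inv (ι 4) * E)) * (-1^ j * c j * ((1# - P) * v)) ≡≈⟨ solve 4 (λ a e c b → a :* (e :* c :* b) := e :* c :* (a :* b)) refl _ (-1^ j) (c j) _ ⟩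
        -1^ j * c j * ((1# + P * P * (inv (ι 4) * E)) * ((1# - P) * v)) ≈⟨ ≈-*ˡ (-1^ j * c j) {{*-O (O--1^ j) O-C}} expand ⟩
        -1^ j * c j * X ∎≈

-- Power sums over the residues and Teichmüller representatives

module PowerSums (F : Field) (p : ℕ) (L : Localisation F p) (p-prime : Prime p) (3<p : 3 < p) where
  open Fermat F p L p-prime 3<p public
  open ≡-Reasoning

  instance
    p-nonZero : ℕ.NonZero p
    p-nonZero = ℕ.≢-nonZero p≢0

  ∣⇒≈0 : ∀ z → p ∣ ℤ.∣ z ∣ → ιℤ z ≈ 0# [ 1 ]
  ∣⇒≈0 (ℤ.+ n) (divides q eq) = ≈-trans (≈-reflexive (trans (ιℤ-pos n) (trans (cong ι eq) (ι-* q p)))) (≈0-*ˡ (ι q) {{O-ι q}} p≈0)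
  ∣⇒≈0 -[1+ n ] (divides q eq) = ≈-trans (≈-reflexive (trans (cong (λ m → - ι m) eq) (trans (cong -_ (ι-* q p)) (solve 2 (λ q p → ⊝ (q :* p) := ⊝ q :* p) refl (ι q) (ι p))))) (≈0-*ˡ (- ι q) {{neg-O (O-ι q)}} p≈0)

  ≈0⇒∣ : ∀ z → ιℤ z ≈ 0# [ 1 ] → p ∣ ℤ.∣ z ∣
  ≈0⇒∣ z (modulo r Or e) = descend z Or (trans (solve 1 (λ x → x := x :- κ 0) refl (ιℤ z)) (trans e (cong (_* r) (*-identityʳ _))))

  ≈0? : ∀ z → Dec (ιℤ z ≈ 0# [ 1 ])
  ≈0? z with p ∣? ℤ.∣ z ∣
  ... | yes d = yes (∣⇒≈0 z d)
  ... | no ¬d = no (λ e → ¬d (≈0⇒∣ z e))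

  ιℤ-- : ∀ x y → ιℤ (x ℤ.- y) ≡ ιℤ x - ιℤ y
  ιℤ-- x y = trans (ιℤ-+ x (ℤ.- y)) (cong (ιℤ x +_) (ιℤ-neg y))

  ιℤ-^ : ∀ x n → ιℤ (x ℤ.^ n) ≡ ιℤ x ^ n
  ιℤ-^ x zero = refl
  ιℤ-^ x (suc n) = trans (ιℤ-* x (x ℤ.^ n)) (cong (ιℤ x *_) (ιℤ-^ x n))

  ≈? : ∀ x y → Dec (ιℤ x ≈ ιℤ y [ 1 ])
  ≈? x y with ≈0? (x ℤ.- y)
  ... | yes e = yes (-≈0⇒≈ (≈-trans (≈-reflexive (sym (ιℤ-- x y))) e))
  ... | no ¬e = no (λ e → ¬e (≈-trans (≈-reflexive (ιℤ-- x y)) (≈⇒-≈0 e)))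

  ≉0 : ∀ {n} → p ∤ n → ¬ (ι n ≈ 0# [ 1 ])
  ≉0 {n} p∤n e = p∤n (≈0⇒∣ (ℤ.+ n) (≈-trans (≈-reflexive (ιℤ-pos n)) e))

  integral-domain : ∀ x y → ιℤ x * ιℤ y ≈ 0# [ 1 ] → ιℤ x ≈ 0# [ 1 ] ⊎ ιℤ y ≈ 0# [ 1 ]
  integral-domain x y e with euclidsLemma ℤ.∣ x ∣ ℤ.∣ y ∣ p-prime (subst (p ∣_) (ℤ.abs-* x y) (≈0⇒∣ (x ℤ.* y) (≈-trans (≈-reflexive (ιℤ-* x y)) e)))
  ... | inj₁ d = inj₁ (∣⇒≈0 x d)
  ... | inj₂ d = inj₂ (∣⇒≈0 y d)

  ιℤ-cancel : ∀ z {x y k} → ¬ (ιℤ z ≈ 0# [ 1 ]) → ιℤ z * x ≈ ιℤ z * y [ k ] → x ≈ y [ k ]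
  ιℤ-cancel (ℤ.+ n) {x} {y} h e = ι-cancel {n} (λ d → h (∣⇒≈0 (ℤ.+ n) d)) (subst (λ m → m * x ≈ m * y [ _ ]) (ιℤ-pos n) e)
  ιℤ-cancel -[1+ n ] {x} {y} h e = ι-cancel {suc n} (λ d → h (∣⇒≈0 -[1+ n ] d))
    (≈-trans (≈-reflexive (lemma x)) (≈-trans (≈-neg e) (≈-reflexive (sym (lemma y)))))
    where
    lemma : ∀ x → ι (suc n) * x ≡ - (- ι (suc n) * x)
    lemma x = solve 2 (λ m x → m :* x := ⊝ (⊝ m :* x)) refl _ x

  open import Data.Nat.DivMod using (_%_; _/_; m≡m%n+[m/n]*n; m%n<n)

  %≈ : ∀ a → ι (a % p) ≈ ι a [ 1 ]
  %≈ a = ≈-sym (begin≈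
    ι a ≡≈⟨ trans (cong ι (m≡m%n+[m/n]*n a p)) (trans (ι-+ (a % p) (a / p ℕ.* p)) (cong (ι (a % p) +_) (ι-* (a / p) p))) ⟩
    ι (a % p) + ι (a / p) * ι p ≈⟨ ≈-+ ≈-refl (≈0-*ˡ (ι (a / p)) {{O-ι (a / p)}} p≈0) ⟩
    ι (a % p) + 0# ≡≈⟨ +-identityʳ _ ⟩
    ι (a % p) ∎≈)
    where open ≈-Reasoning

  private
    ordered : ∀ {a b} → a ≤ b → b < p → ι b ≈ ι a [ 1 ] → a ≡ b
    ordered {a} {b} a≤b b<p e with b ∸ a ℕ.≟ 0
    ... | yes z = ℕ.≤-antisym a≤b (ℕ.m∸n≡0⇒m≤n z)
    ... | no nz = ⊥-elim (≉0 (p∤ nz (ℕ.≤-<-trans (ℕ.m∸n≤m b a) b<p)) (≈-trans (≈-reflexive (ι-∸ a≤b)) (≈⇒-≈0 e)))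

  residue-unique : ∀ {a b} → a < p → b < p → ι a ≈ ι b [ 1 ] → a ≡ b
  residue-unique {a} {b} a<p b<p e with ℕ.≤-total a b
  ... | inj₁ a≤b = ordered a≤b b<p (≈-sym e)
  ... | inj₂ b≤a = sym (ordered b≤a a<p e)

  inverse : ℕ → ℕ
  inverse c = c ℕ.^ ℕ.pred p-1

  p-1-suc : suc (ℕ.pred p-1) ≡ p-1
  p-1-suc = ℕ.suc-pred p-1 {{ℕ.≢-nonZero λ e → ℕ.n≮0 (ℕ.≤-pred (subst (3 <_) (trans (sym p≡1+p-1) (cong suc e)) 3<p))}}

  inverse≈ : ∀ {c} → p ∤ c → ι c * ι (inverse c) ≈ 1# [ 1 ]
  inverse≈ {c} p∤c = ≈-trans (≈-reflexive (trans (cong (ι c *_) (ι-^ c (ℕ.pred p-1))) (cong (ι c ^_) p-1-suc))) (fermat-unit p∤c)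

  module Multiplication (c : ℕ) (p∤c : p ∤ c) where
    multiply unmultiply : ℕ → ℕ
    multiply u = (c ℕ.* u) % p
    unmultiply u = (inverse c ℕ.* u) % p

    multiply< : ∀ i → i < p → multiply i < p
    multiply< i _ = m%n<n (c ℕ.* i) p

    unmultiply< : ∀ i → i < p → unmultiply i < p
    unmultiply< i _ = m%n<n (inverse c ℕ.* i) p

    multiply≈ : ∀ u → ι (multiply u) ≈ ι c * ι u [ 1 ]
    multiply≈ u = ≈-trans (%≈ (c ℕ.* u)) (≈-reflexive (ι-* c u))

    unmultiply≈ : ∀ u → ι (unmultiply u) ≈ ι (inverse c) * ι u [ 1 ]
    unmultiply≈ u = ≈-trans (%≈ (inverse c ℕ.* u)) (≈-reflexive (ι-* (inverse c) u))

    multiply-unmultiply : ∀ i → i < p → multiply (unmultiply i) ≡ i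
    multiply-unmultiply i i<p = residue-unique (multiply< _ (unmultiply< i i<p)) i<p (begin≈
      ι (multiply (unmultiply i)) ≈⟨ ≈-trans (multiply≈ (unmultiply i)) (≈-*ˡ (ι c) {{O-ι c}} (unmultiply≈ i)) ⟩
      ι c * (ι (inverse c) * ι i) ≡≈⟨ sym (*-assoc _ _ _) ⟩
      ι c * ι (inverse c) * ι i ≈⟨ ≈-*ʳ (ι i) {{O-ι i}} (inverse≈ p∤c) ⟩
      1# * ι i ≡≈⟨ *-identityˡ _ ⟩
      ι i ∎≈)
      where open ≈-Reasoning

    unmultiply-multiply : ∀ i → i < p → unmultiply (multiply i) ≡ i
    unmultiply-multiply i i<p = residue-unique (unmultiply< _ (multiply< i i<p)) i<p (begin≈
      ι (unmultiply (multiply i)) ≈⟨ ≈-trans (unmultiply≈ (multiply i)) (≈-*ˡ (ι (inverse c)) {{O-ι (inverse c)}} (multiply≈ i)) ⟩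
      ι (inverse c) * (ι c * ι i) ≡≈⟨ solve 3 (λ x y z → x :* (y :* z) := y :* x :* z) refl _ (ι c) (ι i) ⟩
      ι c * ι (inverse c) * ι i ≈⟨ ≈-*ʳ (ι i) {{O-ι i}} (inverse≈ p∤c) ⟩
      1# * ι i ≡≈⟨ *-identityˡ _ ⟩
      ι i ∎≈)
      where open ≈-Reasoning

  -- Since 0^0 = 1, the value at s = 0 is p, which fits `powersum≈0`.
  powersum : ℕ → Carrier
  powersum s = ∑ p (λ u → ι u ^ s)

  powersum-first : ∀ s → powersum (suc s) ≡ ∑ p-1 (λ u → ι (suc u) ^ suc s)
  powersum-first s = trans (cong (λ q → ∑ q (λ u → ι u ^ suc s)) (sym p≡1+p-1)) (trans (∑-first p-1 _) (trans (cong (_+ ∑ p-1 (λ u → ι (suc u) ^ suc s)) (zeroˡ _)) (+-identityˡ _)))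

  p∤suc : ∀ {u} → u < p-1 → p ∤ suc u
  p∤suc {u} u<p-1 = p∤ (λ ()) (subst (suc u <_) p≡1+p-1 (s≤s u<p-1))

  p-1≈-1 : ι p-1 ≈ - 1# [ 1 ]
  p-1≈-1 = begin≈
    ι p-1 ≡≈⟨ trans (solve 1 (λ x → x := κ 1 :+ x :- κ 1) refl _) (cong (λ q → ι q - 1#) p≡1+p-1) ⟩
    ι p - 1# ≈⟨ ≈-- p≈0 ≈-refl ⟩
    0# - 1# ≡≈⟨ +-identityˡ _ ⟩
    - 1# ∎≈
    where open ≈-Reasoning

  -- Applied in contrapositive form: a power sum that vanishes modulo p yields a unit whose power is
  -- not 1.
  powersum-units : ∀ s → (∀ u → u < p-1 → ι (suc u) ^ suc s ≈ 1# [ 1 ]) → powersum (suc s) ≈ - 1# [ 1 ]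
  powersum-units s h = begin≈
    powersum (suc s) ≡≈⟨ powersum-first s ⟩
    ∑ p-1 (λ u → ι (suc u) ^ suc s) ≈⟨ ∑-≈ p-1 h ⟩
    ∑ p-1 (λ _ → 1#) ≡≈⟨ trans (∑-const p-1 1#) (*-identityʳ _) ⟩
    ι p-1 ≈⟨ p-1≈-1 ⟩
    - 1# ∎≈
    where open ≈-Reasoning

  powersum-top : powersum p-1 ≈ - 1# [ 1 ]
  powersum-top = subst (λ s → powersum s ≈ - 1# [ 1 ]) p-1-suc (powersum-units (ℕ.pred p-1) λ u u<p-1 →
    subst (λ s → ι (suc u) ^ s ≈ 1# [ 1 ]) (sym p-1-suc) (fermat-unit (p∤suc u<p-1)))

  -- Summing (u + 1)^{s+1} - u^{s+1} over u < p telescopes to p^{s+1}. Expanded, it is s + 1 times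
  -- the power sum plus multiples of earlier ones, and s + 1 is a unit.
  powersum≈0 : ∀ s → s < p-1 → powersum s ≈ 0# [ 1 ]
  powersum≈0 s s<p-1 = bounded (suc s) s ℕ.≤-refl s<p-1
    where
    open ≈-Reasoning
    bounded : ∀ B s → s < B → s < p-1 → powersum s ≈ 0# [ 1 ]
    bounded (suc B) s (s≤s s≤B) s<p-1 = ι-cancel (p∤suc s<p-1) (begin≈
      ι (suc s) * powersum s ≡≈⟨ trans (cong (λ m → ι m * powersum s) (sym top-coefficient)) (sym (+-identityˡ _)) ⟩
      0# + c s * powersum s ≈⟨ ≈-+ (≈-sym (∑-≈0 s λ k k<s → ≈0-*ˡ (c k) {{O-ι (suc s C k)}} (bounded B k (ℕ.<-≤-trans k<s s≤B) (ℕ.<-trans k<s s<p-1)))) ≈-refl ⟩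
      ∑ (suc s) (λ k → c k * powersum k) ≡≈⟨ trans (∑-cong (suc s) λ k → sym (∑-*ˡ p (c k) _)) (∑-swap (suc s) p _) ⟩
      ∑ p (λ u → ∑ (suc s) (λ k → c k * ι u ^ k)) ≡≈⟨ ∑-cong p difference-of-powers ⟩
      ∑ p (λ u → ι (suc u) ^ suc s - ι u ^ suc s) ≡≈⟨ ∑-telescope p (λ u → ι u ^ suc s) ⟩
      ι p * ι p ^ s - 0# * 0# ^ s ≈⟨ ≈-- (≈0-*ʳ (ι p ^ s) {{O-^ s O-p}} p≈0) ≈-refl ⟩
      0# - 0# * 0# ^ s ≡≈⟨ solve 2 (λ x y → κ 0 :- κ 0 :* x := y :* κ 0) refl (0# ^ s) (ι (suc s)) ⟩
      ι (suc s) * 0# ∎≈)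
      where
      c : ℕ → Carrier
      c k = ι (suc s C k)
      top-coefficient : suc s C s ≡ suc s
      top-coefficient = trans (nCk≡nC[n∸k] (ℕ.n≤1+n s)) (trans (cong (suc s C_) (trans (ℕ.+-∸-assoc 1 {s} ℕ.≤-refl) (cong suc (ℕ.n∸n≡0 s)))) (nC1≡n (suc s)))
        where open import Data.Nat.Combinatorics using (nC1≡n)
      difference-of-powers : ∀ u → ∑ (suc s) (λ k → c k * ι u ^ k) ≡ ι (suc u) ^ suc s - ι u ^ suc s
      difference-of-powers u = begin
        ∑ (suc s) (λ k → c k * ι u ^ k) ≡⟨ solve 2 (λ x y → x := x :+ (κ 1 :+ κ 0) :* (y :* κ 1) :- y) refl _ (ι u ^ suc s) ⟩
        ∑ (suc s) (λ k → c k * ι u ^ k) + ι 1 * (ι u ^ suc s * 1#) - ι u ^ suc s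
          ≡⟨ cong₂ (λ x y → x + y - ι u ^ suc s) (∑-cong (suc s) λ k → cong (c k *_) (trans (sym (*-identityʳ _)) (cong (ι u ^ k *_) (sym (1^ (suc s ∸ k))))))
               (cong₂ (λ m z → ι m * (ι u ^ suc s * z)) (sym (nCn≡1 (suc s))) (sym (1^ (suc s ∸ suc s)))) ⟩
        ∑ (suc (suc s)) (λ k → c k * (ι u ^ k * 1# ^ (suc s ∸ k))) - ι u ^ suc s ≡⟨ cong (_- ι u ^ suc s) (sym (binomial-theorem (suc s) (ι u) 1#)) ⟩
        (ι u + 1#) ^ suc s - ι u ^ suc s ≡⟨ cong (λ x → x ^ suc s - ι u ^ suc s) (+-comm _ 1#) ⟩
        ι (suc u) ^ suc s - ι u ^ suc s ∎

  -- The form u^p ≡ u of Fermat's theorem includes u = 0, but needs a positive exponent to start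
  -- from: 0^0 = 1 breaks the period at exponent 0.
  powersum-period : ∀ s → powersum (suc s ℕ.+ p-1) ≈ powersum (suc s) [ 1 ]
  powersum-period s = ∑-≈ p λ u _ → begin≈
    ι u ^ (suc s ℕ.+ p-1) ≡≈⟨ trans (cong (ι u ^_) (trans (sym (ℕ.+-suc s p-1)) (cong (s ℕ.+_) p≡1+p-1))) (^-homo-* (ι u) s p) ⟩
    ι u ^ s * ι u ^ p ≈⟨ ≈-*ˡ (ι u ^ s) {{O-^ s (O-ι u)}} (fermat u) ⟩
    ι u ^ s * ι u ≡≈⟨ *-comm _ _ ⟩
    ι u ^ suc s ∎≈
    where open ≈-Reasoning

  private
    geometric : Carrier → Carrier → ℕ → Carrier
    geometric x y zero = 0#
    geometric x y (suc n) = x ^ n + y * geometric x y n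

    geometric-eq : ∀ x y n → x ^ n - y ^ n ≡ (x - y) * geometric x y n
    geometric-eq x y zero = solve 1 (λ d → κ 1 :- κ 1 := d :* κ 0) refl (x - y)
    geometric-eq x y (suc n) = begin
      x * x ^ n - y * y ^ n ≡⟨ solve 4 (λ x y a b → x :* a :- y :* b := (x :- y) :* a :+ y :* (a :- b)) refl x y (x ^ n) (y ^ n) ⟩
      (x - y) * x ^ n + y * (x ^ n - y ^ n) ≡⟨ cong (λ z → (x - y) * x ^ n + y * z) (geometric-eq x y n) ⟩
      (x - y) * x ^ n + y * ((x - y) * geometric x y n) ≡⟨ solve 4 (λ d y a g → d :* a :+ y :* (d :* g) := d :* (a :+ y :* g)) refl (x - y) y (x ^ n) (geometric x y n) ⟩
      (x - y) * geometric x y (suc n) ∎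

    geometric≈ : ∀ {x y} → O x → O y → x ≈ y [ 1 ] → ∀ n → geometric x y (suc n) ≈ ι (suc n) * y ^ n [ 1 ]
    geometric≈ {x} {y} Ox Oy e zero = ≈-reflexive (solve 1 (λ y → κ 1 :+ y :* κ 0 := (κ 1 :+ κ 0) :* κ 1) refl y)
    geometric≈ {x} {y} Ox Oy e (suc n) = ≈-trans (≈-+ (≈-^ (suc n) {{Ox}} {{Oy}} e) (≈-*ˡ y {{Oy}} (geometric≈ Ox Oy e n)))
      (≈-reflexive (solve 3 (λ y z m → y :* z :+ y :* (m :* z) := (κ 1 :+ m) :* (y :* z)) refl y (y ^ n) (ι (suc n))))

  -- x^p - y^p is x - y times a sum of p terms that are all y^{p-1} modulo p, so both factors are
  -- divisible by p.
  ^p-lift : ∀ {x y} → O x → O y → x ≈ y [ 1 ] → x ^ p ≈ y ^ p [ 2 ]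
  ^p-lift {x} {y} Ox Oy e = -≈0⇒≈ (≈-trans (≈-reflexive (geometric-eq x y p)) (≈0-* (≈⇒-≈0 e) (subst (λ q → geometric x y q ≈ 0# [ 1 ]) p≡1+p-1
    (≈-trans (geometric≈ Ox Oy e p-1) (≈0-*ʳ (y ^ p-1) {{O-^ p-1 Oy}} (subst (λ q → ι q ≈ 0# [ 1 ]) (sym p≡1+p-1) p≈0))))))

  -- The Teichmüller representative of u modulo p².
  ω : ℕ → Carrier
  ω u = ι u ^ p

  O-ω : ∀ u → O (ω u)
  O-ω u = O-^ p (O-ι u)

  ω^p : ∀ u → ω u ^ p ≈ ω u [ 2 ]
  ω^p u = ^p-lift (O-ω u) (O-ι u) (fermat u)

  -- Some unit c has c^{s+1} ≢ 1. Multiplication by c permutes the residues, and `ω` is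
  -- multiplicative modulo p², so ω(c)^{s+1} - 1, a unit, annihilates the sum.
  ω-powersum≈0 : ∀ s → powersum (suc s) ≈ 0# [ 1 ] → ∑ p (λ u → ω u ^ suc s) ≈ 0# [ 2 ]
  ω-powersum≈0 s h with ℕ.anyUpTo? (λ c → ¬? (≈? ((ℤ.+ suc c) ℤ.^ suc s) ℤ.1ℤ)) p-1
    where open import Relation.Nullary.Decidable using (¬?)
  ... | no none = ⊥-elim (≉0 {1} (p∤ (λ ()) (ℕ.<-trans (s≤s (s≤s z≤n)) 3<p)) (begin≈
      ι 1 ≡≈⟨ solve 0 (κ 1 :+ κ 0 := ⊝ (⊝ κ 1)) refl ⟩
      - - 1# ≈⟨ ≈-neg (≈-trans (≈-sym (powersum-units s all)) h) ⟩
      - 0# ≡≈⟨ solve 0 (⊝ κ 0 := κ 0) refl ⟩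
      0# ∎≈))
    where
    open ≈-Reasoning
    all : ∀ u → u < p-1 → ι (suc u) ^ suc s ≈ 1# [ 1 ]
    all u u<p-1 with ≈? ((ℤ.+ suc u) ℤ.^ suc s) ℤ.1ℤ
    ... | yes e = ≈-trans (≈-reflexive (sym (trans (ιℤ-^ (ℤ.+ suc u) (suc s)) (cong (_^ suc s) (ιℤ-pos (suc u)))))) e
    ... | no ¬e = ⊥-elim (none (u , u<p-1 , ¬e))
  ... | yes (c′ , c<p , ¬e) = ιℤ-cancel z z≉0 (begin≈
      ιℤ z * S ≡≈⟨ trans (cong (_* S) z-eq) (solve 2 (λ a s → (a :- κ 1) :* s := a :* s :- s) refl _ S) ⟩
      ω c ^ suc s * S - S ≡≈⟨ cong (_- S) (sym (∑-*ˡ p _ _)) ⟩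
      ∑ p (λ u → ω c ^ suc s * ω u ^ suc s) - S ≈⟨ ≈-- (∑-≈ p λ u _ → ≈-trans (≈-reflexive (sym (^-distrib-* (ω c) (ω u) (suc s)))) (≈-^ (suc s) {{*-O (O-ω c) (O-ω u)}} {{O-ω (multiply u)}} (ω-multiply u))) ≈-refl ⟩
      ∑ p (λ u → ω (multiply u) ^ suc s) - S ≡≈⟨ cong (_- S) (∑-permute p (λ u → ω u ^ suc s) multiply unmultiply multiply< unmultiply< multiply-unmultiply unmultiply-multiply) ⟩
      S - S ≡≈⟨ solve 2 (λ s z → s :- s := z :* κ 0) refl S (ιℤ z) ⟩
      ιℤ z * 0# ∎≈)
    where
    open ≈-Reasoning
    c = suc c′
    p∤c : p ∤ c
    p∤c = p∤suc c<p
    open Multiplication c p∤c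
    S = ∑ p (λ u → ω u ^ suc s)
    z = ((ℤ.+ c) ℤ.^ p) ℤ.^ suc s ℤ.- ℤ.1ℤ
    z-eq : ιℤ z ≡ ω c ^ suc s - 1#
    z-eq = trans (ιℤ-- (((ℤ.+ c) ℤ.^ p) ℤ.^ suc s) ℤ.1ℤ) (cong (_- 1#) (trans (ιℤ-^ ((ℤ.+ c) ℤ.^ p) (suc s)) (cong (_^ suc s) (trans (ιℤ-^ (ℤ.+ c) p) (cong (_^ p) (ιℤ-pos c))))))
    z≉0 : ¬ (ιℤ z ≈ 0# [ 1 ])
    z≉0 e = ¬e (-≈0⇒≈ (begin≈
      ιℤ ((ℤ.+ c) ℤ.^ suc s) - 1# ≡≈⟨ cong (_- 1#) (trans (ιℤ-^ (ℤ.+ c) (suc s)) (cong (_^ suc s) (ιℤ-pos c))) ⟩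
      ι c ^ suc s - 1# ≈⟨ ≈-- (≈-^ (suc s) {{O-ι c}} {{O-ω c}} (≈-sym (fermat c))) ≈-refl ⟩
      ω c ^ suc s - 1# ≡≈⟨ sym z-eq ⟩
      ιℤ z ≈⟨ e ⟩
      0# ∎≈))
    ω-multiply : ∀ u → ω c * ω u ≈ ω (multiply u) [ 2 ]
    ω-multiply u = ≈-trans (≈-reflexive (sym (^-distrib-* (ι c) (ι u) p))) (^p-lift (*-O (O-ι c) (O-ι u)) (O-ι (multiply u)) (≈-sym (multiply≈ u)))

  ω-unit : ∀ {u} → p ∤ u → ω u ^ p-1 ≈ 1# [ 2 ]
  ω-unit {u} p∤u = begin≈
    ω u ^ p-1 ≡≈⟨ trans (^-assocʳ (ι u) p p-1) (trans (cong (ι u ^_) (ℕ.*-comm p p-1)) (sym (^-assocʳ (ι u) p-1 p))) ⟩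
    (ι u ^ p-1) ^ p ≈⟨ ^p-lift (O-^ p-1 (O-ι u)) O-1 (fermat-unit p∤u) ⟩
    1# ^ p ≡≈⟨ 1^ p ⟩
    1# ∎≈
    where open ≈-Reasoning

  -- Each of the p - 1 units contributes 1 modulo p². Keeping p - 1 rather than -1 matters for
  -- `main≈`.
  ω-powersum-top : ∑ p (λ u → ω u ^ p-1) ≈ ι p-1 [ 2 ]
  ω-powersum-top = begin≈
    ∑ p (λ u → ω u ^ p-1) ≡≈⟨ cong (λ q → ∑ q (λ u → ω u ^ p-1)) (sym p≡1+p-1) ⟩
    ∑ (suc p-1) (λ u → ω u ^ p-1) ≡≈⟨ ∑-first p-1 _ ⟩
    ω 0 ^ p-1 + ∑ p-1 (λ u → ω (suc u) ^ p-1) ≈⟨ ≈-+ (≈-reflexive zero-term) (∑-≈ p-1 λ u u<p-1 → ω-unit (p∤suc u<p-1)) ⟩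
    0# + ∑ p-1 (λ _ → 1#) ≡≈⟨ trans (+-identityˡ _) (trans (∑-const p-1 1#) (*-identityʳ _)) ⟩
    ι p-1 ∎≈
    where
    open ≈-Reasoning
    zero-term : ω 0 ^ p-1 ≡ 0#
    zero-term = trans (cong₂ (λ q m → (0# ^ q) ^ m) (sym p≡1+p-1) (sym p-1-suc)) (trans (cong (λ z → z ^ suc (ℕ.pred p-1)) (zeroˡ _)) (zeroˡ _))

-- The Legendre symbol for primes that are 1 modulo 4

ℤ-ring : CRing
ℤ-ring = record { isCommutativeRing = ℤ.+-*-isCommutativeRing }

module Z = Sums ℤ-ring

Z-ι : ∀ n → Z.ι n ≡ ℤ.+ n
Z-ι zero = refl
Z-ι (suc n) = cong (λ z → ℤ.1ℤ ℤ.+ z) (Z-ι n)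

data Sign₃ : ℤ → Set where
  null : Sign₃ ℤ.0ℤ
  plus : Sign₃ ℤ.1ℤ
  minus : Sign₃ ℤ.-1ℤ

Sign₃-* : ∀ {a b} → Sign₃ a → Sign₃ b → Sign₃ (a ℤ.* b)
Sign₃-* null b = null
Sign₃-* plus null = null
Sign₃-* plus plus = plus
Sign₃-* plus minus = minus
Sign₃-* minus null = null
Sign₃-* minus plus = minus
Sign₃-* minus minus = plus

module Legendre (F : Field) (p : ℕ) (L : Localisation F p) (p-prime : Prime p) (3<p : 3 < p)
  (n : ℕ) (p≡4n+1 : p ≡ suc (4 ℕ.* n)) where
  open PowerSums F p L p-prime 3<p public
  open ≡-Reasoning

  N : ℕ
  N = 2 ℕ.* n

  p-1≡2N : p-1 ≡ 2 ℕ.* N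
  p-1≡2N = trans (cong ℕ.pred p≡4n+1) (ℕ.*-assoc 2 2 n)

  n≢0 : n ≢ 0
  n≢0 refl = ℕ.<⇒≱ 3<p (subst (_≤ 3) (sym p≡4n+1) (s≤s z≤n))

  double-≡0 : ∀ {m} → 2 ℕ.* m ≡ 0 → m ≡ 0
  double-≡0 {zero} _ = refl

  N-suc : suc (ℕ.pred N) ≡ N
  N-suc = ℕ.suc-pred N {{ℕ.≢-nonZero λ e → n≢0 (double-≡0 e)}}

  ιℤ-∑ : ∀ m f → ιℤ (Z.∑ m f) ≡ ∑ m (λ i → ιℤ (f i))
  ιℤ-∑ zero f = refl
  ιℤ-∑ (suc m) f = trans (ιℤ-+ (Z.∑ m f) (f m)) (cong (_+ ιℤ (f m)) (ιℤ-∑ m f))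

  even-power-neg : ∀ x m → (- x) ^ (2 ℕ.* m) ≡ x ^ (2 ℕ.* m)
  even-power-neg x m = trans (sym (^-assocʳ (- x) 2 m)) (trans (cong (_^ m) (solve 1 (λ x → (⊝ x) :^ 2 := x :^ 2) refl x)) (^-assocʳ x 2 m))

  ιℤ-abs-^ : ∀ z m → ιℤ z ^ (2 ℕ.* m) ≡ ι ℤ.∣ z ∣ ^ (2 ℕ.* m)
  ιℤ-abs-^ (ℤ.+ k) m = cong (_^ (2 ℕ.* m)) (ιℤ-pos k)
  ιℤ-abs-^ -[1+ k ] m = even-power-neg (ι (suc k)) m

  fermat-ℤ : ∀ z → ¬ (ιℤ z ≈ 0# [ 1 ]) → ιℤ z ^ p-1 ≈ 1# [ 1 ]
  fermat-ℤ z h = ≈-trans (≈-reflexive (trans (cong (ιℤ z ^_) p-1≡2N) (trans (ιℤ-abs-^ z N) (cong (ι ℤ.∣ z ∣ ^_) (sym p-1≡2N))))) (fermat-unit λ d → h (∣⇒≈0 z d))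

  p∤1 : p ∤ 1
  p∤1 = p∤ (λ ()) (ℕ.<-trans (s≤s (s≤s z≤n)) 3<p)

  1≉0 : ¬ (1# ≈ 0# [ 1 ])
  1≉0 e = p∤1 (≈0⇒∣ ℤ.1ℤ e)

  -- Two signs differ by at most 2, which is less than p.
  sign-unique : ∀ {a b} → Sign₃ a → Sign₃ b → ιℤ a ≈ ιℤ b [ 1 ] → a ≡ b
  sign-unique {a} {b} sa sb e = cases sa sb (≈0⇒∣ (a ℤ.- b) (≈-trans (≈-reflexive (ιℤ-- a b)) (≈⇒-≈0 e)))
    where
    cases : ∀ {a b} → Sign₃ a → Sign₃ b → p ∣ ℤ.∣ a ℤ.- b ∣ → a ≡ b
    cases null null _ = refl
    cases null plus d = ⊥-elim (p∤1 d)
    cases null minus d = ⊥-elim (p∤1 d)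
    cases plus null d = ⊥-elim (p∤1 d)
    cases plus plus _ = refl
    cases plus minus d = ⊥-elim (p∤2 d)
    cases minus null d = ⊥-elim (p∤1 d)
    cases minus plus d = ⊥-elim (p∤2 d)
    cases minus minus _ = refl

  -- Defined by Euler's criterion, with integer values: sums of symbols are then exact integers and
  -- not only residues.
  χ : ℤ → ℤ
  χ z with ≈? z ℤ.0ℤ | ≈? (z ℤ.^ N) ℤ.1ℤ
  ... | yes _ | _ = ℤ.0ℤ
  ... | no _ | yes _ = ℤ.1ℤ
  ... | no _ | no _ = ℤ.-1ℤ

  χ-sign : ∀ z → Sign₃ (χ z)
  χ-sign z with ≈? z ℤ.0ℤ | ≈? (z ℤ.^ N) ℤ.1ℤ
  ... | yes _ | _ = null
  ... | no _ | yes _ = plus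
  ... | no _ | no _ = minus

  χ-zero : ∀ {z} → ιℤ z ≈ 0# [ 1 ] → χ z ≡ ℤ.0ℤ
  χ-zero {z} e with ≈? z ℤ.0ℤ | ≈? (z ℤ.^ N) ℤ.1ℤ
  ... | yes _ | _ = refl
  ... | no ¬e | _ = ⊥-elim (¬e e)

  χ-unit : ∀ {z} → ¬ (ιℤ z ≈ 0# [ 1 ]) → χ z ≡ ℤ.1ℤ ⊎ χ z ≡ ℤ.-1ℤ
  χ-unit {z} ¬e with ≈? z ℤ.0ℤ | ≈? (z ℤ.^ N) ℤ.1ℤ
  ... | yes e | _ = ⊥-elim (¬e e)
  ... | no _ | yes _ = inj₁ refl
  ... | no _ | no _ = inj₂ refl

  χ-square : ∀ {z} → ¬ (ιℤ z ≈ 0# [ 1 ]) → χ z ℤ.* χ z ≡ ℤ.1ℤ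
  χ-square {z} h with χ z | χ-unit {z} h
  ... | _ | inj₁ refl = refl
  ... | _ | inj₂ refl = refl

  minus-one : ∀ w → ιℤ w * ιℤ w ≈ 1# [ 1 ] → ¬ (ιℤ w ≈ 1# [ 1 ]) → ιℤ w ≈ ιℤ ℤ.-1ℤ [ 1 ]
  minus-one w e ¬1 = conclude (integral-domain (w ℤ.- ℤ.1ℤ) (w ℤ.+ ℤ.1ℤ) (≈-trans (≈-reflexive eq) (≈⇒-≈0 e)))
    where
    x = ιℤ w
    eq : ιℤ (w ℤ.- ℤ.1ℤ) * ιℤ (w ℤ.+ ℤ.1ℤ) ≡ x * x - 1#
    eq = trans (cong₂ _*_ (ιℤ-- w ℤ.1ℤ) (ιℤ-+ w ℤ.1ℤ)) (solve 1 (λ x → (x :- κ 1) :* (x :+ κ 1) := x :* x :- κ 1) refl x)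
    conclude : ιℤ (w ℤ.- ℤ.1ℤ) ≈ 0# [ 1 ] ⊎ ιℤ (w ℤ.+ ℤ.1ℤ) ≈ 0# [ 1 ] → x ≈ ιℤ ℤ.-1ℤ [ 1 ]
    conclude (inj₁ e) = ⊥-elim (¬1 (-≈0⇒≈ (≈-trans (≈-reflexive (sym (ιℤ-- w ℤ.1ℤ))) e)))
    conclude (inj₂ e) = -≈0⇒≈ (≈-trans (≈-reflexive (trans (solve 1 (λ x → x :- ⊝ (κ 1 :+ κ 0) := x :+ κ 1) refl x) (sym (ιℤ-+ w ℤ.1ℤ)))) e)

  ^N-square : ∀ z → ¬ (ιℤ z ≈ 0# [ 1 ]) → ιℤ (z ℤ.^ N) * ιℤ (z ℤ.^ N) ≈ 1# [ 1 ]
  ^N-square z h = ≈-trans (≈-reflexive (trans (cong (λ y → y * y) (ιℤ-^ z N)) (trans (sym (^-homo-* (ιℤ z) N N)) (cong (ιℤ z ^_) (trans (cong (N ℕ.+_) (sym (ℕ.+-identityʳ N))) (sym p-1≡2N)))))) (fermat-ℤ z h)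

  ^N-zero : ∀ z → ιℤ z ≈ 0# [ 1 ] → ιℤ z ^ N ≈ 0# [ 1 ]
  ^N-zero z e = subst (λ m → ιℤ z ^ m ≈ 0# [ 1 ]) N-suc (≈0-*ʳ (ιℤ z ^ ℕ.pred N) {{O-^ (ℕ.pred N) (O-ιℤ z)}} e)

  χ-spec : ∀ z → (ιℤ z ≈ 0# [ 1 ] × χ z ≡ ℤ.0ℤ) ⊎ (ιℤ (z ℤ.^ N) ≈ 1# [ 1 ] × χ z ≡ ℤ.1ℤ) ⊎ (¬ (ιℤ z ≈ 0# [ 1 ]) × ¬ (ιℤ (z ℤ.^ N) ≈ 1# [ 1 ]) × χ z ≡ ℤ.-1ℤ)
  χ-spec z with ≈? z ℤ.0ℤ | ≈? (z ℤ.^ N) ℤ.1ℤ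
  ... | yes e | _ = inj₁ (e , refl)
  ... | no _ | yes e = inj₂ (inj₁ (e , refl))
  ... | no h | no h′ = inj₂ (inj₂ (h , h′ , refl))

  χ≈ : ∀ z → ιℤ (χ z) ≈ ιℤ z ^ N [ 1 ]
  χ≈ z = cases (χ-spec z)
    where
    cases : _ → ιℤ (χ z) ≈ ιℤ z ^ N [ 1 ]
    cases (inj₁ (e , eq)) = ≈-trans (≈-reflexive (cong ιℤ eq)) (≈-sym (^N-zero z e))
    cases (inj₂ (inj₁ (e , eq))) = ≈-trans (≈-reflexive (cong ιℤ eq)) (≈-trans (≈-sym e) (≈-reflexive (ιℤ-^ z N)))
    cases (inj₂ (inj₂ (h , h′ , eq))) = ≈-trans (≈-reflexive (cong ιℤ eq)) (≈-trans (≈-sym (minus-one (z ℤ.^ N) (^N-square z h) h′)) (≈-reflexive (ιℤ-^ z N)))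

  O-ιℤ^ : ∀ z m → O (ιℤ z ^ m)
  O-ιℤ^ z m = O-^ m (O-ιℤ z)

  χ-unique : ∀ {z a} → Sign₃ a → ιℤ a ≈ ιℤ z ^ N [ 1 ] → χ z ≡ a
  χ-unique {z} sa e = sign-unique (χ-sign z) sa (≈-trans (χ≈ z) (≈-sym e))

  χ-cong : ∀ {x y} → ιℤ x ≈ ιℤ y [ 1 ] → χ x ≡ χ y
  χ-cong {x} {y} e = χ-unique {x} (χ-sign y) (≈-trans (χ≈ y) (≈-^ N {{O-ιℤ y}} {{O-ιℤ x}} (≈-sym e)))

  χ-* : ∀ x y → χ (x ℤ.* y) ≡ χ x ℤ.* χ y
  χ-* x y = χ-unique {x ℤ.* y} (Sign₃-* (χ-sign x) (χ-sign y)) (begin≈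
    ιℤ (χ x ℤ.* χ y) ≡≈⟨ ιℤ-* (χ x) (χ y) ⟩
    ιℤ (χ x) * ιℤ (χ y) ≈⟨ ≈-* {{O-ιℤ (χ x)}} {{O-ιℤ^ y N}} (χ≈ x) (χ≈ y) ⟩
    ιℤ x ^ N * ιℤ y ^ N ≡≈⟨ trans (sym (^-distrib-* (ιℤ x) (ιℤ y) N)) (cong (_^ N) (sym (ιℤ-* x y))) ⟩
    ιℤ (x ℤ.* y) ^ N ∎≈)
    where open ≈-Reasoning

  χ-neg : ∀ z → χ (ℤ.- z) ≡ χ z
  χ-neg z = χ-unique {ℤ.- z} (χ-sign z) (≈-trans (χ≈ z) (≈-reflexive (sym (trans (cong (_^ N) (ιℤ-neg z)) (even-power-neg (ιℤ z) n)))))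

  χ-1 : χ ℤ.1ℤ ≡ ℤ.1ℤ
  χ-1 = χ-unique {ℤ.1ℤ} plus (≈-reflexive (sym (1^ N)))

  unit-+ : ∀ {u} → p ∤ u → ¬ (ιℤ (ℤ.+ u) ≈ 0# [ 1 ])
  unit-+ {u} p∤u e = p∤u (≈0⇒∣ (ℤ.+ u) e)

  2-even-N : N < p-1
  2-even-N = subst (N <_) (sym p-1≡2N) (subst (λ m → m < 2 ℕ.* m) N-suc (ℕ.m<m+n (suc (ℕ.pred N)) (s≤s z≤n)))

  powersum-N≈0 : powersum N ≈ 0# [ 1 ]
  powersum-N≈0 = powersum≈0 N 2-even-N

  -- If u^N ≡ 1 held for every unit, `powersum N` would be -1, but it is 0.
  nonresidue : ∃ λ g → (p ∤ g) × χ (ℤ.+ g) ≡ ℤ.-1ℤ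
  nonresidue with ℕ.anyUpTo? (λ u → χ (ℤ.+ suc u) ℤ.≟ ℤ.-1ℤ) p-1
  ... | yes (u , u<p-1 , e) = suc u , p∤suc u<p-1 , e
  ... | no none = ⊥-elim (1≉0 (begin≈
      1# ≡≈⟨ solve 0 (κ 1 := ⊝ (⊝ κ 1)) refl ⟩
      - - 1# ≈⟨ ≈-neg (≈-trans (≈-sym (subst (λ m → powersum m ≈ - 1# [ 1 ]) N-suc (powersum-units (ℕ.pred N) λ u u<p-1 → subst (λ m → ι (suc u) ^ m ≈ 1# [ 1 ]) (sym N-suc) (all u u<p-1)))) powersum-N≈0) ⟩
      - 0# ≡≈⟨ solve 0 (⊝ κ 0 := κ 0) refl ⟩
      0# ∎≈))
    where
    open ≈-Reasoning
    all : ∀ u → u < p-1 → ι (suc u) ^ N ≈ 1# [ 1 ]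
    all u u<p-1 with χ-unit {ℤ.+ suc u} (unit-+ (p∤suc u<p-1))
    ... | inj₂ e = ⊥-elim (none (u , u<p-1 , e))
    ... | inj₁ e = ≈-sym (≈-trans (≈-reflexive (sym (cong ιℤ e))) (≈-trans (χ≈ (ℤ.+ suc u)) (≈-reflexive (cong (_^ N) (ιℤ-pos (suc u))))))

  -- Modulo p the number of square roots of z is 1 + z^N.
  square-root : ∀ z → χ z ≡ ℤ.1ℤ → ∃ λ c → c < p × ιℤ (ℤ.+ c ℤ.* ℤ.+ c) ≈ ιℤ z [ 1 ]
  square-root z χz≡1 with ℕ.anyUpTo? (λ c → ≈? (ℤ.+ c ℤ.* ℤ.+ c) z) p
  ... | yes found = found
  ... | no none = ⊥-elim (≉0 p∤2 (begin≈
      ι 2 ≡≈⟨ solve 0 (κ 2 := ⊝ (⊝ κ 1 :* κ 1 :+ ⊝ κ 1 :* κ 1)) refl ⟩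
      - (- 1# * 1# + - 1# * 1#) ≈⟨ ≈-neg (≈-trans (≈-sym (≈-trans expanded count)) all-units) ⟩
      - 0# ≡≈⟨ solve 0 (⊝ κ 0 := κ 0) refl ⟩
      0# ∎≈))
    where
    open ≈-Reasoning
    y = ιℤ z
    total : Carrier
    total = ∑ p (λ c → (ι c ^ 2 - y) ^ p-1)
    all-units : total ≈ 0# [ 1 ]
    all-units = begin≈
      total ≈⟨ ∑-≈ p (λ c c<p → ≈-trans (≈-reflexive (cong (_^ p-1) (sym (eq c)))) (fermat-ℤ (ℤ.+ c ℤ.* ℤ.+ c ℤ.- z) λ e → none (c , c<p , -≈0⇒≈ (≈-trans (≈-reflexive (sym (ιℤ-- (ℤ.+ c ℤ.* ℤ.+ c) z))) e)))) ⟩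
      ∑ p (λ _ → 1#) ≡≈⟨ trans (∑-const p 1#) (*-identityʳ _) ⟩
      ι p ≈⟨ p≈0 ⟩
      0# ∎≈
      where
      eq : ∀ c → ιℤ (ℤ.+ c ℤ.* ℤ.+ c ℤ.- z) ≡ ι c ^ 2 - y
      eq c = trans (ιℤ-- (ℤ.+ c ℤ.* ℤ.+ c) z) (cong (_- y) (trans (ιℤ-* (ℤ.+ c) (ℤ.+ c)) (trans (cong₂ _*_ (ιℤ-pos c) (ιℤ-pos c)) (cong (ι c *_) (sym (*-identityʳ _))))))
    term : ∀ c i → i < p → ι (p-1 C i) * ((ι c ^ 2) ^ i * (- y) ^ (p-1 ∸ i)) ≈ y ^ (p-1 ∸ i) * ι c ^ (2 ℕ.* i) [ 1 ]
    term c i i<p = begin≈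
      ι (p-1 C i) * ((ι c ^ 2) ^ i * (- y) ^ (p-1 ∸ i)) ≈⟨ ≈-*ʳ _ {{*-O (O-^ i (O-^ 2 (O-ι c))) (O-^ (p-1 ∸ i) (neg-O (O-ιℤ z)))}} ([p-1]C≈ i i<p) ⟩
      -1^ i * ((ι c ^ 2) ^ i * (- y) ^ (p-1 ∸ i)) ≡≈⟨ cong₂ (λ a b → -1^ i * (a * b)) (^-assocʳ (ι c) 2 i)
          (trans (cong (_^ (p-1 ∸ i)) (solve 1 (λ y → ⊝ y := ⊝ κ 1 :* y) refl y)) (trans (^-distrib-* (- 1#) y (p-1 ∸ i)) (cong (_* y ^ (p-1 ∸ i)) sign))) ⟩
      -1^ i * (ι c ^ (2 ℕ.* i) * (-1^ i * y ^ (p-1 ∸ i))) ≡≈⟨ solve 3 (λ e a b → e :* (a :* (e :* b)) := e :* e :* (b :* a)) refl (-1^ i) (ι c ^ (2 ℕ.* i)) (y ^ (p-1 ∸ i)) ⟩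
      -1^ i * -1^ i * (y ^ (p-1 ∸ i) * ι c ^ (2 ℕ.* i)) ≡≈⟨ trans (cong (_* (y ^ (p-1 ∸ i) * ι c ^ (2 ℕ.* i))) (-1^-square i)) (*-identityˡ _) ⟩
      y ^ (p-1 ∸ i) * ι c ^ (2 ℕ.* i) ∎≈
      where
      sign : -1^ (p-1 ∸ i) ≡ -1^ i
      sign = trans (-1^-∸ (ℕ.≤-pred (subst (i <_) (sym p≡1+p-1) i<p))) (trans (cong (_* -1^ i) (trans (cong -1^ p-1≡2N) (-1^-double N))) (*-identityˡ _))
    expanded : total ≈ ∑ p (λ i → y ^ (p-1 ∸ i) * powersum (2 ℕ.* i)) [ 1 ]
    expanded = begin≈
      total ≡≈⟨ ∑-cong p (λ c → trans (binomial-theorem p-1 (ι c ^ 2) (- y)) (cong (λ q → ∑ q (λ i → ι (p-1 C i) * ((ι c ^ 2) ^ i * (- y) ^ (p-1 ∸ i)))) p≡1+p-1)) ⟩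
      ∑ p (λ c → ∑ p (λ i → ι (p-1 C i) * ((ι c ^ 2) ^ i * (- y) ^ (p-1 ∸ i)))) ≈⟨ ∑-≈ p (λ c _ → ∑-≈ p (term c)) ⟩
      ∑ p (λ c → ∑ p (λ i → y ^ (p-1 ∸ i) * ι c ^ (2 ℕ.* i))) ≡≈⟨ trans (∑-swap p p _) (∑-cong p λ i → ∑-*ˡ p (y ^ (p-1 ∸ i)) _) ⟩
      ∑ p (λ i → y ^ (p-1 ∸ i) * powersum (2 ℕ.* i)) ∎≈
    -- For i < p the sum `powersum (2 ℕ.* i)` is -1 modulo p exactly when 2i is a positive multiple
    -- of p - 1, that is for i = N and i = p - 1.
    δ : ℕ → Carrier
    δ i with i ℕ.≟ N | i ℕ.≟ p-1
    ... | yes _ | _ = - 1#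
    ... | no _ | yes _ = - 1#
    ... | no _ | no _ = 0#
    δ-N : δ N ≡ - 1#
    δ-N with N ℕ.≟ N | N ℕ.≟ p-1
    ... | yes _ | _ = refl
    ... | no h | _ = ⊥-elim (h refl)
    δ-p-1 : δ p-1 ≡ - 1#
    δ-p-1 with p-1 ℕ.≟ N | p-1 ℕ.≟ p-1
    ... | yes _ | _ = refl
    ... | no _ | yes _ = refl
    ... | no _ | no h = ⊥-elim (h refl)
    δ-else : ∀ i → i ≢ N → i ≢ p-1 → δ i ≡ 0#
    δ-else i a b with i ℕ.≟ N | i ℕ.≟ p-1
    ... | yes e | _ = ⊥-elim (a e)
    ... | no _ | yes e = ⊥-elim (b e)
    ... | no _ | no _ = refl
    powersum-δ : ∀ i → i < p → powersum (2 ℕ.* i) ≈ δ i [ 1 ]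
    powersum-δ i i<p with i ℕ.≟ N | i ℕ.≟ p-1
    ... | yes refl | _ = subst (λ m → powersum m ≈ - 1# [ 1 ]) p-1≡2N powersum-top
    ... | no _ | yes refl = subst (λ m → powersum m ≈ - 1# [ 1 ]) (trans (cong (ℕ._+ p-1) p-1-suc) (cong (p-1 ℕ.+_) (sym (ℕ.+-identityʳ p-1)))) (≈-trans (powersum-period (ℕ.pred p-1)) (subst (λ m → powersum m ≈ - 1# [ 1 ]) (sym p-1-suc) powersum-top))
    ... | no i≢N | no i≢p-1 with ℕ.<-cmp i N
    ... | tri< i<N _ _ = powersum≈0 (2 ℕ.* i) (subst (2 ℕ.* i <_) (sym p-1≡2N) (ℕ.*-monoʳ-< 2 i<N))
    ... | tri≈ _ e _ = ⊥-elim (i≢N e)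
    ... | tri> _ _ N<i = subst (λ m → powersum m ≈ 0# [ 1 ]) shift (≈-trans (powersum-period (ℕ.pred e)) (subst (λ m → powersum m ≈ 0# [ 1 ]) (sym e-suc) (powersum≈0 e e<)))
      where
      e = 2 ℕ.* (i ∸ N)
      i-N>0 : 0 < i ∸ N
      i-N>0 = ℕ.m<n⇒0<n∸m N<i
      e-suc : suc (ℕ.pred e) ≡ e
      e-suc = ℕ.suc-pred e {{ℕ.>-nonZero (ℕ.*-monoʳ-< 2 i-N>0)}}
      i<p-1 : i < p-1
      i<p-1 = ℕ.≤∧≢⇒< (ℕ.≤-pred (subst (i <_) (sym p≡1+p-1) i<p)) i≢p-1
      e< : e < p-1
      e< = subst (e <_) (sym p-1≡2N) (ℕ.*-monoʳ-< 2 (ℕ.+-cancelʳ-< N (i ∸ N) N (subst₂ _<_ (sym (ℕ.m∸n+n≡m (ℕ.<⇒≤ N<i))) (trans p-1≡2N (cong (N ℕ.+_) (ℕ.+-identityʳ N))) i<p-1)))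
      shift : suc (ℕ.pred e) ℕ.+ p-1 ≡ 2 ℕ.* i
      shift = trans (cong₂ ℕ._+_ e-suc p-1≡2N) (trans (sym (ℕ.*-distribˡ-+ 2 (i ∸ N) N)) (cong (2 ℕ.*_) (ℕ.m∸n+n≡m (ℕ.<⇒≤ N<i))))
    y^N≈1 : y ^ N ≈ 1# [ 1 ]
    y^N≈1 = ≈-sym (≈-trans (≈-reflexive (cong ιℤ (sym χz≡1))) (χ≈ z))
    count : ∑ p (λ i → y ^ (p-1 ∸ i) * powersum (2 ℕ.* i)) ≈ - 1# * 1# + - 1# * 1# [ 1 ]
    count = begin≈
      ∑ p (λ i → y ^ (p-1 ∸ i) * powersum (2 ℕ.* i)) ≈⟨ ∑-≈ p (λ i i<p → ≈-*ˡ (y ^ (p-1 ∸ i)) {{O-ιℤ^ z (p-1 ∸ i)}} (powersum-δ i i<p)) ⟩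
      ∑ p (λ i → y ^ (p-1 ∸ i) * δ i) ≡≈⟨ ∑-pair p N p-1 2-even-N (subst (p-1 <_) p≡1+p-1 ℕ.≤-refl) (λ i _ a b → trans (cong (y ^ (p-1 ∸ i) *_) (δ-else i a b)) (zeroʳ _)) ⟩
      y ^ (p-1 ∸ N) * δ N + y ^ (p-1 ∸ p-1) * δ p-1 ≡≈⟨ cong₂ _+_ (trans (cong₂ (λ m d → y ^ m * d) p-1-N δ-N) (*-comm _ _)) (trans (cong₂ (λ m d → y ^ m * d) (ℕ.n∸n≡0 p-1) δ-p-1) (*-comm _ _)) ⟩
      - 1# * y ^ N + - 1# * 1# ≈⟨ ≈-+ (≈-*ˡ (- 1#) {{neg-O O-1}} y^N≈1) ≈-refl ⟩
      - 1# * 1# + - 1# * 1# ∎≈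
      where
      p-1-N : p-1 ∸ N ≡ N
      p-1-N = trans (cong (_∸ N) (trans p-1≡2N (cong (N ℕ.+_) (ℕ.+-identityʳ N)))) (ℕ.m+n∸m≡n N N)

  χ-multiply : ∀ c u (p∤c : p ∤ c) → χ (ℤ.+ Multiplication.multiply c p∤c u) ≡ χ (ℤ.+ c) ℤ.* χ (ℤ.+ u)
  χ-multiply c u p∤c = trans (χ-cong (≈-trans (≈-reflexive (ιℤ-pos (Multiplication.multiply c p∤c u))) (≈-trans (Multiplication.multiply≈ c p∤c u) (≈-reflexive (trans (sym (cong₂ _*_ (ιℤ-pos c) (ιℤ-pos u))) (sym (ιℤ-* (ℤ.+ c) (ℤ.+ u)))))))) (χ-* (ℤ.+ c) (ℤ.+ u))

  -- Multiplication by a nonresidue permutes the residues and changes the sign of the sum.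
  ∑χ≡0 : Z.∑ p (λ u → χ (ℤ.+ u)) ≡ ℤ.0ℤ
  ∑χ≡0 = negation-zero (begin
    Z.∑ p (λ u → χ (ℤ.+ u)) ≡⟨ sym (Z.∑-permute p _ multiply unmultiply multiply< unmultiply< multiply-unmultiply unmultiply-multiply) ⟩
    Z.∑ p (λ u → χ (ℤ.+ multiply u)) ≡⟨ Z.∑-cong p (λ u → trans (χ-multiply g u p∤g) (cong (ℤ._* χ (ℤ.+ u)) χg)) ⟩
    Z.∑ p (λ u → ℤ.-1ℤ ℤ.* χ (ℤ.+ u)) ≡⟨ Z.∑-*ˡ p ℤ.-1ℤ _ ⟩
    ℤ.-1ℤ ℤ.* Z.∑ p (λ u → χ (ℤ.+ u)) ≡⟨ ℤ.-1*i≡-i _ ⟩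
    ℤ.- Z.∑ p (λ u → χ (ℤ.+ u)) ∎)
    where
    g = proj₁ nonresidue
    p∤g = proj₁ (proj₂ nonresidue)
    χg = proj₂ (proj₂ nonresidue)
    open Multiplication g p∤g
    negation-zero : ∀ {x} → x ≡ ℤ.- x → x ≡ ℤ.0ℤ
    negation-zero {ℤ.+ zero} _ = refl
 

-- Wilson's theorem and the correlations of the Legendre symbol

module Jacobsthal (F : Field) (p : ℕ) (L : Localisation F p) (p-prime : Prime p) (3<p : 3 < p)
  (n : ℕ) (p≡4n+1 : p ≡ suc (4 ℕ.* n)) where
  open Legendre F p L p-prime 3<p n p≡4n+1 public
  open ≡-Reasoning

  -- Power sums of f look like those of a monic polynomial of degree d.
  Monic : ℕ → (ℕ → Carrier) → Set
  Monic d f = ∀ s → (s ℕ.+ d < p-1 → ∑ p (λ k → ι k ^ s * f k) ≈ 0# [ 1 ]) × (s ℕ.+ d ≡ p-1 → ∑ p (λ k → ι k ^ s * f k) ≈ - 1# [ 1 ])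

  monic-1 : Monic 0 (λ _ → 1#)
  monic-1 s = (λ h → ≈-trans (≈-reflexive eq) (powersum≈0 s (subst (_< p-1) (ℕ.+-identityʳ s) h))) ,
              (λ h → ≈-trans (≈-reflexive (trans eq (cong powersum (trans (sym (ℕ.+-identityʳ s)) h)))) powersum-top)
    where
    eq : ∑ p (λ k → ι k ^ s * 1#) ≡ powersum s
    eq = ∑-cong p λ k → *-identityʳ _

  monic-step : ∀ {d f} α → O α → Monic d f → Monic (suc d) (λ k → (ι k - α) * f k)
  monic-step {d} {f} α Oα m s = (λ h → begin≈
      ∑ p (λ k → ι k ^ s * ((ι k - α) * f k)) ≡≈⟨ expand ⟩
      S (suc s) - α * S s ≈⟨ ≈-- (proj₁ (m (suc s)) (shift h)) (≈-*ˡ α {{Oα}} (proj₁ (m s) (ℕ.<-trans (ℕ.n<1+n _) (shift h)))) ⟩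
      0# - α * 0# ≡≈⟨ solve 1 (λ a → κ 0 :- a :* κ 0 := κ 0) refl α ⟩
      0# ∎≈) , (λ h → begin≈
      ∑ p (λ k → ι k ^ s * ((ι k - α) * f k)) ≡≈⟨ expand ⟩
      S (suc s) - α * S s ≈⟨ ≈-- (proj₂ (m (suc s)) (trans (sym (ℕ.+-suc s d)) h)) (≈-*ˡ α {{Oα}} (proj₁ (m s) (subst (s ℕ.+ d <_) (trans (sym (ℕ.+-suc s d)) h) ℕ.≤-refl))) ⟩
      - 1# - α * 0# ≡≈⟨ solve 1 (λ a → ⊝ κ 1 :- a :* κ 0 := ⊝ κ 1) refl α ⟩
      - 1# ∎≈)
    where
    open ≈-Reasoning
    S : ℕ → Carrier
    S s = ∑ p (λ k → ι k ^ s * f k)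
    shift : s ℕ.+ suc d < p-1 → suc s ℕ.+ d < p-1
    shift = subst (_< p-1) (ℕ.+-suc s d)
    expand : ∑ p (λ k → ι k ^ s * ((ι k - α) * f k)) ≡ S (suc s) - α * S s
    expand = trans (∑-cong p λ k → solve 4 (λ e k a f → e :* ((k :- a) :* f) := k :* e :* f :- a :* (e :* f)) refl (ι k ^ s) (ι k) α (f k))
      (trans (∑-- p _ _) (cong (λ z → S (suc s) - z) (∑-*ˡ p α _)))

  monic-∏ : ∀ d (α : ℕ → Carrier) → (∀ i → O (α i)) → ∀ {e f} → Monic e f → Monic (d ℕ.+ e) (λ k → ∏ d (λ i → ι k - α i) * f k)
  monic-∏ zero α Oα m s = (λ h → subst (_≈ 0# [ 1 ]) (∑-cong p λ k → cong (ι k ^ s *_) (sym (*-identityˡ _))) (proj₁ (m s) h)) ,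
                          (λ h → subst (_≈ - 1# [ 1 ]) (∑-cong p λ k → cong (ι k ^ s *_) (sym (*-identityˡ _))) (proj₂ (m s) h))
  monic-∏ (suc d) α Oα {e} {f} m s = (λ h → subst (_≈ 0# [ 1 ]) eq (proj₁ (step s) h)) , (λ h → subst (_≈ - 1# [ 1 ]) eq (proj₂ (step s) h))
    where
    step = monic-step (α d) (Oα d) (monic-∏ d α Oα m)
    eq = ∑-cong p λ k → cong (ι k ^ s *_) (solve 3 (λ x y z → x :* (y :* z) := y :* x :* z) refl (ι k - α d) (∏ d (λ i → ι k - α i)) (f k))

  monic-sum : ∀ {f} → Monic p-1 f → ∑ p f ≈ - 1# [ 1 ]
  monic-sum {f} m = subst (_≈ - 1# [ 1 ]) (∑-cong p λ k → *-identityˡ _) (proj₂ (m 0) refl)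

  -- Evaluate Σ_k (k - 1) ⋯ (k - (p - 1)), whose only nonzero term is k = 0.
  wilson : factorial p-1 ≈ - 1# [ 1 ]
  wilson = ≈-trans (≈-reflexive (sym only-0)) (subst (λ d → Monic d f → ∑ p f ≈ - 1# [ 1 ]) (sym (ℕ.+-identityʳ p-1)) monic-sum (monic-∏ p-1 (λ i → ι (suc i)) (λ i → O-ι (suc i)) monic-1))
    where
    f : ℕ → Carrier
    f k = ∏ p-1 (λ i → ι k - ι (suc i)) * 1#
    only-0 : ∑ p f ≡ factorial p-1
    only-0 = begin
      ∑ p f ≡⟨ ∑-single p 0 (ℕ.<-trans (s≤s z≤n) 3<p) vanish ⟩
      ∏ p-1 (λ i → 0# - ι (suc i)) * 1# ≡⟨ trans (*-identityʳ _) (∏-cong p-1 λ i → solve 1 (λ x → κ 0 :- x := ⊝ κ 1 :* x) refl (ι (suc i))) ⟩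
      ∏ p-1 (λ i → - 1# * ι (suc i)) ≡⟨ ∏-*ˡ p-1 (- 1#) _ ⟩
      -1^ p-1 * factorial p-1 ≡⟨ cong (_* factorial p-1) (trans (cong -1^ p-1≡2N) (-1^-double N)) ⟩
      1# * factorial p-1 ≡⟨ *-identityˡ _ ⟩
      factorial p-1 ∎
      where
      vanish : ∀ i → i < p → i ≢ 0 → f i ≡ 0#
      vanish zero _ h = ⊥-elim (h refl)
      vanish (suc i) i<p _ = trans (*-identityʳ _) (∏-zero p-1 i (ℕ.≤-pred (subst (suc i <_) (sym p≡1+p-1) i<p)) (-‿inverseʳ _))

  open BigOp ℕ.+-0-isCommutativeMonoid using () renaming (big to ∑ℕ)

  ∑ℕ-≤ : ∀ m f c → (∀ i → f i ≤ c) → ∑ℕ m f ≤ m ℕ.* c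
  ∑ℕ-≤ zero f c h = z≤n
  ∑ℕ-≤ (suc m) f c h = subst (∑ℕ m f ℕ.+ f m ≤_) (ℕ.+-comm (m ℕ.* c) c) (ℕ.+-mono-≤ (∑ℕ-≤ m f c h) (h m))

  ≤-∑ℕ : ∀ m f j → j < m → f j ≤ ∑ℕ m f
  ≤-∑ℕ (suc m) f j j<m with ℕ.m≤n⇒m<n∨m≡n (ℕ.≤-pred j<m)
  ... | inj₁ j<m′ = ℕ.≤-trans (≤-∑ℕ m f j j<m′) (ℕ.m≤m+n _ (f m))
  ... | inj₂ refl = ℕ.m≤n+m (f m) _

  pair-≤-∑ℕ : ∀ m f j k → j < k → k < m → f j ℕ.+ f k ≤ ∑ℕ m f
  pair-≤-∑ℕ (suc m) f j k j<k k<m with ℕ.m≤n⇒m<n∨m≡n (ℕ.≤-pred k<m)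
  ... | inj₁ k<m′ = ℕ.≤-trans (pair-≤-∑ℕ m f j k j<k k<m′) (ℕ.m≤m+n _ (f m))
  ... | inj₂ refl = ℕ.+-monoˡ-≤ (f k) (≤-∑ℕ m f j j<k)

  -- Sums of these natural numbers can be bounded from both sides, which turns a value known modulo
  -- p into an exact one.
  deficit : ℤ → ℕ
  deficit e = ℤ.∣ ℤ.1ℤ ℤ.- e ∣

  deficit-eq : ∀ {e} → Sign₃ e → ℤ.+ deficit e ≡ ℤ.1ℤ ℤ.- e
  deficit-eq null = refl
  deficit-eq plus = refl
  deficit-eq minus = refl

  deficit-≤ : ∀ {e} → Sign₃ e → deficit e ≤ 2
  deficit-≤ null = s≤s z≤n
  deficit-≤ plus = z≤n
  deficit-≤ minus = s≤s (s≤s z≤n)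

  ∑-deficit : ∀ m f → (∀ i → Sign₃ (f i)) → ℤ.+ ∑ℕ m (λ i → deficit (f i)) ≡ ℤ.+ m ℤ.- Z.∑ m f
  ∑-deficit zero f h = refl
  ∑-deficit (suc m) f h = trans (cong₂ ℤ._+_ (∑-deficit m f h) (deficit-eq (h m)))
    (Z.solve 3 (λ m s x → m Z.:- s Z.:+ (Z.κ 1 Z.:- x) Z.:= Z.κ 1 Z.:+ m Z.:- (s Z.:+ x)) refl (ℤ.+ m) (Z.∑ m f) (f m))

  V : ℤ → ℤ → ℤ
  V a b = Z.∑ p (λ k → χ (a ℤ.- ℤ.+ k) ℤ.* χ (b ℤ.- ℤ.+ k))

  ιℤ-sub : ∀ a k → ιℤ (a ℤ.- ℤ.+ k) ≡ ιℤ a - ι k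
  ιℤ-sub a k = trans (ιℤ-- a (ℤ.+ k)) (cong (λ x → ιℤ a - x) (ιℤ-pos k))

  -- By Euler's criterion the summand is (k - a)^N (k - b)^N, monic of degree 2N = p - 1 in k.
  V≈-1 : ∀ a b → ιℤ (V a b) ≈ - 1# [ 1 ]
  V≈-1 a b = begin≈
    ιℤ (V a b) ≡≈⟨ ιℤ-∑ p _ ⟩
    ∑ p (λ k → ιℤ (χ (a ℤ.- ℤ.+ k) ℤ.* χ (b ℤ.- ℤ.+ k))) ≈⟨ ∑-≈ p (λ k _ → term k) ⟩
    ∑ p f ≈⟨ monic-sum (subst (λ d → Monic d f) degree (monic-∏ N (λ _ → ιℤ b) (λ _ → O-ιℤ b) (monic-∏ N (λ _ → ιℤ a) (λ _ → O-ιℤ a) monic-1))) ⟩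
    - 1# ∎≈
    where
    open ≈-Reasoning
    degree : N ℕ.+ (N ℕ.+ 0) ≡ p-1
    degree = sym p-1≡2N
    f : ℕ → Carrier
    f k = ∏ N (λ _ → ι k - ιℤ b) * (∏ N (λ _ → ι k - ιℤ a) * 1#)
    flip : ∀ a k → ιℤ (a ℤ.- ℤ.+ k) ^ N ≡ ∏ N (λ _ → ι k - ιℤ a)
    flip a k = trans (cong (_^ N) (trans (ιℤ-sub a k) (solve 2 (λ a k → a :- k := ⊝ (k :- a)) refl (ιℤ a) (ι k)))) (trans (even-power-neg (ι k - ιℤ a) n) (sym (∏-const N _)))
    term : ∀ k → ιℤ (χ (a ℤ.- ℤ.+ k) ℤ.* χ (b ℤ.- ℤ.+ k)) ≈ f k [ 1 ]
    term k = begin≈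
      ιℤ (χ (a ℤ.- ℤ.+ k) ℤ.* χ (b ℤ.- ℤ.+ k)) ≡≈⟨ ιℤ-* (χ (a ℤ.- ℤ.+ k)) _ ⟩
      ιℤ (χ (a ℤ.- ℤ.+ k)) * ιℤ (χ (b ℤ.- ℤ.+ k)) ≈⟨ ≈-* {{O-ιℤ (χ (a ℤ.- ℤ.+ k))}} {{O-ιℤ^ (b ℤ.- ℤ.+ k) N}} (χ≈ (a ℤ.- ℤ.+ k)) (χ≈ (b ℤ.- ℤ.+ k)) ⟩
      ιℤ (a ℤ.- ℤ.+ k) ^ N * ιℤ (b ℤ.- ℤ.+ k) ^ N ≡≈⟨ cong₂ _*_ (flip a k) (flip b k) ⟩
      ∏ N (λ _ → ι k - ιℤ a) * ∏ N (λ _ → ι k - ιℤ b) ≡≈⟨ solve 2 (λ x y → x :* y := y :* (x :* κ 1)) refl _ _ ⟩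
      f k ∎≈

  open import Data.Nat.DivMod using (_%_; m%n<n)

  sub≈0 : ∀ A {k} → k ≡ A % p → ιℤ (ℤ.+ A ℤ.- ℤ.+ k) ≈ 0# [ 1 ]
  sub≈0 A {k} refl = ≈-trans (≈-reflexive (trans (ιℤ-sub (ℤ.+ A) k) (cong (_- ι k) (ιℤ-pos A)))) (≈⇒-≈0 (≈-sym (%≈ A)))

  sub≉0 : ∀ A {k} → k < p → k ≢ A % p → ¬ (ιℤ (ℤ.+ A ℤ.- ℤ.+ k) ≈ 0# [ 1 ])
  sub≉0 A {k} k<p k≢ e = k≢ (residue-unique k<p (m%n<n A p) (≈-sym (≈-trans (%≈ A) (-≈0⇒≈ (≈-trans (≈-reflexive (sym (trans (ιℤ-sub (ℤ.+ A) k) (cong (_- ι k) (ιℤ-pos A))))) e)))))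

  V-equal : ∀ A B → ι A ≈ ι B [ 1 ] → V (ℤ.+ A) (ℤ.+ B) ≡ ℤ.+ p ℤ.- ℤ.1ℤ
  V-equal A B e = trans (Z.solve 2 (λ v q → v Z.:= q Z.:- (q Z.:- v)) refl (V (ℤ.+ A) (ℤ.+ B)) (ℤ.+ p))
    (cong (λ z → ℤ.+ p ℤ.- z) (trans (sym (cong₂ ℤ._-_ (trans (Z.∑-const p ℤ.1ℤ) (trans (ℤ.*-identityʳ (Z.ι p)) (Z-ι p))) refl)) (trans (sym (Z.∑-- p (λ _ → ℤ.1ℤ) _))
      (trans (Z.∑-single p (A % p) (m%n<n A p) others) at))))
    where
    f : ℕ → ℤ
    f k = ℤ.1ℤ ℤ.- χ (ℤ.+ A ℤ.- ℤ.+ k) ℤ.* χ (ℤ.+ B ℤ.- ℤ.+ k)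
    same : ∀ k → χ (ℤ.+ B ℤ.- ℤ.+ k) ≡ χ (ℤ.+ A ℤ.- ℤ.+ k)
    same k = χ-cong (≈-trans (≈-reflexive (trans (ιℤ-sub (ℤ.+ B) k) (cong (_- ι k) (ιℤ-pos B)))) (≈-trans (≈-- (≈-sym e) ≈-refl) (≈-reflexive (sym (trans (ιℤ-sub (ℤ.+ A) k) (cong (_- ι k) (ιℤ-pos A)))))))
    at : f (A % p) ≡ ℤ.1ℤ
    at = cong (λ z → ℤ.1ℤ ℤ.- z ℤ.* χ (ℤ.+ B ℤ.- ℤ.+ (A % p))) (χ-zero (sub≈0 A refl))
    others : ∀ k → k < p → k ≢ A % p → f k ≡ ℤ.0ℤ
    others k k<p k≢ = cong (λ z → ℤ.1ℤ ℤ.- z) (trans (cong (χ (ℤ.+ A ℤ.- ℤ.+ k) ℤ.*_) (same k)) (χ-square {ℤ.+ A ℤ.- ℤ.+ k} (sub≉0 A k<p k≢)))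

  -- The total deficit D = p - V is 1 modulo p. It is at least 2, as χ vanishes at two different
  -- residues, and at most 2p. So D - 1 is a positive multiple of p below 2p, and D = p + 1.
  V-distinct : ∀ A B → ¬ (ι A ≈ ι B [ 1 ]) → V (ℤ.+ A) (ℤ.+ B) ≡ ℤ.-1ℤ
  V-distinct A B A≉B = begin
    V (ℤ.+ A) (ℤ.+ B) ≡⟨ Z.solve 2 (λ v q → v Z.:= q Z.:- (q Z.:- v)) refl (V (ℤ.+ A) (ℤ.+ B)) (ℤ.+ p) ⟩
    ℤ.+ p ℤ.- (ℤ.+ p ℤ.- V (ℤ.+ A) (ℤ.+ B)) ≡⟨ cong (λ z → ℤ.+ p ℤ.- z) (trans (sym D-eq) (cong ℤ.+_ D≡)) ⟩
    ℤ.+ p ℤ.- ℤ.+ suc p ≡⟨ Z.solve 1 (λ q → q Z.:- (Z.κ 1 Z.:+ q) Z.:= Z.⊝ Z.κ 1) refl (ℤ.+ p) ⟩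
    ℤ.-1ℤ ∎
    where
    f : ℕ → ℤ
    f k = χ (ℤ.+ A ℤ.- ℤ.+ k) ℤ.* χ (ℤ.+ B ℤ.- ℤ.+ k)
    f-sign : ∀ k → Sign₃ (f k)
    f-sign k = Sign₃-* (χ-sign (ℤ.+ A ℤ.- ℤ.+ k)) (χ-sign (ℤ.+ B ℤ.- ℤ.+ k))
    g : ℕ → ℕ
    g k = deficit (f k)
    D = ∑ℕ p g
    D-eq : ℤ.+ D ≡ ℤ.+ p ℤ.- V (ℤ.+ A) (ℤ.+ B)
    D-eq = ∑-deficit p f f-sign
    a = A % p
    b = B % p
    a≢b : a ≢ b
    a≢b e = A≉B (≈-trans (≈-sym (%≈ A)) (≈-trans (≈-reflexive (cong ι e)) (%≈ B)))
    g-a : g a ≡ 1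
    g-a = cong deficit (cong (ℤ._* χ (ℤ.+ B ℤ.- ℤ.+ a)) (χ-zero (sub≈0 A refl)))
    g-b : g b ≡ 1
    g-b = cong deficit (trans (cong (χ (ℤ.+ A ℤ.- ℤ.+ b) ℤ.*_) (χ-zero (sub≈0 B refl))) (ℤ.*-zeroʳ (χ (ℤ.+ A ℤ.- ℤ.+ b))))
    2≤D : 2 ≤ D
    2≤D with ℕ.<-cmp a b
    ... | tri< a<b _ _ = subst (_≤ D) (cong₂ ℕ._+_ g-a g-b) (pair-≤-∑ℕ p g a b a<b (m%n<n B p))
    ... | tri≈ _ e _ = ⊥-elim (a≢b e)
    ... | tri> _ _ b<a = subst (_≤ D) (cong₂ ℕ._+_ g-b g-a) (pair-≤-∑ℕ p g b a b<a (m%n<n A p))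
    D≤2p : D ≤ p ℕ.* 2
    D≤2p = ∑ℕ-≤ p g 2 (λ k → deficit-≤ (f-sign k))
    D≈1 : ι D ≈ 1# [ 1 ]
    D≈1 = begin≈
      ι D ≡≈⟨ trans (sym (ιℤ-pos D)) (trans (cong ιℤ D-eq) (trans (ιℤ-- (ℤ.+ p) (V (ℤ.+ A) (ℤ.+ B))) (cong (_- ιℤ (V (ℤ.+ A) (ℤ.+ B))) (ιℤ-pos p)))) ⟩
      ι p - ιℤ (V (ℤ.+ A) (ℤ.+ B)) ≈⟨ ≈-- p≈0 (V≈-1 (ℤ.+ A) (ℤ.+ B)) ⟩
      0# - - 1# ≡≈⟨ solve 0 (κ 0 :- ⊝ κ 1 := κ 1) refl ⟩
      1# ∎≈
      where open ≈-Reasoning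
    p∣D-1 : p ∣ D ∸ 1
    p∣D-1 = ≈0⇒∣ (ℤ.+ (D ∸ 1)) (≈-trans (≈-reflexive (trans (ιℤ-pos (D ∸ 1)) (trans (ι-∸ (ℕ.≤-trans (s≤s z≤n) 2≤D)) (cong (λ z → ι D - z) (+-identityʳ 1#))))) (≈⇒-≈0 D≈1))
    D≡ : D ≡ suc p
    D≡ = trans (sym (ℕ.m+[n∸m]≡n {1} {D} (ℕ.≤-trans (s≤s z≤n) 2≤D))) (cong suc (quotient p∣D-1))
      where
      quotient : p ∣ D ∸ 1 → D ∸ 1 ≡ p
      quotient (divides zero e) = ⊥-elim (ℕ.<⇒≱ 2≤D (ℕ.m∸n≡0⇒m≤n e))
      quotient (divides (suc zero) e) = trans e (ℕ.*-identityˡ p)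
      quotient (divides (suc (suc q)) e) = ⊥-elim (ℕ.<⇒≱ {D ∸ 1} {p ℕ.* 2}
        (ℕ.<-≤-trans (ℕ.∸-monoʳ-< {D} {1} {0} (s≤s z≤n) (ℕ.≤-trans (s≤s z≤n) 2≤D)) D≤2p)
        (subst (p ℕ.* 2 ≤_) (sym e) (subst (_≤ suc (suc q) ℕ.* p) (ℕ.*-comm 2 p) (ℕ.*-monoˡ-≤ p {2} {suc (suc q)} (s≤s (s≤s z≤n))))))
 

-- The second moment of the Jacobsthal sums

module SecondMoment (F : Field) (p : ℕ) (L : Localisation F p) (p-prime : Prime p) (3<p : 3 < p)
  (n : ℕ) (p≡4n+1 : p ≡ suc (4 ℕ.* n)) where
  open Jacobsthal F p L p-prime 3<p n p≡4n+1 public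
  open ≡-Reasoning

  sq : ℕ → ℤ
  sq u = ℤ.+ u ℤ.* ℤ.+ u

  J : ℤ → ℤ
  J k = Z.∑ p (λ u → χ (ℤ.+ u) ℤ.* χ (sq u ℤ.- k))

  ιsq : ∀ u → ιℤ (sq u) ≡ ι u * ι u
  ιsq u = trans (ιℤ-* (ℤ.+ u) (ℤ.+ u)) (cong₂ _*_ (ιℤ-pos u) (ιℤ-pos u))

  J-cong : ∀ {k l} → ιℤ k ≈ ιℤ l [ 1 ] → J k ≡ J l
  J-cong {k} {l} e = Z.∑-cong p λ u → cong (χ (ℤ.+ u) ℤ.*_) (χ-cong (≈-trans (≈-reflexive (ιℤ-- (sq u) k)) (≈-trans (≈-- ≈-refl e) (≈-reflexive (sym (ιℤ-- (sq u) l))))))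

  -- Substitute cu for u: the square c² leaves the second symbol without a trace, and χ(c) remains
  -- from the first.
  J-scale : ∀ c k → p ∤ c → J (sq c ℤ.* k) ≡ χ (ℤ.+ c) ℤ.* J k
  J-scale c k p∤c = begin
    J (sq c ℤ.* k) ≡⟨ sym (Z.∑-permute p _ multiply unmultiply multiply< unmultiply< multiply-unmultiply unmultiply-multiply) ⟩
    Z.∑ p (λ u → χ (ℤ.+ multiply u) ℤ.* χ (sq (multiply u) ℤ.- sq c ℤ.* k)) ≡⟨ Z.∑-cong p (λ u → trans (cong₂ ℤ._*_ (χ-multiply c u p∤c) (second u)) (regroup (χ (ℤ.+ u)) (χ (sq u ℤ.- k)))) ⟩
    Z.∑ p (λ u → χ (ℤ.+ c) ℤ.* (χ (ℤ.+ u) ℤ.* χ (sq u ℤ.- k))) ≡⟨ Z.∑-*ˡ p (χ (ℤ.+ c)) _ ⟩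
    χ (ℤ.+ c) ℤ.* J k ∎
    where
    open Multiplication c p∤c
    second : ∀ u → χ (sq (multiply u) ℤ.- sq c ℤ.* k) ≡ χ (ℤ.+ c) ℤ.* χ (ℤ.+ c) ℤ.* χ (sq u ℤ.- k)
    second u = trans (χ-cong {y = sq c ℤ.* (sq u ℤ.- k)} (begin≈
        ιℤ (sq (multiply u) ℤ.- sq c ℤ.* k) ≡≈⟨ trans (ιℤ-- (sq (multiply u)) (sq c ℤ.* k)) (cong₂ _-_ (ιsq (multiply u)) (ιℤ-* (sq c) k)) ⟩
        ι (multiply u) * ι (multiply u) - ιℤ (sq c) * ιℤ k ≈⟨ ≈-- (≈-* {{O-ι (multiply u)}} {{*-O (O-ι c) (O-ι u)}} (multiply≈ u) (multiply≈ u)) ≈-refl ⟩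
        ι c * ι u * (ι c * ι u) - ιℤ (sq c) * ιℤ k ≡≈⟨ cong (λ x → ι c * ι u * (ι c * ι u) - x * ιℤ k) (ιsq c) ⟩
        ι c * ι u * (ι c * ι u) - ι c * ι c * ιℤ k ≡≈⟨ solve 3 (λ c u k → c :* u :* (c :* u) :- c :* c :* k := c :* c :* (u :* u :- k)) refl (ι c) (ι u) (ιℤ k) ⟩
        ι c * ι c * (ι u * ι u - ιℤ k) ≡≈⟨ sym (trans (ιℤ-* (sq c) (sq u ℤ.- k)) (cong₂ _*_ (ιsq c) (trans (ιℤ-- (sq u) k) (cong (_- ιℤ k) (ιsq u))))) ⟩
        ιℤ (sq c ℤ.* (sq u ℤ.- k)) ∎≈))
      (trans (χ-* (sq c) (sq u ℤ.- k)) (cong (ℤ._* χ (sq u ℤ.- k)) (χ-* (ℤ.+ c) (ℤ.+ c))))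
      where open ≈-Reasoning
    regroup : ∀ x y → χ (ℤ.+ c) ℤ.* x ℤ.* (χ (ℤ.+ c) ℤ.* χ (ℤ.+ c) ℤ.* y) ≡ χ (ℤ.+ c) ℤ.* (x ℤ.* y)
    regroup x y = trans (cong (λ z → χ (ℤ.+ c) ℤ.* x ℤ.* (z ℤ.* y)) (χ-square {ℤ.+ c} (unit-+ p∤c))) (Z.solve 3 (λ c x y → c Z.:* x Z.:* (Z.κ 1 Z.:* y) Z.:= c Z.:* (x Z.:* y)) refl (χ (ℤ.+ c)) x y)

  J² : ℤ → ℤ
  J² k = J k ℤ.* J k

  J²-scale : ∀ c k → p ∤ c → J² (sq c ℤ.* k) ≡ J² k
  J²-scale c k p∤c = trans (cong (λ z → z ℤ.* z) (J-scale c k p∤c)) (trans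
    (Z.solve 2 (λ c j → c Z.:* j Z.:* (c Z.:* j) Z.:= c Z.:* c Z.:* (j Z.:* j)) refl (χ (ℤ.+ c)) (J k))
    (trans (cong (ℤ._* J² k) (χ-square {ℤ.+ c} (unit-+ p∤c))) (ℤ.*-identityˡ (J² k))))

  root-unit : ∀ {c z} → ιℤ (sq c) ≈ ιℤ z [ 1 ] → ¬ (ιℤ z ≈ 0# [ 1 ]) → p ∤ c
  root-unit {c} e h d = h (≈-trans (≈-sym e) (≈-trans (≈-reflexive (ιsq c)) (≈0-*ʳ (ι c) {{O-ι c}} (≈-trans (≈-reflexive (sym (ιℤ-pos c))) (∣⇒≈0 (ℤ.+ c) d)))))

  g : ℕ
  g = proj₁ nonresidue

  p∤g : p ∤ g
  p∤g = proj₁ (proj₂ nonresidue)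

  χg : χ (ℤ.+ g) ≡ ℤ.-1ℤ
  χg = proj₂ (proj₂ nonresidue)

  J²-residue : ∀ k → ¬ (ιℤ k ≈ 0# [ 1 ]) → χ k ≡ ℤ.1ℤ → J² k ≡ J² ℤ.1ℤ
  J²-residue k h χk = conclude (square-root k χk)
    where
    conclude : ∃ (λ c → c < p × ιℤ (sq c) ≈ ιℤ k [ 1 ]) → J² k ≡ J² ℤ.1ℤ
    conclude (c , _ , e) = trans (cong (λ z → z ℤ.* z) (J-cong (≈-trans (≈-sym e) (≈-reflexive (cong ιℤ (sym (ℤ.*-identityʳ (sq c)))))))) (J²-scale c ℤ.1ℤ (root-unit {c} {k} e h))

  -- The product gk is a residue c², so k ≡ (c/g)² g and `J²-scale` applies.
  J²-nonresidue : ∀ k → ¬ (ιℤ k ≈ 0# [ 1 ]) → χ k ≡ ℤ.-1ℤ → J² k ≡ J² (ℤ.+ g)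
  J²-nonresidue k h χk = conclude (square-root (ℤ.+ g ℤ.* k) (trans (χ-* (ℤ.+ g) k) (cong₂ ℤ._*_ χg χk)))
    where
    conclude : ∃ (λ c → c < p × ιℤ (sq c) ≈ ιℤ (ℤ.+ g ℤ.* k) [ 1 ]) → J² k ≡ J² (ℤ.+ g)
    conclude (c , _ , e) = trans (cong (λ z → z ℤ.* z) (J-cong {k} {sq d ℤ.* ℤ.+ g} k≈)) (J²-scale d (ℤ.+ g) p∤d)
      where
      open ≈-Reasoning
      i = inverse g
      d = i ℕ.* c
      k≈ : ιℤ k ≈ ιℤ (sq d ℤ.* ℤ.+ g) [ 1 ]
      k≈ = begin≈
        ιℤ k ≡≈⟨ sym (trans (*-identityˡ _) (*-identityˡ _)) ⟩
        1# * (1# * ιℤ k) ≈⟨ ≈-* {{O-1}} {{*-O (*-O (O-ι g) (O-ι i)) (O-ιℤ k)}} (≈-sym (inverse≈ p∤g)) (≈-*ʳ (ιℤ k) {{O-ιℤ k}} (≈-sym (inverse≈ p∤g))) ⟩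
        ι g * ι i * (ι g * ι i * ιℤ k) ≡≈⟨ trans (solve 3 (λ g i k → g :* i :* (g :* i :* k) := i :* i :* g :* (g :* k)) refl (ι g) (ι i) (ιℤ k)) (cong (λ x → ι i * ι i * ι g * x) (sym (trans (ιℤ-* (ℤ.+ g) k) (cong (_* ιℤ k) (ιℤ-pos g))))) ⟩
        ι i * ι i * ι g * ιℤ (ℤ.+ g ℤ.* k) ≈⟨ ≈-*ˡ (ι i * ι i * ι g) {{*-O (*-O (O-ι i) (O-ι i)) (O-ι g)}} (≈-sym e) ⟩
        ι i * ι i * ι g * ιℤ (sq c) ≡≈⟨ trans (cong (ι i * ι i * ι g *_) (ιsq c)) (solve 3 (λ i g c → i :* i :* g :* (c :* c) := i :* c :* (i :* c) :* g) refl (ι i) (ι g) (ι c)) ⟩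
        ι i * ι c * (ι i * ι c) * ι g ≡≈⟨ sym (trans (ιℤ-* (sq d) (ℤ.+ g)) (cong₂ _*_ (trans (ιsq d) (cong (λ x → x * x) (ι-* i c))) (ιℤ-pos g))) ⟩
        ιℤ (sq d ℤ.* ℤ.+ g) ∎≈
      p∤d : p ∤ d
      p∤d e′ = h (≈-trans k≈ (≈-trans (≈-reflexive (trans (ιℤ-* (sq d) (ℤ.+ g)) (trans (cong (_* ιℤ (ℤ.+ g)) (ιsq d)) (*-assoc _ _ _)))) (≈0-*ʳ (ι d * ιℤ (ℤ.+ g)) {{*-O (O-ι d) (O-ιℤ (ℤ.+ g))}} (≈-trans (≈-reflexive (sym (ιℤ-pos d))) (∣⇒≈0 (ℤ.+ d) e′)))))

  average-plus : ∀ a b → ℤ.+ 2 ℤ.* a ≡ (a ℤ.+ b) ℤ.+ ℤ.1ℤ ℤ.* (a ℤ.- b)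
  average-plus = Z.solve 2 (λ a b → Z.κ 2 Z.:* a Z.:= a Z.:+ b Z.:+ Z.κ 1 Z.:* (a Z.:- b)) refl

  average-minus : ∀ a b → ℤ.+ 2 ℤ.* b ≡ (a ℤ.+ b) ℤ.+ ℤ.-1ℤ ℤ.* (a ℤ.- b)
  average-minus = Z.solve 2 (λ a b → Z.κ 2 Z.:* b Z.:= a Z.:+ b Z.:+ (Z.⊝ Z.κ 1) Z.:* (a Z.:- b)) refl

  -- One formula, linear in χ(k), covers both classes. Summing it over k takes only Σ χ = 0 and no
  -- count of the residues.
  J²-average : ∀ k → ¬ (ιℤ k ≈ 0# [ 1 ]) → ℤ.+ 2 ℤ.* J² k ≡ (J² ℤ.1ℤ ℤ.+ J² (ℤ.+ g)) ℤ.+ χ k ℤ.* (J² ℤ.1ℤ ℤ.- J² (ℤ.+ g))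
  J²-average k h = conclude (χ-unit {k} h)
    where
    a = J² ℤ.1ℤ
    b = J² (ℤ.+ g)
    conclude : χ k ≡ ℤ.1ℤ ⊎ χ k ≡ ℤ.-1ℤ → ℤ.+ 2 ℤ.* J² k ≡ (a ℤ.+ b) ℤ.+ χ k ℤ.* (a ℤ.- b)
    conclude (inj₁ e) = trans (cong (ℤ.+ 2 ℤ.*_) (J²-residue k h e)) (trans (average-plus a b) (cong (λ z → (a ℤ.+ b) ℤ.+ z ℤ.* (a ℤ.- b)) (sym e)))
    conclude (inj₂ e) = trans (cong (ℤ.+ 2 ℤ.*_) (J²-nonresidue k h e)) (trans (average-minus a b) (cong (λ z → (a ℤ.+ b) ℤ.+ z ℤ.* (a ℤ.- b)) (sym e)))

  Z∑-first : ∀ f → Z.∑ p f ≡ f 0 ℤ.+ Z.∑ p-1 (λ u → f (suc u))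
  Z∑-first f = trans (cong (λ q → Z.∑ q f) (sym p≡1+p-1)) (Z.∑-first p-1 f)

  χ0 : χ ℤ.0ℤ ≡ ℤ.0ℤ
  χ0 = χ-zero {ℤ.0ℤ} ≈-refl

  ∑χ-units≡0 : Z.∑ p-1 (λ u → χ (ℤ.+ suc u)) ≡ ℤ.0ℤ
  ∑χ-units≡0 = trans (sym (ℤ.+-identityˡ _)) (trans (cong (ℤ._+ Z.∑ p-1 (λ u → χ (ℤ.+ suc u))) (sym χ0)) (trans (sym (Z∑-first (λ u → χ (ℤ.+ u)))) ∑χ≡0))

  J-0 : J ℤ.0ℤ ≡ ℤ.0ℤ
  J-0 = trans (Z.∑-cong p λ u → trans (cong (χ (ℤ.+ u) ℤ.*_) (trans (cong χ (ℤ.+-identityʳ (sq u))) (χ-* (ℤ.+ u) (ℤ.+ u)))) (cube (χ-sign (ℤ.+ u)))) ∑χ≡0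
    where
    cube : ∀ {e} → Sign₃ e → e ℤ.* (e ℤ.* e) ≡ e
    cube null = refl
    cube plus = refl
    cube minus = refl

  unit-suc : ∀ {u} → u < p-1 → ¬ (ιℤ (ℤ.+ suc u) ≈ 0# [ 1 ])
  unit-suc u<p-1 = unit-+ (p∤suc u<p-1)

  second-moment-classes : ℤ.+ 2 ℤ.* Z.∑ p (λ k → J² (ℤ.+ k)) ≡ ℤ.+ p-1 ℤ.* (J² ℤ.1ℤ ℤ.+ J² (ℤ.+ g))
  second-moment-classes = begin
    ℤ.+ 2 ℤ.* Z.∑ p (λ k → J² (ℤ.+ k)) ≡⟨ cong (ℤ.+ 2 ℤ.*_) (trans (Z∑-first (λ k → J² (ℤ.+ k))) (trans (cong (λ z → z ℤ.* z ℤ.+ Z.∑ p-1 (λ k → J² (ℤ.+ suc k))) J-0) (ℤ.+-identityˡ _))) ⟩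
    ℤ.+ 2 ℤ.* Z.∑ p-1 (λ k → J² (ℤ.+ suc k)) ≡⟨ sym (Z.∑-*ˡ p-1 (ℤ.+ 2) _) ⟩
    Z.∑ p-1 (λ k → ℤ.+ 2 ℤ.* J² (ℤ.+ suc k)) ≡⟨ Z.∑-cong< p-1 (λ k k<p-1 → J²-average (ℤ.+ suc k) (unit-suc k<p-1)) ⟩
    Z.∑ p-1 (λ k → a ℤ.+ χ (ℤ.+ suc k) ℤ.* b) ≡⟨ Z.∑-+ p-1 (λ _ → a) (λ k → χ (ℤ.+ suc k) ℤ.* b) ⟩
    Z.∑ p-1 (λ _ → a) ℤ.+ Z.∑ p-1 (λ k → χ (ℤ.+ suc k) ℤ.* b) ≡⟨ cong₂ ℤ._+_ (trans (Z.∑-const p-1 a) (cong (ℤ._* a) (Z-ι p-1))) (trans (Z.∑-*ʳ p-1 b (λ k → χ (ℤ.+ suc k))) (cong (ℤ._* b) ∑χ-units≡0)) ⟩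
    ℤ.+ p-1 ℤ.* a ℤ.+ ℤ.0ℤ ℤ.* b ≡⟨ ℤ.+-identityʳ _ ⟩
    ℤ.+ p-1 ℤ.* a ∎
    where
    a = J² ℤ.1ℤ ℤ.+ J² (ℤ.+ g)
    b = J² ℤ.1ℤ ℤ.- J² (ℤ.+ g)

  -- Only v = ± u contribute.
  row : ℕ → ℤ
  row u = Z.∑ p (λ v → χ (ℤ.+ u) ℤ.* χ (ℤ.+ v) ℤ.* (V (sq u) (sq v) ℤ.+ ℤ.1ℤ))

  -- Square out and sum over k first, which produces the correlations V(u², v²). Adding 1 to V
  -- changes nothing because Σ χ(v) = 0, and it makes the terms with u² ≢ v² vanish.
  second-moment-rows : Z.∑ p (λ k → J² (ℤ.+ k)) ≡ Z.∑ p row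
  second-moment-rows = begin
    Z.∑ p (λ k → J² (ℤ.+ k)) ≡⟨ Z.∑-cong p (λ k → trans (sym (Z.∑-*ʳ p (J (ℤ.+ k)) (x k))) (Z.∑-cong p λ u → sym (Z.∑-*ˡ p (x k u) (x k)))) ⟩
    Z.∑ p (λ k → Z.∑ p (λ u → Z.∑ p (λ v → x k u ℤ.* x k v))) ≡⟨ trans (Z.∑-swap p p _) (Z.∑-cong p λ u → Z.∑-swap p p _) ⟩
    Z.∑ p (λ u → Z.∑ p (λ v → Z.∑ p (λ k → x k u ℤ.* x k v))) ≡⟨ Z.∑-cong p (λ u → Z.∑-cong p λ v → trans (Z.∑-cong p λ k → Z.solve 4 (λ a b c d → a Z.:* b Z.:* (c Z.:* d) Z.:= a Z.:* c Z.:* (b Z.:* d)) refl (χ (ℤ.+ u)) (χ (sq u ℤ.- ℤ.+ k)) (χ (ℤ.+ v)) (χ (sq v ℤ.- ℤ.+ k))) (Z.∑-*ˡ p (χ (ℤ.+ u) ℤ.* χ (ℤ.+ v)) _)) ⟩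
    Z.∑ p (λ u → Z.∑ p (λ v → χ (ℤ.+ u) ℤ.* χ (ℤ.+ v) ℤ.* V (sq u) (sq v))) ≡⟨ Z.∑-cong p (λ u → begin
      Z.∑ p (λ v → χ (ℤ.+ u) ℤ.* χ (ℤ.+ v) ℤ.* V (sq u) (sq v)) ≡⟨ Z.∑-cong p (λ v → Z.solve 3 (λ a b w → a Z.:* b Z.:* w Z.:= a Z.:* b Z.:* (w Z.:+ Z.κ 1) Z.:- a Z.:* b) refl (χ (ℤ.+ u)) (χ (ℤ.+ v)) (V (sq u) (sq v))) ⟩
      Z.∑ p (λ v → χ (ℤ.+ u) ℤ.* χ (ℤ.+ v) ℤ.* (V (sq u) (sq v) ℤ.+ ℤ.1ℤ) ℤ.- χ (ℤ.+ u) ℤ.* χ (ℤ.+ v)) ≡⟨ Z.∑-- p _ _ ⟩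
      row u ℤ.- Z.∑ p (λ v → χ (ℤ.+ u) ℤ.* χ (ℤ.+ v)) ≡⟨ cong (λ z → row u ℤ.- z) (trans (Z.∑-*ˡ p (χ (ℤ.+ u)) _) (trans (cong (χ (ℤ.+ u) ℤ.*_) ∑χ≡0) (ℤ.*-zeroʳ (χ (ℤ.+ u))))) ⟩
      row u ℤ.- ℤ.0ℤ ≡⟨ ℤ.+-identityʳ _ ⟩
      row u ∎) ⟩
    Z.∑ p row ∎
    where
    x : ℕ → ℕ → ℤ
    x k u = χ (ℤ.+ u) ℤ.* χ (sq u ℤ.- ℤ.+ k)

  row-0 : row 0 ≡ ℤ.0ℤ
  row-0 = Z.∑-0 p λ v _ → cong (λ z → z ℤ.* χ (ℤ.+ v) ℤ.* (V (sq 0) (sq v) ℤ.+ ℤ.1ℤ)) χ0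

  sq-nat : ∀ u → sq u ≡ ℤ.+ (u ℕ.* u)
  sq-nat u = sym (ℤ.pos-* u u)

  -- At v = u and v = p - u one has V + 1 = p, with sign χ(u)χ(v) = 1 because -1 is a residue. The
  -- two points differ as p is odd.
  row-suc : ∀ u → u < p-1 → row (suc u) ≡ ℤ.+ 2 ℤ.* ℤ.+ p
  row-suc u′ u′<p-1 = begin
    row u ≡⟨ two-points ⟩
    ℤ.+ p ℤ.+ ℤ.+ p ≡⟨ Z.solve 1 (λ q → q Z.:+ q Z.:= Z.κ 2 Z.:* q) refl (ℤ.+ p) ⟩
    ℤ.+ 2 ℤ.* ℤ.+ p ∎
    where
    u = suc u′
    u<p : u < p
    u<p = subst (u <_) p≡1+p-1 (s≤s u′<p-1)
    f : ℕ → ℤ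
    f v = χ (ℤ.+ u) ℤ.* χ (ℤ.+ v) ℤ.* (V (sq u) (sq v) ℤ.+ ℤ.1ℤ)
    ι-nat-sq : ∀ v → ι (v ℕ.* v) ≡ ι v * ι v
    ι-nat-sq v = ι-* v v
    V+1 : ∀ v → ι (u ℕ.* u) ≈ ι (v ℕ.* v) [ 1 ] → V (sq u) (sq v) ℤ.+ ℤ.1ℤ ≡ ℤ.+ p
    V+1 v e = trans (cong (ℤ._+ ℤ.1ℤ) (trans (cong₂ V (sq-nat u) (sq-nat v)) (V-equal (u ℕ.* u) (v ℕ.* v) e))) (Z.solve 1 (λ q → q Z.:- Z.κ 1 Z.:+ Z.κ 1 Z.:= q) refl (ℤ.+ p))
    at : ∀ v → χ (ℤ.+ v) ≡ χ (ℤ.+ u) → ι (u ℕ.* u) ≈ ι (v ℕ.* v) [ 1 ] → f v ≡ ℤ.+ p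
    at v χv e = trans (cong₂ (λ y w → χ (ℤ.+ u) ℤ.* y ℤ.* w) χv (V+1 v e)) (trans (cong (ℤ._* ℤ.+ p) (χ-square {ℤ.+ u} (unit-suc u′<p-1))) (ℤ.*-identityˡ (ℤ.+ p)))
    ū = p ∸ u
    ιū : ι ū ≈ - ι u [ 1 ]
    ιū = ≈-trans (≈-reflexive (ι-∸ (ℕ.<⇒≤ u<p))) (≈-trans (≈-- p≈0 ≈-refl) (≈-reflexive (+-identityˡ _)))
    f-u : f u ≡ ℤ.+ p
    f-u = at u refl ≈-refl
    f-ū : f ū ≡ ℤ.+ p
    f-ū = at ū (trans (χ-cong {ℤ.+ ū} {ℤ.- (ℤ.+ u)} (≈-trans (≈-reflexive (ιℤ-pos ū)) (≈-trans ιū (≈-reflexive (sym (trans (ιℤ-neg (ℤ.+ u)) (cong -_ (ιℤ-pos u)))))))) (χ-neg (ℤ.+ u)))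
      (≈-sym (≈-trans (≈-reflexive (ι-nat-sq ū)) (≈-trans (≈-* {{O-ι ū}} {{neg-O (O-ι u)}} ιū ιū) (≈-reflexive (trans (solve 1 (λ x → ⊝ x :* ⊝ x := x :* x) refl (ι u)) (sym (ι-nat-sq u)))))))
    others : ∀ v → v < p → v ≢ u → v ≢ ū → f v ≡ ℤ.0ℤ
    others v v<p v≢u v≢ū = trans (cong (λ w → χ (ℤ.+ u) ℤ.* χ (ℤ.+ v) ℤ.* (w ℤ.+ ℤ.1ℤ)) (trans (cong₂ V (sq-nat u) (sq-nat v)) (V-distinct (u ℕ.* u) (v ℕ.* v) distinct))) (ℤ.*-zeroʳ (χ (ℤ.+ u) ℤ.* χ (ℤ.+ v)))
      where
      distinct : ¬ (ι (u ℕ.* u) ≈ ι (v ℕ.* v) [ 1 ])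
      distinct e = conclude (integral-domain (ℤ.+ u ℤ.- ℤ.+ v) (ℤ.+ u ℤ.+ ℤ.+ v) (≈-trans (≈-reflexive (begin
        ιℤ (ℤ.+ u ℤ.- ℤ.+ v) * ιℤ (ℤ.+ u ℤ.+ ℤ.+ v) ≡⟨ cong₂ _*_ (trans (ιℤ-sub (ℤ.+ u) v) (cong (_- ι v) (ιℤ-pos u))) (trans (ιℤ-+ (ℤ.+ u) (ℤ.+ v)) (cong₂ _+_ (ιℤ-pos u) (ιℤ-pos v))) ⟩
        (ι u - ι v) * (ι u + ι v) ≡⟨ solve 2 (λ u v → (u :- v) :* (u :+ v) := u :* u :- v :* v) refl (ι u) (ι v) ⟩
        ι u * ι u - ι v * ι v ≡⟨ sym (cong₂ _-_ (ι-nat-sq u) (ι-nat-sq v)) ⟩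
        ι (u ℕ.* u) - ι (v ℕ.* v) ∎)) (≈⇒-≈0 e)))
        where
        conclude : ιℤ (ℤ.+ u ℤ.- ℤ.+ v) ≈ 0# [ 1 ] ⊎ ιℤ (ℤ.+ u ℤ.+ ℤ.+ v) ≈ 0# [ 1 ] → ⊥
        conclude (inj₁ e₁) = v≢u (residue-unique v<p u<p (≈-sym (-≈0⇒≈ (≈-trans (≈-reflexive (sym (trans (ιℤ-sub (ℤ.+ u) v) (cong (_- ι v) (ιℤ-pos u))))) e₁))))
        conclude (inj₂ e₂) = v≢ū (residue-unique v<p (ℕ.∸-monoʳ-< {p} {u} {0} (s≤s z≤n) (ℕ.<⇒≤ u<p)) (≈-trans (-≈0⇒≈ (≈-trans (≈-reflexive (trans (solve 2 (λ u v → v :- ⊝ u := u :+ v) refl (ι u) (ι v)) (sym (trans (ιℤ-+ (ℤ.+ u) (ℤ.+ v)) (cong₂ _+_ (ιℤ-pos u) (ιℤ-pos v)))))) e₂)) (≈-sym ιū)))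
    ū<p : ū < p
    ū<p = ℕ.∸-monoʳ-< {p} {u} {0} (s≤s z≤n) (ℕ.<⇒≤ u<p)
    two-points : row u ≡ ℤ.+ p ℤ.+ ℤ.+ p
    two-points = cases (ℕ.<-cmp u ū)
      where
      cases : Tri (u < ū) (u ≡ ū) (ū < u) → row u ≡ ℤ.+ p ℤ.+ ℤ.+ p
      cases (tri< u<ū _ _) = trans (Z.∑-pair p u ū u<ū ū<p others) (cong₂ ℤ._+_ f-u f-ū)
      cases (tri> _ _ ū<u) = trans (Z.∑-pair p ū u ū<u u<p (λ v v<p a b → others v v<p b a)) (cong₂ ℤ._+_ f-ū f-u)
      cases (tri≈ _ u≡ū _) = ⊥-elim (p∤-* p∤2 (p∤suc u′<p-1) (≈0⇒∣ (ℤ.+ (2 ℕ.* u)) (≈-trans (≈-reflexive (trans (ιℤ-pos (2 ℕ.* u)) (trans (ι-* 2 u) (solve 1 (λ x → κ 2 :* x := x :- ⊝ x) refl (ι u))))) (≈⇒-≈0 (≈-trans (≈-reflexive (cong ι u≡ū)) ιū)))))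

  second-moment : J² ℤ.1ℤ ℤ.+ J² (ℤ.+ g) ≡ ℤ.+ 4 ℤ.* ℤ.+ p
  second-moment = ℤ.*-cancelˡ-≡ (ℤ.+ p-1) _ _ {{nonZero}} (begin
    ℤ.+ p-1 ℤ.* (J² ℤ.1ℤ ℤ.+ J² (ℤ.+ g)) ≡⟨ sym second-moment-classes ⟩
    ℤ.+ 2 ℤ.* Z.∑ p (λ k → J² (ℤ.+ k)) ≡⟨ cong (ℤ.+ 2 ℤ.*_) (trans second-moment-rows (trans (Z∑-first row) (cong₂ ℤ._+_ row-0 (Z.∑-cong< p-1 row-suc)))) ⟩
    ℤ.+ 2 ℤ.* (ℤ.0ℤ ℤ.+ Z.∑ p-1 (λ _ → ℤ.+ 2 ℤ.* ℤ.+ p)) ≡⟨ cong (λ z → ℤ.+ 2 ℤ.* (ℤ.0ℤ ℤ.+ z)) (trans (Z.∑-const p-1 (ℤ.+ 2 ℤ.* ℤ.+ p)) (cong (ℤ._* (ℤ.+ 2 ℤ.* ℤ.+ p)) (Z-ι p-1))) ⟩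
    ℤ.+ 2 ℤ.* (ℤ.0ℤ ℤ.+ ℤ.+ p-1 ℤ.* (ℤ.+ 2 ℤ.* ℤ.+ p)) ≡⟨ Z.solve 2 (λ m q → Z.κ 2 Z.:* (Z.κ 0 Z.:+ m Z.:* (Z.κ 2 Z.:* q)) Z.:= m Z.:* (Z.κ 4 Z.:* q)) refl (ℤ.+ p-1) (ℤ.+ p) ⟩
    ℤ.+ p-1 ℤ.* (ℤ.+ 4 ℤ.* ℤ.+ p) ∎)
    where
    nonZero : ℤ.NonZero (ℤ.+ p-1)
    nonZero = subst (λ m → ℤ.NonZero (ℤ.+ m)) p-1-suc _

-- Uniqueness of the odd part in a sum of two squares

parity-ℕ : ∀ m → ∃ λ k → m ≡ 2 ℕ.* k ⊎ m ≡ suc (2 ℕ.* k)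
parity-ℕ zero = 0 , inj₁ refl
parity-ℕ (suc m) = step (parity-ℕ m)
  where
  step : (∃ λ k → m ≡ 2 ℕ.* k ⊎ m ≡ suc (2 ℕ.* k)) → ∃ λ k → suc m ≡ 2 ℕ.* k ⊎ suc m ≡ suc (2 ℕ.* k)
  step (k , inj₁ e) = k , inj₂ (cong suc e)
  step (k , inj₂ e) = suc k , inj₁ (trans (cong suc e) (sym (ℕ.*-suc 2 k)))

parity-ℤ : ∀ y → ∃ λ z → y ≡ ℤ.+ 2 ℤ.* z ⊎ y ≡ ℤ.1ℤ ℤ.+ ℤ.+ 2 ℤ.* z
parity-ℤ (ℤ.+ m) = convert (parity-ℕ m)
  where
  convert : (∃ λ k → m ≡ 2 ℕ.* k ⊎ m ≡ suc (2 ℕ.* k)) → ∃ λ z → ℤ.+ m ≡ ℤ.+ 2 ℤ.* z ⊎ ℤ.+ m ≡ ℤ.1ℤ ℤ.+ ℤ.+ 2 ℤ.* z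
  convert (k , inj₁ e) = ℤ.+ k , inj₁ (trans (cong ℤ.+_ e) (ℤ.pos-* 2 k))
  convert (k , inj₂ e) = ℤ.+ k , inj₂ (trans (cong ℤ.+_ e) (cong (λ z → ℤ.1ℤ ℤ.+ z) (ℤ.pos-* 2 k)))
parity-ℤ -[1+ m ] = convert (parity-ℕ m)
  where
  convert : (∃ λ k → m ≡ 2 ℕ.* k ⊎ m ≡ suc (2 ℕ.* k)) → ∃ λ z → -[1+ m ] ≡ ℤ.+ 2 ℤ.* z ⊎ -[1+ m ] ≡ ℤ.1ℤ ℤ.+ ℤ.+ 2 ℤ.* z
  convert (k , inj₁ e) = ℤ.- (ℤ.1ℤ ℤ.+ ℤ.+ k) , inj₂ (trans (cong (λ x → ℤ.- (ℤ.1ℤ ℤ.+ x)) (trans (cong ℤ.+_ e) (ℤ.pos-* 2 k)))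
    (Z.solve 1 (λ k → Z.⊝ (Z.κ 1 Z.:+ Z.κ 2 Z.:* k) Z.:= Z.κ 1 Z.:+ Z.κ 2 Z.:* Z.⊝ (Z.κ 1 Z.:+ k)) refl (ℤ.+ k)))
  convert (k , inj₂ e) = ℤ.- (ℤ.1ℤ ℤ.+ ℤ.+ k) , inj₁ (trans (cong (λ x → ℤ.- (ℤ.1ℤ ℤ.+ x)) (trans (cong ℤ.+_ e) (cong (λ z → ℤ.1ℤ ℤ.+ z) (ℤ.pos-* 2 k))))
    (Z.solve 1 (λ k → Z.⊝ (Z.κ 1 Z.:+ (Z.κ 1 Z.:+ Z.κ 2 Z.:* k)) Z.:= Z.κ 2 Z.:* Z.⊝ (Z.κ 1 Z.:+ k)) refl (ℤ.+ k)))

odd≢even : ∀ s t → ℤ.1ℤ ℤ.+ ℤ.+ 2 ℤ.* s ≢ ℤ.+ 2 ℤ.* t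
odd≢even s t e = impossible ℤ.∣ t ℤ.- s ∣ (sym (trans (cong ℤ.∣_∣ one) (ℤ.abs-* (ℤ.+ 2) (t ℤ.- s))))
  where
  one : ℤ.1ℤ ≡ ℤ.+ 2 ℤ.* (t ℤ.- s)
  one = trans (Z.solve 1 (λ s → Z.κ 1 Z.:= Z.κ 1 Z.:+ Z.κ 2 Z.:* s Z.:- Z.κ 2 Z.:* s) refl s)
    (trans (cong (ℤ._- ℤ.+ 2 ℤ.* s) e) (Z.solve 2 (λ s t → Z.κ 2 Z.:* t Z.:- Z.κ 2 Z.:* s Z.:= Z.κ 2 Z.:* (t Z.:- s)) refl s t))
  impossible : ∀ k → 2 ℕ.* k ≢ 1
  impossible zero ()
  impossible (suc k) h = ℕ.1+n≢0 (ℕ.suc-injective (trans (sym (ℕ.*-suc 2 k)) h))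

square-abs : ∀ z → z ℤ.* z ≡ ℤ.+ (ℤ.∣ z ∣ ℕ.* ℤ.∣ z ∣)
square-abs (ℤ.+ m) = sym (ℤ.pos-* m m)
square-abs -[1+ m ] = refl

module TwoSquares (p : ℕ) (p-prime : Prime p) (p′ : ℤ) (p-odd : ℤ.+ p ≡ ℤ.1ℤ ℤ.+ ℤ.+ 2 ℤ.* p′) where
  open ≡-Reasoning

  private
    p≢0 : p ≢ 0
    p≢0 refl = odd≢even p′ ℤ.0ℤ (sym p-odd)

    p-nonZero : ℤ.NonZero (ℤ.+ p)
    p-nonZero = ℕ.≢-nonZero p≢0

  -- With c = ax + by and d = ay - bx one has c² + d² = p². Divisibility of d by p leaves d = 0 or d
  -- = ± p. In the first case c = ± p and the two vectors agree up to sign; the second forces c = 0,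
  -- but c is odd because y is even.
  same-line : ∀ {a b x y a′ x′} → a ℤ.* a ℤ.+ b ℤ.* b ≡ ℤ.+ p → x ℤ.* x ℤ.+ y ℤ.* y ≡ ℤ.+ p →
    a ≡ ℤ.1ℤ ℤ.+ ℤ.+ 2 ℤ.* a′ → x ≡ ℤ.1ℤ ℤ.+ ℤ.+ 2 ℤ.* x′ → p ∣ ℤ.∣ a ℤ.* y ℤ.- b ℤ.* x ∣ → a ≡ x ⊎ a ≡ ℤ.- x
  same-line {a} {b} {x} {y} {a′} {x′} ab xy a-odd x-odd (divides e eq) = by-quotient e eq
    where
    d = a ℤ.* y ℤ.- b ℤ.* x
    c = a ℤ.* x ℤ.+ b ℤ.* y
    brahmagupta : c ℤ.* c ℤ.+ d ℤ.* d ≡ ℤ.+ p ℤ.* ℤ.+ p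
    brahmagupta = trans (Z.solve 4 (λ a b x y → (a Z.:* x Z.:+ b Z.:* y) Z.:* (a Z.:* x Z.:+ b Z.:* y) Z.:+ (a Z.:* y Z.:- b Z.:* x) Z.:* (a Z.:* y Z.:- b Z.:* x)
        Z.:= (a Z.:* a Z.:+ b Z.:* b) Z.:* (x Z.:* x Z.:+ y Z.:* y)) refl a b x y) (cong₂ ℤ._*_ ab xy)
    norms : ℤ.∣ c ∣ ℕ.* ℤ.∣ c ∣ ℕ.+ ℤ.∣ d ∣ ℕ.* ℤ.∣ d ∣ ≡ p ℕ.* p
    norms = ℤ.+-injective (trans (ℤ.pos-+ (ℤ.∣ c ∣ ℕ.* ℤ.∣ c ∣) _) (trans (cong₂ ℤ._+_ (sym (square-abs c)) (sym (square-abs d))) (trans brahmagupta (sym (ℤ.pos-* p p)))))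
    square-injective : ∀ m k → m ℕ.* m ≡ k ℕ.* k → m ≡ k
    square-injective m k h = compare (ℕ.<-cmp m k)
      where
      compare : Tri (m < k) (m ≡ k) (k < m) → m ≡ k
      compare (tri≈ _ q _) = q
      compare (tri< m<k _ _) = ⊥-elim (ℕ.<-irrefl h (ℕ.*-mono-< m<k m<k))
      compare (tri> _ _ k<m) = ⊥-elim (ℕ.<-irrefl (sym h) (ℕ.*-mono-< k<m k<m))
    y-even : ∃ λ y′ → y ≡ ℤ.+ 2 ℤ.* y′
    y-even = cases (parity-ℤ y)
      where
      cases : (∃ λ z → y ≡ ℤ.+ 2 ℤ.* z ⊎ y ≡ ℤ.1ℤ ℤ.+ ℤ.+ 2 ℤ.* z) → ∃ λ y′ → y ≡ ℤ.+ 2 ℤ.* y′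
      cases (z , inj₁ q) = z , q
      cases (z , inj₂ q) = ⊥-elim (odd≢even p′ (ℤ.1ℤ ℤ.+ ℤ.+ 2 ℤ.* (x′ ℤ.+ x′ ℤ.* x′ ℤ.+ z ℤ.+ z ℤ.* z)) (trans (sym p-odd) (trans (sym xy) (trans (cong₂ (λ u v → u ℤ.* u ℤ.+ v ℤ.* v) x-odd q)
        (Z.solve 2 (λ x z → (Z.κ 1 Z.:+ Z.κ 2 Z.:* x) Z.:* (Z.κ 1 Z.:+ Z.κ 2 Z.:* x) Z.:+ (Z.κ 1 Z.:+ Z.κ 2 Z.:* z) Z.:* (Z.κ 1 Z.:+ Z.κ 2 Z.:* z)
          Z.:= Z.κ 2 Z.:* (Z.κ 1 Z.:+ Z.κ 2 Z.:* (x Z.:+ x Z.:* x Z.:+ z Z.:+ z Z.:* z))) refl x′ z)))))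
    c≢0 : c ≢ ℤ.0ℤ
    c≢0 h = odd≢even (a′ ℤ.+ x′ ℤ.+ ℤ.+ 2 ℤ.* (a′ ℤ.* x′) ℤ.+ b ℤ.* proj₁ y-even) ℤ.0ℤ (trans (sym (trans (cong₂ (λ u v → u ℤ.+ b ℤ.* v) (cong₂ ℤ._*_ a-odd x-odd) (proj₂ y-even))
      (Z.solve 4 (λ a x b y → (Z.κ 1 Z.:+ Z.κ 2 Z.:* a) Z.:* (Z.κ 1 Z.:+ Z.κ 2 Z.:* x) Z.:+ b Z.:* (Z.κ 2 Z.:* y) Z.:= Z.κ 1 Z.:+ Z.κ 2 Z.:* (a Z.:+ x Z.:+ Z.κ 2 Z.:* (a Z.:* x) Z.:+ b Z.:* y)) refl a′ x′ b (proj₁ y-even)))) h)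
    parallel : d ≡ ℤ.0ℤ → a ℤ.* ℤ.+ p ≡ x ℤ.* c
    parallel h = begin
      a ℤ.* ℤ.+ p ≡⟨ cong (a ℤ.*_) (sym xy) ⟩
      a ℤ.* (x ℤ.* x ℤ.+ y ℤ.* y) ≡⟨ Z.solve 4 (λ a b x y → a Z.:* (x Z.:* x Z.:+ y Z.:* y) Z.:= x Z.:* (a Z.:* x Z.:+ b Z.:* y) Z.:+ (a Z.:* y Z.:- b Z.:* x) Z.:* y) refl a b x y ⟩
      x ℤ.* c ℤ.+ d ℤ.* y ≡⟨ cong (λ z → x ℤ.* c ℤ.+ z ℤ.* y) h ⟩
      x ℤ.* c ℤ.+ ℤ.0ℤ ≡⟨ ℤ.+-identityʳ _ ⟩
      x ℤ.* c ∎
    signs : ∀ z → ℤ.∣ z ∣ ≡ p → z ≡ ℤ.+ p ⊎ z ≡ ℤ.- (ℤ.+ p)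
    signs (ℤ.+ m) refl = inj₁ refl
    signs -[1+ m ] refl = inj₂ refl
    conclude : d ≡ ℤ.0ℤ → c ≡ ℤ.+ p ⊎ c ≡ ℤ.- (ℤ.+ p) → a ≡ x ⊎ a ≡ ℤ.- x
    conclude h (inj₁ q) = inj₁ (ℤ.*-cancelʳ-≡ a x (ℤ.+ p) {{p-nonZero}} (trans (parallel h) (cong (x ℤ.*_) q)))
    conclude h (inj₂ q) = inj₂ (ℤ.*-cancelʳ-≡ a (ℤ.- x) (ℤ.+ p) {{p-nonZero}} (trans (parallel h) (trans (cong (x ℤ.*_) q) (Z.solve 2 (λ x q → x Z.:* (Z.⊝ q) Z.:= (Z.⊝ x) Z.:* q) refl x (ℤ.+ p)))))
    by-quotient : ∀ e → ℤ.∣ d ∣ ≡ e ℕ.* p → a ≡ x ⊎ a ≡ ℤ.- x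
    by-quotient zero q = conclude (ℤ.∣i∣≡0⇒i≡0 q) (signs c (square-injective ℤ.∣ c ∣ p (trans (sym (ℕ.+-identityʳ _)) (trans (cong (λ m → ℤ.∣ c ∣ ℕ.* ℤ.∣ c ∣ ℕ.+ m ℕ.* m) (sym q)) norms))))
    by-quotient (suc zero) q = ⊥-elim (c≢0 (ℤ.∣i∣≡0⇒i≡0 (square-injective ℤ.∣ c ∣ 0 (ℕ.+-cancelʳ-≡ (p ℕ.* p) _ 0 (trans (cong (λ m → ℤ.∣ c ∣ ℕ.* ℤ.∣ c ∣ ℕ.+ m ℕ.* m) (sym (trans q (ℕ.*-identityˡ p)))) norms)))))
    by-quotient (suc (suc e)) q = ⊥-elim (ℕ.<-irrefl (sym norms) (ℕ.<-≤-trans (ℕ.*-mono-< p<d p<d) (ℕ.m≤n+m _ (ℤ.∣ c ∣ ℕ.* ℤ.∣ c ∣))))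
      where
      p<d : p < ℤ.∣ d ∣
      p<d = subst (p <_) (sym q) (ℕ.m<m+n p {p ℕ.+ e ℕ.* p} (ℕ.<-≤-trans (ℕ.n≢0⇒n>0 p≢0) (ℕ.m≤m+n p (e ℕ.* p))))

  -- (ay - bx)(ay + bx) = (a² - x²)p, so p divides one of the factors; changing the sign of b
  -- exchanges them.
  two-squares-unique : ∀ {a b x y a′ x′} → a ℤ.* a ℤ.+ b ℤ.* b ≡ ℤ.+ p → x ℤ.* x ℤ.+ y ℤ.* y ≡ ℤ.+ p →
    a ≡ ℤ.1ℤ ℤ.+ ℤ.+ 2 ℤ.* a′ → x ≡ ℤ.1ℤ ℤ.+ ℤ.+ 2 ℤ.* x′ → a ≡ x ⊎ a ≡ ℤ.- x
  two-squares-unique {a} {b} {x} {y} {a′} {x′} ab xy a-odd x-odd = cases (euclidsLemma ℤ.∣ d ∣ ℤ.∣ d′ ∣ p-prime (divides ℤ.∣ a ℤ.* a ℤ.- x ℤ.* x ∣ (trans (sym (ℤ.abs-* d d′)) (trans (cong ℤ.∣_∣ product) (ℤ.abs-* (a ℤ.* a ℤ.- x ℤ.* x) (ℤ.+ p))))))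
    where
    d = a ℤ.* y ℤ.- b ℤ.* x
    d′ = a ℤ.* y ℤ.- (ℤ.- b) ℤ.* x
    product : d ℤ.* d′ ≡ (a ℤ.* a ℤ.- x ℤ.* x) ℤ.* ℤ.+ p
    product = begin
      d ℤ.* d′ ≡⟨ Z.solve 4 (λ a b x y → (a Z.:* y Z.:- b Z.:* x) Z.:* (a Z.:* y Z.:- (Z.⊝ b) Z.:* x) Z.:= a Z.:* a Z.:* (x Z.:* x Z.:+ y Z.:* y) Z.:- x Z.:* x Z.:* (a Z.:* a Z.:+ b Z.:* b)) refl a b x y ⟩
      a ℤ.* a ℤ.* (x ℤ.* x ℤ.+ y ℤ.* y) ℤ.- x ℤ.* x ℤ.* (a ℤ.* a ℤ.+ b ℤ.* b) ≡⟨ cong₂ (λ u v → a ℤ.* a ℤ.* u ℤ.- x ℤ.* x ℤ.* v) xy ab ⟩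
      a ℤ.* a ℤ.* ℤ.+ p ℤ.- x ℤ.* x ℤ.* ℤ.+ p ≡⟨ Z.solve 3 (λ a x q → a Z.:* a Z.:* q Z.:- x Z.:* x Z.:* q Z.:= (a Z.:* a Z.:- x Z.:* x) Z.:* q) refl a x (ℤ.+ p) ⟩
      (a ℤ.* a ℤ.- x ℤ.* x) ℤ.* ℤ.+ p ∎
    cases : p ∣ ℤ.∣ d ∣ ⊎ p ∣ ℤ.∣ d′ ∣ → a ≡ x ⊎ a ≡ ℤ.- x
    cases (inj₁ h) = same-line {a} {b} {x} {y} {a′} {x′} ab xy a-odd x-odd h
    cases (inj₂ h) = same-line {a} {ℤ.- b} {x} {y} {a′} {x′} (trans (Z.solve 2 (λ a b → a Z.:* a Z.:+ (Z.⊝ b) Z.:* (Z.⊝ b) Z.:= a Z.:* a Z.:+ b Z.:* b) refl a b) ab) xy a-odd x-odd h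

-- The Jacobsthal sum as an integer

Unit± : ℤ → Set
Unit± e = e ≡ ℤ.1ℤ ⊎ e ≡ ℤ.-1ℤ

-- Each -1 lowers the sum by 2, so modulo 4 only the parity of their number counts, and the product
-- records this parity.
sum-of-signs : ∀ m (ε : ℕ → ℤ) → (∀ i → i < m → Unit± (ε i)) → Unit± (Z.∏ m ε) × ∃ λ q → Z.∑ m ε ≡ ℤ.+ m ℤ.- ℤ.1ℤ ℤ.+ Z.∏ m ε ℤ.+ ℤ.+ 4 ℤ.* q
sum-of-signs zero ε h = inj₁ refl , ℤ.0ℤ , refl
sum-of-signs (suc m) ε h = step (sum-of-signs m ε (λ i i<m → h i (ℕ.m<n⇒m<1+n i<m))) (h m ℕ.≤-refl)
  where
  S = Z.∑ m ε
  P = Z.∏ m ε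
  Goal : ℤ → ℤ → Set
  Goal P e = Unit± (P ℤ.* e) × ∃ λ q → S ℤ.+ e ≡ ℤ.+ suc m ℤ.- ℤ.1ℤ ℤ.+ P ℤ.* e ℤ.+ ℤ.+ 4 ℤ.* q
  combine : ∀ {P e} q → Unit± P → Unit± e → S ≡ ℤ.+ m ℤ.- ℤ.1ℤ ℤ.+ P ℤ.+ ℤ.+ 4 ℤ.* q → Goal P e
  combine {P} q u (inj₁ refl) eq = subst Unit± (sym (ℤ.*-identityʳ P)) u , q , trans (cong (ℤ._+ ℤ.1ℤ) eq)
    (Z.solve 3 (λ m P q → m Z.:- Z.κ 1 Z.:+ P Z.:+ Z.κ 4 Z.:* q Z.:+ Z.κ 1 Z.:= Z.κ 1 Z.:+ m Z.:- Z.κ 1 Z.:+ P Z.:* Z.κ 1 Z.:+ Z.κ 4 Z.:* q) refl (ℤ.+ m) P q)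
  combine q (inj₁ refl) (inj₂ refl) eq = inj₂ refl , q , trans (cong (ℤ._+ ℤ.-1ℤ) eq)
    (Z.solve 2 (λ m q → m Z.:- Z.κ 1 Z.:+ Z.κ 1 Z.:+ Z.κ 4 Z.:* q Z.:+ Z.⊝ Z.κ 1 Z.:= Z.κ 1 Z.:+ m Z.:- Z.κ 1 Z.:+ Z.κ 1 Z.:* Z.⊝ Z.κ 1 Z.:+ Z.κ 4 Z.:* q) refl (ℤ.+ m) q)
  combine q (inj₂ refl) (inj₂ refl) eq = inj₁ refl , q ℤ.- ℤ.1ℤ , trans (cong (ℤ._+ ℤ.-1ℤ) eq)
    (Z.solve 2 (λ m q → m Z.:- Z.κ 1 Z.:+ Z.⊝ Z.κ 1 Z.:+ Z.κ 4 Z.:* q Z.:+ Z.⊝ Z.κ 1 Z.:= Z.κ 1 Z.:+ m Z.:- Z.κ 1 Z.:+ Z.⊝ Z.κ 1 Z.:* Z.⊝ Z.κ 1 Z.:+ Z.κ 4 Z.:* (q Z.:- Z.κ 1)) refl (ℤ.+ m) q)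
  step : Unit± P × (∃ λ q → S ≡ ℤ.+ m ℤ.- ℤ.1ℤ ℤ.+ P ℤ.+ ℤ.+ 4 ℤ.* q) → Unit± (ε m) → Goal P (ε m)
  step (u , q , eq) e = combine q u e eq

module JacobsthalValue (F : Field) (p : ℕ) (L : Localisation F p) (p-prime : Prime p) (3<p : 3 < p)
  (n : ℕ) (p≡4n+1 : p ≡ suc (4 ℕ.* n)) where
  open SecondMoment F p L p-prime 3<p n p≡4n+1 public
  open ≡-Reasoning

  term : ℤ → ℕ → ℤ
  term k u = χ (ℤ.+ u) ℤ.* χ (sq u ℤ.- k)

  half : ℤ → ℤ
  half k = Z.∑ N (λ u → term k (suc u))

  term-0 : ∀ k → term k 0 ≡ ℤ.0ℤ
  term-0 k = cong (ℤ._* χ (sq 0 ℤ.- k)) χ0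

  term-reflect : ∀ k v w → v ℕ.+ w ≡ p → term k v ≡ term k w
  term-reflect k v w e = cong₂ ℤ._*_ (trans (χ-cong {ℤ.+ v} {ℤ.- (ℤ.+ w)} (≈-trans (≈-reflexive (ιℤ-pos v)) (≈-trans v≈ (≈-reflexive (sym (trans (ιℤ-neg (ℤ.+ w)) (cong -_ (ιℤ-pos w)))))))) (χ-neg (ℤ.+ w)))
      (χ-cong {sq v ℤ.- k} {sq w ℤ.- k} (≈-trans (≈-reflexive (trans (ιℤ-- (sq v) k) (cong (_- ιℤ k) (ιsq v)))) (≈-trans (≈-- (≈-trans (≈-* {{O-ι v}} {{neg-O (O-ι w)}} v≈ v≈) (≈-reflexive (solve 1 (λ x → ⊝ x :* ⊝ x := x :* x) refl (ι w)))) ≈-refl) (≈-reflexive (sym (trans (ιℤ-- (sq w) k) (cong (_- ιℤ k) (ιsq w))))))))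
    where
    v≈ : ι v ≈ - ι w [ 1 ]
    v≈ = ≈-trans (≈-reflexive (trans (solve 2 (λ v w → v := v :+ w :- w) refl (ι v) (ι w)) (cong (_- ι w) (trans (sym (ι-+ v w)) (cong ι e))))) (≈-trans (≈-- p≈0 ≈-refl) (≈-reflexive (+-identityˡ _)))

  p-1≡N+N : p-1 ≡ N ℕ.+ N
  p-1≡N+N = trans p-1≡2N (cong (N ℕ.+_) (ℕ.+-identityʳ N))

  J-even : ∀ k → J k ≡ ℤ.+ 2 ℤ.* half k
  J-even k = begin
    J k ≡⟨ Z∑-first (term k) ⟩
    term k 0 ℤ.+ Z.∑ p-1 (λ u → term k (suc u)) ≡⟨ trans (cong (ℤ._+ Z.∑ p-1 (λ u → term k (suc u))) (term-0 k)) (ℤ.+-identityˡ _) ⟩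
    Z.∑ p-1 (λ u → term k (suc u)) ≡⟨ trans (cong (λ m → Z.∑ m (λ u → term k (suc u))) p-1≡N+N) (Z.∑-split N N (λ u → term k (suc u))) ⟩
    half k ℤ.+ Z.∑ N (λ u → term k (suc (N ℕ.+ u))) ≡⟨ cong (λ z → half k ℤ.+ z) (trans (Z.∑-reverse N (λ u → term k (suc (N ℕ.+ u)))) (Z.∑-cong< N (λ u u<N → term-reflect k (suc (N ℕ.+ (N ∸ suc u))) (suc u) (index u u<N)))) ⟩
    half k ℤ.+ half k ≡⟨ double (half k) ⟩
    ℤ.+ 2 ℤ.* half k ∎
    where
    double : ∀ x → x ℤ.+ x ≡ ℤ.+ 2 ℤ.* x
    double = Z.solve 1 (λ x → x Z.:+ x Z.:= Z.κ 2 Z.:* x) refl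
    index : ∀ u → u < N → suc (N ℕ.+ (N ∸ suc u)) ℕ.+ suc u ≡ p
    index u u<N = trans (cong suc (trans (ℕ.+-assoc N _ _) (trans (cong (N ℕ.+_) (ℕ.m∸n+n≡m u<N)) (sym p-1≡N+N)))) p≡1+p-1

  half-squares : half ℤ.1ℤ ℤ.* half ℤ.1ℤ ℤ.+ half (ℤ.+ g) ℤ.* half (ℤ.+ g) ≡ ℤ.+ p
  half-squares = ℤ.*-cancelˡ-≡ (ℤ.+ 4) _ _ (trans (quadruple (half ℤ.1ℤ) (half (ℤ.+ g))) (trans (cong₂ (λ a b → a ℤ.* a ℤ.+ b ℤ.* b) (sym (J-even ℤ.1ℤ)) (sym (J-even (ℤ.+ g)))) second-moment))
    where
    quadruple : ∀ a b → ℤ.+ 4 ℤ.* (a ℤ.* a ℤ.+ b ℤ.* b) ≡ (ℤ.+ 2 ℤ.* a) ℤ.* (ℤ.+ 2 ℤ.* a) ℤ.+ (ℤ.+ 2 ℤ.* b) ℤ.* (ℤ.+ 2 ℤ.* b)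
    quadruple = Z.solve 2 (λ a b → Z.κ 4 Z.:* (a Z.:* a Z.:+ b Z.:* b) Z.:= (Z.κ 2 Z.:* a) Z.:* (Z.κ 2 Z.:* a) Z.:+ (Z.κ 2 Z.:* b) Z.:* (Z.κ 2 Z.:* b)) refl

  N′ : ℕ
  N′ = ℕ.pred N

  -- The argument u(u² - 1) of the combined symbol, started at u = 2 because the term at u = 1 is
  -- zero. As a product of three consecutive numbers it leads to factorials.
  cubic : ℕ → ℤ
  cubic u = ℤ.+ suc (suc u) ℤ.* (sq (suc (suc u)) ℤ.- ℤ.1ℤ)

  ι-cubic : ∀ u → ιℤ (cubic u) ≡ ι (suc u) * ι (suc (suc u)) * ι (suc (suc (suc u)))
  ι-cubic u = trans (ιℤ-* (ℤ.+ suc (suc u)) (sq (suc (suc u)) ℤ.- ℤ.1ℤ)) (trans (cong₂ _*_ (ιℤ-pos (suc (suc u))) (trans (ιℤ-- (sq (suc (suc u))) ℤ.1ℤ) (cong (_- 1#) (ιsq (suc (suc u))))))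
    (solve 1 (λ u → (κ 1 :+ (κ 1 :+ u)) :* ((κ 1 :+ (κ 1 :+ u)) :* (κ 1 :+ (κ 1 :+ u)) :- κ 1) := (κ 1 :+ u) :* (κ 1 :+ (κ 1 :+ u)) :* (κ 1 :+ (κ 1 :+ (κ 1 :+ u)))) refl (ι u)))

  half-cubic : half ℤ.1ℤ ≡ Z.∑ N′ (λ u → χ (cubic u))
  half-cubic = begin
    half ℤ.1ℤ ≡⟨ cong (λ m → Z.∑ m (λ u → term ℤ.1ℤ (suc u))) (sym N-suc) ⟩
    Z.∑ (suc N′) (λ u → term ℤ.1ℤ (suc u)) ≡⟨ Z.∑-first N′ (λ u → term ℤ.1ℤ (suc u)) ⟩
    term ℤ.1ℤ 1 ℤ.+ Z.∑ N′ (λ u → term ℤ.1ℤ (suc (suc u))) ≡⟨ cong₂ ℤ._+_ (trans (cong (χ (ℤ.+ 1) ℤ.*_) χ0) (ℤ.*-zeroʳ (χ (ℤ.+ 1)))) (Z.∑-cong N′ (λ u → sym (χ-* (ℤ.+ suc (suc u)) (sq (suc (suc u)) ℤ.- ℤ.1ℤ)))) ⟩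
    ℤ.0ℤ ℤ.+ Z.∑ N′ (λ u → χ (cubic u)) ≡⟨ ℤ.+-identityˡ _ ⟩
    Z.∑ N′ (λ u → χ (cubic u)) ∎

  N<p-1 : N < p-1
  N<p-1 = 2-even-N

  cubic-unit : ∀ u → u < N′ → Unit± (χ (cubic u))
  cubic-unit u u<N′ = χ-unit {cubic u} (λ e → p∤-* (p∤-* (p∤ (λ ()) 1+u<p) (p∤ (λ ()) 2+u<p)) (p∤ (λ ()) 3+u<p) (≈0⇒∣ (ℤ.+ (suc u ℕ.* suc (suc u) ℕ.* suc (suc (suc u)))) (≈-trans (≈-reflexive (trans (ιℤ-pos (suc u ℕ.* suc (suc u) ℕ.* suc (suc (suc u)))) (trans (ι-* (suc u ℕ.* suc (suc u)) (suc (suc (suc u)))) (trans (cong (_* ι (suc (suc (suc u)))) (ι-* (suc u) (suc (suc u)))) (sym (ι-cubic u)))))) e)))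
    where
    3+u<p : suc (suc (suc u)) < p
    3+u<p = subst (suc (suc (suc u)) <_) p≡1+p-1 (s≤s (ℕ.≤-trans (s≤s (subst (suc (suc u) ≤_) N-suc (s≤s u<N′))) N<p-1))
    2+u<p = ℕ.<-trans (ℕ.n<1+n (suc (suc u))) 3+u<p
    1+u<p = ℕ.<-trans (ℕ.n<1+n (suc u)) 2+u<p

  χ-∏ : ∀ m f → χ (Z.∏ m f) ≡ Z.∏ m (λ i → χ (f i))
  χ-∏ zero f = χ-1
  χ-∏ (suc m) f = trans (χ-* (Z.∏ m f) (f m)) (cong (ℤ._* χ (f m)) (χ-∏ m f))

  ιℤ-∏ : ∀ m f → ιℤ (Z.∏ m f) ≡ ∏ m (λ i → ιℤ (f i))
  ιℤ-∏ zero f = refl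
  ιℤ-∏ (suc m) f = trans (ιℤ-* (Z.∏ m f) (f m)) (cong (_* ιℤ (f m)) (ιℤ-∏ m f))

  private
    R : ℤ
    R = Z.∏ N′ cubic

    X F! : Carrier
    X = ιℤ R
    F! = factorial N

  -- The three runs of consecutive numbers multiply to (N - 1)!, N! and (N + 1)!/2.
  X-factorials : X * ι N * ι 2 ≡ F! * F! * F! * ι (suc N)
  X-factorials = begin
    X * ι N * ι 2 ≡⟨ cong (λ x → x * ι N * ι 2) (trans (ιℤ-∏ N′ cubic) (trans (∏-cong N′ ι-cubic) (trans (∏-* N′ _ _) (cong (_* T) (∏-* N′ _ _))))) ⟩
    factorial N′ * S * T * ι N * ι 2 ≡⟨ solve 5 (λ f s t n d → f :* s :* t :* n :* d := f :* n :* s :* (t :* d)) refl (factorial N′) S T (ι N) (ι 2) ⟩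
    factorial N′ * ι N * S * (T * ι 2) ≡⟨ cong₂ _*_ (cong₂ _*_ first second) third ⟩
    F! * F! * (F! * ι (suc N)) ≡⟨ sym (*-assoc _ _ _) ⟩
    F! * F! * F! * ι (suc N) ∎
    where
    S = ∏ N′ (λ u → ι (suc (suc u)))
    T = ∏ N′ (λ u → ι (suc (suc (suc u))))
    first : factorial N′ * ι N ≡ F!
    first = subst (λ m → factorial N′ * ι m ≡ factorial m) N-suc refl
    second : S ≡ F!
    second = trans (trans (solve 1 (λ s → s := (κ 1 :+ κ 0) :* s) refl S) (sym (∏-first N′ (λ u → ι (suc u))))) (cong factorial N-suc)
    third : T * ι 2 ≡ F! * ι (suc N)
    third = trans (trans (solve 1 (λ t → t :* κ 2 := (κ 1 :+ κ 0) :* (κ 2 :* t)) refl T) (sym (trans (∏-first (suc N′) (λ u → ι (suc u))) (cong (ι 1 *_) (∏-first N′ (λ u → ι (suc (suc u)))))))) (cong (λ m → factorial (suc m)) N-suc)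

  O-factorial : ∀ m → O (factorial m)
  O-factorial m = O-∏ m (λ i _ → O-ι (suc i))

  choose-p-1≈ : ∀ k → k ≤ p-1 → choose p-1 k ≈ -1^ k [ 1 ]
  choose-p-1≈ k k≤p-1 = ≈-trans (∏-≈ k (λ i i<k → *-O (O-ι (p-1 ∸ i)) (O-inv (p∤s i i<k))) (λ _ _ → neg-O O-1) factor) (≈-reflexive (∏-const k (- 1#)))
    where
    open ≈-Reasoning
    p∤s : ∀ i → i < k → p ∤ suc i
    p∤s i i<k = p∤suc (ℕ.<-≤-trans i<k k≤p-1)
    factor : ∀ i → i < k → ι (p-1 ∸ i) * inv (ι (suc i)) ≈ - 1# [ 1 ]
    factor i i<k = begin≈
      ι (p-1 ∸ i) * inv (ι (suc i)) ≡≈⟨ cong (_* inv (ι (suc i))) (ι-∸ (ℕ.<⇒≤ (ℕ.<-≤-trans i<k k≤p-1))) ⟩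
      (ι p-1 - ι i) * inv (ι (suc i)) ≈⟨ ≈-*ʳ (inv (ι (suc i))) {{O-inv (p∤s i i<k)}} (≈-- p-1≈-1 ≈-refl) ⟩
      (- 1# - ι i) * inv (ι (suc i)) ≡≈⟨ solve 2 (λ i v → (⊝ κ 1 :- i) :* v := ⊝ ((κ 1 :+ i) :* v)) refl (ι i) (inv (ι (suc i))) ⟩
      - (ι (suc i) * inv (ι (suc i))) ≡≈⟨ cong -_ (*-invʳ _ (char-0 i)) ⟩
      - 1# ∎≈

  -- C(p - 1, N) N!² = (p - 1)!, where the binomial coefficient is (-1)^N = 1 modulo p and the
  -- right-hand side is -1 by Wilson's theorem.
  F!²≈-1 : F! * F! ≈ - 1# [ 1 ]
  F!²≈-1 = begin≈
    F! * F! ≡≈⟨ sym (*-identityˡ _) ⟩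
    1# * (F! * F!) ≈⟨ ≈-*ʳ (F! * F!) {{*-O (O-factorial N) (O-factorial N)}} (≈-sym choose≈1) ⟩
    choose p-1 N * (F! * F!) ≡≈⟨ trans (cong (λ m → choose p-1 N * (F! * factorial m)) (sym p-1∸N)) (choose-factorial p-1 N (ℕ.<⇒≤ N<p-1)) ⟩
    factorial p-1 ≈⟨ wilson ⟩
    - 1# ∎≈
    where
    open ≈-Reasoning
    p-1∸N : p-1 ∸ N ≡ N
    p-1∸N = trans (cong (_∸ N) p-1≡N+N) (ℕ.m+n∸m≡n N N)
    choose≈1 : choose p-1 N ≈ 1# [ 1 ]
    choose≈1 = ≈-trans (choose-p-1≈ N (ℕ.<⇒≤ N<p-1)) (≈-reflexive (-1^-double n))

  O-X : O X
  O-X = O-ιℤ R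

  -- As 2N ≡ -1 and 2(N + 1) ≡ 1, `X-factorials` reads -X ≡ N!³/2, and N!² ≡ -1.
  2X≈F! : ι 2 * X ≈ F! [ 1 ]
  2X≈F! = begin≈
    ι 2 * X ≡≈⟨ solve 1 (λ x → κ 2 :* x := ⊝ (κ 2 :* (x :* ⊝ κ 1))) refl X ⟩
    - (ι 2 * (X * - 1#)) ≈⟨ ≈-neg (≈-*ˡ (ι 2) {{O-ι 2}} (≈-*ˡ X {{O-X}} (≈-sym (≈-trans (≈-reflexive (trans (sym (ι-* 2 N)) (cong ι (sym p-1≡2N)))) p-1≈-1)))) ⟩
    - (ι 2 * (X * (ι 2 * ι N))) ≡≈⟨ cong -_ (trans (solve 2 (λ x m → κ 2 :* (x :* (κ 2 :* m)) := κ 2 :* (x :* m :* κ 2)) refl X (ι N)) (trans (cong (ι 2 *_) X-factorials) (solve 2 (λ f m → κ 2 :* (f :* f :* f :* m) := f :* f :* (f :* (κ 2 :* m))) refl F! (ι (suc N))))) ⟩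
    - (F! * F! * (F! * (ι 2 * ι (suc N)))) ≈⟨ ≈-neg (≈-* {{*-O (O-factorial N) (O-factorial N)}} {{*-O (O-factorial N) O-1}} F!²≈-1 (≈-*ˡ F! {{O-factorial N}} double≈1)) ⟩
    - (- 1# * (F! * 1#)) ≡≈⟨ solve 1 (λ f → ⊝ (⊝ κ 1 :* (f :* κ 1)) := f) refl F! ⟩
    F! ∎≈
    where
    open ≈-Reasoning
    double≈1 : ι 2 * ι (suc N) ≈ 1# [ 1 ]
    double≈1 = begin≈
      ι 2 * ι (suc N) ≡≈⟨ trans (solve 1 (λ m → κ 2 :* (κ 1 :+ m) := κ 1 :+ (κ 1 :+ κ 2 :* m)) refl (ι N)) (cong (λ x → 1# + (1# + x)) (trans (sym (ι-* 2 N)) (cong ι (sym p-1≡2N)))) ⟩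
      1# + ι (suc p-1) ≡≈⟨ cong (λ m → 1# + ι m) p≡1+p-1 ⟩
      1# + ι p ≈⟨ ≈-+ ≈-refl p≈0 ⟩
      1# + 0# ≡≈⟨ +-identityʳ 1# ⟩
      1# ∎≈

  N≡n+n : N ≡ n ℕ.+ n
  N≡n+n = cong (n ℕ.+_) (ℕ.+-identityʳ n)

  2^N≈ : ι 2 ^ N ≈ -1^ n [ 1 ]
  2^N≈ = subst (λ m → ι 2 ^ m ≈ -1^ n [ 1 ]) (sym N≡n+n) (2-residue n n (trans (sym p≡1+p-1) (cong suc (trans p-1≡2N (cong (2 ℕ.*_) N≡n+n)))) (trans (cong factorial (sym N≡n+n)) (factorial-even n)))

  -- 2^N X^N ≡ N!^N = (N!²)^n ≡ (-1)^n, and 2^N is the same sign. It follows that the signs in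
  -- `half-cubic` multiply to 1.
  X^N≈1 : X ^ N ≈ 1# [ 1 ]
  X^N≈1 = begin≈
    X ^ N ≡≈⟨ trans (sym (*-identityˡ _)) (cong (_* X ^ N) (sym (-1^-square n))) ⟩
    -1^ n * -1^ n * X ^ N ≡≈⟨ *-assoc _ _ _ ⟩
    -1^ n * (-1^ n * X ^ N) ≈⟨ ≈-*ˡ (-1^ n) {{O--1^ n}} (≈-*ʳ (X ^ N) {{O-^ N O-X}} (≈-sym 2^N≈)) ⟩
    -1^ n * (ι 2 ^ N * X ^ N) ≡≈⟨ cong (-1^ n *_) (sym (^-distrib-* (ι 2) X N)) ⟩
    -1^ n * (ι 2 * X) ^ N ≈⟨ ≈-*ˡ (-1^ n) {{O--1^ n}} (≈-^ N {{*-O (O-ι 2) O-X}} {{O-factorial N}} 2X≈F!) ⟩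
    -1^ n * F! ^ N ≡≈⟨ cong (-1^ n *_) (trans (sym (^-assocʳ F! 2 n)) (cong (_^ n) (cong (F! *_) (*-identityʳ F!)))) ⟩
    -1^ n * (F! * F!) ^ n ≈⟨ ≈-*ˡ (-1^ n) {{O--1^ n}} (≈-^ n {{*-O (O-factorial N) (O-factorial N)}} {{neg-O O-1}} F!²≈-1) ⟩
    -1^ n * -1^ n ≡≈⟨ -1^-square n ⟩
    1# ∎≈
    where open ≈-Reasoning

  half-mod-4 : ∃ λ q → half ℤ.1ℤ ≡ ℤ.+ N′ ℤ.+ ℤ.+ 4 ℤ.* q
  half-mod-4 = q , trans half-cubic (trans eq (trans (cong (λ z → ℤ.+ N′ ℤ.- ℤ.1ℤ ℤ.+ z ℤ.+ ℤ.+ 4 ℤ.* q) product) (cancel (ℤ.+ N′) q)))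
    where
    sums = sum-of-signs N′ (λ u → χ (cubic u)) cubic-unit
    q = proj₁ (proj₂ sums)
    eq = proj₂ (proj₂ sums)
    product : Z.∏ N′ (λ u → χ (cubic u)) ≡ ℤ.1ℤ
    product = trans (sym (χ-∏ N′ cubic)) (χ-unique {R} plus (≈-sym X^N≈1))
    cancel : ∀ m q → m ℤ.- ℤ.1ℤ ℤ.+ ℤ.1ℤ ℤ.+ ℤ.+ 4 ℤ.* q ≡ m ℤ.+ ℤ.+ 4 ℤ.* q
    cancel = Z.solve 2 (λ m q → m Z.:- Z.κ 1 Z.:+ Z.κ 1 Z.:+ Z.κ 4 Z.:* q Z.:= m Z.:+ Z.κ 4 Z.:* q) refl

  half-odd : half ℤ.1ℤ ≡ ℤ.-1ℤ ℤ.+ ℤ.+ 2 ℤ.* ℤ.+ n ℤ.+ ℤ.+ 4 ℤ.* proj₁ half-mod-4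
  half-odd = trans (proj₂ half-mod-4) (cong (λ z → z ℤ.+ ℤ.+ 4 ℤ.* proj₁ half-mod-4) (trans (add-sub (ℤ.+ N′)) (cong (λ z → ℤ.-1ℤ ℤ.+ z) (trans (cong ℤ.+_ N-suc) (ℤ.pos-* 2 n)))))
    where
    add-sub : ∀ m → m ≡ ℤ.-1ℤ ℤ.+ (ℤ.1ℤ ℤ.+ m)
    add-sub = Z.solve 1 (λ m → m Z.:= Z.⊝ Z.κ 1 Z.:+ (Z.κ 1 Z.:+ m)) refl

  -- Uniqueness of the representation gives ± x. The half sum is 2n - 1 and x is 1 modulo 4, so the
  -- parity of n decides the sign.
  half-value : ∀ x y → ℤ.+ p ≡ x ℤ.* x ℤ.+ y ℤ.* y → (x′ : ℤ) → x ≡ ℤ.1ℤ ℤ.+ ℤ.+ 4 ℤ.* x′ → ιℤ (half ℤ.1ℤ) ≡ - (-1^ n * ιℤ x)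
  half-value x y p≡ x′ x-eq = by-sign (parity-ℕ n) (two-squares-unique {half ℤ.1ℤ} {half (ℤ.+ g)} {x} {y} {a′} {ℤ.+ 2 ℤ.* x′} half-squares (sym p≡)
      (trans half-odd (odd-form (ℤ.+ n) q)) (trans x-eq (cong (λ z → ℤ.1ℤ ℤ.+ z) (four x′))))
    where
    q = proj₁ half-mod-4
    a′ = ℤ.+ n ℤ.- ℤ.1ℤ ℤ.+ ℤ.+ 2 ℤ.* q
    four : ∀ x → ℤ.+ 4 ℤ.* x ≡ ℤ.+ 2 ℤ.* (ℤ.+ 2 ℤ.* x)
    four = Z.solve 1 (λ x → Z.κ 4 Z.:* x Z.:= Z.κ 2 Z.:* (Z.κ 2 Z.:* x)) refl
    odd-form : ∀ n q → ℤ.-1ℤ ℤ.+ ℤ.+ 2 ℤ.* n ℤ.+ ℤ.+ 4 ℤ.* q ≡ ℤ.1ℤ ℤ.+ ℤ.+ 2 ℤ.* (n ℤ.- ℤ.1ℤ ℤ.+ ℤ.+ 2 ℤ.* q)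
    odd-form = Z.solve 2 (λ n q → Z.⊝ Z.κ 1 Z.:+ Z.κ 2 Z.:* n Z.:+ Z.κ 4 Z.:* q Z.:= Z.κ 1 Z.:+ Z.κ 2 Z.:* (n Z.:- Z.κ 1 Z.:+ Z.κ 2 Z.:* q)) refl
    p-odd : ℤ.+ p ≡ ℤ.1ℤ ℤ.+ ℤ.+ 2 ℤ.* ℤ.+ N
    p-odd = trans (cong ℤ.+_ (trans (sym p≡1+p-1) (cong suc p-1≡2N))) (cong (λ z → ℤ.1ℤ ℤ.+ z) (ℤ.pos-* 2 N))
    open TwoSquares p p-prime (ℤ.+ N) p-odd
    clash : ∀ s t → ℤ.+ 2 ℤ.* (ℤ.1ℤ ℤ.+ ℤ.+ 2 ℤ.* s) ≢ ℤ.+ 2 ℤ.* (ℤ.+ 2 ℤ.* t)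
    clash s t h = odd≢even s t (ℤ.*-cancelˡ-≡ (ℤ.+ 2) _ _ h)
    even-n : ∀ k → n ≡ 2 ℕ.* k → half ℤ.1ℤ ≡ x → ⊥
    even-n k e h = clash x′ (ℤ.+ k ℤ.+ q) (rearrange (ℤ.+ k) q x′ (trans (sym (trans half-odd (cong (λ m → ℤ.-1ℤ ℤ.+ ℤ.+ 2 ℤ.* m ℤ.+ ℤ.+ 4 ℤ.* q) (trans (cong ℤ.+_ e) (ℤ.pos-* 2 k))))) (trans h x-eq)))
      where
      rearrange : ∀ k q x → ℤ.-1ℤ ℤ.+ ℤ.+ 2 ℤ.* (ℤ.+ 2 ℤ.* k) ℤ.+ ℤ.+ 4 ℤ.* q ≡ ℤ.1ℤ ℤ.+ ℤ.+ 4 ℤ.* x → ℤ.+ 2 ℤ.* (ℤ.1ℤ ℤ.+ ℤ.+ 2 ℤ.* x) ≡ ℤ.+ 2 ℤ.* (ℤ.+ 2 ℤ.* (k ℤ.+ q))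
      rearrange k q x h = trans (Z.solve 1 (λ x → Z.κ 2 Z.:* (Z.κ 1 Z.:+ Z.κ 2 Z.:* x) Z.:= Z.κ 1 Z.:+ Z.κ 4 Z.:* x Z.:+ Z.κ 1) refl x) (trans (cong (ℤ._+ ℤ.1ℤ) (sym h))
        (Z.solve 2 (λ k q → Z.⊝ Z.κ 1 Z.:+ Z.κ 2 Z.:* (Z.κ 2 Z.:* k) Z.:+ Z.κ 4 Z.:* q Z.:+ Z.κ 1 Z.:= Z.κ 2 Z.:* (Z.κ 2 Z.:* (k Z.:+ q))) refl k q))
    odd-n : ∀ k → n ≡ suc (2 ℕ.* k) → half ℤ.1ℤ ≡ ℤ.- x → ⊥
    odd-n k e h = clash (ℤ.+ k ℤ.+ q) (ℤ.- x′) (rearrange (ℤ.+ k) q x′ (trans (sym (trans half-odd (cong (λ m → ℤ.-1ℤ ℤ.+ ℤ.+ 2 ℤ.* m ℤ.+ ℤ.+ 4 ℤ.* q) (trans (cong ℤ.+_ e) (cong (λ z → ℤ.1ℤ ℤ.+ z) (ℤ.pos-* 2 k)))))) (trans h (cong ℤ.-_ x-eq))))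
      where
      rearrange : ∀ k q x → ℤ.-1ℤ ℤ.+ ℤ.+ 2 ℤ.* (ℤ.1ℤ ℤ.+ ℤ.+ 2 ℤ.* k) ℤ.+ ℤ.+ 4 ℤ.* q ≡ ℤ.- (ℤ.1ℤ ℤ.+ ℤ.+ 4 ℤ.* x) → ℤ.+ 2 ℤ.* (ℤ.1ℤ ℤ.+ ℤ.+ 2 ℤ.* (k ℤ.+ q)) ≡ ℤ.+ 2 ℤ.* (ℤ.+ 2 ℤ.* (ℤ.- x))
      rearrange k q x h = trans (Z.solve 2 (λ k q → Z.κ 2 Z.:* (Z.κ 1 Z.:+ Z.κ 2 Z.:* (k Z.:+ q)) Z.:= Z.⊝ Z.κ 1 Z.:+ Z.κ 2 Z.:* (Z.κ 1 Z.:+ Z.κ 2 Z.:* k) Z.:+ Z.κ 4 Z.:* q Z.:+ Z.κ 1) refl k q) (trans (cong (ℤ._+ ℤ.1ℤ) h)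
        (Z.solve 1 (λ x → Z.⊝ (Z.κ 1 Z.:+ Z.κ 4 Z.:* x) Z.:+ Z.κ 1 Z.:= Z.κ 2 Z.:* (Z.κ 2 Z.:* Z.⊝ x)) refl x))
    by-sign : (∃ λ k → n ≡ 2 ℕ.* k ⊎ n ≡ suc (2 ℕ.* k)) → half ℤ.1ℤ ≡ x ⊎ half ℤ.1ℤ ≡ ℤ.- x → ιℤ (half ℤ.1ℤ) ≡ - (-1^ n * ιℤ x)
    by-sign (k , inj₁ e) (inj₁ h) = ⊥-elim (even-n k e h)
    by-sign (k , inj₁ e) (inj₂ h) = trans (cong ιℤ h) (trans (ιℤ-neg x) (cong -_ (trans (sym (*-identityˡ _)) (cong (_* ιℤ x) (sym (trans (cong -1^ e) (-1^-double k)))))))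
    by-sign (k , inj₂ e) (inj₁ h) = trans (cong ιℤ h) (trans (solve 1 (λ x → x := ⊝ (⊝ κ 1 :* κ 1 :* x)) refl (ιℤ x)) (cong (λ s → - (s * ιℤ x)) (sym (trans (cong -1^ e) (cong (- 1# *_) (-1^-double k))))))
    by-sign (k , inj₂ e) (inj₂ h) = ⊥-elim (odd-n k e h)

-- Alternating binomial sums with reciprocals

module BinomialSums (F : Field) where
  open FieldTheory F
  open ≡-Reasoning

  C-step : ∀ m k → ι (suc k) * ι (m C suc k) ≡ (ι m - ι k) * ι (m C k)
  C-step m k = begin
    ι (suc k) * ι (m C suc k) ≡⟨ solve 3 (λ k x y → (κ 1 :+ k) :* y := (κ 1 :+ k) :* (x :+ y) :- (κ 1 :+ k) :* x) refl (ι k) (ι (m C k)) (ι (m C suc k)) ⟩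
    ι (suc k) * (ι (m C k) + ι (m C suc k)) - ι (suc k) * ι (m C k) ≡⟨ cong (_- ι (suc k) * ι (m C k)) (begin
      ι (suc k) * (ι (m C k) + ι (m C suc k)) ≡⟨ cong (ι (suc k) *_) (trans (sym (ι-+ (m C k) (m C suc k))) (cong ι (nCk+nC[k+1]≡[n+1]C[k+1] m k))) ⟩
      ι (suc k) * ι (suc m C suc k) ≡⟨ sym (ι-* (suc k) (suc m C suc k)) ⟩
      ι (suc k ℕ.* (suc m C suc k)) ≡⟨ cong ι (absorption m k) ⟩
      ι (suc m ℕ.* (m C k)) ≡⟨ ι-* (suc m) (m C k) ⟩
      ι (suc m) * ι (m C k) ∎) ⟩
    ι (suc m) * ι (m C k) - ι (suc k) * ι (m C k) ≡⟨ solve 3 (λ m k x → (κ 1 :+ m) :* x :- (κ 1 :+ k) :* x := (m :- k) :* x) refl (ι m) (ι k) (ι (m C k)) ⟩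
    (ι m - ι k) * ι (m C k) ∎

  module _ (M : ℕ) where
    signed : ℕ → Carrier
    signed k = (- 1#) ^ k * ι (M C k)

    signed-step : ∀ k → ι (suc k) * signed (suc k) ≡ - ((ι M - ι k) * signed k)
    signed-step k = begin
      ι (suc k) * (- 1# * (- 1#) ^ k * ι (M C suc k)) ≡⟨ solve 3 (λ s e x → s :* (⊝ κ 1 :* e :* x) := ⊝ (e :* (s :* x))) refl (ι (suc k)) ((- 1#) ^ k) (ι (M C suc k)) ⟩
      - ((- 1#) ^ k * (ι (suc k) * ι (M C suc k))) ≡⟨ cong (λ x → - ((- 1#) ^ k * x)) (C-step M k) ⟩
      - ((- 1#) ^ k * ((ι M - ι k) * ι (M C k))) ≡⟨ solve 3 (λ e d x → ⊝ (e :* (d :* x)) := ⊝ (d :* (e :* x))) refl ((- 1#) ^ k) (ι M - ι k) (ι (M C k)) ⟩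
      - ((ι M - ι k) * signed k) ∎

    -- The coefficient of z^m in -(1 - z)^M log (1 - z).
    logarithmic : ℕ → Carrier
    logarithmic m = ∑ m (λ k → signed k * inv (ι (m ∸ k)))

    ∸-≢0 : ∀ {m k} → k < m → ι (m ∸ k) ≢ 0#
    ∸-≢0 {m} {k} k<m = ι-≢0 (m ∸ k) (λ e → ℕ.<⇒≱ k<m (ℕ.m∸n≡0⇒m≤n e))

    -- Coefficients of the differential equation (1 - z) L' = (1 - z)^M - M L for L = -(1 - z)^M log
    -- (1 - z).
    logarithmic-step : ∀ m → ι (suc m) * logarithmic (suc m) ≡ signed m - (ι M - ι m) * logarithmic m
    logarithmic-step m = begin
      ι (suc m) * logarithmic (suc m) ≡⟨ trans (sym (∑-*ˡ (suc m) (ι (suc m)) _)) (∑-cong< (suc m) split) ⟩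
      ∑ (suc m) (λ k → signed k + ι k * signed k * inv (ι (suc m ∸ k))) ≡⟨ ∑-+ (suc m) _ _ ⟩
      ∑ (suc m) signed + ∑ (suc m) (λ k → ι k * signed k * inv (ι (suc m ∸ k))) ≡⟨ cong (∑ (suc m) signed +_) shifted ⟩
      ∑ (suc m) signed + - ((ι M - ι m) * logarithmic m + ∑ m signed) ≡⟨ solve 4 (λ S s d l → S :+ s :+ ⊝ (d :* l :+ S) := s :- d :* l) refl (∑ m signed) (signed m) (ι M - ι m) (logarithmic m) ⟩
      signed m - (ι M - ι m) * logarithmic m ∎
      where
      split : ∀ k → k < suc m → ι (suc m) * (signed k * inv (ι (suc m ∸ k))) ≡ signed k + ι k * signed k * inv (ι (suc m ∸ k))
      split k k<1+m = begin
        ι (suc m) * (signed k * v) ≡⟨ solve 4 (λ m k s v → m :* (s :* v) := s :* ((m :- k) :* v) :+ k :* s :* v) refl (ι (suc m)) (ι k) (signed k) v ⟩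
        signed k * ((ι (suc m) - ι k) * v) + ι k * signed k * v ≡⟨ cong (λ x → signed k * (x * v) + ι k * signed k * v) (sym (ι-∸ (ℕ.<⇒≤ k<1+m))) ⟩
        signed k * (ι (suc m ∸ k) * v) + ι k * signed k * v ≡⟨ cong (λ x → signed k * x + ι k * signed k * v) (*-invʳ _ (∸-≢0 k<1+m)) ⟩
        signed k * 1# + ι k * signed k * v ≡⟨ cong (_+ ι k * signed k * v) (*-identityʳ _) ⟩
        signed k + ι k * signed k * v ∎
        where v = inv (ι (suc m ∸ k))
      shifted : ∑ (suc m) (λ k → ι k * signed k * inv (ι (suc m ∸ k))) ≡ - ((ι M - ι m) * logarithmic m + ∑ m signed)
      shifted = begin
        ∑ (suc m) (λ k → ι k * signed k * inv (ι (suc m ∸ k))) ≡⟨ ∑-first m _ ⟩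
        0# * signed 0 * inv (ι (suc m)) + ∑ m (λ k → ι (suc k) * signed (suc k) * inv (ι (m ∸ k))) ≡⟨ cong₂ _+_ (solve 2 (λ x y → κ 0 :* x :* y := κ 0) refl (signed 0) (inv (ι (suc m)))) (∑-cong< m term) ⟩
        0# + ∑ m (λ k → - ((ι M - ι m) * (signed k * inv (ι (m ∸ k))) + signed k)) ≡⟨ trans (+-identityˡ _) (trans (∑-neg m _) (cong -_ (trans (∑-+ m _ _) (cong (_+ ∑ m signed) (∑-*ˡ m _ _))))) ⟩
        - ((ι M - ι m) * logarithmic m + ∑ m signed) ∎
        where
        term : ∀ k → k < m → ι (suc k) * signed (suc k) * inv (ι (m ∸ k)) ≡ - ((ι M - ι m) * (signed k * inv (ι (m ∸ k))) + signed k)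
        term k k<m = begin
          ι (suc k) * signed (suc k) * v ≡⟨ cong (_* v) (signed-step k) ⟩
          - ((ι M - ι k) * signed k) * v ≡⟨ solve 5 (λ M m k s v → ⊝ ((M :- k) :* s) :* v := ⊝ ((M :- m) :* (s :* v) :+ s :* ((m :- k) :* v))) refl (ι M) (ι m) (ι k) (signed k) v ⟩
          - ((ι M - ι m) * (signed k * v) + signed k * ((ι m - ι k) * v)) ≡⟨ cong (λ x → - ((ι M - ι m) * (signed k * v) + signed k * (x * v))) (sym (ι-∸ (ℕ.<⇒≤ k<m))) ⟩
          - ((ι M - ι m) * (signed k * v) + signed k * (ι (m ∸ k) * v)) ≡⟨ cong (λ x → - ((ι M - ι m) * (signed k * v) + x)) (trans (cong (signed k *_) (*-invʳ _ (∸-≢0 k<m))) (*-identityʳ _)) ⟩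
          - ((ι M - ι m) * (signed k * v) + signed k) ∎
          where v = inv (ι (m ∸ k))

    -- L is minus the derivative of (1 - z)^M in the exponent M. Logarithmic differentiation of M(M
    -- - 1)⋯(M - m + 1) produces the sum of the 1/(M - i).
    logarithmic-closed : ∀ m → m ≤ M → logarithmic m ≡ - (signed m * ∑ m (λ i → inv (ι (M ∸ i))))
    logarithmic-closed zero _ = solve 1 (λ x → κ 0 := ⊝ (x :* κ 0)) refl (signed 0)
    logarithmic-closed (suc m) m<M = *-cancelˡ (char-0 m) (begin
      ι (suc m) * logarithmic (suc m) ≡⟨ logarithmic-step m ⟩
      signed m - d * logarithmic m ≡⟨ cong (λ x → signed m - d * x) (logarithmic-closed m (ℕ.<⇒≤ m<M)) ⟩
      signed m - d * - (signed m * h) ≡⟨ solve 3 (λ s d h → s :- d :* ⊝ (s :* h) := s :* κ 1 :+ d :* s :* h) refl (signed m) d h ⟩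
      signed m * 1# + d * signed m * h ≡⟨ cong (λ x → signed m * x + d * signed m * h) (sym (trans (cong (_* v) (sym (ι-∸ (ℕ.<⇒≤ m<M)))) (*-invʳ _ (∸-≢0 m<M)))) ⟩
      signed m * (d * v) + d * signed m * h ≡⟨ solve 4 (λ s d h v → s :* (d :* v) :+ d :* s :* h := ⊝ (⊝ (d :* s)) :* (h :+ v)) refl (signed m) d h v ⟩
      - - (d * signed m) * (h + v) ≡⟨ cong (λ x → - x * (h + v)) (sym (signed-step m)) ⟩
      - (ι (suc m) * signed (suc m)) * (h + v) ≡⟨ solve 3 (λ a b c → ⊝ (a :* b) :* c := a :* ⊝ (b :* c)) refl (ι (suc m)) (signed (suc m)) (h + v) ⟩
      ι (suc m) * - (signed (suc m) * (h + v)) ∎)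
      where
      d = ι M - ι m
      h = ∑ m (λ i → inv (ι (M ∸ i)))
      v = inv (ι (M ∸ m))

  signed-sum : ∀ M → ∑ (suc (suc M)) (signed (suc M)) ≡ 0#
  signed-sum M = trans (∑-cong (suc (suc M)) λ k → trans (*-comm _ _) (cong (ι (suc M C k) *_) (trans (sym (*-identityʳ _)) (cong ((- 1#) ^ k *_) (sym (1^ (suc M ∸ k)))))))
    (trans (sym (binomial-theorem (suc M) (- 1#) 1#)) (trans (cong (_* (- 1# + 1#) ^ M) (-‿inverseˡ 1#)) (zeroˡ _)))

  -- The expansion of M!/(X(X + 1)⋯(X + M)) at X = x + 1. Multiplying by X leads from M + 1 at X to
  -- M at X + 1, because the alternating sum of a binomial row vanishes.
  partial-fractions : ∀ M x → ∑ (suc M) (λ k → signed M k * inv (ι (suc x ℕ.+ k))) ≡ ∏ M (λ i → ι (suc i)) * ∏ (suc M) (λ k → inv (ι (suc x ℕ.+ k)))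
  partial-fractions zero x = solve 1 (λ v → κ 0 :+ κ 1 :* (κ 1 :+ κ 0) :* v := κ 1 :* (κ 1 :* v)) refl _
  partial-fractions (suc M) x = *-cancelˡ (char-0 x) (begin
    X * ∑ (suc (suc M)) (λ k → s k * inv (ι (suc x ℕ.+ k))) ≡⟨ trans (sym (∑-*ˡ (suc (suc M)) X _)) (∑-cong (suc (suc M)) split) ⟩
    ∑ (suc (suc M)) (λ k → s k - ι k * s k * inv (ι (suc x ℕ.+ k))) ≡⟨ trans (∑-- (suc (suc M)) _ _) (cong₂ _-_ (signed-sum M) (∑-first (suc M) _)) ⟩
    0# - (0# * s 0 * inv (ι (suc x ℕ.+ 0)) + ∑ (suc M) (λ k → ι (suc k) * s (suc k) * inv (ι (suc x ℕ.+ suc k)))) ≡⟨ cong (λ y → 0# - (0# * s 0 * inv (ι (suc x ℕ.+ 0)) + y)) (trans (∑-cong (suc M) shift) (∑-*ˡ (suc M) (- ι (suc M)) _)) ⟩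
    0# - (0# * s 0 * inv (ι (suc x ℕ.+ 0)) + - ι (suc M) * ∑ (suc M) (λ k → signed M k * inv (ι (suc (suc x) ℕ.+ k)))) ≡⟨ solve 4 (λ s v m S → κ 0 :- (κ 0 :* s :* v :+ ⊝ m :* S) := m :* S) refl (s 0) _ (ι (suc M)) _ ⟩
    ι (suc M) * ∑ (suc M) (λ k → signed M k * inv (ι (suc (suc x) ℕ.+ k))) ≡⟨ cong (ι (suc M) *_) (partial-fractions M (suc x)) ⟩
    ι (suc M) * (fac * tail) ≡⟨ solve 3 (λ m f t → m :* (f :* t) := κ 1 :* (f :* m :* t)) refl (ι (suc M)) fac tail ⟩
    1# * (fac * ι (suc M) * tail) ≡⟨ cong (_* (fac * ι (suc M) * tail)) (sym (*-invʳ X (char-0 x))) ⟩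
    X * inv X * (fac * ι (suc M) * tail) ≡⟨ solve 4 (λ x v f t → x :* v :* (f :* t) := x :* (f :* (v :* t))) refl X (inv X) (fac * ι (suc M)) tail ⟩
    X * (fac * ι (suc M) * (inv X * tail)) ≡⟨ cong (λ y → X * (fac * ι (suc M) * y)) (sym (trans (∏-first (suc M) (λ k → inv (ι (suc x ℕ.+ k)))) (cong₂ _*_ (cong (λ m → inv (ι m)) (ℕ.+-identityʳ (suc x))) (∏-cong (suc M) λ k → cong (λ m → inv (ι m)) (ℕ.+-suc (suc x) k))))) ⟩
    X * (fac * ι (suc M) * ∏ (suc (suc M)) (λ k → inv (ι (suc x ℕ.+ k)))) ∎)
    where
    X = ι (suc x)
    s = signed (suc M)
    fac = ∏ M (λ i → ι (suc i))
    tail = ∏ (suc M) (λ k → inv (ι (suc (suc x) ℕ.+ k)))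
    split : ∀ k → X * (s k * inv (ι (suc x ℕ.+ k))) ≡ s k - ι k * s k * inv (ι (suc x ℕ.+ k))
    split k = begin
      X * (s k * v) ≡⟨ solve 4 (λ x k s v → x :* (s :* v) := s :* ((x :+ k) :* v) :- k :* s :* v) refl X (ι k) (s k) v ⟩
      s k * ((X + ι k) * v) - ι k * s k * v ≡⟨ cong (λ y → s k * y - ι k * s k * v) (trans (cong (_* v) (sym (ι-+ (suc x) k))) (*-invʳ _ (char-0 (x ℕ.+ k)))) ⟩
      s k * 1# - ι k * s k * v ≡⟨ cong (_- ι k * s k * v) (*-identityʳ _) ⟩
      s k - ι k * s k * v ∎
      where v = inv (ι (suc x ℕ.+ k))
    shift : ∀ k → ι (suc k) * s (suc k) * inv (ι (suc x ℕ.+ suc k)) ≡ - ι (suc M) * (signed M k * inv (ι (suc (suc x) ℕ.+ k)))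
    shift k = begin
      ι (suc k) * (- 1# * (- 1#) ^ k * ι (suc M C suc k)) * inv (ι (suc x ℕ.+ suc k)) ≡⟨ cong (λ m → ι (suc k) * (- 1# * (- 1#) ^ k * ι (suc M C suc k)) * inv (ι m)) (ℕ.+-suc (suc x) k) ⟩
      ι (suc k) * (- 1# * (- 1#) ^ k * ι (suc M C suc k)) * v ≡⟨ solve 4 (λ m e c v → m :* (⊝ κ 1 :* e :* c) :* v := ⊝ (m :* c) :* (e :* v)) refl (ι (suc k)) ((- 1#) ^ k) (ι (suc M C suc k)) v ⟩
      - (ι (suc k) * ι (suc M C suc k)) * ((- 1#) ^ k * v) ≡⟨ cong (λ y → - y * ((- 1#) ^ k * v)) (trans (sym (ι-* (suc k) (suc M C suc k))) (trans (cong ι (absorption M k)) (ι-* (suc M) (M C k)))) ⟩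
      - (ι (suc M) * ι (M C k)) * ((- 1#) ^ k * v) ≡⟨ solve 4 (λ m e c v → ⊝ (m :* c) :* (e :* v) := ⊝ m :* (e :* c :* v)) refl (ι (suc M)) ((- 1#) ^ k) (ι (M C k)) v ⟩
      - ι (suc M) * (signed M k * v) ∎
      where v = inv (ι (suc (suc x) ℕ.+ k))

-- The Jacobsthal sum modulo p²

module JacobsthalModP² (F : Field) (p : ℕ) (L : Localisation F p) (p-prime : Prime p) (3<p : 3 < p)
  (n : ℕ) (p≡4n+1 : p ≡ suc (4 ℕ.* n)) where
  open JacobsthalValue F p L p-prime 3<p n p≡4n+1 public
  open BinomialSums F
  open ≡-Reasoning

  ∑-single-≈ : ∀ m {f l} k → k < m → (∀ i → i < m → i ≢ k → f i ≈ 0# [ l ]) → ∑ m f ≈ f k [ l ]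
  ∑-single-≈ (suc m) {f} {l} k k<m h = cases (ℕ.m≤n⇒m<n∨m≡n (ℕ.≤-pred k<m))
    where
    h′ : ∀ i → i < m → i ≢ k → f i ≈ 0# [ l ]
    h′ i i<m = h i (ℕ.m<n⇒m<1+n i<m)
    cases : k < m ⊎ k ≡ m → ∑ (suc m) f ≈ f k [ l ]
    cases (inj₁ k<m) = ≈-trans (≈-+ (∑-single-≈ m k k<m h′) (h m ℕ.≤-refl λ e → ℕ.<-irrefl (sym e) k<m)) (≈-reflexive (+-identityʳ _))
    cases (inj₂ refl) = ≈-trans (≈-+ (∑-≈0 m λ i i<m → h′ i i<m λ e → ℕ.<-irrefl e i<m) ≈-refl) (≈-reflexive (+-identityˡ _))

  sign-^p : ∀ {e} → Sign₃ e → ιℤ e ^ p ≡ ιℤ e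
  sign-^p null = subst (λ q → 0# ^ q ≡ 0#) p≡1+p-1 (zeroˡ _)
  sign-^p plus = 1^ p
  sign-^p minus = trans (cong (_^ p) -1≡) (trans (subst (λ q → -1^ q ≡ - 1#) p≡1+p-1 (trans (cong (- 1# *_) (trans (cong -1^ p-1≡2N) (-1^-double N))) (*-identityʳ _))) (sym -1≡))
    where
    -1≡ : ιℤ ℤ.-1ℤ ≡ - 1#
    -1≡ = cong -_ (+-identityʳ 1#)

  -- A sign equals its own p-th power, and p-th powers lift Euler's criterion from p to p².
  χ-lift : ∀ z {w} → O w → ιℤ z ≈ w [ 1 ] → ιℤ (χ z) ≈ (w ^ N) ^ p [ 2 ]
  χ-lift z {w} Ow e = ≈-trans (≈-reflexive (sym (sign-^p (χ-sign z)))) (^p-lift (O-ιℤ (χ z)) (O-^ N Ow) (≈-trans (χ≈ z) (≈-^ N {{O-ιℤ z}} {{Ow}} e)))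

  ^-swap : ∀ x m k → (x ^ m) ^ k ≡ (x ^ k) ^ m
  ^-swap x m k = trans (^-assocʳ x m k) (trans (cong (x ^_) (ℕ.*-comm m k)) (sym (^-assocʳ x k m)))

  χ-ω : ∀ u → ιℤ (χ (ℤ.+ u)) ≈ ω u ^ N [ 2 ]
  χ-ω u = ≈-trans (χ-lift (ℤ.+ u) (O-ι u) (≈-reflexive (ιℤ-pos u))) (≈-reflexive (^-swap (ι u) N p))

  -- ((x² - 1)^p - (x² - 1)) / p modulo p at a Teichmüller representative x.
  quotient : Carrier → Carrier
  quotient x = ∑ p-1 (λ i → inv (ι (suc i)) * (x ^ 2) ^ suc i)

  O-quotient : ∀ {x} → O x → O (quotient x)
  O-quotient Ox = O-∑ p-1 λ i i<p-1 → *-O (O-inv (p∤suc i<p-1)) (O-^ (suc i) (O-^ 2 Ox))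

  pC≈ : ∀ i → i < p-1 → ι (p C suc i) * -1^ (p ∸ suc i) ≈ ι p * inv (ι (suc i)) [ 2 ]
  pC≈ i i<p-1 = begin≈
    ι (p C suc i) * -1^ (p ∸ suc i) ≡≈⟨ cong₂ _*_ pC-eq (cong -1^ (cong (_∸ suc i) (sym p≡1+p-1))) ⟩
    ι p * (inv (ι (suc i)) * ι (p-1 C i)) * -1^ (p-1 ∸ i) ≡≈⟨ solve 4 (λ p v c e → p :* (v :* c) :* e := p :* (v :* (c :* e))) refl (ι p) (inv (ι (suc i))) (ι (p-1 C i)) (-1^ (p-1 ∸ i)) ⟩
    ι p * (inv (ι (suc i)) * (ι (p-1 C i) * -1^ (p-1 ∸ i))) ≈⟨ ≈-scale {{*-O O-v (*-O (O-ι (p-1 C i)) (O--1^ (p-1 ∸ i)))}} p≈0 (≈-*ˡ (inv (ι (suc i))) {{O-v}} unit) ⟩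
    ι p * (inv (ι (suc i)) * 1#) ≡≈⟨ cong (ι p *_) (*-identityʳ _) ⟩
    ι p * inv (ι (suc i)) ∎≈
    where
    open ≈-Reasoning
    O-v = O-inv (p∤suc i<p-1)
    pC-eq : ι (p C suc i) ≡ ι p * (inv (ι (suc i)) * ι (p-1 C i))
    pC-eq = *-cancelˡ (char-0 i) (begin
      ι (suc i) * ι (p C suc i) ≡⟨ sym (ι-* (suc i) (p C suc i)) ⟩
      ι (suc i ℕ.* (p C suc i)) ≡⟨ cong ι (subst (λ q → suc i ℕ.* (q C suc i) ≡ q ℕ.* (p-1 C i)) p≡1+p-1 (absorption p-1 i)) ⟩
      ι (p ℕ.* (p-1 C i)) ≡⟨ ι-* p (p-1 C i) ⟩
      ι p * ι (p-1 C i) ≡⟨ sym (*-identityˡ _) ⟩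
      1# * (ι p * ι (p-1 C i)) ≡⟨ cong (_* (ι p * ι (p-1 C i))) (sym (*-invʳ _ (char-0 i))) ⟩
      ι (suc i) * inv (ι (suc i)) * (ι p * ι (p-1 C i)) ≡⟨ solve 4 (λ s v p c → s :* v :* (p :* c) := s :* (p :* (v :* c))) refl (ι (suc i)) (inv (ι (suc i))) (ι p) (ι (p-1 C i)) ⟩
      ι (suc i) * (ι p * (inv (ι (suc i)) * ι (p-1 C i))) ∎)
    unit : ι (p-1 C i) * -1^ (p-1 ∸ i) ≈ 1# [ 1 ]
    unit = begin≈
      ι (p-1 C i) * -1^ (p-1 ∸ i) ≈⟨ ≈-*ʳ (-1^ (p-1 ∸ i)) {{O--1^ (p-1 ∸ i)}} ([p-1]C≈ i (subst (i <_) p≡1+p-1 (ℕ.m<n⇒m<1+n i<p-1))) ⟩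
      -1^ i * -1^ (p-1 ∸ i) ≡≈⟨ trans (cong (-1^ i *_) (trans (-1^-∸ (ℕ.<⇒≤ i<p-1)) (trans (cong (_* -1^ i) (trans (cong -1^ p-1≡2N) (-1^-double N))) (*-identityˡ _)))) (-1^-square i) ⟩
      1# ∎≈

  O-ω²-1 : ∀ u → O (ω u ^ 2 - 1#)
  O-ω²-1 u = +-O (O-^ 2 (O-ω u)) (neg-O O-1)

  -- ω² - 1 is not a Teichmüller representative, and `quotient` measures the failure. In the
  -- binomial expansion the end terms persist as ω^p ≡ ω modulo p², and C(p, i + 1) is p/(i + 1) up
  -- to sign.
  ω²-1^p : ∀ u → (ω u ^ 2 - 1#) ^ p ≈ (ω u ^ 2 - 1#) + ι p * quotient (ω u) [ 2 ]
  ω²-1^p u = begin≈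
    (w² - 1#) ^ p ≡≈⟨ binomial-theorem p w² (- 1#) ⟩
    ∑ p T + T p ≡≈⟨ cong (λ q → ∑ q T + T p) (sym p≡1+p-1) ⟩
    ∑ (suc p-1) T + T p ≡≈⟨ cong (_+ T p) (∑-first p-1 T) ⟩
    T 0 + ∑ p-1 (λ i → T (suc i)) + T p ≈⟨ ≈-+ (≈-+ (≈-reflexive T-0) (∑-≈ p-1 middle)) T-p ⟩
    - 1# + ∑ p-1 (λ i → ι p * (inv (ι (suc i)) * w² ^ suc i)) + w² ≡≈⟨ cong (λ x → - 1# + x + w²) (∑-*ˡ p-1 (ι p) _) ⟩
    - 1# + ι p * quotient (ω u) + w² ≡≈⟨ solve 2 (λ g w → ⊝ κ 1 :+ g :+ w := w :- κ 1 :+ g) refl (ι p * quotient (ω u)) w² ⟩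
    (w² - 1#) + ι p * quotient (ω u) ∎≈
    where
    open ≈-Reasoning
    w² = ω u ^ 2
    T : ℕ → Carrier
    T k = ι (p C k) * (w² ^ k * -1^ (p ∸ k))
    T-0 : T 0 ≡ - 1#
    T-0 = trans (cong₂ (λ x y → x * (1# * y)) (+-identityʳ 1#) (trans (cong -1^ (sym p≡1+p-1)) (cong (- 1# *_) (trans (cong -1^ p-1≡2N) (-1^-double N))))) (solve 0 (κ 1 :* (κ 1 :* (⊝ κ 1 :* κ 1)) := ⊝ κ 1) refl)
    T-p : T p ≈ w² [ 2 ]
    T-p = begin≈
      ι (p C p) * (w² ^ p * -1^ (p ∸ p)) ≡≈⟨ cong₂ (λ x y → ι x * (w² ^ p * -1^ y)) (nCn≡1 p) (ℕ.n∸n≡0 p) ⟩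
      ι 1 * (w² ^ p * 1#) ≡≈⟨ solve 1 (λ x → (κ 1 :+ κ 0) :* (x :* κ 1) := x) refl (w² ^ p) ⟩
      w² ^ p ≡≈⟨ ^-swap (ω u) 2 p ⟩
      (ω u ^ p) ^ 2 ≈⟨ ≈-^ 2 {{O-^ p (O-ω u)}} {{O-ω u}} (ω^p u) ⟩
      w² ∎≈
    middle : ∀ i → i < p-1 → T (suc i) ≈ ι p * (inv (ι (suc i)) * w² ^ suc i) [ 2 ]
    middle i i<p-1 = begin≈
      ι (p C suc i) * (w² ^ suc i * -1^ (p ∸ suc i)) ≡≈⟨ solve 3 (λ c w e → c :* (w :* e) := c :* e :* w) refl (ι (p C suc i)) (w² ^ suc i) (-1^ (p ∸ suc i)) ⟩
      ι (p C suc i) * -1^ (p ∸ suc i) * w² ^ suc i ≈⟨ ≈-*ʳ (w² ^ suc i) {{O-^ (suc i) (O-^ 2 (O-ω u))}} (pC≈ i i<p-1) ⟩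
      ι p * inv (ι (suc i)) * w² ^ suc i ≡≈⟨ *-assoc _ _ _ ⟩
      ι p * (inv (ι (suc i)) * w² ^ suc i) ∎≈

  linearise : ∀ {a b} → O a → O b → ∀ m → (a + ι p * b) ^ suc m ≈ a ^ suc m + ι p * (ι (suc m) * a ^ m * b) [ 2 ]
  linearise {a} {b} Oa Ob zero = ≈-reflexive (solve 3 (λ a b p → (a :+ p :* b) :* κ 1 := a :* κ 1 :+ p :* ((κ 1 :+ κ 0) :* κ 1 :* b)) refl a b (ι p))
  linearise {a} {b} Oa Ob (suc m) = begin≈
    (a + ι p * b) * (a + ι p * b) ^ suc m ≈⟨ ≈-*ˡ (a + ι p * b) {{+-O Oa (*-O O-p Ob)}} (linearise Oa Ob m) ⟩
    (a + ι p * b) * (a ^ suc m + ι p * (ι (suc m) * a ^ m * b)) ≡≈⟨ solve 5 (λ a b p y k → (a :+ p :* b) :* (a :* y :+ p :* (k :* y :* b)) := a :* (a :* y) :+ p :* ((κ 1 :+ k) :* (a :* y) :* b) :+ p :* p :* (k :* y :* b :* b)) refl a b (ι p) (a ^ m) (ι (suc m)) ⟩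
    a ^ suc (suc m) + ι p * (ι (suc (suc m)) * a ^ suc m * b) + ι p * ι p * (ι (suc m) * a ^ m * b * b) ≈⟨ ≈-+ ≈-refl (≈0-*ʳ (ι (suc m) * a ^ m * b * b) {{*-O (*-O (*-O (O-ι (suc m)) (O-^ m Oa)) Ob) Ob}} (≈0-* p≈0 p≈0)) ⟩
    a ^ suc (suc m) + ι p * (ι (suc (suc m)) * a ^ suc m * b) + 0# ≡≈⟨ +-identityʳ _ ⟩
    a ^ suc (suc m) + ι p * (ι (suc (suc m)) * a ^ suc m * b) ∎≈
    where open ≈-Reasoning

  main-part correction-part : Carrier
  main-part = ∑ p (λ u → ω u ^ N * (ω u ^ 2 - 1#) ^ N)
  correction-part = ∑ p (λ u → ι u ^ N * (ι u ^ 2 - 1#) ^ N′ * quotient (ι u))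

  -- The symbol of u² - 1 is the N-th power of (ω² - 1)^p. Linearising at ω² - 1 splits off a term
  -- with a factor p, in which `ω u` may be replaced by u.
  J-expansion : ιℤ (J ℤ.1ℤ) ≈ main-part + ι p * (ι N * correction-part) [ 2 ]
  J-expansion = begin≈
    ιℤ (J ℤ.1ℤ) ≡≈⟨ ιℤ-∑ p _ ⟩
    ∑ p (λ u → ιℤ (χ (ℤ.+ u) ℤ.* χ (sq u ℤ.- ℤ.1ℤ))) ≈⟨ ∑-≈ p (λ u _ → summand u) ⟩
    ∑ p (λ u → ω u ^ N * (ω u ^ 2 - 1#) ^ N + ι p * (ι N * (ι u ^ N * (ι u ^ 2 - 1#) ^ N′ * quotient (ι u)))) ≡≈⟨ trans (∑-+ p _ _) (cong (main-part +_) (trans (∑-*ˡ p (ι p) _) (cong (ι p *_) (∑-*ˡ p (ι N) _)))) ⟩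
    main-part + ι p * (ι N * correction-part) ∎≈
    where
    open ≈-Reasoning
    summand : ∀ u → ιℤ (χ (ℤ.+ u) ℤ.* χ (sq u ℤ.- ℤ.1ℤ)) ≈ ω u ^ N * (ω u ^ 2 - 1#) ^ N + ι p * (ι N * (ι u ^ N * (ι u ^ 2 - 1#) ^ N′ * quotient (ι u))) [ 2 ]
    summand u = begin≈
      ιℤ (χ (ℤ.+ u) ℤ.* χ (sq u ℤ.- ℤ.1ℤ)) ≡≈⟨ ιℤ-* (χ (ℤ.+ u)) (χ (sq u ℤ.- ℤ.1ℤ)) ⟩
      ιℤ (χ (ℤ.+ u)) * ιℤ (χ (sq u ℤ.- ℤ.1ℤ)) ≈⟨ ≈-* {{O-ιℤ (χ (ℤ.+ u))}} {{O-^ N (O-^ p Oa)}} (χ-ω u) (≈-trans (χ-lift (sq u ℤ.- ℤ.1ℤ) Oa base) (≈-reflexive (^-swap a N p))) ⟩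
      ω u ^ N * (a ^ p) ^ N ≈⟨ ≈-*ˡ (ω u ^ N) {{O-^ N (O-ω u)}} (≈-^ N {{O-^ p Oa}} {{+-O Oa (*-O O-p Ob)}} (ω²-1^p u)) ⟩
      ω u ^ N * (a + ι p * b) ^ N ≈⟨ ≈-*ˡ (ω u ^ N) {{O-^ N (O-ω u)}} (subst (λ m → (a + ι p * b) ^ m ≈ a ^ m + ι p * (ι m * a ^ N′ * b) [ 2 ]) N-suc (linearise Oa Ob N′)) ⟩
      ω u ^ N * (a ^ N + ι p * (ι N * a ^ N′ * b)) ≡≈⟨ solve 6 (λ w a p k y b → w :* (a :+ p :* (k :* y :* b)) := w :* a :+ p :* (k :* (w :* y :* b))) refl (ω u ^ N) (a ^ N) (ι p) (ι N) (a ^ N′) b ⟩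
      ω u ^ N * a ^ N + ι p * (ι N * (ω u ^ N * a ^ N′ * b)) ≈⟨ ≈-+ ≈-refl (≈-scale {{*-O (O-ι N) (*-O (*-O (O-^ N (O-ω u)) (O-^ N′ Oa)) Ob)}} p≈0 (≈-*ˡ (ι N) {{O-ι N}} reduce)) ⟩
      ω u ^ N * a ^ N + ι p * (ι N * (ι u ^ N * (ι u ^ 2 - 1#) ^ N′ * quotient (ι u))) ∎≈
      where
      a = ω u ^ 2 - 1#
      b = quotient (ω u)
      Oa = O-ω²-1 u
      Ob = O-quotient (O-ω u)
      ωu : ω u ≈ ι u [ 1 ]
      ωu = fermat u
      a≈ : a ≈ ι u ^ 2 - 1# [ 1 ]
      a≈ = ≈-- (≈-^ 2 {{O-ω u}} {{O-ι u}} ωu) ≈-refl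
      base : ιℤ (sq u ℤ.- ℤ.1ℤ) ≈ a [ 1 ]
      base = ≈-trans (≈-reflexive (trans (ιℤ-- (sq u) ℤ.1ℤ) (cong (_- 1#) (trans (ιsq u) (cong (ι u *_) (sym (*-identityʳ (ι u)))))))) (≈-sym a≈)
      Ou²-1 : O (ι u ^ 2 - 1#)
      Ou²-1 = +-O (O-^ 2 (O-ι u)) (neg-O O-1)
      b≈ : b ≈ quotient (ι u) [ 1 ]
      b≈ = ∑-≈ p-1 λ i i<p-1 → ≈-*ˡ (inv (ι (suc i))) {{O-inv (p∤suc i<p-1)}} (≈-^ (suc i) {{O-^ 2 (O-ω u)}} {{O-^ 2 (O-ι u)}} (≈-^ 2 {{O-ω u}} {{O-ι u}} ωu))
      reduce : ω u ^ N * a ^ N′ * b ≈ ι u ^ N * (ι u ^ 2 - 1#) ^ N′ * quotient (ι u) [ 1 ]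
      reduce = ≈-* {{*-O (O-^ N (O-ω u)) (O-^ N′ Oa)}} {{O-quotient (O-ι u)}} (≈-* {{O-^ N (O-ω u)}} {{O-^ N′ Ou²-1}} (≈-^ N {{O-ω u}} {{O-ι u}} ωu) (≈-^ N′ {{Oa}} {{Ou²-1}} a≈)) b≈

  -- Exponents of this shape arise from u^N times a polynomial in u². Modulo p the value is -1 for m
  -- ≡ n modulo N and 0 otherwise.
  E : ℕ → Carrier
  E m = powersum (N ℕ.+ 2 ℕ.* m)

  n<N : n < N
  n<N = ℕ.m<m+n n (ℕ.<-≤-trans (ℕ.n≢0⇒n>0 n≢0) (ℕ.m≤m+n n 0))

  exponent-suc : ∀ m → suc (N′ ℕ.+ 2 ℕ.* m) ≡ N ℕ.+ 2 ℕ.* m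
  exponent-suc m = cong (ℕ._+ 2 ℕ.* m) N-suc

  E-period : ∀ m → E (m ℕ.+ N) ≈ E m [ 1 ]
  E-period m = subst₂ (λ a b → powersum a ≈ powersum b [ 1 ]) (trans (cong (ℕ._+ p-1) (exponent-suc m)) (trans (cong (N ℕ.+ 2 ℕ.* m ℕ.+_) p-1≡2N) (trans (ℕ.+-assoc N _ _) (cong (N ℕ.+_) (sym (ℕ.*-distribˡ-+ 2 m N)))))) (exponent-suc m) (powersum-period (N′ ℕ.+ 2 ℕ.* m))

  E-n : E n ≈ - 1# [ 1 ]
  E-n = subst (λ m → powersum m ≈ - 1# [ 1 ]) p-1≡N+N powersum-top

  E≈0 : ∀ m → m < N → m ≢ n → E m ≈ 0# [ 1 ]
  E≈0 m m<N m≢n = cases (ℕ.<-cmp m n)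
    where
    cases : Tri (m < n) (m ≡ n) (n < m) → E m ≈ 0# [ 1 ]
    cases (tri< m<n _ _) = powersum≈0 (N ℕ.+ 2 ℕ.* m) (subst (N ℕ.+ 2 ℕ.* m <_) (sym p-1≡N+N) (ℕ.+-monoʳ-< N (ℕ.*-monoʳ-< 2 m<n)))
    cases (tri≈ _ e _) = ⊥-elim (m≢n e)
    cases (tri> _ _ n<m) = subst (λ k → powersum k ≈ 0# [ 1 ]) exponent (≈-trans (powersum-period (ℕ.pred d)) (subst (λ k → powersum k ≈ 0# [ 1 ]) (sym d-suc) (powersum≈0 d d<)))
      where
      d = 2 ℕ.* (m ∸ n)
      d-suc : suc (ℕ.pred d) ≡ d
      d-suc = ℕ.suc-pred d {{ℕ.>-nonZero (ℕ.*-monoʳ-< 2 (ℕ.m<n⇒0<n∸m n<m))}}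
      d< : d < p-1
      d< = subst (d <_) (sym p-1≡2N) (ℕ.*-monoʳ-< 2 (ℕ.≤-<-trans (ℕ.m∸n≤m m n) m<N))
      exponent : suc (ℕ.pred d) ℕ.+ p-1 ≡ N ℕ.+ 2 ℕ.* m
      exponent = trans (cong₂ ℕ._+_ d-suc p-1≡N+N) (trans (ℕ.+-comm d _) (trans (ℕ.+-assoc N N d) (cong (N ℕ.+_) (trans (sym (ℕ.*-distribˡ-+ 2 n (m ∸ n))) (cong (2 ℕ.*_) (ℕ.m+[n∸m]≡n (ℕ.<⇒≤ n<m)))))))

  ω-E : ∀ k → E k ≈ 0# [ 1 ] → ∑ p (λ u → ω u ^ (N ℕ.+ 2 ℕ.* k)) ≈ 0# [ 2 ]
  ω-E k h = subst (λ e → ∑ p (λ u → ω u ^ e) ≈ 0# [ 2 ]) (exponent-suc k) (ω-powersum≈0 (N′ ℕ.+ 2 ℕ.* k) (subst (λ e → powersum e ≈ 0# [ 1 ]) (sym (exponent-suc k)) h))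

  E-N≈0 : E N ≈ 0# [ 1 ]
  E-N≈0 = ≈-trans (E-period 0) (E≈0 0 (ℕ.<-trans (ℕ.n≢0⇒n>0 n≢0) n<N) (λ e → n≢0 (sym e)))

  c : Carrier
  c = ι (N C n)

  O-c : O c
  O-c = O-ι (N C n)

  power-expand : ∀ x m l → x ^ N * (x ^ 2 - 1#) ^ m * (x ^ 2) ^ l ≡ ∑ (suc m) (λ k → ι (m C k) * -1^ (m ∸ k) * x ^ (N ℕ.+ 2 ℕ.* (k ℕ.+ l)))
  power-expand x m l = begin
    x ^ N * (x ^ 2 - 1#) ^ m * (x ^ 2) ^ l ≡⟨ trans (cong (λ y → x ^ N * y * (x ^ 2) ^ l) (binomial-theorem m (x ^ 2) (- 1#))) (solve 3 (λ a b c → a :* b :* c := a :* c :* b) refl (x ^ N) _ ((x ^ 2) ^ l)) ⟩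
    x ^ N * (x ^ 2) ^ l * ∑ (suc m) (λ k → ι (m C k) * ((x ^ 2) ^ k * -1^ (m ∸ k))) ≡⟨ sym (∑-*ˡ (suc m) _ _) ⟩
    ∑ (suc m) (λ k → x ^ N * (x ^ 2) ^ l * (ι (m C k) * ((x ^ 2) ^ k * -1^ (m ∸ k)))) ≡⟨ ∑-cong (suc m) (λ k → trans (solve 5 (λ a l c k e → a :* l :* (c :* (k :* e)) := c :* e :* (a :* (k :* l))) refl (x ^ N) ((x ^ 2) ^ l) (ι (m C k)) ((x ^ 2) ^ k) (-1^ (m ∸ k)))
        (cong (ι (m C k) * -1^ (m ∸ k) *_) (trans (cong (x ^ N *_) (trans (sym (^-homo-* (x ^ 2) k l)) (^-assocʳ x 2 (k ℕ.+ l)))) (sym (^-homo-* x N (2 ℕ.* (k ℕ.+ l))))))) ⟩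
    ∑ (suc m) (λ k → ι (m C k) * -1^ (m ∸ k) * x ^ (N ℕ.+ 2 ℕ.* (k ℕ.+ l))) ∎

  -- Among the exponents N + 2k with k ≤ N only k = n gives a multiple of p - 1, so one binomial
  -- coefficient C(2n, n) survives.
  main≈ : main-part ≈ -1^ n * c * (ι p - 1#) [ 2 ]
  main≈ = begin≈
    main-part ≡≈⟨ ∑-cong p (λ u → trans (trans (sym (*-identityʳ _)) (power-expand (ω u) N 0)) (∑-cong (suc N) λ k → cong (λ e → ι (N C k) * -1^ (N ∸ k) * ω u ^ (N ℕ.+ 2 ℕ.* e)) (ℕ.+-identityʳ k))) ⟩
    ∑ p (λ u → ∑ (suc N) (λ k → ι (N C k) * -1^ (N ∸ k) * ω u ^ (N ℕ.+ 2 ℕ.* k))) ≡≈⟨ trans (∑-swap p (suc N) _) (∑-cong (suc N) λ k → ∑-*ˡ p _ _) ⟩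
    ∑ (suc N) T ≈⟨ ∑-single-≈ (suc N) n (ℕ.m<n⇒m<1+n n<N) others ⟩
    T n ≈⟨ ≈-*ˡ (c * -1^ (N ∸ n)) {{*-O O-c (O--1^ (N ∸ n))}} (≈-trans (≈-reflexive (cong (λ m → ∑ p (λ u → ω u ^ m)) (sym p-1≡N+N))) ω-powersum-top) ⟩
    c * -1^ (N ∸ n) * ι p-1 ≡≈⟨ cong₂ (λ m y → c * -1^ m * y) (trans (cong (_∸ n) N≡n+n) (ℕ.m+n∸m≡n n n)) (trans (solve 1 (λ x → x := κ 1 :+ x :- κ 1) refl (ι p-1)) (cong (λ q → ι q - 1#) p≡1+p-1)) ⟩
    c * -1^ n * (ι p - 1#) ≡≈⟨ cong (_* (ι p - 1#)) (*-comm _ _) ⟩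
    -1^ n * c * (ι p - 1#) ∎≈
    where
    open ≈-Reasoning
    T : ℕ → Carrier
    T k = ι (N C k) * -1^ (N ∸ k) * ∑ p (λ u → ω u ^ (N ℕ.+ 2 ℕ.* k))
    E-vanish : ∀ k → k < suc N → k ≢ n → E k ≈ 0# [ 1 ]
    E-vanish k k<1+N k≢n = cases (ℕ.m≤n⇒m<n∨m≡n (ℕ.≤-pred k<1+N))
      where
      cases : k < N ⊎ k ≡ N → E k ≈ 0# [ 1 ]
      cases (inj₁ k<N) = E≈0 k k<N k≢n
      cases (inj₂ e) = subst (λ m → E m ≈ 0# [ 1 ]) (sym e) E-N≈0
    others : ∀ k → k < suc N → k ≢ n → T k ≈ 0# [ 2 ]
    others k k<1+N k≢n = ≈0-*ˡ (ι (N C k) * -1^ (N ∸ k)) {{*-O (O-ι (N C k)) (O--1^ (N ∸ k))}} (ω-E k (E-vanish k k<1+N k≢n))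

  inner : ℕ → Carrier
  inner k = ∑ p-1 (λ i → inv (ι (suc i)) * E (k ℕ.+ suc i))

  correction-expand : correction-part ≡ ∑ N (λ k → ι (N′ C k) * -1^ (N′ ∸ k) * inner k)
  correction-expand = begin
    correction-part ≡⟨ ∑-cong p (λ u → trans (sym (∑-*ˡ p-1 _ _)) (∑-cong p-1 λ i → trans (solve 3 (λ a v y → a :* (v :* y) := v :* (a :* y)) refl (ι u ^ N * (ι u ^ 2 - 1#) ^ N′) (inv (ι (suc i))) ((ι u ^ 2) ^ suc i)) (trans (cong (inv (ι (suc i)) *_) (trans (power-expand (ι u) N′ (suc i)) (cong (λ m → ∑ m (λ k → ι (N′ C k) * -1^ (N′ ∸ k) * ι u ^ (N ℕ.+ 2 ℕ.* (k ℕ.+ suc i)))) N-suc))) (sym (∑-*ˡ N _ _))))) ⟩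
    ∑ p (λ u → ∑ p-1 (λ i → ∑ N (λ k → t u i k))) ≡⟨ trans (∑-cong p λ u → ∑-swap p-1 N _) (trans (∑-swap p N _) (∑-cong N λ k → ∑-swap p p-1 _)) ⟩
    ∑ N (λ k → ∑ p-1 (λ i → ∑ p (λ u → t u i k))) ≡⟨ ∑-cong N (λ k → trans (∑-cong p-1 λ i → trans (∑-cong p λ u → solve 3 (λ v a x → v :* (a :* x) := a :* v :* x) refl (inv (ι (suc i))) (a k) (ι u ^ (N ℕ.+ 2 ℕ.* (k ℕ.+ suc i)))) (trans (∑-*ˡ p _ _) (*-assoc _ _ _))) (∑-*ˡ p-1 (a k) _)) ⟩
    ∑ N (λ k → a k * inner k) ∎
    where
    a : ℕ → Carrier
    a k = ι (N′ C k) * -1^ (N′ ∸ k)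
    t : ℕ → ℕ → ℕ → Carrier
    t u i k = inv (ι (suc i)) * (a k * ι u ^ (N ℕ.+ 2 ℕ.* (k ℕ.+ suc i)))

  -- Only i + 1 = r and i + 1 = r + N contribute, where k + r ≡ n modulo N.
  inner≈ : ∀ k r → k < N → r < N → k ℕ.+ suc r ≡ n ⊎ k ℕ.+ suc r ≡ n ℕ.+ N → inner k ≈ - (inv (ι (suc r)) + inv (ι (suc (N ℕ.+ r)))) [ 1 ]
  inner≈ k r k<N r<N hyp = begin≈
    inner k ≡≈⟨ trans (cong (λ m → ∑ m f) p-1≡N+N) (trans (∑-split N N f) (sym (∑-+ N _ _))) ⟩
    ∑ N (λ i → f i + f (N ℕ.+ i)) ≈⟨ ∑-≈ N fold ⟩
    ∑ N (λ i → v i * E (k ℕ.+ suc i)) ≈⟨ ∑-single-≈ N r r<N others ⟩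
    v r * E (k ℕ.+ suc r) ≈⟨ ≈-*ˡ (v r) {{O-v r r<N}} (at hyp) ⟩
    v r * - 1# ≡≈⟨ solve 1 (λ x → x :* ⊝ κ 1 := ⊝ x) refl (v r) ⟩
    - v r ∎≈
    where
    open ≈-Reasoning
    f v : ℕ → Carrier
    f i = inv (ι (suc i)) * E (k ℕ.+ suc i)
    v i = inv (ι (suc i)) + inv (ι (suc (N ℕ.+ i)))
    p∤₁ : ∀ i → i < N → p ∤ suc i
    p∤₁ i i<N = p∤suc (ℕ.<-trans i<N N<p-1)
    p∤₂ : ∀ i → i < N → p ∤ suc (N ℕ.+ i)
    p∤₂ i i<N = p∤suc (subst (N ℕ.+ i <_) (sym p-1≡N+N) (ℕ.+-monoʳ-< N i<N))
    O-v : ∀ i → i < N → O (v i)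
    O-v i i<N = +-O (O-inv (p∤₁ i i<N)) (O-inv (p∤₂ i i<N))
    index : ∀ i → k ℕ.+ suc (N ℕ.+ i) ≡ k ℕ.+ suc i ℕ.+ N
    index i = solveℕ 3 (λ k N i → k ⊞ (# 1 ⊞ (N ⊞ i)) :≡ k ⊞ (# 1 ⊞ i) ⊞ N) refl k N i
    fold : ∀ i → i < N → f i + f (N ℕ.+ i) ≈ v i * E (k ℕ.+ suc i) [ 1 ]
    fold i i<N = ≈-trans (≈-+ ≈-refl (≈-*ˡ (inv (ι (suc (N ℕ.+ i)))) {{O-inv (p∤₂ i i<N)}} (subst (λ m → E m ≈ E (k ℕ.+ suc i) [ 1 ]) (sym (index i)) (E-period (k ℕ.+ suc i))))) (≈-reflexive (sym (distribʳ _ _ _)))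
    at : k ℕ.+ suc r ≡ n ⊎ k ℕ.+ suc r ≡ n ℕ.+ N → E (k ℕ.+ suc r) ≈ - 1# [ 1 ]
    at (inj₁ e) = subst (λ m → E m ≈ - 1# [ 1 ]) (sym e) E-n
    at (inj₂ e) = subst (λ m → E m ≈ - 1# [ 1 ]) (sym e) (≈-trans (E-period n) E-n)
    not-target : ∀ i → i < N → i ≢ r → (k ℕ.+ suc i ≢ n) × (k ℕ.+ suc i ≢ n ℕ.+ N)
    not-target i i<N i≢r = go hyp
      where
      same : k ℕ.+ suc i ≡ k ℕ.+ suc r → ⊥
      same e = i≢r (ℕ.suc-injective (ℕ.+-cancelˡ-≡ k _ _ e))
      -- If k + i + 1 and k + r + 1 differ by N, then so do i and r, which are both below N.
      far : ∀ {x y} → x < N → k ℕ.+ suc x ≡ n ℕ.+ N → k ℕ.+ suc y ≡ n → ⊥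
      far {x} {y} x<N e e′ = ℕ.<⇒≱ x<N (subst (N ≤_) (ℕ.suc-injective (ℕ.+-cancelˡ-≡ k _ _ (trans (trans (solveℕ 3 (λ k y N → k ⊞ (# 1 ⊞ (y ⊞ N)) :≡ k ⊞ (# 1 ⊞ y) ⊞ N) refl k y N) (cong (ℕ._+ N) e′)) (sym e)))) (ℕ.m≤n+m N y))
      go : k ℕ.+ suc r ≡ n ⊎ k ℕ.+ suc r ≡ n ℕ.+ N → (k ℕ.+ suc i ≢ n) × (k ℕ.+ suc i ≢ n ℕ.+ N)
      go (inj₁ e) = (λ h → same (trans h (sym e))) , (λ h → far i<N h e)
      go (inj₂ e) = (λ h → far r<N e h) , (λ h → same (trans h (sym e)))
    others : ∀ i → i < N → i ≢ r → v i * E (k ℕ.+ suc i) ≈ 0# [ 1 ]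
    others i i<N i≢r = ≈0-*ˡ (v i) {{O-v i i<N}} (cases (ℕ.<-≤-connex (k ℕ.+ suc i) N))
      where
      ¬target = not-target i i<N i≢r
      cases : k ℕ.+ suc i < N ⊎ N ≤ k ℕ.+ suc i → E (k ℕ.+ suc i) ≈ 0# [ 1 ]
      cases (inj₁ m<N) = E≈0 (k ℕ.+ suc i) m<N (proj₁ ¬target)
      cases (inj₂ N≤m) = subst (λ m → E m ≈ 0# [ 1 ]) (ℕ.m∸n+n≡m N≤m) (≈-trans (E-period (k ℕ.+ suc i ∸ N)) (E≈0 _ small (λ e → proj₂ ¬target (trans (sym (ℕ.m∸n+n≡m N≤m)) (cong (ℕ._+ N) e)))))
        where
        small : k ℕ.+ suc i ∸ N < N
        small = ℕ.+-cancelʳ-< N (k ℕ.+ suc i ∸ N) N (subst (_< N ℕ.+ N) (sym (ℕ.m∸n+n≡m N≤m)) (ℕ.+-mono-<-≤ k<N i<N))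

-- The correction term as a harmonic sum

module JacobsthalHarmonic (F : Field) (p : ℕ) (L : Localisation F p) (p-prime : Prime p) (3<p : 3 < p)
  (n : ℕ) (p≡4n+1 : p ≡ suc (4 ℕ.* n)) where
  open JacobsthalModP² F p L p-prime 3<p n p≡4n+1 public
  open BinomialSums F
  open ≡-Reasoning

  choose-C : ∀ m k → k ≤ m → choose m k ≡ ι (m C k)
  choose-C m zero _ = sym (+-identityʳ 1#)
  choose-C m (suc k) k<m = *-cancelˡ (char-0 k) (begin
    ι (suc k) * (choose m k * (ι (m ∸ k) * inv (ι (suc k)))) ≡⟨ solve 4 (λ s c d v → s :* (c :* (d :* v)) := d :* c :* (s :* v)) refl (ι (suc k)) (choose m k) (ι (m ∸ k)) (inv (ι (suc k))) ⟩
    ι (m ∸ k) * choose m k * (ι (suc k) * inv (ι (suc k))) ≡⟨ cong₂ _*_ (cong₂ _*_ (ι-∸ (ℕ.<⇒≤ k<m)) (choose-C m k (ℕ.<⇒≤ k<m))) (*-invʳ _ (char-0 k)) ⟩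
    (ι m - ι k) * ι (m C k) * 1# ≡⟨ trans (*-identityʳ _) (sym (C-step m k)) ⟩
    ι (suc k) * ι (m C suc k) ∎)

  N′-odd : -1^ N′ ≡ - 1#
  N′-odd = begin
    -1^ N′ ≡⟨ solve 1 (λ x → x := ⊝ (⊝ κ 1 :* x)) refl (-1^ N′) ⟩
    - -1^ (suc N′) ≡⟨ cong (λ m → - -1^ m) N-suc ⟩
    - -1^ N ≡⟨ cong -_ (-1^-double n) ⟩
    - 1# ∎

  s : ℕ → Carrier
  s = signed N′

  coefficient : ∀ k → k ≤ N′ → ι (N′ C k) * -1^ (N′ ∸ k) ≡ - s k
  coefficient k k≤N′ = trans (cong (ι (N′ C k) *_) (trans (-1^-∸ k≤N′) (cong (_* -1^ k) N′-odd))) (solve 2 (λ c e → c :* (⊝ κ 1 :* e) := ⊝ (e :* c)) refl (ι (N′ C k)) (-1^ k))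

  -- N′ = 2n - 1 is odd, so the signed binomial row is antisymmetric.
  s-reflect : ∀ k → k ≤ N′ → s (N′ ∸ k) ≡ - s k
  s-reflect k k≤N′ = trans (*-comm _ _) (trans (cong (λ m → ι m * -1^ (N′ ∸ k)) (sym (nCk≡nC[n∸k] k≤N′))) (coefficient k k≤N′))

  -- One formula for a denominator of `inner≈`: the second one, N + r + 1, when k < n, and the first
  -- one, r + 1, when k ≥ n.
  y : ℕ → ℕ
  y k = n ℕ.+ N ∸ k

  O-s : ∀ k → O (s k)
  O-s k = *-O (O--1^ k) (O-ι (N′ C k))

  ≤N′ : ∀ {k} → k < N → k ≤ N′
  ≤N′ {k} k<N = ℕ.≤-pred (subst (suc k ≤_) (sym N-suc) k<N)

  low-term : ∀ k → k < n → ι (N′ C k) * -1^ (N′ ∸ k) * inner k ≈ s k * (inv (ι (n ∸ k)) + inv (ι (y k))) [ 1 ]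
  low-term k k<n = begin≈
    ι (N′ C k) * -1^ (N′ ∸ k) * inner k ≡≈⟨ cong (_* inner k) (coefficient k (≤N′ k<N)) ⟩
    - s k * inner k ≈⟨ ≈-*ˡ (- s k) {{neg-O (O-s k)}} (inner≈ k r k<N r<N (inj₁ k+r)) ⟩
    - s k * - (inv (ι (suc r)) + inv (ι (suc (N ℕ.+ r)))) ≡≈⟨ trans (solve 3 (λ s u v → ⊝ s :* ⊝ (u :+ v) := s :* (u :+ v)) refl (s k) _ _) (cong₂ (λ a b → s k * (inv (ι a) + inv (ι b))) (sym suc-r) y-eq) ⟩
    s k * (inv (ι (n ∸ k)) + inv (ι (y k))) ∎≈
    where
    open ≈-Reasoning
    k<N = ℕ.<-trans k<n n<N
    r = n ∸ suc k
    r<N : r < N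
    r<N = ℕ.≤-<-trans (ℕ.m∸n≤m n (suc k)) n<N
    suc-r : n ∸ k ≡ suc r
    suc-r = ∸-suc k<n
    k+r : k ℕ.+ suc r ≡ n
    k+r = trans (cong (k ℕ.+_) (sym suc-r)) (ℕ.m+[n∸m]≡n (ℕ.<⇒≤ k<n))
    y-eq : suc (N ℕ.+ r) ≡ y k
    y-eq = trans (sym (ℕ.+-suc N r)) (trans (cong (N ℕ.+_) (sym suc-r)) (trans (sym (ℕ.+-∸-assoc N (ℕ.<⇒≤ k<n))) (cong (_∸ k) (ℕ.+-comm N n))))

  -- Here the second denominator is p - 1 - k, whose inverse is that of -(k + 1) modulo p.
  high-term : ∀ k → k < n → ι (N′ C (n ℕ.+ k)) * -1^ (N′ ∸ (n ℕ.+ k)) * inner (n ℕ.+ k) ≈ s (n ℕ.+ k) * (- inv (ι (suc k)) + inv (ι (y (n ℕ.+ k)))) [ 1 ]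
  high-term k k<n = begin≈
    ι (N′ C m) * -1^ (N′ ∸ m) * inner m ≡≈⟨ cong (_* inner m) (coefficient m (≤N′ m<N)) ⟩
    - s m * inner m ≈⟨ ≈-*ˡ (- s m) {{neg-O (O-s m)}} (inner≈ m r m<N r<N (inj₂ m+r)) ⟩
    - s m * - (inv (ι (suc r)) + inv (ι (suc (N ℕ.+ r)))) ≡≈⟨ solve 3 (λ s u v → ⊝ s :* ⊝ (u :+ v) := s :* (v :+ u)) refl (s m) _ _ ⟩
    s m * (inv (ι (suc (N ℕ.+ r))) + inv (ι (suc r))) ≈⟨ ≈-*ˡ (s m) {{O-s m}} (≈-+ reflect (≈-reflexive (cong (λ x → inv (ι x)) y-eq))) ⟩
    s m * (- inv (ι (suc k)) + inv (ι (y m))) ∎≈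
    where
    open ≈-Reasoning
    m = n ℕ.+ k
    m<N : m < N
    m<N = subst (m <_) (sym N≡n+n) (ℕ.+-monoʳ-< n k<n)
    k<N = ℕ.<-trans k<n n<N
    r = N ∸ suc k
    suc-r : N ∸ k ≡ suc r
    suc-r = ∸-suc k<N
    r<N : r < N
    r<N = subst (_≤ N) suc-r (ℕ.m∸n≤m N k)
    m+r : m ℕ.+ suc r ≡ n ℕ.+ N
    m+r = trans (cong (m ℕ.+_) (sym suc-r)) (trans (ℕ.+-assoc n k _) (cong (n ℕ.+_) (ℕ.m+[n∸m]≡n (ℕ.<⇒≤ k<N))))
    y-eq : suc r ≡ y m
    y-eq = trans (sym suc-r) (sym (ℕ.[m+n]∸[m+o]≡n∸o n N k))
    big = suc (N ℕ.+ r)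
    total : big ℕ.+ suc k ≡ p
    total = trans (cong suc (trans (ℕ.+-assoc N r (suc k)) (trans (cong (N ℕ.+_) (ℕ.m∸n+n≡m k<N)) (sym p-1≡N+N)))) p≡1+p-1
    big<p : big < p
    big<p = subst (big <_) total (ℕ.m<m+n big (s≤s z≤n))
    p∤big : p ∤ big
    p∤big = p∤ (λ ()) big<p
    p∤k : p ∤ suc k
    p∤k = p∤suc (ℕ.<-trans k<N N<p-1)
    reflect : inv (ι big) ≈ - inv (ι (suc k)) [ 1 ]
    reflect = inv-reflect p∤big p∤k total

  tail-product : Carrier
  tail-product = ∏ N (λ k → inv (ι (suc n ℕ.+ k)))

  n≤N′ : n ≤ N′
  n≤N′ = ≤N′ n<N

  -- The denominators n - k and k + 1 give the same logarithmic sum twice, by `s-reflect`. The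
  -- denominators `y k` run through n + 1, ..., n + N and form a partial fraction.
  correction≈ : correction-part ≈ ι 2 * logarithmic N′ n - factorial N′ * tail-product [ 1 ]
  correction≈ = begin≈
    correction-part ≡≈⟨ trans correction-expand (trans (cong (λ m → ∑ m t) N≡n+n) (∑-split n n t)) ⟩
    ∑ n t + ∑ n (λ k → t (n ℕ.+ k)) ≈⟨ ≈-+ (∑-≈ n low-term) (∑-≈ n high-term) ⟩
    ∑ n (λ k → s k * (inv (ι (n ∸ k)) + inv (ι (y k)))) + ∑ n (λ k → s (n ℕ.+ k) * (- inv (ι (suc k)) + inv (ι (y (n ℕ.+ k))))) ≡≈⟨ cong₂ _+_ (trans (∑-cong n λ k → distribˡ _ _ _) (∑-+ n _ _)) (trans (∑-cong n λ k → distribˡ _ _ _) (∑-+ n _ _)) ⟩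
    (logarithmic N′ n + ∑ n b) + (upper + ∑ n (λ k → b (n ℕ.+ k))) ≡≈⟨ cong (λ x → (logarithmic N′ n + ∑ n b) + (x + ∑ n (λ k → b (n ℕ.+ k)))) upper-eq ⟩
    (logarithmic N′ n + ∑ n b) + (logarithmic N′ n + ∑ n (λ k → b (n ℕ.+ k))) ≡≈⟨ solve 3 (λ l x y → (l :+ x) :+ (l :+ y) := κ 2 :* l :+ (x :+ y)) refl (logarithmic N′ n) _ _ ⟩
    ι 2 * logarithmic N′ n + (∑ n b + ∑ n (λ k → b (n ℕ.+ k))) ≡≈⟨ cong (ι 2 * logarithmic N′ n +_) (trans (sym (∑-split n n b)) (trans (cong (λ m → ∑ m b) (sym N≡n+n)) b-sum)) ⟩
    ι 2 * logarithmic N′ n - factorial N′ * tail-product ∎≈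
    where
    open ≈-Reasoning
    t b : ℕ → Carrier
    t k = ι (N′ C k) * -1^ (N′ ∸ k) * inner k
    b k = s k * inv (ι (y k))
    upper : Carrier
    upper = ∑ n (λ k → s (n ℕ.+ k) * - inv (ι (suc k)))
    upper-eq : upper ≡ logarithmic N′ n
    upper-eq = trans (∑-reverse n _) (∑-cong< n λ k k<n → trans (cong₂ (λ m l → s m * - inv (ι l)) (index k k<n) (sym (∸-suc k<n))) (trans (cong (_* - inv (ι (n ∸ k))) (s-reflect k (ℕ.≤-trans (ℕ.<⇒≤ k<n) n≤N′))) (solve 2 (λ s v → ⊝ s :* ⊝ v := s :* v) refl (s k) (inv (ι (n ∸ k))))))
      where
      index : ∀ k → k < n → n ℕ.+ (n ∸ suc k) ≡ N′ ∸ k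
      index k k<n = trans (sym (ℕ.+-∸-assoc n k<n)) (trans (cong (_∸ suc k) (trans (sym N≡n+n) (sym N-suc))) refl)
    b-sum : ∑ N b ≡ - (factorial N′ * tail-product)
    b-sum = begin
      ∑ N b ≡⟨ trans (cong (λ m → ∑ m b) (sym N-suc)) (∑-reverse (suc N′) b) ⟩
      ∑ (suc N′) (λ k → b (N′ ∸ k)) ≡⟨ ∑-cong< (suc N′) (λ k k<N → trans (cong₂ (λ x m → x * inv (ι m)) (s-reflect k (ℕ.≤-pred k<N)) (index k (ℕ.≤-pred k<N))) (sym (-‿distrib (s k) _))) ⟩
      ∑ (suc N′) (λ k → - (s k * inv (ι (suc n ℕ.+ k)))) ≡⟨ trans (∑-neg (suc N′) _) (cong -_ (partial-fractions N′ n)) ⟩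
      - (factorial N′ * ∏ (suc N′) (λ k → inv (ι (suc n ℕ.+ k)))) ≡⟨ cong (λ m → - (factorial N′ * ∏ m (λ k → inv (ι (suc n ℕ.+ k))))) N-suc ⟩
      - (factorial N′ * tail-product) ∎
      where
      -‿distrib : ∀ x y → - (x * y) ≡ - x * y
      -‿distrib = solve 2 (λ x y → ⊝ (x :* y) := ⊝ x :* y) refl
      index : ∀ k → k ≤ N′ → y (N′ ∸ k) ≡ suc n ℕ.+ k
      index k k≤N′ = trans (cong (λ m → n ℕ.+ m ∸ (N′ ∸ k)) (sym N-suc)) (trans (cong (_∸ (N′ ∸ k)) total) (ℕ.m+n∸n≡m (suc n ℕ.+ k) (N′ ∸ k)))
        where
        total : n ℕ.+ suc N′ ≡ suc n ℕ.+ k ℕ.+ (N′ ∸ k)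
        total = trans (ℕ.+-suc n N′) (trans (cong (λ m → suc (n ℕ.+ m)) (sym (ℕ.m+[n∸m]≡n k≤N′))) (cong suc (sym (ℕ.+-assoc n k (N′ ∸ k)))))

  η : Carrier
  η = ∑ n (λ i → inv (ι (N ∸ i)))

  ιN≡2n : ι N ≡ ι 2 * ι n
  ιN≡2n = ι-* 2 n

  c-half : c ≡ ι 2 * ι (N′ C n)
  c-half = trans (trans (cong (λ m → ι (m C n)) (sym N-suc)) (cong (λ m → ι (suc N′ C m)) (sym n-suc))) (trans (cong ι (sym (nCk+nC[k+1]≡[n+1]C[k+1] N′ n′))) (trans (ι-+ (N′ C n′) (N′ C suc n′)) (trans (cong (_+ ι (N′ C suc n′)) equal) (trans (solve 1 (λ x → x :+ x := κ 2 :* x) refl _) (cong (λ m → ι 2 * ι (N′ C m)) n-suc)))))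
    where
    n′ = ℕ.pred n
    n-suc : suc n′ ≡ n
    n-suc = ℕ.suc-pred n {{ℕ.≢-nonZero n≢0}}
    equal : ι (N′ C n′) ≡ ι (N′ C suc n′)
    equal = *-cancelˡ (char-0 n′) (sym (trans (C-step N′ n′) (cong (_* ι (N′ C n′)) (begin
      ι N′ - ι n′ ≡⟨ solve 2 (λ x y → x :- y := κ 1 :+ x :- (κ 1 :+ y)) refl (ι N′) (ι n′) ⟩
      ι (suc N′) - ι (suc n′) ≡⟨ cong₂ (λ a b → ι a - ι b) N-suc n-suc ⟩
      ι N - ι n ≡⟨ cong (_- ι n) ιN≡2n ⟩
      ι 2 * ι n - ι n ≡⟨ solve 1 (λ x → κ 2 :* x :- x := x) refl (ι n) ⟩
      ι n ≡⟨ cong ι (sym n-suc) ⟩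
      ι (suc n′) ∎))))

  -- The left sum has 1/n in place of the 1/N of `η`; multiplied by N = 2n, the difference is 2 - 1.
  harmonic-shift : ι N * ∑ n (λ i → inv (ι (N′ ∸ i))) ≡ ι N * η + 1#
  harmonic-shift = begin
    ι N * h ≡⟨ solve 3 (λ m h v → m :* h := m :* (v :+ h) :- m :* v) refl (ι N) h (inv (ι N)) ⟩
    ι N * (inv (ι N) + h) - ι N * inv (ι N) ≡⟨ cong₂ (λ x z → ι N * x - z) recount (*-invʳ (ι N) N≢0) ⟩
    ι N * (η + inv (ι n)) - 1# ≡⟨ cong (_- 1#) (trans (distribˡ _ _ _) (cong (ι N * η +_) (trans (cong (_* inv (ι n)) ιN≡2n) (trans (*-assoc _ _ _) (trans (cong (ι 2 *_) (*-invʳ (ι n) (ι-≢0 n n≢0))) (*-identityʳ _)))))) ⟩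
    ι N * η + ι 2 - 1# ≡⟨ solve 1 (λ x → x :+ κ 2 :- κ 1 := x :+ κ 1) refl (ι N * η) ⟩
    ι N * η + 1# ∎
    where
    h = ∑ n (λ i → inv (ι (N′ ∸ i)))
    N≢0 : ι N ≢ 0#
    N≢0 = ι-≢0 N (λ e → n≢0 (double-≡0 e))
    recount : inv (ι N) + h ≡ η + inv (ι n)
    recount = begin
      inv (ι N) + h ≡⟨ cong (inv (ι N) +_) (∑-cong n λ i → cong (λ m → inv (ι (m ∸ suc i))) N-suc) ⟩
      inv (ι N) + ∑ n (λ i → inv (ι (N ∸ suc i))) ≡⟨ sym (∑-first n (λ i → inv (ι (N ∸ i)))) ⟩
      η + inv (ι (N ∸ n)) ≡⟨ cong (λ m → η + inv (ι m)) (trans (cong (_∸ n) N≡n+n) (ℕ.m+n∸m≡n n n)) ⟩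
      η + inv (ι n) ∎

  -- As n + N = 3n, this is -1/C(3n, n).
  B′ : Carrier
  B′ = - (factorial N * tail-product)

  N-correction : ι N * correction-part ≈ - (-1^ n * c * (ι N * η + 1#)) + B′ [ 1 ]
  N-correction = begin≈
    ι N * correction-part ≈⟨ ≈-*ˡ (ι N) {{O-ι N}} correction≈ ⟩
    ι N * (ι 2 * logarithmic N′ n - factorial N′ * tail-product) ≡≈⟨ cong (λ x → ι N * (ι 2 * x - factorial N′ * tail-product)) (logarithmic-closed N′ n n≤N′) ⟩
    ι N * (ι 2 * - (-1^ n * ι (N′ C n) * h) - factorial N′ * tail-product) ≡≈⟨ solve 6 (λ m e x h f t → m :* (κ 2 :* ⊝ (e :* x :* h) :- f :* t) := ⊝ (e :* (κ 2 :* x) :* (m :* h)) :+ ⊝ (f :* m :* t)) refl (ι N) (-1^ n) (ι (N′ C n)) h (factorial N′) tail-product ⟩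
    - (-1^ n * (ι 2 * ι (N′ C n)) * (ι N * h)) + - (factorial N′ * ι N * tail-product) ≡≈⟨ cong₂ (λ a b → - a + - (b * tail-product)) (cong₂ (λ x z → -1^ n * x * z) (sym c-half) harmonic-shift) (subst (λ m → factorial N′ * ι m ≡ factorial m) N-suc refl) ⟩
    - (-1^ n * c * (ι N * η + 1#)) + B′ ∎≈
    where
    open ≈-Reasoning
    h = ∑ n (λ i → inv (ι (N′ ∸ i)))

  p∤tail : ∀ k → k < N → p ∤ suc n ℕ.+ k
  p∤tail k k<N = p∤suc (subst (n ℕ.+ k <_) (sym p-1≡N+N) (ℕ.+-mono-<-≤ n<N (ℕ.<⇒≤ k<N)))

  O-B′ : O B′
  O-B′ = neg-O (*-O (O-factorial N) (O-∏ N λ k k<N → O-inv (p∤tail k k<N)))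

  O-η : O η
  O-η = O-∑ n λ i i<n → O-inv (p∤ (λ e → ℕ.<⇒≱ (ℕ.<-trans i<n n<N) (ℕ.m∸n≡0⇒m≤n e)) (subst (N ∸ i <_) p≡1+p-1 (s≤s (ℕ.≤-trans (ℕ.m∸n≤m N i) (ℕ.<⇒≤ N<p-1)))))

  -- The p in the factor p - 1 of the main term cancels against the 1 in `N-correction`.
  J≈ : ιℤ (J ℤ.1ℤ) ≈ - (-1^ n * c * (1# + ι p * (ι N * η))) + ι p * B′ [ 2 ]
  J≈ = begin≈
    ιℤ (J ℤ.1ℤ) ≈⟨ J-expansion ⟩
    main-part + ι p * (ι N * correction-part) ≈⟨ ≈-+ main≈ (≈-scale {{O-≈ {{O-value}} N-correction}} p≈0 N-correction) ⟩
    -1^ n * c * (ι p - 1#) + ι p * (- (-1^ n * c * (ι N * η + 1#)) + B′) ≡≈⟨ solve 4 (λ e p x b → e :* (p :- κ 1) :+ p :* (⊝ (e :* (x :+ κ 1)) :+ b) := ⊝ (e :* (κ 1 :+ p :* x)) :+ p :* b) refl (-1^ n * c) (ι p) (ι N * η) B′ ⟩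
    - (-1^ n * c * (1# + ι p * (ι N * η))) + ι p * B′ ∎≈
    where
    open ≈-Reasoning
    O-value : O (- (-1^ n * c * (ι N * η + 1#)) + B′)
    O-value = +-O (neg-O (*-O (*-O (O--1^ n) O-c) (+-O (*-O (O-ι N) O-η) O-1))) O-B′

  c-factorial : c * (factorial n * factorial n) ≡ factorial N
  c-factorial = trans (cong₂ (λ x m → x * (factorial n * factorial m)) (sym (choose-C N n (ℕ.<⇒≤ n<N))) (sym (trans (cong (_∸ n) N≡n+n) (ℕ.m+n∸m≡n n n)))) (choose-factorial N n (ℕ.<⇒≤ n<N))

  -- (p - 1)! = C(p - 1, n) n!² (n + 1)⋯(3n). Together with C(2n, n) n!² = N! this expresses cB′
  -- through N!², (p - 1)! and C(p - 1, n), all known modulo p.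
  cB′≈ : c * B′ ≈ - -1^ n [ 1 ]
  cB′≈ = ≈-trans (≈-reflexive (solve 3 (λ c f t → c :* ⊝ (f :* t) := ⊝ (c :* f :* t)) refl c (factorial N) tail-product)) (≈-neg Y≈)
    where
    open ≈-Reasoning
    Y G G² : Carrier
    Y = c * factorial N * tail-product
    G = ∏ N (λ k → ι (suc n ℕ.+ k))
    G² = factorial N * factorial N
    G-inv : G * tail-product ≡ 1#
    G-inv = trans (sym (∏-* N _ _)) (∏-1 N λ k _ → *-invʳ _ (char-0 (n ℕ.+ k)))
    n≤p-1 : n ≤ p-1
    n≤p-1 = ℕ.<⇒≤ (ℕ.<-trans n<N N<p-1)
    p-1∸n : p-1 ∸ n ≡ n ℕ.+ N
    p-1∸n = trans (cong (_∸ n) (trans p-1≡N+N (trans (cong (ℕ._+ N) N≡n+n) (ℕ.+-assoc n n N)))) (ℕ.m+n∸m≡n n _)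
    key : Y * factorial p-1 ≡ G² * choose p-1 n
    key = begin
      Y * factorial p-1 ≡⟨ cong (Y *_) (sym (trans (cong (λ m → choose p-1 n * (factorial n * m)) (trans (sym (∏-split n N (λ i → ι (suc i)))) (cong factorial (sym p-1∸n)))) (choose-factorial p-1 n n≤p-1))) ⟩
      Y * (choose p-1 n * (factorial n * (factorial n * G))) ≡⟨ solve 6 (λ c f t x m g → c :* f :* t :* (x :* (m :* (m :* g))) := c :* (m :* m) :* f :* x :* (g :* t)) refl c (factorial N) tail-product (choose p-1 n) (factorial n) G ⟩
      c * (factorial n * factorial n) * factorial N * choose p-1 n * (G * tail-product) ≡⟨ cong₂ (λ a b → a * factorial N * choose p-1 n * b) c-factorial G-inv ⟩
      G² * choose p-1 n * 1# ≡⟨ *-identityʳ _ ⟩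
      G² * choose p-1 n ∎
    O-Y : O Y
    O-Y = *-O (*-O O-c (O-factorial N)) (O-∏ N λ k k<N → O-inv (p∤tail k k<N))
    Y≈ : Y ≈ -1^ n [ 1 ]
    Y≈ = begin≈
      Y ≡≈⟨ solve 1 (λ y → y := ⊝ (y :* ⊝ κ 1)) refl Y ⟩
      - (Y * - 1#) ≈⟨ ≈-neg (≈-*ˡ Y {{O-Y}} (≈-sym wilson)) ⟩
      - (Y * factorial p-1) ≡≈⟨ cong -_ key ⟩
      - (G² * choose p-1 n) ≈⟨ ≈-neg (≈-* {{*-O (O-factorial N) (O-factorial N)}} {{O--1^ n}} F!²≈-1 (choose-p-1≈ n n≤p-1)) ⟩
      - (- 1# * -1^ n) ≡≈⟨ solve 1 (λ e → ⊝ (⊝ κ 1 :* e) := e) refl (-1^ n) ⟩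
      -1^ n ∎≈

-- Primes that are 1 modulo 4

module CaseOne (F : Field) (p : ℕ) (L : Localisation F p) (p-prime : Prime p) (3<p : 3 < p)
  (n : ℕ) (p≡4n+1 : p ≡ suc (4 ℕ.* n)) where
  open JacobsthalHarmonic F p L p-prime 3<p n p≡4n+1 hiding (s; y; O-s)
  open ≡-Reasoning

  -- The reciprocals of the odd and of the even numbers below p/2. Every harmonic sum that follows
  -- is reduced to a multiple of o modulo p.
  P σ o e : Carrier
  P = ι p
  σ = -1^ n
  o = ∑ n (λ i → inv (odd i))
  e = ∑ n (λ i → inv (ι (2 ℕ.* suc i)))

  -P : Carrier
  -P = - P

  P²≈0 : P * P ≈ 0# [ 2 ]
  P²≈0 = ≈0-* p≈0 p≈0

  -P²≈0 : -P * -P ≈ 0# [ 2 ]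
  -P²≈0 = ≈-trans (≈-reflexive (solve 1 (λ x → ⊝ x :* ⊝ x := x :* x) refl P)) P²≈0

  perturb : ∀ m (f : ℕ → ℕ) {ε} → O ε → ε * ε ≈ 0# [ 2 ] → (∀ i → i < m → p ∤ f i) →
    ∏ m (λ i → ι (f i) + ε) ≈ ∏ m (λ i → ι (f i)) * (1# + ε * ∑ m (λ i → inv (ι (f i)))) [ 2 ]
  perturb m f {ε} Oε ε² p∤f = ≈-trans (≈-reflexive (trans (∏-cong< m factor) (∏-* m _ _)))
      (≈-*ˡ (∏ m (λ i → ι (f i))) {{O-∏ m λ i _ → O-ι (f i)}} (∏-1+ m {{Oε}} ε² λ i i<m → O-inv (p∤f i i<m)))
    where
    factor : ∀ i → i < m → ι (f i) + ε ≡ ι (f i) * (1# + ε * inv (ι (f i)))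
    factor i i<m = trans (cong (λ x → ι (f i) + x) (trans (sym (*-identityʳ ε)) (cong (ε *_) (sym (ι-invʳ (p∤f i i<m)))))) (solve 3 (λ f e v → f :+ e :* (f :* v) := f :* (κ 1 :+ e :* v)) refl (ι (f i)) ε (inv (ι (f i))))

  p∤odd-N : ∀ i → i < N → p ∤ suc (2 ℕ.* i)
  p∤odd-N i i<N = p∤odd N (subst (_≤ p) p-1≡2N (subst (p-1 ≤_) p≡1+p-1 (ℕ.n≤1+n p-1))) i<N

  p∤even-N : ∀ i → i < N → p ∤ 2 ℕ.* suc i
  p∤even-N i i<N = p∤-* {2} {suc i} p∤2 (p∤suc (ℕ.<-trans i<N N<p-1))

  n≤N : n ≤ N
  n≤N = ℕ.<⇒≤ n<N

  p∤odd-n : ∀ i → i < n → p ∤ suc (2 ℕ.* i)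
  p∤odd-n i i<n = p∤odd-N i (ℕ.<-≤-trans i<n n≤N)

  p∤even-n : ∀ i → i < n → p ∤ 2 ℕ.* suc i
  p∤even-n i i<n = p∤even-N i (ℕ.<-≤-trans i<n n≤N)

  ∏-cancel : ∀ m (f : ℕ → ℕ) {x y k} → (∀ i → i < m → p ∤ f i) → ∏ m (λ i → ι (f i)) * x ≈ ∏ m (λ i → ι (f i)) * y [ k ] → x ≈ y [ k ]
  ∏-cancel m f p∤f = ≈-cancel (∏ m (λ i → inv (ι (f i)))) {{O-∏ m λ i i<m → O-inv (p∤f i i<m)}} (trans (sym (∏-* m _ _)) (∏-1 m λ i i<m → ι-invˡ (p∤f i i<m)))

  p-eq : p ≡ suc (2 ℕ.* (n ℕ.+ n))
  p-eq = trans (sym p≡1+p-1) (cong suc (trans p-1≡2N (cong (2 ℕ.*_) N≡n+n)))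

  O-o : O o
  O-o = O-∑ n λ i i<n → O-inv (p∤odd-n i i<n)

  O-e : O e
  O-e = O-∑ n λ i i<n → O-inv (p∤even-n i i<n)

  O-σ : O σ
  O-σ = O--1^ n

  2^N≈₂ : ι 2 ^ N ≈ σ * (1# + -P * o) [ 2 ]
  2^N≈₂ = ∏-cancel n (λ i → suc (2 ℕ.* i)) p∤odd-n (begin≈
    odds n * ι 2 ^ N ≡≈⟨ trans (*-comm _ _) (trans (cong (λ m → ι 2 ^ m * odds n) N≡n+n) (gauss-lemma n n p-eq (trans (cong factorial (sym N≡n+n)) (factorial-even n)))) ⟩
    ∏ n (λ i → P - odd i) ≡≈⟨ trans (∏-cong n λ i → solve 2 (λ p o → p :- o := ⊝ κ 1 :* (o :+ ⊝ p)) refl P (odd i)) (∏-*ˡ n (- 1#) _) ⟩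
    σ * ∏ n (λ i → odd i + -P) ≈⟨ ≈-*ˡ σ {{O-σ}} (perturb n (λ i → suc (2 ℕ.* i)) (neg-O O-p) -P²≈0 p∤odd-n) ⟩
    σ * (odds n * (1# + -P * o)) ≡≈⟨ solve 3 (λ s d x → s :* (d :* x) := d :* (s :* x)) refl σ (odds n) (1# + -P * o) ⟩
    odds n * (σ * (1# + -P * o)) ∎≈)
    where open ≈-Reasoning

  Oₙ Eₙ : Carrier
  Oₙ = ∑ N (λ i → inv (odd i))
  Eₙ = ∑ N (λ i → inv (ι (2 ℕ.* suc i)))

  O-Eₙ : O Eₙ
  O-Eₙ = O-∑ N λ i i<N → O-inv (p∤even-N i i<N)

  even-shift : ∀ i → ι (2 ℕ.* suc (N ℕ.+ i)) ≡ odd i + P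
  even-shift i = trans (cong ι (trans (solveℕ 2 (λ N i → # 2 ⊠ (# 1 ⊞ (N ⊞ i)) :≡ # 1 ⊞ # 2 ⊠ i ⊞ (# 1 ⊞ # 2 ⊠ N)) refl N i) (cong (suc (2 ℕ.* i) ℕ.+_) (trans (cong suc (sym p-1≡2N)) p≡1+p-1)))) (ι-+ (suc (2 ℕ.* i)) p)

  -- The even numbers up to 4N multiply to 2^{2N}(2N)!. Those above 2N are p plus an odd number, and
  -- the others cancel against (2N)!.
  2^p-1-odds : ι 2 ^ p-1 * odds N ≡ ∏ N (λ i → odd i + P)
  2^p-1-odds = *-cancelˡ (evens-≢0 N) (begin
    evens N * (ι 2 ^ p-1 * odds N) ≡⟨ solve 3 (λ a b c → a :* (b :* c) := b :* (c :* a)) refl (evens N) (ι 2 ^ p-1) (odds N) ⟩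
    ι 2 ^ p-1 * (odds N * evens N) ≡⟨ cong₂ _*_ (cong (ι 2 ^_) p-1≡2N) (sym (factorial-even N)) ⟩
    ι 2 ^ (2 ℕ.* N) * factorial (2 ℕ.* N) ≡⟨ sym (evens-factorial (2 ℕ.* N)) ⟩
    evens (2 ℕ.* N) ≡⟨ trans (cong evens (cong (N ℕ.+_) (ℕ.+-identityʳ N))) (∏-split N N _) ⟩
    evens N * ∏ N (λ i → ι (2 ℕ.* suc (N ℕ.+ i))) ≡⟨ cong (evens N *_) (∏-cong N even-shift) ⟩
    evens N * ∏ N (λ i → odd i + P) ∎)

  2^p-1≈ : ι 2 ^ p-1 ≈ 1# + P * Oₙ [ 2 ]
  2^p-1≈ = ∏-cancel N (λ i → suc (2 ℕ.* i)) p∤odd-N (≈-trans (≈-reflexive (trans (*-comm _ _) 2^p-1-odds)) (perturb N (λ i → suc (2 ℕ.* i)) O-p P²≈0 p∤odd-N))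

  divide-p : ∀ {x y k} → P * x ≈ P * y [ suc k ] → x ≈ y [ k ]
  divide-p {x} {y} {k} (modulo r Or eq) = modulo r Or (*-cancelˡ ιp≢0 (trans (solve 3 (λ p x y → p :* (x :- y) := p :* x :- p :* y) refl P x y) (trans eq (*-assoc P (P ^ k) r))))

  -- Squaring `2^N≈₂` gives 2^{p-1} ≡ 1 - 2po; compare with 1 + p Oₙ modulo p² and divide by p.
  Oₙ≈ : Oₙ ≈ - (ι 2 * o) [ 1 ]
  Oₙ≈ = divide-p (begin≈
    P * Oₙ ≡≈⟨ solve 1 (λ x → x := κ 1 :+ x :- κ 1) refl (P * Oₙ) ⟩
    1# + P * Oₙ - 1# ≈⟨ ≈-- (≈-sym 2^p-1≈) ≈-refl ⟩
    ι 2 ^ p-1 - 1# ≡≈⟨ cong (_- 1#) (trans (cong (ι 2 ^_) p-1≡N+N) (^-homo-* (ι 2) N N)) ⟩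
    ι 2 ^ N * ι 2 ^ N - 1# ≈⟨ ≈-- (≈-* {{O-^ N (O-ι 2)}} {{*-O O-σ (+-O O-1 (*-O (neg-O O-p) O-o))}} 2^N≈₂ 2^N≈₂) ≈-refl ⟩
    σ * (1# + -P * o) * (σ * (1# + -P * o)) - 1# ≡≈⟨ trans (solve 3 (λ s p o → s :* (κ 1 :+ ⊝ p :* o) :* (s :* (κ 1 :+ ⊝ p :* o)) :- κ 1 := s :* s :* (κ 1 :- p :* (κ 2 :* o)) :- κ 1 :+ p :* p :* (s :* s :* o :* o)) refl σ P o) (cong (λ x → x * (1# - P * (ι 2 * o)) - 1# + P * P * (x * o * o)) (-1^-square n)) ⟩
    1# * (1# - P * (ι 2 * o)) - 1# + P * P * (1# * o * o) ≈⟨ ≈-+ ≈-refl (≈0-*ʳ (1# * o * o) {{*-O (*-O O-1 O-o) O-o}} P²≈0) ⟩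
    1# * (1# - P * (ι 2 * o)) - 1# + 0# ≡≈⟨ solve 2 (λ p o → κ 1 :* (κ 1 :- p :* (κ 2 :* o)) :- κ 1 :+ κ 0 := p :* ⊝ (κ 2 :* o)) refl P o ⟩
    P * - (ι 2 * o) ∎≈)
    where open ≈-Reasoning

  odd-even-sum : ∀ i → i < N → suc (2 ℕ.* (N ∸ suc i)) ℕ.+ 2 ℕ.* suc i ≡ p
  odd-even-sum i i<N = trans (cong suc (trans (sym (ℕ.*-distribˡ-+ 2 (N ∸ suc i) (suc i))) (cong (2 ℕ.*_) (ℕ.m∸n+n≡m i<N)))) (trans (cong suc (sym p-1≡2N)) p≡1+p-1)

  ∸suc<N : ∀ {i} → i < N → N ∸ suc i < N
  ∸suc<N i<N = ℕ.∸-monoʳ-< {N} {_} {0} (s≤s z≤n) i<N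

  Eₙ≈ : Eₙ ≈ ι 2 * o [ 1 ]
  Eₙ≈ = begin≈
    Eₙ ≡≈⟨ solve 1 (λ x → x := ⊝ ⊝ x) refl Eₙ ⟩
    - - Eₙ ≡≈⟨ cong -_ (sym (∑-neg N _)) ⟩
    - ∑ N (λ i → - inv (ι (2 ℕ.* suc i))) ≈⟨ ≈-neg (∑-≈ N λ i i<N → ≈-sym (inv-reflect (p∤odd-N (N ∸ suc i) (∸suc<N i<N)) (p∤even-N i i<N) (odd-even-sum i i<N))) ⟩
    - ∑ N (λ i → inv (odd (N ∸ suc i))) ≡≈⟨ cong -_ (sym (∑-reverse N _)) ⟩
    - Oₙ ≈⟨ ≈-neg Oₙ≈ ⟩
    - - (ι 2 * o) ≡≈⟨ solve 1 (λ x → ⊝ ⊝ x := x) refl (ι 2 * o) ⟩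
    ι 2 * o ∎≈
    where open ≈-Reasoning

  harmonic : ℕ → Carrier
  harmonic m = ∑ m (λ i → inv (ι (suc i)))

  double-inv : ∀ m → ι 2 * ∑ m (λ i → inv (ι (2 ℕ.* suc i))) ≡ harmonic m
  double-inv m = trans (sym (∑-*ˡ m (ι 2) _)) (∑-cong m λ i → trans (cong (ι 2 *_) (trans (cong inv (ι-* 2 (suc i))) (inv-* (char-0 1) (char-0 i)))) (trans (sym (*-assoc _ _ _)) (trans (cong (_* inv (ι (suc i))) (*-invʳ (ι 2) (char-0 1))) (*-identityˡ _))))

  harmonic-N : harmonic N ≡ o + e
  harmonic-N = trans (∑-parity n _) (cong (o +_) (∑-cong n λ i → cong (λ m → inv (ι m)) (sym (ℕ.*-suc 2 i))))

  -- o + e is the harmonic number of N, which is also 2 Eₙ ≡ 4o.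
  e≈3o : e ≈ ι 3 * o [ 1 ]
  e≈3o = begin≈
    e ≡≈⟨ trans (solve 2 (λ o e → e := o :+ e :- o) refl o e) (cong (_- o) (trans (sym harmonic-N) (sym (double-inv N)))) ⟩
    ι 2 * Eₙ - o ≈⟨ ≈-- (≈-*ˡ (ι 2) {{O-ι 2}} Eₙ≈) ≈-refl ⟩
    ι 2 * (ι 2 * o) - o ≡≈⟨ solve 1 (λ o → κ 2 :* (κ 2 :* o) :- o := κ 3 :* o) refl o ⟩
    ι 3 * o ∎≈
    where open ≈-Reasoning

  η-eq : η ≡ o - e
  η-eq = begin
    η ≡⟨ solve 2 (λ h x → h := x :+ h :- x) refl η (harmonic n) ⟩
    harmonic n + η - harmonic n ≡⟨ cong (λ x → harmonic n + x - harmonic n) (sym (trans (∑-reverse n _) (∑-cong< n λ i i<n → cong (λ m → inv (ι m)) (index i i<n)))) ⟩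
    harmonic n + ∑ n (λ i → inv (ι (suc (n ℕ.+ i)))) - harmonic n ≡⟨ cong₂ _-_ (trans (sym (∑-split n n _)) (trans (cong harmonic (sym N≡n+n)) harmonic-N)) (sym (double-inv n)) ⟩
    o + e - ι 2 * e ≡⟨ solve 2 (λ o e → o :+ e :- κ 2 :* e := o :- e) refl o e ⟩
    o - e ∎
    where
    index : ∀ i → i < n → suc (n ℕ.+ (n ∸ suc i)) ≡ N ∸ i
    index i i<n = trans (sym (ℕ.+-suc n _)) (trans (cong (n ℕ.+_) (sym (∸-suc i<n))) (trans (sym (ℕ.+-∸-assoc n (ℕ.<⇒≤ i<n))) (cong (_∸ i) (sym N≡n+n))))

  -- η = o - e ≡ -2o, and 2N ≡ -1.
  Nη≈o : ι N * η ≈ o [ 1 ]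
  Nη≈o = begin≈
    ι N * η ≡≈⟨ cong (ι N *_) η-eq ⟩
    ι N * (o - e) ≈⟨ ≈-*ˡ (ι N) {{O-ι N}} (≈-- ≈-refl e≈3o) ⟩
    ι N * (o - ι 3 * o) ≡≈⟨ trans (solve 2 (λ m o → m :* (o :- κ 3 :* o) := ⊝ (κ 2 :* m) :* o) refl (ι N) o) (cong (λ x → - x * o) (trans (sym (ι-* 2 N)) (cong ι (sym p-1≡2N)))) ⟩
    - ι p-1 * o ≈⟨ ≈-*ʳ o {{O-o}} (≈-neg p-1≈-1) ⟩
    - - 1# * o ≡≈⟨ solve 1 (λ o → ⊝ ⊝ κ 1 :* o := o) refl o ⟩
    o ∎≈
    where open ≈-Reasoning

  J≈₂ : ιℤ (J ℤ.1ℤ) ≈ - (σ * c * (1# + P * o)) + P * B′ [ 2 ]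
  J≈₂ = ≈-trans J≈ (≈-+ (≈-neg (≈-*ˡ (σ * c) {{*-O O-σ O-c}} (≈-+ ≈-refl (≈-scale {{*-O (O-ι N) O-η}} p≈0 Nη≈o)))) ≈-refl)

  odds-evens : odds N ≈ evens N * (1# + -P * Eₙ) [ 2 ]
  odds-evens = begin≈
    odds N ≡≈⟨ trans (∏-reverse N odd) (∏-cong< N λ i i<N → trans (solve 2 (λ x y → x := x :+ y :- y) refl (odd (N ∸ suc i)) (ι (2 ℕ.* suc i))) (trans (cong (_- ι (2 ℕ.* suc i)) (trans (sym (ι-+ (suc (2 ℕ.* (N ∸ suc i))) (2 ℕ.* suc i))) (cong ι (odd-even-sum i i<N)))) (solve 2 (λ p y → p :- y := ⊝ κ 1 :* (y :+ ⊝ p)) refl P (ι (2 ℕ.* suc i))))) ⟩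
    ∏ N (λ i → - 1# * (ι (2 ℕ.* suc i) + -P)) ≡≈⟨ trans (∏-*ˡ N (- 1#) _) (trans (cong (_* ∏ N (λ i → ι (2 ℕ.* suc i) + -P)) (-1^-double n)) (*-identityˡ _)) ⟩
    ∏ N (λ i → ι (2 ℕ.* suc i) + -P) ≈⟨ perturb N (λ i → 2 ℕ.* suc i) (neg-O O-p) -P²≈0 p∤even-N ⟩
    evens N * (1# + -P * Eₙ) ∎≈
    where open ≈-Reasoning

  -- ∏_{m ≤ 3n} (2m + 1)/(2m) = p Π
  T₁ T₂ Π : Carrier
  T₁ = ∏ n (λ i → ι (2 ℕ.* suc i) + P)
  T₂ = ∏ n (λ i → odd i + P)
  Π = odds N * inv (evens N) * (T₁ * inv T₂)

  T₂-nat : T₂ ≡ ∏ n (λ i → ι (2 ℕ.* suc (N ℕ.+ i)))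
  T₂-nat = ∏-cong n λ i → sym (even-shift i)

  p∤T₂ : ∀ i → i < n → p ∤ 2 ℕ.* suc (N ℕ.+ i)
  p∤T₂ i i<n = p∤-* {2} {suc (N ℕ.+ i)} p∤2 (p∤suc (subst (N ℕ.+ i <_) (sym p-1≡N+N) (ℕ.+-monoʳ-< N (ℕ.<-≤-trans i<n n≤N))))

  T₂≢0 : T₂ ≢ 0#
  T₂≢0 h = ∏-≢0 n (λ i _ → char-0 (N ℕ.+ i ℕ.+ suc (N ℕ.+ i ℕ.+ 0))) (trans (sym T₂-nat) h)

  O-inv-T₂ : O (inv T₂)
  O-inv-T₂ = subst O (sym (trans (cong inv T₂-nat) (inv-∏ n λ i _ → char-0 (N ℕ.+ i ℕ.+ suc (N ℕ.+ i ℕ.+ 0))))) (O-∏ n λ i i<n → O-inv (p∤T₂ i i<n))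

  O-inv-evens : O (inv (evens N))
  O-inv-evens = subst O (sym (inv-∏ N λ i _ → char-0 (i ℕ.+ suc (i ℕ.+ 0)))) (O-∏ N λ i i<N → O-inv (p∤even-N i i<N))

  O-T₁ : O T₁
  O-T₁ = O-∏ n λ i _ → +-O (O-ι (2 ℕ.* suc i)) O-p

  O-odds : ∀ m → O (odds m)
  O-odds m = O-∏ m λ i _ → O-ι (suc (2 ℕ.* i))

  O-Π : O Π
  O-Π = *-O (*-O (O-odds N) O-inv-evens) (*-O O-T₁ O-inv-T₂)

  c-evens : c * evens n ≡ ι 2 ^ N * odds n
  c-evens = *-cancelˡ (evens-≢0 n) (begin
    evens n * (c * evens n) ≡⟨ cong₂ (λ x y → x * (c * y)) (evens-factorial n) (evens-factorial n) ⟩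
    ι 2 ^ n * factorial n * (c * (ι 2 ^ n * factorial n)) ≡⟨ solve 3 (λ t f c → t :* f :* (c :* (t :* f)) := t :* t :* (c :* (f :* f))) refl (ι 2 ^ n) (factorial n) c ⟩
    ι 2 ^ n * ι 2 ^ n * (c * (factorial n * factorial n)) ≡⟨ cong₂ _*_ (trans (sym (^-homo-* (ι 2) n n)) (cong (ι 2 ^_) (sym N≡n+n))) (trans c-factorial (factorial-even n)) ⟩
    ι 2 ^ N * (odds n * evens n) ≡⟨ solve 3 (λ t o e → t :* (o :* e) := e :* (t :* o)) refl (ι 2 ^ N) (odds n) (evens n) ⟩
    evens n * (ι 2 ^ N * odds n) ∎)

  -- To first order in p, Π contributes -Eₙ + e - o and the power of 2 inside c contributes -o. With
  -- Eₙ ≡ 2o and e ≡ 3o the total is -o; the remaining odd and even products cancel.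
  Πc≈ : σ * Π * c ≈ 1# + -P * o [ 2 ]
  Πc≈ = ∏-cancel n (λ i → suc (2 ℕ.* i)) p∤odd-n (begin≈
    -- Inserting 1 - (po)² ≡ 1 creates the factor 1 + po that completes `odds n` to `T₂`, the
    -- denominator of Π.
    odds n * (σ * Π * c) ≡≈⟨ solve 3 (λ d x y → d :* x := d :* (x :* (κ 1 :- y :* y)) :+ y :* y :* (d :* x)) refl (odds n) (σ * Π * c) (P * o) ⟩
    odds n * (σ * Π * c * (1# - P * o * (P * o))) + P * o * (P * o) * (odds n * (σ * Π * c)) ≈⟨ ≈-+ ≈-refl (≈0-*ʳ (odds n * (σ * Π * c)) {{*-O (O-odds n) (*-O (*-O O-σ O-Π) O-c)}} (≈0-* Po≈0 Po≈0)) ⟩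
    odds n * (σ * Π * c * (1# - P * o * (P * o))) + 0# ≡≈⟨ solve 6 (λ d s π c p o → d :* (s :* π :* c :* (κ 1 :- p :* o :* (p :* o))) :+ κ 0 := d :* (κ 1 :+ p :* o) :* π :* (s :* c :* (κ 1 :+ ⊝ p :* o))) refl (odds n) σ Π c P o ⟩
    odds n * (1# + P * o) * Π * (σ * c * u) ≈⟨ ≈-*ʳ (σ * c * u) {{O-σcu}} (≈-*ʳ Π {{O-Π}} (≈-sym (perturb n (λ i → suc (2 ℕ.* i)) O-p P²≈0 p∤odd-n))) ⟩
    T₂ * Π * (σ * c * u) ≡≈⟨ trans (solve 6 (λ t d v t₁ w x → t :* (d :* v :* (t₁ :* w)) :* x := d :* v :* t₁ :* (t :* w) :* x) refl T₂ (odds N) (inv (evens N)) T₁ (inv T₂) (σ * c * u)) (cong (λ x → odds N * inv (evens N) * T₁ * x * (σ * c * u)) (*-invʳ T₂ T₂≢0)) ⟩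
    odds N * inv (evens N) * T₁ * 1# * (σ * c * u) ≈⟨ ≈-*ʳ (σ * c * u) {{O-σcu}} (≈-*ʳ 1# {{O-1}} (≈-* {{*-O (O-odds N) O-inv-evens}} {{*-O (O-evens n) (+-O O-1 (*-O O-p O-e))}} ratio (perturb n (λ i → 2 ℕ.* suc i) O-p P²≈0 p∤even-n))) ⟩
    (1# + -P * Eₙ) * (evens n * (1# + P * e)) * 1# * (σ * c * u) ≡≈⟨ solve 6 (λ a v b s c u → a :* (v :* b) :* κ 1 :* (s :* c :* u) := c :* v :* (a :* b :* (s :* u))) refl (1# + -P * Eₙ) (evens n) (1# + P * e) σ c u ⟩
    c * evens n * ((1# + -P * Eₙ) * (1# + P * e) * (σ * u)) ≡≈⟨ cong (_* ((1# + -P * Eₙ) * (1# + P * e) * (σ * u))) c-evens ⟩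
    ι 2 ^ N * odds n * ((1# + -P * Eₙ) * (1# + P * e) * (σ * u)) ≈⟨ ≈-*ʳ _ {{*-O (*-O (+-O O-1 (*-O (neg-O O-p) O-Eₙ)) (+-O O-1 (*-O O-p O-e))) (*-O O-σ O-u)}} (≈-*ʳ (odds n) {{O-odds n}} 2^N≈₂) ⟩
    σ * u * odds n * ((1# + -P * Eₙ) * (1# + P * e) * (σ * u)) ≡≈⟨ solve 5 (λ s u d a b → s :* u :* d :* (a :* b :* (s :* u)) := d :* (s :* s :* (u :* a :* b :* u))) refl σ u (odds n) (1# + -P * Eₙ) (1# + P * e) ⟩
    odds n * (σ * σ * (u * (1# + -P * Eₙ) * (1# + P * e) * u)) ≡≈⟨ cong (λ x → odds n * (x * (u * (1# + -P * Eₙ) * (1# + P * e) * u))) (-1^-square n) ⟩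
    odds n * (1# * (u * (1# + -P * Eₙ) * (1# + P * e) * u)) ≈⟨ ≈-*ˡ (odds n) {{O-odds n}} (≈-trans (≈-reflexive (*-identityˡ _)) collect) ⟩
    odds n * u ∎≈)
    where
    open ≈-Reasoning
    u = 1# + -P * o
    O-u : O u
    O-u = +-O O-1 (*-O (neg-O O-p) O-o)
    O-σcu : O (σ * c * u)
    O-σcu = *-O (*-O O-σ O-c) O-u
    Po≈0 : P * o ≈ 0# [ 1 ]
    Po≈0 = ≈0-*ʳ o {{O-o}} p≈0
    O-evens : ∀ m → O (evens m)
    O-evens m = O-∏ m λ i _ → O-ι (2 ℕ.* suc i)
    ratio : odds N * inv (evens N) ≈ 1# + -P * Eₙ [ 2 ]
    ratio = ≈-trans (≈-*ʳ (inv (evens N)) {{O-inv-evens}} odds-evens) (≈-reflexive (trans (solve 3 (λ v x w → v :* x :* w := v :* w :* x) refl (evens N) (1# + -P * Eₙ) (inv (evens N))) (trans (cong (_* (1# + -P * Eₙ)) (*-invʳ (evens N) (evens-≢0 N))) (*-identityˡ _))))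
    collect : u * (1# + -P * Eₙ) * (1# + P * e) * u ≈ u [ 2 ]
    collect = begin≈
      u * (1# + -P * Eₙ) * (1# + P * e) * u ≡≈⟨ solve 4 (λ p o x e → (κ 1 :+ ⊝ p :* o) :* (κ 1 :+ ⊝ p :* x) :* (κ 1 :+ p :* e) :* (κ 1 :+ ⊝ p :* o)
          := κ 1 :+ p :* (e :- x :- κ 2 :* o) :+ p :* p :* (o :* o :+ κ 2 :* o :* x :- κ 2 :* o :* e :- x :* e :+ p :* (o :* o :* e :- o :* o :* x :+ κ 2 :* o :* x :* e) :- p :* p :* (o :* o :* x :* e))) refl P o Eₙ e ⟩
      1# + P * (e - Eₙ - ι 2 * o) + P * P * R ≈⟨ ≈-+ (≈-+ ≈-refl (≈-scale {{+-O (+-O O-e (neg-O O-Eₙ)) (neg-O (*-O (O-ι 2) O-o))}} p≈0 (≈-- (≈-- e≈3o Eₙ≈) ≈-refl))) (≈0-*ʳ R {{O-R}} P²≈0) ⟩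
      1# + P * (ι 3 * o - ι 2 * o - ι 2 * o) + 0# ≡≈⟨ solve 2 (λ p o → κ 1 :+ p :* (κ 3 :* o :- κ 2 :* o :- κ 2 :* o) :+ κ 0 := κ 1 :+ ⊝ p :* o) refl P o ⟩
      u ∎≈
      where
      R : Carrier
      R = o * o + ι 2 * o * Eₙ - ι 2 * o * e - Eₙ * e + P * (o * o * e - o * o * Eₙ + ι 2 * o * Eₙ * e) - P * P * (o * o * Eₙ * e)
      oo = *-O O-o O-o
      2o = *-O (O-ι 2) O-o
      O-R : O R
      O-R = +-O (+-O (+-O (+-O (+-O oo (*-O 2o O-Eₙ)) (neg-O (*-O 2o O-e))) (neg-O (*-O O-Eₙ O-e))) (*-O O-p (+-O (+-O (*-O oo O-e) (neg-O (*-O oo O-Eₙ))) (*-O (*-O 2o O-Eₙ) O-e)))) (neg-O (*-O (*-O O-p O-p) (*-O (*-O oo O-Eₙ) O-e)))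

  private
    j : ℕ
    j = N ℕ.+ n

    4j+3≡3p : 4 ℕ.* j ℕ.+ 3 ≡ 3 ℕ.* p
    4j+3≡3p = trans (solveℕ 1 (λ n → # 4 ⊠ (# 2 ⊠ n ⊞ n) ⊞ # 3 :≡ # 3 ⊠ (# 1 ⊞ # 4 ⊠ n)) refl n) (cong (3 ℕ.*_) (sym p≡4n+1))

    j<p : j < p
    j<p = ℕ.<-trans (subst (j <_) (sym p-1≡N+N) (ℕ.+-monoʳ-< N n<N)) (subst (p-1 <_) p≡1+p-1 ℕ.≤-refl)

  open Reduction F p L p-prime 3<p 3 j 4j+3≡3p j<p
    using (B; reduction; closed-form; s; ½; t; t≈0; O-t; s<p; O-inv-s) public

  product-eq : ∏ j (λ i → (s i + ½) * inv (s i)) ≡ P * Π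
  product-eq = begin
    ∏ j (λ i → (s i + ½) * inv (s i)) ≡⟨ ∏-cong j double ⟩
    ∏ j f ≡⟨ ∏-split N n f ⟩
    ∏ N f * ∏ n (λ i → f (N ℕ.+ i)) ≡⟨ cong₂ _*_ lower upper ⟩
    odds N * P * inv (evens N) * (T₁ * inv T₂) ≡⟨ solve 4 (λ d p v t → d :* p :* v :* t := p :* (d :* v :* t)) refl (odds N) P (inv (evens N)) (T₁ * inv T₂) ⟩
    P * Π ∎
    where
    f : ℕ → Carrier
    f m = odd (suc m) * inv (ι (2 ℕ.* suc m))
    double : ∀ i → (s i + ½) * inv (s i) ≡ f i
    double i = cross-multiply (char-0 i) (char-0 (i ℕ.+ suc (i ℕ.+ 0))) (begin
      (s i + ½) * ι (2 ℕ.* suc i) ≡⟨ cong ((s i + ½) *_) (ι-* 2 (suc i)) ⟩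
      (s i + ½) * (ι 2 * s i) ≡⟨ solve 2 (λ s h → (s :+ h) :* (κ 2 :* s) := (κ 2 :* h :+ κ 2 :* s) :* s) refl (s i) ½ ⟩
      (ι 2 * ½ + ι 2 * s i) * s i ≡⟨ cong₂ (λ x y → (x + y) * s i) (ι-invʳ p∤2) (sym (ι-* 2 (suc i))) ⟩
      odd (suc i) * s i ∎)
    -- The last of the first N numerators, 2N + 1, is the factor p of the whole product.
    odd-N : odd N ≡ P
    odd-N = cong ι (trans (cong suc (sym p-1≡2N)) p≡1+p-1)
    lower : ∏ N f ≡ odds N * P * inv (evens N)
    lower = trans (∏-* N _ _) (cong₂ _*_ (trans (trans (solve 1 (λ x → x := (κ 1 :+ κ 0) :* x) refl _) (sym (∏-first N odd))) (cong (odds N *_) odd-N)) (sym (inv-∏ N λ i _ → char-0 (i ℕ.+ suc (i ℕ.+ 0)))))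
    upper : ∏ n (λ i → f (N ℕ.+ i)) ≡ T₁ * inv T₂
    upper = trans (∏-* n _ _) (cong₂ _*_ (∏-cong n λ i → trans (cong ι (solveℕ 2 (λ N i → # 1 ⊞ # 2 ⊠ (# 1 ⊞ (N ⊞ i)) :≡ # 2 ⊠ (# 1 ⊞ i) ⊞ (# 1 ⊞ # 2 ⊠ N)) refl N i)) (trans (ι-+ (2 ℕ.* suc i) (suc (2 ℕ.* N))) (cong (ι (2 ℕ.* suc i) +_) odd-N)))
      (sym (trans (cong inv T₂-nat) (inv-∏ n λ i _ → char-0 (N ℕ.+ i ℕ.+ suc (N ℕ.+ i ℕ.+ 0))))))

  -- The product of the 1 - t²/m² is 1 modulo p², and the p in front of Π gives the third power.
  closed≈ : closed-form ≈ P * Π [ 3 ]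
  closed≈ = begin≈
    closed-form ≡≈⟨ trans (∏-* j _ _) (trans (cong₂ _*_ (∏-cong j λ i → solve 2 (λ t σ → κ 1 :- t :* t :* (σ :* σ) := κ 1 :+ ⊝ (t :* t) :* (σ :* σ)) refl t (inv (s i))) product-eq) (solve 3 (λ a p x → a :* (p :* x) := p :* (a :* x)) refl A P Π)) ⟩
    P * (A * Π) ≈⟨ ≈-scale {{*-O O-A O-Π}} p≈0 (≈-*ʳ Π {{O-Π}} A≈1) ⟩
    P * (1# * Π) ≡≈⟨ cong (P *_) (*-identityˡ Π) ⟩
    P * Π ∎≈
    where
    open ≈-Reasoning
    A = ∏ j (λ i → 1# + - (t * t) * (inv (s i) * inv (s i)))
    O-square : ∀ i → i < j → O (inv (s i) * inv (s i))
    O-square i i<j = *-O (O-inv-s {i} (s<p i<j)) (O-inv-s {i} (s<p i<j))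
    O-A : O A
    O-A = O-∏ j λ i i<j → +-O O-1 (*-O (neg-O (*-O O-t O-t)) (O-square i i<j))
    t²≈0 : - (t * t) ≈ 0# [ 2 ]
    t²≈0 = ≈-trans (≈-neg (≈0-* t≈0 t≈0)) (≈-reflexive (solve 0 (⊝ κ 0 := κ 0) refl))
    A≈1 : A ≈ 1# [ 2 ]
    A≈1 = ≈-trans (∏-1+ j {{neg-O (*-O O-t O-t)}} (≈-lower 2 {2} (≈0-* t²≈0 t²≈0)) O-square) (≈-trans (≈-+ ≈-refl (≈0-*ʳ _ {{O-∑ j O-square}} t²≈0)) (≈-reflexive (+-identityʳ 1#)))

  inverse-integer : ∀ z → ¬ (ιℤ z ≈ 0# [ 1 ]) → ∃ λ v → O v × ιℤ z * v ≡ 1#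
  inverse-integer (ℤ.+ m) h = inv (ι m) , O-inv p∤m , trans (cong (_* inv (ι m)) (ιℤ-pos m)) (ι-invʳ p∤m)
    where
    p∤m : p ∤ m
    p∤m d = h (∣⇒≈0 (ℤ.+ m) d)
  inverse-integer -[1+ m ] h = - inv (ι (suc m)) , neg-O (O-inv p∤m) , trans (solve 2 (λ x v → ⊝ x :* ⊝ v := x :* v) refl (ι (suc m)) _) (ι-invʳ p∤m)
    where
    p∤m : p ∤ suc m
    p∤m d = h (∣⇒≈0 -[1+ m ] d)

  module _ (x y : ℤ) (p≡x²+y² : ℤ.+ p ≡ x ℤ.* x ℤ.+ y ℤ.* y) (x′ : ℤ) (x≡1+4x′ : x ≡ ℤ.1ℤ ℤ.+ ℤ.+ 4 ℤ.* x′) where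

    private
      -- ξ is 2x, and β is an inverse of c = C(2n, n) modulo p, see `cβ≈1`.
      ξ β : Carrier
      ξ = ι 2 * ιℤ x
      β = - (σ * B′)

      O-β : O β
      O-β = neg-O (*-O O-σ O-B′)

      O-ξ : O ξ
      O-ξ = *-O (O-ι 2) (O-ιℤ x)

      J-value : ιℤ (J ℤ.1ℤ) ≡ - (σ * ξ)
      J-value = trans (cong ιℤ (J-even ℤ.1ℤ)) (trans (ιℤ-* (ℤ.+ 2) (half ℤ.1ℤ)) (trans (cong (ι 2 *_) (half-value x y p≡x²+y² x′ x≡1+4x′)) (solve 3 (λ t s x → t :* ⊝ (s :* x) := ⊝ (s :* (t :* x))) refl (ι 2) σ (ιℤ x))))

      -- The integer value of the Jacobsthal sum is compared with its value modulo p²: in effect 2x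
      -- ≡ c(1 + po) + p/c.
      ξ≈ : ξ ≈ c * (1# + P * o) + P * β [ 2 ]
      ξ≈ = begin≈
        ξ ≡≈⟨ trans (sym (*-identityˡ ξ)) (trans (cong (_* ξ) (sym (-1^-square n))) (solve 2 (λ s x → s :* s :* x := ⊝ s :* ⊝ (s :* x)) refl σ ξ)) ⟩
        - σ * - (σ * ξ) ≈⟨ ≈-*ˡ (- σ) {{neg-O O-σ}} (≈-trans (≈-reflexive (sym J-value)) J≈₂) ⟩
        - σ * (- (σ * c * (1# + P * o)) + P * B′) ≡≈⟨ trans (solve 5 (λ s c u p b → ⊝ s :* (⊝ (s :* c :* u) :+ p :* b) := s :* s :* (c :* u) :+ p :* ⊝ (s :* b)) refl σ c (1# + P * o) P B′) (cong (λ z → z * (c * (1# + P * o)) + P * β) (-1^-square n)) ⟩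
        1# * (c * (1# + P * o)) + P * β ≡≈⟨ cong (_+ P * β) (*-identityˡ _) ⟩
        c * (1# + P * o) + P * β ∎≈
        where open ≈-Reasoning

      ξ≈c : ξ ≈ c [ 1 ]
      ξ≈c = begin≈
        ξ ≈⟨ ≈-lower 1 {1} ξ≈ ⟩
        c * (1# + P * o) + P * β ≡≈⟨ solve 4 (λ c p o b → c :* (κ 1 :+ p :* o) :+ p :* b := c :+ p :* (c :* o :+ b)) refl c P o β ⟩
        c + P * (c * o + β) ≈⟨ ≈-+ ≈-refl (≈0-*ʳ (c * o + β) {{+-O (*-O O-c O-o) O-β}} p≈0) ⟩
        c + 0# ≡≈⟨ +-identityʳ c ⟩
        c ∎≈
        where open ≈-Reasoning

      cβ≈1 : c * β ≈ 1# [ 1 ]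
      cβ≈1 = ≈-trans (≈-reflexive (solve 3 (λ c s b → c :* ⊝ (s :* b) := ⊝ s :* (c :* b)) refl c σ B′)) (≈-trans (≈-*ˡ (- σ) {{neg-O O-σ}} cB′≈) (≈-reflexive (trans (solve 1 (λ s → ⊝ s :* ⊝ s := s :* s) refl σ) (-1^-square n))))

      c≉0 : ¬ (c ≈ 0# [ 1 ])
      c≉0 h = 1≉0 (≈-trans (≈-sym cβ≈1) (≈0-*ʳ β {{O-β}} h))

      p∤c : p ∤ (N C n)
      p∤c d = c≉0 (≈-trans (≈-reflexive (sym (ιℤ-pos (N C n)))) (∣⇒≈0 (ℤ.+ (N C n)) d))

      -- Multiplied by c, it eliminates o and c: σΠc is 1 - po, ξ(1 - po) is c + pβ modulo p², and
      -- ξ²β ≡ c²β ≡ c modulo p.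
      cubic-relation : ξ ^ 3 * (σ * Π) ≈ ξ * ξ + P [ 2 ]
      cubic-relation = ι-cancel p∤c (begin≈
        c * (ξ ^ 3 * (σ * Π)) ≡≈⟨ solve 4 (λ c x s π → c :* (x :^ 3 :* (s :* π)) := x :^ 3 :* (s :* π :* c)) refl c ξ σ Π ⟩
        ξ ^ 3 * (σ * Π * c) ≈⟨ ≈-*ˡ (ξ ^ 3) {{O-^ 3 O-ξ}} Πc≈ ⟩
        ξ ^ 3 * (1# + -P * o) ≡≈⟨ solve 3 (λ x p o → x :^ 3 :* (κ 1 :+ ⊝ p :* o) := x :* x :* (x :* (κ 1 :+ ⊝ p :* o))) refl ξ P o ⟩
        ξ * ξ * (ξ * (1# + -P * o)) ≈⟨ ≈-*ˡ (ξ * ξ) {{*-O O-ξ O-ξ}} linear ⟩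
        ξ * ξ * (c + P * β) ≡≈⟨ solve 4 (λ x c p b → x :* x :* (c :+ p :* b) := c :* (x :* x) :+ p :* (x :* x :* b)) refl ξ c P β ⟩
        c * (ξ * ξ) + P * (ξ * ξ * β) ≈⟨ ≈-+ ≈-refl (≈-scale {{*-O (*-O O-ξ O-ξ) O-β}} p≈0 square) ⟩
        c * (ξ * ξ) + P * c ≡≈⟨ solve 3 (λ c x p → c :* x :+ p :* c := c :* (x :+ p)) refl c (ξ * ξ) P ⟩
        c * (ξ * ξ + P) ∎≈)
        where
        open ≈-Reasoning
        linear : ξ * (1# + -P * o) ≈ c + P * β [ 2 ]
        linear = begin≈
          ξ * (1# + -P * o) ≈⟨ ≈-*ʳ (1# + -P * o) {{+-O O-1 (*-O (neg-O O-p) O-o)}} ξ≈ ⟩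
          (c * (1# + P * o) + P * β) * (1# + -P * o) ≡≈⟨ solve 4 (λ c p o b → (c :* (κ 1 :+ p :* o) :+ p :* b) :* (κ 1 :+ ⊝ p :* o) := c :+ p :* b :+ p :* p :* ⊝ (c :* o :* o :+ b :* o)) refl c P o β ⟩
          c + P * β + P * P * - (c * o * o + β * o) ≈⟨ ≈-+ ≈-refl (≈0-*ʳ _ {{neg-O (+-O (*-O (*-O O-c O-o) O-o) (*-O O-β O-o))}} P²≈0) ⟩
          c + P * β + 0# ≡≈⟨ +-identityʳ _ ⟩
          c + P * β ∎≈
        square : ξ * ξ * β ≈ c [ 1 ]
        square = begin≈
          ξ * ξ * β ≈⟨ ≈-*ʳ β {{O-β}} (≈-* {{O-ξ}} {{O-c}} ξ≈c ξ≈c) ⟩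
          c * c * β ≡≈⟨ *-assoc c c β ⟩
          c * (c * β) ≈⟨ ≈-*ˡ c {{O-c}} cβ≈1 ⟩
          c * 1# ≡≈⟨ *-identityʳ c ⟩
          c ∎≈

      z : ℤ
      z = ℤ.+ 2 ℤ.* x

      ιz : ιℤ z ≡ ξ
      ιz = ιℤ-* (ℤ.+ 2) x

      ξ-inverse : ∃ λ v → O v × ξ * v ≡ 1#
      ξ-inverse = subst (λ w → ∃ λ v → O v × w * v ≡ 1#) ιz (inverse-integer z (λ h → c≉0 (≈-trans (≈-sym ξ≈c) (≈-trans (≈-reflexive (sym ιz)) h))))

    ξ≢0 : ι 2 * ιℤ x ≢ 0#
    ξ≢0 = unit-≢0 (proj₂ (proj₂ ξ-inverse))

    private
      v : Carrier
      v = inv ξ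

      ξv : ξ * v ≡ 1#
      ξv = *-invʳ ξ ξ≢0

      O-v : O v
      O-v = subst O (sym (inv-unique (proj₂ (proj₂ ξ-inverse)))) (proj₁ (proj₂ ξ-inverse))

      Π≈ : Π ≈ σ * (v + P * v ^ 3) [ 2 ]
      Π≈ = begin≈
        Π ≡≈⟨ trans (solve 1 (λ π → π := κ 1 :* κ 1 :^ 3 :* π) refl Π) (cong₂ (λ a b → a * b ^ 3 * Π) (sym (-1^-square n)) (sym ξv)) ⟩
        σ * σ * (ξ * v) ^ 3 * Π ≡≈⟨ solve 4 (λ s x v π → s :* s :* (x :* v) :^ 3 :* π := s :* v :^ 3 :* (x :^ 3 :* (s :* π))) refl σ ξ v Π ⟩
        σ * v ^ 3 * (ξ ^ 3 * (σ * Π)) ≈⟨ ≈-*ˡ (σ * v ^ 3) {{*-O O-σ (O-^ 3 O-v)}} cubic-relation ⟩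
        σ * v ^ 3 * (ξ * ξ + P) ≡≈⟨ trans (solve 4 (λ s v x p → s :* v :^ 3 :* (x :* x :+ p) := s :* ((x :* v) :* (x :* v) :* v :+ p :* v :^ 3)) refl σ v ξ P) (cong (λ w → σ * (w * w * v + P * v ^ 3)) ξv) ⟩
        σ * (1# * 1# * v + P * v ^ 3) ≡≈⟨ cong (λ w → σ * (w + P * v ^ 3)) (solve 1 (λ v → κ 1 :* κ 1 :* v := v) refl v) ⟩
        σ * (v + P * v ^ 3) ∎≈
        where open ≈-Reasoning

    case-one : ∑ p (λ k → ι (8 ℕ.* k ℕ.+ 3) * B k ^ 4)
      ≈ -1^ n * (ι 3 * P ^ 2 * inv (ι 2 * ιℤ x) + ι 3 * P ^ 3 * inv (ι 2 * ιℤ x) ^ 3) [ 4 ]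
    case-one = begin≈
      ∑ p (λ k → ι (8 ℕ.* k ℕ.+ 3) * B k ^ 4) ≈⟨ reduction ⟩
      ι 3 * P * closed-form ≈⟨ ≈-scale {j = 1} {{O-≈ {{*-O O-p O-Π}} closed≈}} (≈0-*ˡ (ι 3) {{O-ι 3}} p≈0) closed≈ ⟩
      ι 3 * P * (P * Π) ≡≈⟨ solve 2 (λ p π → κ 3 :* p :* (p :* π) := κ 3 :* (p :* p) :* π) refl P Π ⟩
      ι 3 * (P * P) * Π ≈⟨ ≈-scale {{O-Π}} (≈0-*ˡ (ι 3) {{O-ι 3}} P²≈0) Π≈ ⟩
      ι 3 * (P * P) * (σ * (v + P * v ^ 3)) ≡≈⟨ solve 3 (λ p s v → κ 3 :* (p :* p) :* (s :* (v :+ p :* v :^ 3)) := s :* (κ 3 :* p :^ 2 :* v :+ κ 3 :* p :^ 3 :* v :^ 3)) refl P σ v ⟩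
      -1^ n * (ι 3 * P ^ 2 * v + ι 3 * P ^ 3 * v ^ 3) ∎≈
      where open ≈-Reasoning

-- The localisation of the integers at p

module PrimeLocalisation (F : Field) (p : ℕ) (p-prime : Prime p) where
  open FieldTheory F
  open ≡-Reasoning

  -- The fraction need not be in lowest terms, so sums and products of such elements take no gcd.
  record IsIntegral (r : Carrier) : Set where
    constructor fraction
    field
      denominator : ℕ
      numerator : ℤ
      p∤denominator : p ∤ denominator
      equation : r * ι denominator ≡ ιℤ numerator

  private
    p∤1 : p ∤ 1
    p∤1 d = ℕ.<-irrefl (sym (Div.∣1⇒≡1 d)) (ℕ.nonTrivial⇒n>1 p {{prime⇒nonTrivial p-prime}})

    p∤-* : ∀ {m n} → p ∤ m → p ∤ n → p ∤ m ℕ.* n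
    p∤-* {m} {n} a b h = cases (euclidsLemma m n p-prime h)
      where
      cases : p ∣ m ⊎ p ∣ n → ⊥
      cases (inj₁ c) = a c
      cases (inj₂ c) = b c

    ιℤ-injective-0 : ∀ z → ιℤ z ≡ 0# → z ≡ ℤ.0ℤ
    ιℤ-injective-0 (ℤ.+ zero) _ = refl
    ιℤ-injective-0 (ℤ.+ suc n) e = ⊥-elim (char-0 n (trans (sym (ιℤ-pos (suc n))) e))
    ιℤ-injective-0 -[1+ n ] e = ⊥-elim (char-0 n (trans (solve 1 (λ x → x := ⊝ ⊝ x) refl (ι (suc n))) (trans (cong -_ e) (solve 0 (⊝ κ 0 := κ 0) refl))))

    ιℤ-injective : ∀ x y → ιℤ x ≡ ιℤ y → x ≡ y
    ιℤ-injective x y e = ℤ.i-j≡0⇒i≡j x y (ιℤ-injective-0 (x ℤ.- y) (trans (ιℤ-+ x (ℤ.- y)) (trans (cong₂ _+_ e (ιℤ-neg y)) (-‿inverseʳ _))))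

  localisation : Localisation F p
  localisation = record
    { Integral = IsIntegral
    ; Integral-+ = λ { {x} {y} (fraction d z p∤d e) (fraction d′ z′ p∤d′ e′) → fraction (d ℕ.* d′) (z ℤ.* ℤ.+ d′ ℤ.+ z′ ℤ.* ℤ.+ d) (p∤-* p∤d p∤d′) (begin
        (x + y) * ι (d ℕ.* d′) ≡⟨ cong ((x + y) *_) (ι-* d d′) ⟩
        (x + y) * (ι d * ι d′) ≡⟨ solve 4 (λ x y d d′ → (x :+ y) :* (d :* d′) := x :* d :* d′ :+ y :* d′ :* d) refl x y (ι d) (ι d′) ⟩
        x * ι d * ι d′ + y * ι d′ * ι d ≡⟨ cong₂ (λ u v → u * ι d′ + v * ι d) e e′ ⟩
        ιℤ z * ι d′ + ιℤ z′ * ι d ≡⟨ sym (trans (ιℤ-+ (z ℤ.* ℤ.+ d′) (z′ ℤ.* ℤ.+ d)) (cong₂ _+_ (trans (ιℤ-* z (ℤ.+ d′)) (cong (ιℤ z *_) (ιℤ-pos d′))) (trans (ιℤ-* z′ (ℤ.+ d)) (cong (ιℤ z′ *_) (ιℤ-pos d))))) ⟩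
        ιℤ (z ℤ.* ℤ.+ d′ ℤ.+ z′ ℤ.* ℤ.+ d) ∎) }
    ; Integral-* = λ { {x} {y} (fraction d z p∤d e) (fraction d′ z′ p∤d′ e′) → fraction (d ℕ.* d′) (z ℤ.* z′) (p∤-* p∤d p∤d′) (begin
        x * y * ι (d ℕ.* d′) ≡⟨ cong (x * y *_) (ι-* d d′) ⟩
        x * y * (ι d * ι d′) ≡⟨ solve 4 (λ x y d d′ → x :* y :* (d :* d′) := x :* d :* (y :* d′)) refl x y (ι d) (ι d′) ⟩
        x * ι d * (y * ι d′) ≡⟨ cong₂ _*_ e e′ ⟩
        ιℤ z * ιℤ z′ ≡⟨ sym (ιℤ-* z z′) ⟩
        ιℤ (z ℤ.* z′) ∎) }
    ; Integral-neg = λ { {x} (fraction d z p∤d e) → fraction d (ℤ.- z) p∤d (trans (solve 2 (λ x d → ⊝ x :* d := ⊝ (x :* d)) refl x (ι d)) (trans (cong -_ e) (sym (ιℤ-neg z)))) }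
    ; Integral-0 = fraction 1 ℤ.0ℤ p∤1 (zeroˡ _)
    ; Integral-1 = fraction 1 ℤ.1ℤ p∤1 (trans (*-identityˡ _) (+-identityʳ 1#))
    ; Integral-inv = λ n p∤n → fraction n ℤ.1ℤ p∤n (trans (*-comm _ _) (*-invʳ (ι n) (ι-≢0 n (λ { refl → p∤n (p Div.∣0) }))))
    -- From zd = wp and p ∤ d, Euclid's lemma gives p ∣ z.
    ; descend = λ { z {r} (fraction d w p∤d e) eq → conclude d p∤d (euclidsLemma ℤ.∣ z ∣ d p-prime (divides ℤ.∣ w ∣ (trans (sym (ℤ.abs-* z (ℤ.+ d))) (trans (cong ℤ.∣_∣ (ιℤ-injective (z ℤ.* ℤ.+ d) (w ℤ.* ℤ.+ p) (begin
        ιℤ (z ℤ.* ℤ.+ d) ≡⟨ trans (ιℤ-* z (ℤ.+ d)) (cong₂ _*_ eq (ιℤ-pos d)) ⟩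
        ι p * r * ι d ≡⟨ solve 3 (λ p r d → p :* r :* d := r :* d :* p) refl (ι p) r (ι d) ⟩
        r * ι d * ι p ≡⟨ cong (_* ι p) e ⟩
        ιℤ w * ι p ≡⟨ sym (trans (ιℤ-* w (ℤ.+ p)) (cong (ιℤ w *_) (ιℤ-pos p))) ⟩
        ιℤ (w ℤ.* ℤ.+ p) ∎))) (ℤ.abs-* w (ℤ.+ p)))))) }
    }
    where
    conclude : ∀ {m} d → p ∤ d → p ∣ m ⊎ p ∣ d → p ∣ m
    conclude d p∤d (inj₁ h) = h
    conclude d p∤d (inj₂ h) = ⊥-elim (p∤d h)

-- The rationals as a field

module RationalField where
  open import Defs using (ℕ→ℚ; ℤ→ℚ; _÷ℚ_; _^ℚ_)
  open import Data.Rational as ℚ using (ℚ; mkℚ; 0ℚ; 1ℚ; ↧ₙ_)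
  import Data.Rational.Properties as ℚ
  open import Data.Rational.Unnormalised as ℚᵘ using (ℚᵘ; mkℚᵘ; *≡*; _≃_)
  import Data.Rational.Unnormalised.Properties as ℚᵘ
  import Data.Nat.Coprimality as Coprimality

  ℚ-ring : CRing
  ℚ-ring = record { isCommutativeRing = ℚ.+-*-isCommutativeRing }

  private module R = RingTheory ℚ-ring

  invℚ : ℚ → ℚ
  invℚ x = 1ℚ ÷ℚ x

  ÷-nonzero : ∀ a {b} (b≢0 : b ≢ 0ℚ) → a ÷ℚ b ≡ a ℚ.* (ℚ.1/ b) {{ℚ.≢-nonZero b≢0}}
  ÷-nonzero a {b} b≢0 with b ℚ.≟ 0ℚ
  ... | yes e = ⊥-elim (b≢0 e)
  ... | no _ = refl

  ÷-inv : ∀ a {b} → b ≢ 0ℚ → a ÷ℚ b ≡ a ℚ.* invℚ b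
  ÷-inv a {b} b≢0 = trans (÷-nonzero a b≢0) (cong (a ℚ.*_) (sym (trans (÷-nonzero 1ℚ b≢0) (ℚ.*-identityˡ _))))

  invℚ-inverse : ∀ x → x ≢ 0ℚ → x ℚ.* invℚ x ≡ 1ℚ
  invℚ-inverse x x≢0 = trans (cong (x ℚ.*_) (trans (÷-nonzero 1ℚ x≢0) (ℚ.*-identityˡ _))) (ℚ.*-inverseʳ x {{ℚ.≢-nonZero x≢0}})

  toℚᵘ-ℤ : ∀ z → ℚ.toℚᵘ (ℤ→ℚ z) ≃ mkℚᵘ z 0
  toℚᵘ-ℤ z = ℚ.toℚᵘ-fromℚᵘ (mkℚᵘ z 0)

  ℕ→ℚ-suc : ∀ n → ℕ→ℚ (suc n) ≡ 1ℚ ℚ.+ ℕ→ℚ n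
  ℕ→ℚ-suc n = ℚ.toℚᵘ-injective (ℚᵘ.≃-trans (toℚᵘ-ℤ (ℤ.+ suc n)) (ℚᵘ.≃-sym (ℚᵘ.≃-trans (ℚ.toℚᵘ-homo-+ 1ℚ (ℕ→ℚ n)) (ℚᵘ.≃-trans (ℚᵘ.+-congʳ (ℚ.toℚᵘ 1ℚ) (toℚᵘ-ℤ (ℤ.+ n)))
    (*≡* (trans (ℤ.*-identityʳ _) (trans (cong (λ z → ℤ.1ℤ ℤ.+ z) (ℤ.*-identityʳ (ℤ.+ n))) (sym (ℤ.*-identityʳ (ℤ.+ suc n))))))))))

  ι-ℕ→ℚ : ∀ n → R.ι n ≡ ℕ→ℚ n
  ι-ℕ→ℚ zero = refl
  ι-ℕ→ℚ (suc n) = trans (cong (1ℚ ℚ.+_) (ι-ℕ→ℚ n)) (sym (ℕ→ℚ-suc n))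

  ιℤ-ℤ→ℚ : ∀ z → R.ιℤ z ≡ ℤ→ℚ z
  ιℤ-ℤ→ℚ (ℤ.+ n) = trans (R.ιℤ-pos n) (ι-ℕ→ℚ n)
  ιℤ-ℤ→ℚ -[1+ n ] = cong ℚ.-_ (ι-ℕ→ℚ (suc n))

  ℕ→ℚ-suc≢0 : ∀ n → R.ι (suc n) ≢ 0ℚ
  ℕ→ℚ-suc≢0 n e = impossible (ℚᵘ.≃-trans (ℚᵘ.≃-sym (toℚᵘ-ℤ (ℤ.+ suc n))) (ℚ.toℚᵘ-cong (trans (sym (ι-ℕ→ℚ (suc n))) e)))
    where
    impossible : ¬ (mkℚᵘ (ℤ.+ suc n) 0 ≃ ℚ.toℚᵘ 0ℚ)
    impossible (*≡* ())

  ℚ-field : Field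
  ℚ-field = record { cring = ℚ-ring ; inv = invℚ ; *-invʳ = invℚ-inverse ; char-0 = ℕ→ℚ-suc≢0 }

  ^ℚ-^ : ∀ q n → q ^ℚ n ≡ q R.^ n
  ^ℚ-^ q zero = refl
  ^ℚ-^ q (suc n) = cong (q ℚ.*_) (^ℚ-^ q n)

  -- Cross-multiplication gives num · d = z · den, and num is coprime to den. This carries
  -- integrality over from an arbitrary fraction to the reduced one.
  denominator-divides : ∀ r d z → r ℚ.* ℕ→ℚ d ≡ ℤ→ℚ z → ↧ₙ r ∣ d
  denominator-divides r@(mkℚ num d-1 coprime) d z e = Coprimality.coprime-divisor (Coprimality.sym (Coprimality.recompute coprime)) (divides ℤ.∣ z ∣ (trans (sym (ℤ.abs-* num (ℤ.+ d))) (trans (cong ℤ.∣_∣ (cross product)) (ℤ.abs-* z (ℤ.+ suc d-1)))))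
    where
    product : mkℚᵘ num d-1 ℚᵘ.* mkℚᵘ (ℤ.+ d) 0 ≃ mkℚᵘ z 0
    product = ℚᵘ.≃-trans (ℚᵘ.*-congˡ {mkℚᵘ num d-1} (ℚᵘ.≃-sym (toℚᵘ-ℤ (ℤ.+ d)))) (ℚᵘ.≃-trans (ℚᵘ.≃-sym (ℚ.toℚᵘ-homo-* r (ℕ→ℚ d))) (ℚᵘ.≃-trans (ℚ.toℚᵘ-cong e) (toℚᵘ-ℤ z)))
    cross : mkℚᵘ num d-1 ℚᵘ.* mkℚᵘ (ℤ.+ d) 0 ≃ mkℚᵘ z 0 → num ℤ.* ℤ.+ d ≡ z ℤ.* ℤ.+ suc d-1
    cross (*≡* h) = trans (sym (ℤ.*-identityʳ (num ℤ.* ℤ.+ d))) (trans h (cong (λ m → z ℤ.* ℤ.+ suc m) (ℕ.*-identityʳ d-1)))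

  integral-denominator : ∀ {p} (p-prime : Prime p) {r} → PrimeLocalisation.IsIntegral ℚ-field p p-prime r → ¬ (p ∣ ↧ₙ r)
  integral-denominator p-prime {r} (PrimeLocalisation.fraction d z p∤d e) p∣ = p∤d (Div.∣-trans p∣ (denominator-divides r d z (trans (cong (r ℚ.*_) (sym (ι-ℕ→ℚ d))) (trans e (ιℤ-ℤ→ℚ z)))))

-- The recurrence of the Euler numbers

module EulerNumbers where
  open import Defs using (evenEs; headℤ; euler)
  open import Data.List using (foldr; zipWith; applyUpTo)
  open import Data.Nat.DivMod using (_%_; _/_; m*n%n≡0; m*n/n≡m)

  E₂ : ℕ → ℤ
  E₂ n = headℤ (evenEs n)

  -- The index map g is a variable because passing to the tail of the list shifts it by one.
  zip-sum : ∀ (f : ℕ → ℤ → ℤ) (g : ℕ → ℕ) n → foldr ℤ._+_ ℤ.0ℤ (zipWith f (applyUpTo g (suc n)) (evenEs n)) ≡ Z.∑ (suc n) (λ j → f (g j) (E₂ (n ∸ j)))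
  zip-sum f g zero = ℤ.+-comm (f (g 0) ℤ.1ℤ) ℤ.0ℤ
  zip-sum f g (suc n) = trans (cong (λ z → f (g 0) (E₂ (suc n)) ℤ.+ z) (zip-sum f (g ∘ suc) n)) (sym (Z.∑-first (suc n) (λ j → f (g j) (E₂ (suc n ∸ j)))))

  recurrence-ℤ : ∀ n → Z.∑ (suc (suc n)) (λ k → ℤ.+ ((2 ℕ.* suc n) C (2 ℕ.* k)) ℤ.* E₂ (suc n ∸ k)) ≡ ℤ.0ℤ
  recurrence-ℤ n = trans (Z.∑-first (suc n) f) (trans (cong₂ ℤ._+_ (trans (ℤ.*-identityˡ (E₂ (suc n))) (cong ℤ.-_ (zip-sum (λ j e → ℤ.+ ((2 ℕ.* suc n) C (2 ℕ.* suc j)) ℤ.* e) (λ j → j) n))) refl) (ℤ.+-inverseˡ (Z.∑ (suc n) (λ k → f (suc k)))))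
    where
    f : ℕ → ℤ
    f k = ℤ.+ ((2 ℕ.* suc n) C (2 ℕ.* k)) ℤ.* E₂ (suc n ∸ k)

  euler-at : ∀ m n → m % 2 ≡ 0 → m / 2 ≡ n → euler m ≡ E₂ n
  euler-at m n e refl with m % 2
  euler-at m n refl refl | .0 = refl

  euler-even : ∀ n → euler (2 ℕ.* n) ≡ E₂ n
  euler-even n = euler-at (2 ℕ.* n) n (trans (cong (_% 2) (ℕ.*-comm 2 n)) (m*n%n≡0 n 2)) (trans (cong (_/ 2) (ℕ.*-comm 2 n)) (m*n/n≡m n 2))

-- The two congruences over the rationals

module Bridge (p : ℕ) (p-prime : Prime p) (3<p : 3 < p) where
  open import Defs
  open EulerNumbers
  open RationalField
  open import Data.Rational as ℚ using (ℚ; 0ℚ; 1ℚ)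
  import Data.Rational.Properties as ℚ

  L : Localisation ℚ-field p
  L = PrimeLocalisation.localisation ℚ-field p p-prime

  open Fermat ℚ-field p L p-prime 3<p
  open ≡-Reasoning

  toCongMod : ∀ {a b a′ b′} → a′ ≡ a → b′ ≡ b → a ≈ b [ 4 ] → CongMod p 4 a′ b′
  toCongMod refl refl (modulo r (mkO i) e) = r , integral-denominator p-prime i , trans e (cong (ℚ._* r) (sym (trans (^ℚ-^ (ℕ→ℚ p) 4) (cong (_^ 4) (sym (ι-ℕ→ℚ p))))))

  Σ<-∑ : ∀ n {f g} → (∀ i → f i ≡ g i) → Σ< n f ≡ ∑ n g
  Σ<-∑ zero h = refl
  Σ<-∑ (suc n) h = cong₂ ℚ._+_ (Σ<-∑ n h) (h n)

  a : ℚ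
  a = ι 3 * inv (ι 4)

  b : ℕ → ℚ
  b k = ∏ k (λ i → (a + ι i) * inv (ι (suc i)))

  binom-b : ∀ k → binom (-[1+ 2 ] ℚ./ 4) k ≡ -1^ k * b k
  binom-b zero = refl
  binom-b (suc k) = begin
    (binom q k ℚ.* (q ℚ.- ℕ→ℚ k)) ÷ℚ ℕ→ℚ (suc k) ≡⟨ cong₂ (λ x y → (x ℚ.* (q ℚ.- y)) ÷ℚ ℕ→ℚ (suc k)) (binom-b k) (sym (ι-ℕ→ℚ k)) ⟩
    -- Both `q` and `- a` are closed rationals and compute to -3/4.
    (-1^ k * b k * (- a - ι k)) ÷ℚ ℕ→ℚ (suc k) ≡⟨ cong ((-1^ k * b k * (- a - ι k)) ÷ℚ_) (sym (ι-ℕ→ℚ (suc k))) ⟩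
    (-1^ k * b k * (- a - ι k)) ÷ℚ ι (suc k) ≡⟨ ÷-inv (-1^ k * b k * (- a - ι k)) (char-0 k) ⟩
    -1^ k * b k * (- a - ι k) * inv (ι (suc k)) ≡⟨ solve 5 (λ e b a k v → e :* b :* (⊝ a :- k) :* v := ⊝ κ 1 :* e :* (b :* ((a :+ k) :* v))) refl (-1^ k) (b k) a (ι k) (inv (ι (suc k))) ⟩
    -1^ (suc k) * b (suc k) ∎
    where
    q : ℚ
    q = -[1+ 2 ] ℚ./ 4

  binom⁴ : ∀ k → binom (-[1+ 2 ] ℚ./ 4) k ^ℚ 4 ≡ b k ^ 4
  binom⁴ k = trans (^ℚ-^ (binom (-[1+ 2 ] ℚ./ 4) k) 4) (trans (cong (_^ 4) (binom-b k)) (trans (solve 2 (λ e b → (e :* b) :^ 4 := (e :* e) :^ 2 :* b :^ 4) refl (-1^ k) (b k)) (trans (cong (λ x → x ^ 2 * b k ^ 4) (-1^-square k)) (solve 1 (λ x → κ 1 :^ 2 :* x := x) refl (b k ^ 4)))))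

  left-side : Σ< p (λ k → ℕ→ℚ (8 ℕ.* k ℕ.+ 3) ℚ.* (binom (-[1+ 2 ] ℚ./ 4) k ^ℚ 4)) ≡ ∑ p (λ k → ι (8 ℕ.* k ℕ.+ 3) * b k ^ 4)
  left-side = Σ<-∑ p λ k → cong₂ _*_ (sym (ι-ℕ→ℚ (8 ℕ.* k ℕ.+ 3))) (binom⁴ k)

  sgn-eq : ∀ n → sgn n ≡ -1^ n
  sgn-eq n = ^ℚ-^ (ℚ.- 1ℚ) n

  residue-one : (n : ℕ) → p ≡ suc (4 ℕ.* n) → (x y : ℤ) → ℤ.+ p ≡ x ℤ.* x ℤ.+ y ℤ.* y → (x′ : ℤ) → x ≡ ℤ.1ℤ ℤ.+ ℤ.+ 4 ℤ.* x′ →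
    CongMod p 4 (Σ< p (λ k → ℕ→ℚ (8 ℕ.* k ℕ.+ 3) ℚ.* (binom (-[1+ 2 ] ℚ./ 4) k ^ℚ 4)))
      (sgn n ℚ.* (((ℕ→ℚ 3 ℚ.* (ℕ→ℚ p ^ℚ 2)) ÷ℚ (ℕ→ℚ 2 ℚ.* ℤ→ℚ x)) ℚ.+ ((ℕ→ℚ 3 ℚ.* (ℕ→ℚ p ^ℚ 3)) ÷ℚ (ℕ→ℚ 8 ℚ.* (ℤ→ℚ x ^ℚ 3)))))
  residue-one n p≡ x y p≡x²+y² x′ x≡ = toCongMod left-side right-side (case-one x y p≡x²+y² x′ x≡)
    where
    open CaseOne ℚ-field p L p-prime 3<p n p≡ using (case-one; ξ≢0)
    X ξ : ℚ
    X = ιℤ x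
    ξ = ι 2 * X
    ξ≠0 : ξ ≢ 0ℚ
    ξ≠0 = ξ≢0 x y p≡x²+y² x′ x≡
    power : ∀ m → ℕ→ℚ p ^ℚ m ≡ ι p ^ m
    power m = trans (^ℚ-^ (ℕ→ℚ p) m) (cong (_^ m) (sym (ι-ℕ→ℚ p)))
    cube : ℕ→ℚ 8 ℚ.* (ℤ→ℚ x ^ℚ 3) ≡ ξ ^ 3
    cube = trans (cong₂ _*_ (sym (ι-ℕ→ℚ 8)) (trans (^ℚ-^ (ℤ→ℚ x) 3) (cong (_^ 3) (sym (ιℤ-ℤ→ℚ x))))) (solve 1 (λ x → κ 8 :* x :^ 3 := (κ 2 :* x) :^ 3) refl X)
    first : (ℕ→ℚ 3 ℚ.* (ℕ→ℚ p ^ℚ 2)) ÷ℚ (ℕ→ℚ 2 ℚ.* ℤ→ℚ x) ≡ ι 3 * ι p ^ 2 * inv ξ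
    first = trans (cong₂ _÷ℚ_ (cong₂ _*_ (sym (ι-ℕ→ℚ 3)) (power 2)) (cong₂ _*_ (sym (ι-ℕ→ℚ 2)) (sym (ιℤ-ℤ→ℚ x)))) (÷-inv (ι 3 * ι p ^ 2) ξ≠0)
    second : (ℕ→ℚ 3 ℚ.* (ℕ→ℚ p ^ℚ 3)) ÷ℚ (ℕ→ℚ 8 ℚ.* (ℤ→ℚ x ^ℚ 3)) ≡ ι 3 * ι p ^ 3 * inv ξ ^ 3
    second = trans (cong₂ _÷ℚ_ (cong₂ _*_ (sym (ι-ℕ→ℚ 3)) (power 3)) cube) (trans (÷-inv (ι 3 * ι p ^ 3) (^-≢0 3 ξ≠0)) (cong (ι 3 * ι p ^ 3 *_) (inv-^ 3 ξ≠0)))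
    right-side : sgn n ℚ.* (((ℕ→ℚ 3 ℚ.* (ℕ→ℚ p ^ℚ 2)) ÷ℚ (ℕ→ℚ 2 ℚ.* ℤ→ℚ x)) ℚ.+ ((ℕ→ℚ 3 ℚ.* (ℕ→ℚ p ^ℚ 3)) ÷ℚ (ℕ→ℚ 8 ℚ.* (ℤ→ℚ x ^ℚ 3))))
      ≡ -1^ n * (ι 3 * ι p ^ 2 * inv ξ + ι 3 * ι p ^ 3 * inv ξ ^ 3)
    right-side = cong₂ _*_ (sgn-eq n) (cong₂ _+_ first second)

  residue-three : (j : ℕ) → p ≡ 4 ℕ.* j ℕ.+ 3 → 0 < j →
    CongMod p 4 (Σ< p (λ k → ℕ→ℚ (8 ℕ.* k ℕ.+ 3) ℚ.* (binom (-[1+ 2 ] ℚ./ 4) k ^ℚ 4)))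
      (sgn j ℚ.* ℕ→ℚ p ℚ.* ℕ→ℚ ((2 ℕ.* j) C j)
        ℚ.* ((1ℚ ℚ.- ℕ→ℚ p ℚ.* (1ℚ ℚ.+ (ℤ.+ 1 ℚ./ 2) ℚ.* qp2 p))
           ℚ.+ (ℕ→ℚ p ^ℚ 2) ℚ.* ((ℤ.+ 1 ℚ./ 2) ℚ.* qp2 p ℚ.+ (ℤ.+ 3 ℚ./ 8) ℚ.* (qp2 p ^ℚ 2) ℚ.+ (ℤ.+ 1 ℚ./ 4) ℚ.* ℤ→ℚ (euler (2 ℕ.* (2 ℕ.* j))))))
  residue-three j p≡ 0<j = toCongMod left-side right-side (case-three 𝔼 refl 𝔼-recurrence 0<j)
    where
    open CaseThree ℚ-field p L p-prime 3<p j p≡ using (case-three)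
    𝔼 : ℕ → ℚ
    𝔼 n = ιℤ (E₂ n)
    ιℤ-sum : ∀ m f → ιℤ (Z.∑ m f) ≡ ∑ m (λ i → ιℤ (f i))
    ιℤ-sum zero f = refl
    ιℤ-sum (suc m) f = trans (ιℤ-+ (Z.∑ m f) (f m)) (cong (_+ ιℤ (f m)) (ιℤ-sum m f))
    𝔼-recurrence : ∀ n → ∑ (suc (suc n)) (λ k → ι ((2 ℕ.* suc n) C (2 ℕ.* k)) * 𝔼 (suc n ∸ k)) ≡ 0#
    𝔼-recurrence n = trans (∑-cong (suc (suc n)) λ k → sym (trans (ιℤ-* (ℤ.+ ((2 ℕ.* suc n) C (2 ℕ.* k))) (E₂ (suc n ∸ k))) (cong (_* 𝔼 (suc n ∸ k)) (ιℤ-pos ((2 ℕ.* suc n) C (2 ℕ.* k))))))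
      (trans (sym (ιℤ-sum (suc (suc n)) (λ k → ℤ.+ ((2 ℕ.* suc n) C (2 ℕ.* k)) ℤ.* E₂ (suc n ∸ k)))) (cong ιℤ (recurrence-ℤ n)))
    Q : ℚ
    Q = (ι 2 ^ p-1 - 1#) * inv (ι p)
    qp2-Q : qp2 p ≡ Q
    qp2-Q = trans (cong₂ (λ x y → (x ℚ.- 1ℚ) ÷ℚ y) (trans (sym (ι-ℕ→ℚ (2 ℕ.^ (p ∸ 1)))) (ι-^ 2 (p ∸ 1))) (sym (ι-ℕ→ℚ p))) (÷-inv (ι 2 ^ p-1 - 1#) ιp≢0)
    right-side : sgn j ℚ.* ℕ→ℚ p ℚ.* ℕ→ℚ ((2 ℕ.* j) C j)
        ℚ.* ((1ℚ ℚ.- ℕ→ℚ p ℚ.* (1ℚ ℚ.+ (ℤ.+ 1 ℚ./ 2) ℚ.* qp2 p))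
           ℚ.+ (ℕ→ℚ p ^ℚ 2) ℚ.* ((ℤ.+ 1 ℚ./ 2) ℚ.* qp2 p ℚ.+ (ℤ.+ 3 ℚ./ 8) ℚ.* (qp2 p ^ℚ 2) ℚ.+ (ℤ.+ 1 ℚ./ 4) ℚ.* ℤ→ℚ (euler (2 ℕ.* (2 ℕ.* j)))))
      ≡ -1^ j * ι p * ι ((2 ℕ.* j) C j) * (1# - ι p * (1# + inv (ι 2) * Q) + ι p ^ 2 * (inv (ι 2) * Q + ι 3 * inv (ι 8) * Q ^ 2 + inv (ι 4) * 𝔼 (2 ℕ.* j)))
    -- The literals 1/2, 3/8 and 1/4 compute to `inv (ι 2)`, `ι 3 * inv (ι 8)` and `inv (ι 4)`.
    right-side = cong₂ _*_ (cong₂ _*_ (cong₂ _*_ (sgn-eq j) (sym (ι-ℕ→ℚ p))) (sym (ι-ℕ→ℚ ((2 ℕ.* j) C j))))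
      (cong₂ _+_ (cong₂ (λ P q → 1# - P * (1# + inv (ι 2) * q)) (sym (ι-ℕ→ℚ p)) qp2-Q)
        (cong₂ _*_ (trans (^ℚ-^ (ℕ→ℚ p) 2) (cong (_^ 2) (sym (ι-ℕ→ℚ p))))
          (cong₂ _+_ (cong₂ (λ q q² → inv (ι 2) * q + ι 3 * inv (ι 8) * q²) qp2-Q (trans (^ℚ-^ (qp2 p) 2) (cong (_^ 2) qp2-Q)))
            (cong (inv (ι 4) *_) (trans (cong ℤ→ℚ (euler-even (2 ℕ.* j))) (sym (ιℤ-ℤ→ℚ (E₂ (2 ℕ.* j)))))))))

-- Residues of p modulo 4 and the theorem

open import Defs
open import Data.Nat using (_%_)
open import Data.Nat.DivMod using (m≡m%n+[m/n]*n; m*n/n≡m)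
open import Data.Integer using (+_)
open import Data.Integer.Divisibility as ℤd using ()
open import Data.Integer.Divisibility.Signed as Signed using (∣ᵤ⇒∣)
open import Data.Rational as ℚ using (ℚ; _+_; _*_; _-_; 1ℚ)

private
  module Quotient (p : ℕ) where
    split : ∀ r → p % 4 ≡ r → p ≡ r ℕ.+ 4 ℕ.* (p ℕ./ 4)
    split r e = trans (m≡m%n+[m/n]*n p 4) (cong₂ ℕ._+_ e (ℕ.*-comm (p ℕ./ 4) 4))

    /4 : ∀ r → p % 4 ≡ r → (p ∸ r) ℕ./ 4 ≡ p ℕ./ 4
    /4 r e = trans (cong (λ m → (m ∸ r) ℕ./ 4) (split r e)) (trans (cong (ℕ._/ 4) (trans (ℕ.m+n∸m≡n r (4 ℕ.* (p ℕ./ 4))) (ℕ.*-comm 4 (p ℕ./ 4)))) (m*n/n≡m (p ℕ./ 4) 4))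

    ∸3 : p % 4 ≡ 3 → p ∸ 3 ≡ 2 ℕ.* (2 ℕ.* (p ℕ./ 4))
    ∸3 e = trans (cong (_∸ 3) (split 3 e)) (trans (ℕ.m+n∸m≡n 3 (4 ℕ.* (p ℕ./ 4))) (ℕ.*-assoc 2 2 (p ℕ./ 4)))

    /2 : p % 4 ≡ 3 → (p ∸ 3) ℕ./ 2 ≡ 2 ℕ.* (p ℕ./ 4)
    /2 e = trans (cong (ℕ._/ 2) (trans (∸3 e) (ℕ.*-comm 2 (2 ℕ.* (p ℕ./ 4))))) (m*n/n≡m (2 ℕ.* (p ℕ./ 4)) 2)

  shift-one : ∀ x → (+ 4) ℤd.∣ (x ℤ.- + 1) → ∃ λ x′ → x ≡ ℤ.1ℤ ℤ.+ ℤ.+ 4 ℤ.* x′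
  shift-one x d = Signed._∣_.quotient d′ , trans 1+[x-1] (cong (λ z → + 1 ℤ.+ z) (trans (Signed._∣_.equality d′) (ℤ.*-comm (Signed._∣_.quotient d′) (+ 4))))
    where
    d′ : (+ 4) Signed.∣ (x ℤ.- + 1)
    d′ = ∣ᵤ⇒∣ {+ 4} {x ℤ.- + 1} d
    1+[x-1] : x ≡ + 1 ℤ.+ (x ℤ.- + 1)
    1+[x-1] = trans (sym (ℤ.+-identityʳ x)) (trans (ℤ.+-comm x (+ 0)) (trans (cong (ℤ._+ x) (sym (ℤ.+-inverseʳ (+ 1)))) (trans (ℤ.+-assoc (+ 1) (ℤ.- + 1) x) (cong (λ z → + 1 ℤ.+ z) (ℤ.+-comm (ℤ.- + 1) x)))))

theorem5p4 : (p : ℕ) → Prime p → 3 < p →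
    ((p % 4 ≡ 1) → (x y : ℤ) → + p ≡ x ℤ.* x ℤ.+ y ℤ.* y → (+ 4) ℤd.∣ (x ℤ.- + 1) →
      CongMod p 4
        (Σ< p (λ k → (ℕ→ℚ (8 ℕ.* k ℕ.+ 3)) * (binom (-[1+ 2 ] ℚ./ 4) k ^ℚ 4)))
        (sgn ((p ∸ 1) ℕ./ 4)
          * (((ℕ→ℚ 3 * (ℕ→ℚ p ^ℚ 2)) ÷ℚ (ℕ→ℚ 2 * ℤ→ℚ x))
             + ((ℕ→ℚ 3 * (ℕ→ℚ p ^ℚ 3)) ÷ℚ (ℕ→ℚ 8 * (ℤ→ℚ x ^ℚ 3))))))
    ×
    ((p % 4 ≡ 3) →
      CongMod p 4
        (Σ< p (λ k → (ℕ→ℚ (8 ℕ.* k ℕ.+ 3)) * (binom (-[1+ 2 ] ℚ./ 4) k ^ℚ 4)))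
        (sgn ((p ∸ 3) ℕ./ 4) * ℕ→ℚ p * ℕ→ℚ (((p ∸ 3) ℕ./ 2) C ((p ∸ 3) ℕ./ 4))
          * ((1ℚ - ℕ→ℚ p * (1ℚ + (+ 1 ℚ./ 2) * qp2 p))
             + (ℕ→ℚ p ^ℚ 2) * ((+ 1 ℚ./ 2) * qp2 p + (+ 3 ℚ./ 8) * (qp2 p ^ℚ 2)
                               + (+ 1 ℚ./ 4) * ℤ→ℚ (euler (p ∸ 3))))))
theorem5p4 p p-prime 3<p = one , three
  where
  open Bridge p p-prime 3<p using (residue-one; residue-three)
  open Quotient p
  S : ℚ
  S = Σ< p (λ k → (ℕ→ℚ (8 ℕ.* k ℕ.+ 3)) * (binom (-[1+ 2 ] ℚ./ 4) k ^ℚ 4))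
  right₁ : ℤ → ℕ → ℚ
  right₁ x m = sgn m * (((ℕ→ℚ 3 * (ℕ→ℚ p ^ℚ 2)) ÷ℚ (ℕ→ℚ 2 * ℤ→ℚ x)) + ((ℕ→ℚ 3 * (ℕ→ℚ p ^ℚ 3)) ÷ℚ (ℕ→ℚ 8 * (ℤ→ℚ x ^ℚ 3))))
  one : p % 4 ≡ 1 → (x y : ℤ) → + p ≡ x ℤ.* x ℤ.+ y ℤ.* y → (+ 4) ℤd.∣ (x ℤ.- + 1) → CongMod p 4 S (right₁ x ((p ∸ 1) ℕ./ 4))
  one e x y p≡ d = subst (λ m → CongMod p 4 S (right₁ x m)) (sym (/4 1 e)) (residue-one (p ℕ./ 4) (split 1 e) x y p≡ (proj₁ (shift-one x d)) (proj₂ (shift-one x d)))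
  right₃ : ℕ → ℕ → ℕ → ℚ
  right₃ j m k = sgn j * ℕ→ℚ p * ℕ→ℚ (m C j)
    * ((1ℚ - ℕ→ℚ p * (1ℚ + (+ 1 ℚ./ 2) * qp2 p))
       + (ℕ→ℚ p ^ℚ 2) * ((+ 1 ℚ./ 2) * qp2 p + (+ 3 ℚ./ 8) * (qp2 p ^ℚ 2) + (+ 1 ℚ./ 4) * ℤ→ℚ (euler k)))
  -- A zero quotient would mean p = 3.
  0<j : p % 4 ≡ 3 → 0 < p ℕ./ 4
  0<j e = ℕ.n≢0⇒n>0 λ j≡0 → ℕ.<-irrefl (sym (trans (split 3 e) (cong (λ j → 3 ℕ.+ 4 ℕ.* j) j≡0))) 3<p
  three : p % 4 ≡ 3 → CongMod p 4 S (right₃ ((p ∸ 3) ℕ./ 4) ((p ∸ 3) ℕ./ 2) (p ∸ 3))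
  three e = subst (CongMod p 4 S) (sym (trans (cong₂ (λ j m → right₃ j m (p ∸ 3)) (/4 3 e) (/2 e)) (cong (right₃ (p ℕ./ 4) (2 ℕ.* (p ℕ./ 4))) (∸3 e))))
    (residue-three (p ℕ./ 4) (trans (split 3 e) (ℕ.+-comm 3 (4 ℕ.* (p ℕ./ 4)))) (0<j e))
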